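{- Let $\Phi=\mathbf C_2=\{\pm e_1\pm e_2,\pm 2e_1,\pm 2e_2\}$, let $R$ be an arbitrary commutative ring with $1$, and suppose that either $\pi=\mathrm{ad}$ (i.e. the Chevalley group is adjoint) or $1/2\in R$. Let $G$ be a large subgroup of $G_\pi(\mathbf C_2,R)$. Then for every $\gamma\in\Phi$ the subgroup $X_\gamma=\{x_\gamma(t)\mid t\in R\}$ is Diophantine in $G$.
   Context: Let $\mathcal L$ be the complex semisimple Lie algebra with root system $\Phi$, with Chevalley basis $\{h_i;x_\alpha\}$, and let $\pi$ be a faithful finite-dimensional representation of $\mathcal L$ with weight lattice $\Lambda_\pi$ (a lattice between the root lattice and the lattice of all weights); $\pi=\mathrm{ad}$ means that $\Lambda_\pi$ is the root lattice. $G_\pi(\Phi,R)$ denotes the Chevalley group of type $(\Phi,\Lambda_\pi)$ over $R$, i.e. the group of $R$-points of the Chevalley--Demazure group scheme, realized as the subgroup of $\mathrm{SL}_n(R)$, $n=\dim\pi$, given by polynomial equations with integer coefficients in the matrix entries. For $\alpha\in\Phi$, $t\in R$, $x_\alpha(t)=\exp(t\pi(x_\alpha))$ is the elementary root unipotent; $E_\pi(\Phi,R)$ is the subgroup generated by all $x_\alpha(t)$; a subgroup of $G_\pi(\Phi,R)$ is large if it contains $E_\pi(\Phi,R)$. "$1/2\in R$" means that $2$ is invertible in $R$. A subset $H$ of a group $G$ is Diophantine in $G$ if it is definable in $G$ by a formula $\exists y_1\dots\exists y_n\bigwedge_{i=1}^k w_i(x,y_1,\dots,y_n)=1$, where each $w_i$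 is a group word in $x,y_1,\dots,y_n$ and constants from $G$. -}

module Defs where

open import Algebra.Bundles using (Group; AbelianGroup; CommutativeRing)
open import Algebra.Construct.DirectProduct using (abelianGroup)
open import Data.Bool.Base using (if_then_else_)
open import Data.Fin.Base using (Fin; toℕ)
open import Data.Fin.Patterns using (0F; 1F)
open import Data.Fin.Properties using (_≟_)
open import Data.Integer.Base as ℤ using (ℤ; +_; -[1+_]; _◃_)
import Data.Integer.Properties as ℤ
open import Data.List.Base using (List)
open import Data.List.Relation.Unary.All using (All)
open import Data.Nat.Base as ℕ using (ℕ; zero; suc; _!)
open import Data.Product.Base using (Σ; ∃; ∃-syntax; _×_; _,_; proj₁; proj₂)
import Data.Rational.Properties as ℚ
open import Data.Sign.Base using (Sign; opposite) renaming (+ to pos; - to neg)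
open import Data.Sum.Base using (_⊎_)
open import Data.Vec.Functional using (Vector; []; _∷_)
open import Function.Bundles using (_⇔_)
open import Level using (Level; _⊔_) renaming (suc to lsuc)
open import Relation.Binary.PropositionalEquality as ≡ using (_≡_; _≢_)
open import Relation.Nullary.Decidable.Core using (does)
open import Relation.Nullary.Negation.Core using (¬_)
open import Relation.Unary using (Pred; _⊆_)

ℤ-ring : CommutativeRing _ _
ℤ-ring = ℤ.+-*-commutativeRing

ℚ-ring : CommutativeRing _ _
ℚ-ring = ℚ.+-*-commutativeRing

------------------------------------------------------------------------
-- Subgroups and Diophantine subsets of a group

module _ {c ℓ} (Γ : Group c ℓ) where
  open Group Γ

  data Generated {p} (S : Pred Carrier p) : Pred Carrier (c ⊔ ℓ ⊔ p) where
    gen  : ∀ {x} → S x → Generated S x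
    unit : Generated S ε
    mul  : ∀ {x y} → Generated S x → Generated S y → Generated S (x ∙ y)
    inv  : ∀ {x} → Generated S x → Generated S (x ⁻¹)
    resp : ∀ {x y} → x ≈ y → Generated S x → Generated S y

  record Subgroup p : Set (c ⊔ ℓ ⊔ lsuc p) where
    field
      member    : Pred Carrier p
      ≈-closed  : ∀ {x y} → x ≈ y → member x → member y
      ε-closed  : member ε
      ∙-closed  : ∀ {x y} → member x → member y → member (x ∙ y)
      ⁻¹-closed : ∀ {x} → member x → member (x ⁻¹)

    group : Group (c ⊔ p) ℓ
    group = record
      { Carrier = Σ Carrier member
      ; _≈_     = λ x y → proj₁ x ≈ proj₁ y
      ; _∙_     = λ x y → (proj₁ x ∙ proj₁ y) , ∙-closed (proj₂ x) (proj₂ y)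
      ; ε       = ε , ε-closed
      ; _⁻¹     = λ x → (proj₁ x ⁻¹) , ⁻¹-closed (proj₂ x)
      ; isGroup = record
        { isMonoid = record
          { isSemigroup = record
            { isMagma = record
              { isEquivalence = record { refl = refl ; sym = sym ; trans = trans }
              ; ∙-cong        = ∙-cong
              }
            ; assoc = λ x y z → assoc (proj₁ x) (proj₁ y) (proj₁ z)
            }
          ; identity = (λ x → identityˡ (proj₁ x)) , (λ x → identityʳ (proj₁ x))
          }
        ; inverse = (λ x → inverseˡ (proj₁ x)) , (λ x → inverseʳ (proj₁ x))
        ; ⁻¹-cong = ⁻¹-cong
        }
      }

  data Word (m : ℕ) : Set c where
    const : Carrier → Word m
    var   : Fin m → Word m
    _·_   : Word m → Word m → Word m
    _′    : Word m → Word m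

  evalWord : ∀ {m} → Vector Carrier m → Word m → Carrier
  evalWord ρ (const g) = g
  evalWord ρ (var i)   = ρ i
  evalWord ρ (v · w)   = evalWord ρ v ∙ evalWord ρ w
  evalWord ρ (w ′)     = evalWord ρ w ⁻¹

  Diophantine : ∀ {p} → Pred Carrier p → Set (c ⊔ ℓ ⊔ p)
  Diophantine D =
    ∃[ m ] Σ (List (Word (suc m))) λ ws →
      ∀ x → D x ⇔ (Σ (Vector Carrier m) λ y → All (λ w → evalWord (x ∷ y) w ≈ ε) ws)

------------------------------------------------------------------------
-- Square matrices over a commutative ring

module Matrices {c ℓ} (R : CommutativeRing c ℓ) where
  open CommutativeRing R
  open import Algebra.Properties.Semiring.Sum semiring
    using (sum; sum-cong-≋; sum-replicate-zero; ∑-comm; *-distribˡ-sum; *-distribʳ-sum)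
  open import Algebra.Properties.Monoid.Mult +-monoid using () renaming (_×_ to _×ℕ_)
  open import Relation.Binary.Reasoning.Setoid setoid

  ι : ℤ → Carrier
  ι (+ k)    = k ×ℕ 1#
  ι -[1+ k ] = - (suc k ×ℕ 1#)

  Matrix : ℕ → Set c
  Matrix n = Fin n → Fin n → Carrier

  module _ {n : ℕ} where
    infix  4 _≈ᴹ_
    infixl 6 _+ᴹ_ _-ᴹ_
    infixl 7 _*ᴹ_
    infixr 7 _·ᴹ_
    infixr 8 _^ᴹ_

    _≈ᴹ_ : Matrix n → Matrix n → Set ℓ
    A ≈ᴹ B = ∀ i j → A i j ≈ B i j

    0ᴹ 1ᴹ : Matrix n
    0ᴹ i j = 0#
    1ᴹ i j = if does (i ≟ j) then 1# else 0#

    _+ᴹ_ _-ᴹ_ _*ᴹ_ [_,_] : Matrix n → Matrix n → Matrix n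
    (A +ᴹ B) i j = A i j + B i j
    (A -ᴹ B) i j = A i j - B i j
    (A *ᴹ B) i j = sum λ k → A i k * B k j
    [ A , B ] = A *ᴹ B -ᴹ B *ᴹ A

    _·ᴹ_ : Carrier → Matrix n → Matrix n
    (r ·ᴹ A) i j = r * A i j

    _^ᴹ_ : Matrix n → ℕ → Matrix n
    A ^ᴹ zero  = 1ᴹ
    A ^ᴹ suc k = A *ᴹ A ^ᴹ k

    ∑ᴹ : ∀ {m} → Vector (Matrix n) m → Matrix n
    ∑ᴹ As i j = sum λ k → As k i j

    *ᴹ-cong : ∀ {A A′ B B′} → A ≈ᴹ A′ → B ≈ᴹ B′ → A *ᴹ B ≈ᴹ A′ *ᴹ B′
    *ᴹ-cong p q i j = sum-cong-≋ λ k → *-cong (p i k) (q k j)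

    *ᴹ-congˡ : ∀ A {B B′} → B ≈ᴹ B′ → A *ᴹ B ≈ᴹ A *ᴹ B′
    *ᴹ-congˡ A = *ᴹ-cong {A = A} (λ _ _ → refl)

    *ᴹ-congʳ : ∀ B {A A′} → A ≈ᴹ A′ → A *ᴹ B ≈ᴹ A′ *ᴹ B
    *ᴹ-congʳ B p = *ᴹ-cong {B = B} p (λ _ _ → refl)

    *ᴹ-assoc : ∀ A B C → (A *ᴹ B) *ᴹ C ≈ᴹ A *ᴹ (B *ᴹ C)
    *ᴹ-assoc A B C i j = begin
      sum (λ k → sum (λ l → A i l * B l k) * C k j)
        ≈⟨ sum-cong-≋ (λ k → *-distribʳ-sum (C k j) (λ l → A i l * B l k)) ⟩
      sum (λ k → sum (λ l → A i l * B l k * C k j))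
        ≈⟨ ∑-comm (λ k l → A i l * B l k * C k j) ⟩
      sum (λ l → sum (λ k → A i l * B l k * C k j))
        ≈⟨ sum-cong-≋ (λ l → sum-cong-≋ λ k → *-assoc (A i l) (B l k) (C k j)) ⟩
      sum (λ l → sum (λ k → A i l * (B l k * C k j)))
        ≈⟨ sum-cong-≋ (λ l → *-distribˡ-sum (A i l) (λ k → B l k * C k j)) ⟨
      sum (λ l → A i l * sum (λ k → B l k * C k j)) ∎

  private
    δˡ : ∀ {n} (i : Fin n) (v : Vector Carrier n) →
         sum (λ k → (if does (i ≟ k) then 1# else 0#) * v k) ≈ v i
    δˡ {suc n} Fin.zero v = begin
      1# * v 0F + sum (λ k → 0# * v (Fin.suc k))
        ≈⟨ +-cong (*-identityˡ _) (sum-cong-≋ λ k → zeroˡ (v (Fin.suc k))) ⟩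
      v 0F + sum {n} (λ _ → 0#)
        ≈⟨ +-congˡ (sum-replicate-zero n) ⟩
      v 0F + 0#
        ≈⟨ +-identityʳ _ ⟩
      v 0F ∎
    δˡ (Fin.suc i) v = begin
      0# * v 0F + sum (λ k → (if does (i ≟ k) then 1# else 0#) * v (Fin.suc k))
        ≈⟨ +-cong (zeroˡ _) (δˡ i (λ k → v (Fin.suc k))) ⟩
      0# + v (Fin.suc i)
        ≈⟨ +-identityˡ _ ⟩
      v (Fin.suc i) ∎

    1ᴹ-sym : ∀ {n} (i j : Fin n) → 1ᴹ i j ≈ 1ᴹ j i
    1ᴹ-sym Fin.zero    Fin.zero    = refl
    1ᴹ-sym Fin.zero    (Fin.suc j) = refl
    1ᴹ-sym (Fin.suc i) Fin.zero    = refl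
    1ᴹ-sym (Fin.suc i) (Fin.suc j) = 1ᴹ-sym i j

  *ᴹ-identityˡ : ∀ {n} (A : Matrix n) → 1ᴹ *ᴹ A ≈ᴹ A
  *ᴹ-identityˡ A i j = δˡ i (λ k → A k j)

  *ᴹ-identityʳ : ∀ {n} (A : Matrix n) → A *ᴹ 1ᴹ ≈ᴹ A
  *ᴹ-identityʳ A i j = trans
    (sum-cong-≋ λ k → trans (*-comm (A i k) (1ᴹ k j)) (*-congʳ (1ᴹ-sym k j)))
    (δˡ j (A i))

  record Invertible (n : ℕ) : Set (c ⊔ ℓ) where
    constructor invertible
    field
      mat     : Matrix n
      mat⁻¹   : Matrix n
      invˡ    : mat⁻¹ *ᴹ mat ≈ᴹ 1ᴹ
      invʳ    : mat *ᴹ mat⁻¹ ≈ᴹ 1ᴹ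
  open Invertible public

  private
    cancel : ∀ {n} (A B C D : Matrix n) → B *ᴹ C ≈ᴹ 1ᴹ → A *ᴹ D ≈ᴹ 1ᴹ →
             (A *ᴹ B) *ᴹ (C *ᴹ D) ≈ᴹ 1ᴹ
    cancel A B C D p q i j = begin
      ((A *ᴹ B) *ᴹ (C *ᴹ D)) i j  ≈⟨ *ᴹ-assoc A B (C *ᴹ D) i j ⟩
      (A *ᴹ (B *ᴹ (C *ᴹ D))) i j  ≈⟨ *ᴹ-congˡ A (*ᴹ-assoc B C D) i j ⟨
      (A *ᴹ ((B *ᴹ C) *ᴹ D)) i j  ≈⟨ *ᴹ-congˡ A (*ᴹ-congʳ D p) i j ⟩
      (A *ᴹ (1ᴹ *ᴹ D)) i j        ≈⟨ *ᴹ-congˡ A (*ᴹ-identityˡ D) i j ⟩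
      (A *ᴹ D) i j                ≈⟨ q i j ⟩
      1ᴹ i j ∎

    inverse-unique : ∀ {n} (g h : Invertible n) → mat g ≈ᴹ mat h → mat⁻¹ g ≈ᴹ mat⁻¹ h
    inverse-unique g h p i j = begin
      mat⁻¹ g i j                            ≈⟨ *ᴹ-identityʳ (mat⁻¹ g) i j ⟨
      (mat⁻¹ g *ᴹ 1ᴹ) i j                    ≈⟨ *ᴹ-congˡ (mat⁻¹ g) (invʳ h) i j ⟨
      (mat⁻¹ g *ᴹ (mat h *ᴹ mat⁻¹ h)) i j    ≈⟨ *ᴹ-assoc (mat⁻¹ g) (mat h) (mat⁻¹ h) i j ⟨
      ((mat⁻¹ g *ᴹ mat h) *ᴹ mat⁻¹ h) i j    ≈⟨ *ᴹ-congʳ (mat⁻¹ h) (*ᴹ-congˡ (mat⁻¹ g) p) i j ⟨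
      ((mat⁻¹ g *ᴹ mat g) *ᴹ mat⁻¹ h) i j    ≈⟨ *ᴹ-congʳ (mat⁻¹ h) (invˡ g) i j ⟩
      (1ᴹ *ᴹ mat⁻¹ h) i j                    ≈⟨ *ᴹ-identityˡ (mat⁻¹ h) i j ⟩
      mat⁻¹ h i j ∎

  GL : ℕ → Group (c ⊔ ℓ) ℓ
  GL n = record
    { Carrier = Invertible n
    ; _≈_     = λ g h → mat g ≈ᴹ mat h
    ; _∙_     = λ g h → invertible (mat g *ᴹ mat h) (mat⁻¹ h *ᴹ mat⁻¹ g)
                  (cancel (mat⁻¹ h) (mat⁻¹ g) (mat g) (mat h) (invˡ g) (invˡ h))
                  (cancel (mat g) (mat h) (mat⁻¹ h) (mat⁻¹ g) (invʳ h) (invʳ g))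
    ; ε       = invertible 1ᴹ 1ᴹ (*ᴹ-identityˡ 1ᴹ) (*ᴹ-identityˡ 1ᴹ)
    ; _⁻¹     = λ g → invertible (mat⁻¹ g) (mat g) (invʳ g) (invˡ g)
    ; isGroup = record
      { isMonoid = record
        { isSemigroup = record
          { isMagma = record
            { isEquivalence = record
              { refl  = λ _ _ → refl
              ; sym   = λ p i j → sym (p i j)
              ; trans = λ p q i j → trans (p i j) (q i j)
              }
            ; ∙-cong = *ᴹ-cong
            }
          ; assoc = λ f g h → *ᴹ-assoc (mat f) (mat g) (mat h)
          }
        ; identity = (λ g → *ᴹ-identityˡ (mat g)) , (λ g → *ᴹ-identityʳ (mat g))
        }
      ; inverse = invˡ , invʳ
      ; ⁻¹-cong = λ {g} {h} → inverse-unique g h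
      }
    }

-- Polynomials with integer coefficients in n² matrix entries, as terms.
data Poly (n : ℕ) : Set where
  con   : ℤ → Poly n
  entry : Fin n → Fin n → Poly n
  _⊕_   : Poly n → Poly n → Poly n
  _⊗_   : Poly n → Poly n → Poly n

module _ {c ℓ} (R : CommutativeRing c ℓ) where
  open CommutativeRing R
  open Matrices R

  evalPoly : ∀ {n} → Matrix n → Poly n → Carrier
  evalPoly A (con k)     = ι k
  evalPoly A (entry i j) = A i j
  evalPoly A (p ⊕ q)     = evalPoly A p + evalPoly A q
  evalPoly A (p ⊗ q)     = evalPoly A p * evalPoly A q

  TwoInvertible : Set (c ⊔ ℓ)
  TwoInvertible = ∃[ u ] (1# + 1#) * u ≈ 1#

------------------------------------------------------------------------
-- The root system C₂, in coordinates with respect to e₁, e₂.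
-- The weight lattice of C₂ is ℤe₁ ⊕ ℤe₂.

Weight : AbelianGroup _ _
Weight = abelianGroup ℤ.+-0-abelianGroup ℤ.+-0-abelianGroup

open AbelianGroup Weight using () renaming
  ( Carrier to ℤ²; _≈_ to _≈ʷ_; _∙_ to _+ʷ_; _-_ to _-ʷ_; group to Weight-group )

_·ʷ_ : ℕ → ℤ² → ℤ²
k ·ʷ (a , b) = + k ℤ.* a , + k ℤ.* b

-- short s t = s e₁ + t e₂  and  long i s = 2 s eᵢ
data Root : Set where
  short : Sign → Sign → Root
  long  : Fin 2 → Sign → Root

coords : Root → ℤ²
coords (short s t) = s ◃ 1 , t ◃ 1
coords (long 0F s) = s ◃ 2 , + 0
coords (long 1F s) = + 0 , s ◃ 2

-- γ^∨ = 2γ/(γ,γ)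
coroot : Root → ℤ²
coroot (short s t) = s ◃ 1 , t ◃ 1
coroot (long 0F s) = s ◃ 1 , + 0
coroot (long 1F s) = + 0 , s ◃ 1

⟨_,_^∨⟩ : ℤ² → Root → ℤ
⟨ (a , b) , γ ^∨⟩ = a ℤ.* proj₁ (coroot γ) ℤ.+ b ℤ.* proj₂ (coroot γ)

-ᴿ_ : Root → Root
-ᴿ (short s t) = short (opposite s) (opposite t)
-ᴿ (long i s)  = long i (opposite s)

simple : Fin 2 → Root
simple 0F = short pos neg
simple 1F = long 1F pos

-- a e₁ + b e₂ = a (e₁ - e₂) + (a + b) e₂, and the simple coroots are e₁ - e₂ and e₂.
corootCoeff : Root → Fin 2 → ℤ
corootCoeff γ 0F = proj₁ (coroot γ)
corootCoeff γ 1F = proj₁ (coroot γ) ℤ.+ proj₂ (coroot γ)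

roots : Vector Root 8
roots = short pos pos ∷ short pos neg ∷ short neg pos ∷ short neg neg
      ∷ long 0F pos ∷ long 0F neg ∷ long 1F pos ∷ long 1F neg ∷ []

IsRoot : Pred ℤ² _
IsRoot μ = ∃[ γ ] coords γ ≈ʷ μ

-- r is the greatest integer such that β - r α is a root.
StringLength : Root → Root → ℕ → Set
StringLength α β r =
  IsRoot (coords β -ʷ (r ·ʷ coords α)) ×
  (∀ k → IsRoot (coords β -ʷ (k ·ʷ coords α)) → k ℕ.≤ r)

------------------------------------------------------------------------
-- Representations

open Matrices ℤ-ring using () renaming
  ( Matrix to ℤMatrix; _≈ᴹ_ to _≈ᶻ_; 0ᴹ to 0ᶻ; [_,_] to [_,_]ᶻ; _·ᴹ_ to _·ᶻ_
  ; _+ᴹ_ to _+ᶻ_; _^ᴹ_ to _^ᶻ_; ∑ᴹ to ∑ᶻ )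

-- A faithful n-dimensional representation π of the Lie algebra of type C₂, written
-- in a basis of an admissible ℤ-lattice, so that H i = π(hᵢ), X α = π(x_α) and the
-- divided powers π(x_α)ᵏ/k! are integer matrices.  The relations are those of a
-- Chevalley basis.  The signs of the structure constants are left open, which
-- allows every choice of Chevalley basis.
record Representation (n : ℕ) : Set where
  field
    H : Fin 2 → ℤMatrix n
    X : Root → ℤMatrix n

    [H,H]   : ∀ i j → [ H i , H j ]ᶻ ≈ᶻ 0ᶻ
    [H,X]   : ∀ i α → [ H i , X α ]ᶻ ≈ᶻ ⟨ coords α , simple i ^∨⟩ ·ᶻ X α
    [X,X⁻]  : ∀ α → [ X α , X (-ᴿ α) ]ᶻ ≈ᶻ ∑ᶻ (λ i → corootCoeff α i ·ᶻ H i)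
    [X,X]   : ∀ α β δ r → coords α +ʷ coords β ≈ʷ coords δ → StringLength α β r →
              ([ X α , X β ]ᶻ ≈ᶻ + suc r ·ᶻ X δ) ⊎ ([ X α , X β ]ᶻ ≈ᶻ -[1+ r ] ·ᶻ X δ)
    [X,X]≈0 : ∀ α β → β ≢ -ᴿ α → ¬ IsRoot (coords α +ʷ coords β) →
              [ X α , X β ]ᶻ ≈ᶻ 0ᶻ

    faithful : ∀ (a : Fin 2 → ℤ) (b : Root → ℤ) →
               ∑ᶻ (λ i → a i ·ᶻ H i) +ᶻ ∑ᶻ (λ k → b (roots k) ·ᶻ X (roots k)) ≈ᶻ 0ᶻ →
               (∀ i → a i ≡ + 0) × (∀ γ → b γ ≡ + 0)

    divPow      : Root → ℕ → ℤMatrix n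
    divPow-spec : ∀ α k → (+ (k !)) ·ᶻ divPow α k ≈ᶻ X α ^ᶻ k

    -- Root vectors always act nilpotently; the bound makes exp(t X α) a finite sum.
    bound     : ℕ
    nilpotent : ∀ α → X α ^ᶻ bound ≈ᶻ 0ᶻ

module _ {n} (π : Representation n) where
  open Representation π

  -- Weights are integral, so eigenvectors can be taken in the lattice ℤⁿ.
  IsWeight : Pred ℤ² _
  IsWeight μ = Σ (Vector ℤ n) λ v →
    ¬ (∀ i → v i ≡ + 0) ×
    (∀ k i → sum (λ j → H k i j ℤ.* v j) ≡ ⟨ μ , simple k ^∨⟩ ℤ.* v i)
    where open import Algebra.Properties.Semiring.Sum (CommutativeRing.semiring ℤ-ring) using (sum)

  -- Λ_π, the lattice generated by the weights of π, is the root lattice.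
  IsAdjoint : Set
  IsAdjoint = ∀ μ → Generated Weight-group IsWeight μ ⇔ Generated Weight-group IsRoot μ

------------------------------------------------------------------------
-- Chevalley groups

module _ {c ℓ} (R : CommutativeRing c ℓ) {n} (π : Representation n) where
  open CommutativeRing R
  open Representation π
  open Matrices R
  open import Algebra.Properties.Semiring.Sum semiring using (sum)
  open import Algebra.Properties.Semiring.Exp semiring using (_^_)

  -- x_γ(t) = exp(t π(x_γ))
  rootElement : Root → Carrier → Matrix n
  rootElement γ t i j = sum {bound} λ k → t ^ toℕ k * ι (divPow γ (toℕ k) i j)

  IsRootElement : Root → Pred (Invertible n) _
  IsRootElement γ g = ∃[ t ] mat g ≈ᴹ rootElement γ t

  Elementary : Pred (Invertible n) _
  Elementary = Generated (GL n) λ g → ∃[ γ ] IsRootElement γ g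

-- The coordinate ring of the Chevalley–Demazure scheme is ℤ[xᵢⱼ]/I, where I is the
-- ideal of integer polynomials vanishing on the Chevalley group over ℂ.  That group
-- is the Zariski closure of the elementary group over ℚ, hence I is also the ideal
-- of polynomials vanishing on the latter.  As I contains det - 1, the points below
-- lie in SLₙ(R).
ChevalleyGroup : ∀ {c ℓ} (R : CommutativeRing c ℓ) {n} (π : Representation n) →
                 Pred (Matrices.Invertible R n) ℓ
ChevalleyGroup R {n} π g =
  ∀ (p : Poly n) →
  (∀ h → Elementary ℚ-ring π h → CommutativeRing._≈_ ℚ-ring (evalPoly ℚ-ring (Q.mat h) p) Q.0#) →
  evalPoly R (mat g) p ≈ 0#
  where
  open CommutativeRing R using (_≈_; 0#)
  open Matrices R using (mat)
  module Q where
    open CommutativeRing ℚ-ring public using (0#)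
    open Matrices ℚ-ring public using (mat)

record LargeSubgroup {c ℓ} (R : CommutativeRing c ℓ) {n} (π : Representation n) p
       : Set (c ⊔ ℓ ⊔ lsuc p) where
  field
    subgroup : Subgroup (Matrices.GL R n) p
  open Subgroup subgroup public
  field
    ⊆Chevalley  : member ⊆ ChevalleyGroup R π
    Elementary⊆ : Elementary R π ⊆ member

module _ {c ℓ p} {R : CommutativeRing c ℓ} {n} {π : Representation n}
         (G : LargeSubgroup R π p) where

  RootSubgroup : Root → Pred (Group.Carrier (LargeSubgroup.group G)) _
  RootSubgroup γ g = IsRootElement R π γ (proj₁ g)

{-# OPTIONS --safe #-}
module Submission where

open import Defs
open import Algebra.Bundles using (Group; AbelianGroup; CommutativeRing; Ring)
import Algebra.Properties.Ring
open import Data.Bool.Base using (Bool; true; false; if_then_else_; not)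
open import Data.Empty using (⊥; ⊥-elim)
open import Data.Fin.Base using (Fin; punchIn; punchOut; _↑ˡ_; _↑ʳ_; splitAt) renaming (toℕ to #)
import Data.Fin.Base as F
open import Data.Fin.Patterns using (0F; 1F; 2F; 3F; 4F; 5F; 6F; 7F; 8F; 9F)
import Data.Fin.Properties as F
open import Data.Integer.Base as O using (ℤ; +_; -[1+_])
import Data.Integer.Properties as O
open import Data.List.Base using (List; []; _∷_; _++_; map; length)
open import Data.List.Relation.Unary.All using (All; []; _∷_)
open import Data.Maybe.Base using (Maybe; just; nothing)
open import Data.Nat.Base as N using (ℕ; zero; suc; _!; z≤n; s≤s)
import Data.Nat.Properties as N
import Data.List.Base
import Data.Vec.Base
import Data.Nat.Combinatorics
open import Data.Product.Base using (Σ; ∃; ∃-syntax; _×_; _,_) renaming (proj₁ to fst; proj₂ to snd)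
import Data.Sign.Properties
open import Data.Sign.Base using (Sign) renaming (+ to pos; - to neg)
open import Data.Sum.Base using (_⊎_) renaming (inj₁ to inl; inj₂ to inr)
open import Data.Unit.Base using (⊤; tt)
open import Data.Vec.Base using (Vec; []; _∷_; lookup)
open import Function.Base using (_∘_; _$_; id)
open import Level using (Level; _⊔_; 0ℓ) renaming (suc to lsuc)
open import Relation.Binary.PropositionalEquality as J using (_≡_; _≢_; cong; cong₂) renaming (refl to rfl)
open import Relation.Nullary.Decidable using (Dec; yes; no; does; map′; toWitness; fromWitness; True; False; toWitnessFalse; _×-dec_; _→-dec_; ¬?)
open import Relation.Nullary.Negation.Core using (¬_; contradiction)
import Relation.Binary.Reasoning.Setoid as Reasoning
import Function.Bundles
import Data.Vec.Functional
import Data.Sum.Base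
import Data.Rational.Base as Q
import Data.Rational.Properties as Q

infixr 5 _::_
pattern _::_ x xs = x ∷ xs

-- Identities in an algebra over a commutative ring

record ScalarAction {c ℓ a m} (R : CommutativeRing c ℓ) (A : Ring a m) : Set (c ⊔ ℓ ⊔ a ⊔ m) where
 private
  module R = CommutativeRing R
  module A = Ring A
 infixr 7 _⊙_
 field
  _⊙_ : R.Carrier -> A.Carrier -> A.Carrier
  %-cong : ∀ {r s x y} -> r R.≈ s -> x A.≈ y -> (r ⊙ x) A.≈ (s ⊙ y)
  %-distribr : ∀ r s x -> ((r R.+ s) ⊙ x) A.≈ (r ⊙ x A.+ s ⊙ x)
  %-distribl : ∀ r x y -> (r ⊙ (x A.+ y)) A.≈ (r ⊙ x A.+ r ⊙ y)
  %-mul : ∀ r s x y -> ((r ⊙ x) A.* (s ⊙ y)) A.≈ ((r R.* s) ⊙ (x A.* y))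
  %-one : ∀ x -> (R.1# ⊙ x) A.≈ x

infixl 6 _:+_ _:-_ _+:_ _-:_
infixl 7 _:*_ _*:_
infixr 7 _:%_

data Scalar (k : ℕ) : Set where
 sv : Fin k -> Scalar k
 0: 1: : Scalar k
 _+:_ _*:_ _-:_ : Scalar k -> Scalar k -> Scalar k
 -:_ : Scalar k -> Scalar k

data Expr (k l : ℕ) : Set where
 mv : Fin l -> Expr k l
 :0 :1 : Expr k l
 _:+_ _:*_ _:-_ : Expr k l -> Expr k l -> Expr k l
 :-_ : Expr k l -> Expr k l
 _:%_ : Scalar k -> Expr k l -> Expr k l

pattern s0 = sv 0F
pattern s1 = sv 1F
pattern s2 = sv 2F
pattern s3 = sv 3F
pattern s4 = sv 4F
pattern s5 = sv 5F
pattern s6 = sv 6F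
pattern s7 = sv 7F
pattern s8 = sv 8F
pattern m0 = mv 0F
pattern m1 = mv 1F
pattern m2 = mv 2F
pattern m3 = mv 3F
pattern m4 = mv 4F
pattern m5 = mv 5F
pattern m6 = mv 6F
pattern m7 = mv 7F
pattern m8 = mv 8F
pattern m9 = mv 9F

-- A polynomial is normalised to a list of signed monomials, commutative in the
-- scalars and non-commutative in the elements of the algebra; an identity holds as
-- soon as the monomials of the difference cancel in pairs.
module AlgebraSolver {c ℓ a m} {R : CommutativeRing c ℓ} {A : Ring a m} (𝒜 : ScalarAction R A) where
 private
  module R where
   open CommutativeRing R public
   open Algebra.Properties.Ring ring public
  module A where
   open Ring A public
   open Algebra.Properties.Ring A public
 open ScalarAction 𝒜
 open Reasoning A.setoid

 private
  MTerm = \ k l -> Bool × List (Fin k) × List (Fin l)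

 module _ {k l : ℕ} (σ : Vec R.Carrier k) (ρ : Vec A.Carrier l) where
  ⟦_⟧s : Scalar k -> R.Carrier
  ⟦ sv i ⟧s = lookup σ i
  ⟦ 0: ⟧s = R.0#
  ⟦ 1: ⟧s = R.1#
  ⟦ s +: t ⟧s = ⟦ s ⟧s R.+ ⟦ t ⟧s
  ⟦ s *: t ⟧s = ⟦ s ⟧s R.* ⟦ t ⟧s
  ⟦ s -: t ⟧s = ⟦ s ⟧s R.- ⟦ t ⟧s
  ⟦ -: t ⟧s = R.- ⟦ t ⟧s

  ⟦_⟧ : Expr k l -> A.Carrier
  ⟦ mv i ⟧ = lookup ρ i
  ⟦ :0 ⟧ = A.0#
  ⟦ :1 ⟧ = A.1#
  ⟦ s :+ t ⟧ = ⟦ s ⟧ A.+ ⟦ t ⟧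
  ⟦ s :* t ⟧ = ⟦ s ⟧ A.* ⟦ t ⟧
  ⟦ s :- t ⟧ = ⟦ s ⟧ A.- ⟦ t ⟧
  ⟦ :- t ⟧ = A.- ⟦ t ⟧
  ⟦ s :% t ⟧ = ⟦ s ⟧s ⊙ ⟦ t ⟧

  private
   sgn : Bool -> A.Carrier -> A.Carrier
   sgn true x = x
   sgn false x = A.- x

   sword : List (Fin k) -> R.Carrier
   sword [] = R.1#
   sword (i :: u) = lookup σ i R.* sword u

   mword : List (Fin l) -> A.Carrier
   mword [] = A.1#
   mword (i :: w) = lookup ρ i A.* mword w

   term : MTerm k l -> A.Carrier
   term (b , u , w) = sgn b (sword u ⊙ mword w)

   terms : List (MTerm k l) -> A.Carrier
   terms [] = A.0#
   terms (t :: ts) = term t A.+ terms ts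

   insert : Fin k -> List (Fin k) -> List (Fin k)
   insert i [] = i :: []
   insert i (j :: u) = if does (i F.≤? j) then i :: j :: u else j :: insert i u

   merge : List (Fin k) -> List (Fin k) -> List (Fin k)
   merge [] v = v
   merge (i :: u) v = insert i (merge u v)

   _xnor_ : Bool -> Bool -> Bool
   true xnor b = b
   false xnor b = not b

   mulTerm : MTerm k l -> MTerm k l -> MTerm k l
   mulTerm (b , u , w) (b′ , u' , w') = b xnor b′ , merge u u' , w ++ w'

   mulTerm1 : MTerm k l -> List (MTerm k l) -> List (MTerm k l)
   mulTerm1 t [] = []
   mulTerm1 t (s :: ss) = mulTerm t s :: mulTerm1 t ss

   mulTerms : List (MTerm k l) -> List (MTerm k l) -> List (MTerm k l)
   mulTerms [] ss = []
   mulTerms (t :: ts) ss = mulTerm1 t ss ++ mulTerms ts ss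

   negTerms : List (MTerm k l) -> List (MTerm k l)
   negTerms [] = []
   negTerms ((b , u , w) :: ts) = (not b , u , w) :: negTerms ts

   snf : Scalar k -> List (MTerm k l)
   snf (sv i) = (true , i :: [] , []) :: []
   snf 0: = []
   snf 1: = (true , [] , []) :: []
   snf (s +: t) = snf s ++ snf t
   snf (s *: t) = mulTerms (snf s) (snf t)
   snf (s -: t) = snf s ++ negTerms (snf t)
   snf (-: t) = negTerms (snf t)

   nf : Expr k l -> List (MTerm k l)
   nf (mv i) = (true , [] , i :: []) :: []
   nf :0 = []
   nf :1 = (true , [] , []) :: []
   nf (s :+ t) = nf s ++ nf t
   nf (s :* t) = mulTerms (nf s) (nf t)
   nf (s :- t) = nf s ++ negTerms (nf t)
   nf (:- t) = negTerms (nf t)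
   nf (s :% t) = mulTerms (snf s) (nf t)

   eqList : ∀ {n} (u v : List (Fin n)) -> Maybe (u ≡ v)
   eqList [] [] = just rfl
   eqList [] (_ :: _) = nothing
   eqList (_ :: _) [] = nothing
   eqList (i :: u) (j :: v) with i F.≟ j | eqList u v
   ... | yes rfl | just rfl = just rfl
   ... | _ | _ = nothing

   isOpposite : (t s : MTerm k l) -> Maybe (s ≡ (not (fst t) , snd t))
   isOpposite (true , u , w) (false , u' , w') with eqList u u' | eqList w w'
   ... | just rfl | just rfl = just rfl
   ... | _ | _ = nothing
   isOpposite (false , u , w) (true , u' , w') with eqList u u' | eqList w w'
   ... | just rfl | just rfl = just rfl
   ... | _ | _ = nothing
   isOpposite (true , _) (true , _) = nothing
   isOpposite (false , _) (false , _) = nothing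

   opposite-cancels : ∀ t -> term t A.+ term (not (fst t) , snd t) A.≈ A.0#
   opposite-cancels (true , _) = A.-‿inverseʳ _
   opposite-cancels (false , _) = A.-‿inverseˡ _

   remove : ∀ t ts -> Maybe (Σ (List (MTerm k l)) \ ts' -> term t A.+ terms ts A.≈ terms ts')
   remove t [] = nothing
   remove t (s :: ts) with isOpposite t s
   ... | just rfl = just (ts , A.trans (A.sym (A.+-assoc _ _ _)) (A.trans (A.+-congʳ (opposite-cancels t)) (A.+-identityˡ _)))
   ... | nothing with remove t ts
   ... | nothing = nothing
   ... | just (ts' , p) = just (s :: ts' , (begin
    term t A.+ (term s A.+ terms ts) ≈⟨ A.+-assoc _ _ _ ⟨
    term t A.+ term s A.+ terms ts ≈⟨ A.+-congʳ (A.+-comm _ _) ⟩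
    term s A.+ term t A.+ terms ts ≈⟨ A.+-assoc _ _ _ ⟩
    term s A.+ (term t A.+ terms ts) ≈⟨ A.+-congˡ p ⟩
    term s A.+ terms ts' ∎))

   vanishes : ℕ -> ∀ ts -> Maybe (terms ts A.≈ A.0#)
   vanishes _ [] = just A.refl
   vanishes zero (t :: ts) = nothing
   vanishes (suc n) (t :: ts) with remove t ts
   ... | nothing = nothing
   ... | just (ts' , p) with vanishes n ts'
   ... | nothing = nothing
   ... | just q = just (A.trans p q)

   terms-++ : ∀ ts ss -> terms (ts ++ ss) A.≈ terms ts A.+ terms ss
   terms-++ [] ss = A.sym (A.+-identityˡ _)
   terms-++ (t :: ts) ss = A.trans (A.+-congˡ (terms-++ ts ss)) (A.sym (A.+-assoc _ _ _))

   %-zerol : ∀ x -> R.0# ⊙ x A.≈ A.0#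
   %-zerol x = A.x+x≈x⇒x≈0 _ (A.trans (A.sym (%-distribr R.0# R.0# x)) (%-cong (R.+-identityʳ _) A.refl))

   %-negl : ∀ r x -> (R.- r) ⊙ x A.≈ A.- (r ⊙ x)
   %-negl r x = A.+-inverseˡ-unique _ _ (A.trans (A.sym (%-distribr (R.- r) r x)) (A.trans (%-cong (R.-‿inverseˡ r) A.refl) (%-zerol x)))

   insert-sound : ∀ i u -> sword (insert i u) R.≈ lookup σ i R.* sword u
   insert-sound i [] = R.refl
   insert-sound i (j :: u) with does (i F.≤? j)
   ... | true = R.refl
   ... | false = R.trans (R.*-congˡ (insert-sound i u)) (R.trans (R.sym (R.*-assoc _ _ _)) (R.trans (R.*-congʳ (R.*-comm _ _)) (R.*-assoc _ _ _)))

   merge-sound : ∀ u v -> sword (merge u v) R.≈ sword u R.* sword v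
   merge-sound [] v = R.sym (R.*-identityˡ _)
   merge-sound (i :: u) v = R.trans (insert-sound i (merge u v)) (R.trans (R.*-congˡ (merge-sound u v)) (R.sym (R.*-assoc _ _ _)))

   mword-++ : ∀ u v -> mword (u ++ v) A.≈ mword u A.* mword v
   mword-++ [] v = A.sym (A.*-identityˡ _)
   mword-++ (i :: u) v = A.trans (A.*-congˡ (mword-++ u v)) (A.sym (A.*-assoc _ _ _))

   sgn-cong : ∀ b {x y} -> x A.≈ y -> sgn b x A.≈ sgn b y
   sgn-cong true p = p
   sgn-cong false p = A.-‿cong p

   sgn-mul : ∀ b b′ x y -> sgn (b xnor b′) (x A.* y) A.≈ sgn b x A.* sgn b′ y
   sgn-mul true true x y = A.refl
   sgn-mul true false x y = A.-‿distribʳ-* x y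
   sgn-mul false true x y = A.-‿distribˡ-* x y
   sgn-mul false false x y = begin
    x A.* y ≈⟨ A.-‿involutive _ ⟨
    A.- (A.- (x A.* y)) ≈⟨ A.-‿cong (A.-‿distribʳ-* x y) ⟩
    A.- (x A.* A.- y) ≈⟨ A.-‿distribˡ-* x (A.- y) ⟩
    A.- x A.* A.- y ∎

   mulTerm-sound : ∀ t s -> term (mulTerm t s) A.≈ term t A.* term s
   mulTerm-sound (b , u , w) (b′ , u' , w') = begin
    sgn (b xnor b′) (sword (merge u u') ⊙ mword (w ++ w'))
    ≈⟨ sgn-cong (b xnor b′) (%-cong (merge-sound u u') (mword-++ w w')) ⟩
    sgn (b xnor b′) ((sword u R.* sword u') ⊙ (mword w A.* mword w'))
    ≈⟨ sgn-cong (b xnor b′) (%-mul _ _ _ _) ⟨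
    sgn (b xnor b′) ((sword u ⊙ mword w) A.* (sword u' ⊙ mword w'))
    ≈⟨ sgn-mul b b′ _ _ ⟩
    sgn b (sword u ⊙ mword w) A.* sgn b′ (sword u' ⊙ mword w') ∎

   mulTerm1-sound : ∀ t ss -> terms (mulTerm1 t ss) A.≈ term t A.* terms ss
   mulTerm1-sound t [] = A.sym (A.zeroʳ _)
   mulTerm1-sound t (s :: ss) = A.trans (A.+-cong (mulTerm-sound t s) (mulTerm1-sound t ss)) (A.sym (A.distribˡ _ _ _))

   mulTerms-sound : ∀ ts ss -> terms (mulTerms ts ss) A.≈ terms ts A.* terms ss
   mulTerms-sound [] ss = A.sym (A.zeroˡ _)
   mulTerms-sound (t :: ts) ss = A.trans (terms-++ (mulTerm1 t ss) _) (A.trans (A.+-cong (mulTerm1-sound t ss) (mulTerms-sound ts ss)) (A.sym (A.distribʳ _ _ _)))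

   negTerm-sound : ∀ b x -> sgn (not b) x A.≈ A.- sgn b x
   negTerm-sound true x = A.refl
   negTerm-sound false x = A.sym (A.-‿involutive x)

   negTerms-sound : ∀ ts -> terms (negTerms ts) A.≈ A.- terms ts
   negTerms-sound [] = A.sym A.-0#≈0#
   negTerms-sound ((b , t) :: ts) = A.trans (A.+-cong (negTerm-sound b _) (negTerms-sound ts)) (A.-‿+-comm _ _)

   snf-sound : ∀ s -> terms (snf s) A.≈ ⟦ s ⟧s ⊙ A.1#
   snf-sound (sv i) = A.trans (A.+-identityʳ _) (%-cong (R.*-identityʳ _) A.refl)
   snf-sound 0: = A.sym (%-zerol _)
   snf-sound 1: = A.+-identityʳ _
   snf-sound (s +: t) = A.trans (terms-++ (snf s) _) (A.trans (A.+-cong (snf-sound s) (snf-sound t)) (A.sym (%-distribr _ _ _)))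
   snf-sound (s *: t) = A.trans (mulTerms-sound (snf s) _) (A.trans (A.*-cong (snf-sound s) (snf-sound t)) (A.trans (%-mul _ _ _ _) (%-cong R.refl (A.*-identityˡ _))))
   snf-sound (s -: t) = A.trans (terms-++ (snf s) _) (A.trans (A.+-cong (snf-sound s) (A.trans (negTerms-sound (snf t)) (A.trans (A.-‿cong (snf-sound t)) (A.sym (%-negl _ _))))) (A.sym
    (%-distribr _ _ _)))
   snf-sound (-: t) = A.trans (negTerms-sound (snf t)) (A.trans (A.-‿cong (snf-sound t)) (A.sym (%-negl _ _)))

   nf-sound : ∀ e -> terms (nf e) A.≈ ⟦ e ⟧
   nf-sound (mv i) = A.trans (A.+-identityʳ _) (A.trans (%-one _) (A.*-identityʳ _))
   nf-sound :0 = A.refl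
   nf-sound :1 = A.trans (A.+-identityʳ _) (%-one _)
   nf-sound (s :+ t) = A.trans (terms-++ (nf s) _) (A.+-cong (nf-sound s) (nf-sound t))
   nf-sound (s :* t) = A.trans (mulTerms-sound (nf s) _) (A.*-cong (nf-sound s) (nf-sound t))
   nf-sound (s :- t) = A.trans (terms-++ (nf s) _) (A.+-cong (nf-sound s) (A.trans (negTerms-sound (nf t)) (A.-‿cong (nf-sound t))))
   nf-sound (:- t) = A.trans (negTerms-sound (nf t)) (A.-‿cong (nf-sound t))
   nf-sound (s :% t) = begin
    terms (mulTerms (snf s) (nf t)) ≈⟨ mulTerms-sound (snf s) _ ⟩
    terms (snf s) A.* terms (nf t) ≈⟨ A.*-cong (snf-sound s) (A.trans (nf-sound t) (A.sym (%-one _))) ⟩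
    (⟦ s ⟧s ⊙ A.1#) A.* (R.1# ⊙ ⟦ t ⟧) ≈⟨ %-mul _ _ _ _ ⟩
    (⟦ s ⟧s R.* R.1#) ⊙ (A.1# A.* ⟦ t ⟧) ≈⟨ %-cong (R.*-identityʳ _) (A.*-identityˡ _) ⟩
    ⟦ s ⟧s ⊙ ⟦ t ⟧ ∎

  Valid : Expr k l -> Expr k l -> Set
  Valid e f with vanishes (length (nf (e :- f))) (nf (e :- f))
  ... | just _ = ⊤
  ... | nothing = ⊥

  solve : ∀ e f -> {Valid e f} -> ⟦ e ⟧ A.≈ ⟦ f ⟧
  solve e f {v} with vanishes (length (nf (e :- f))) (nf (e :- f))
  ... | just p = A.x∙y⁻¹≈ε⇒x≈y _ _ (A.trans (A.sym (nf-sound (e :- f))) p)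

-- Matrix algebras and the embedding of the integers

module IntegerScalars {c ℓ} (R : CommutativeRing c ℓ) where
 open CommutativeRing R
 open Algebra.Properties.Ring ring
 open Matrices R using (ι)
 open import Algebra.Properties.Semiring.Mult semiring using (×-homo-+; ×1-homo-*; ×-congˡ) renaming (_×_ to _×ℕ_)
 open Reasoning setoid

 ι-cong : ∀ {i j} -> i ≡ j -> ι i ≈ ι j
 ι-cong rfl = refl

 ι-⊖ : ∀ m n -> ι (m O.⊖ n) ≈ m ×ℕ 1# - n ×ℕ 1#
 ι-⊖ zero zero = sym (-‿inverseʳ _)
 ι-⊖ (suc m) zero = sym (trans (+-congˡ -0#≈0#) (+-identityʳ _))
 ι-⊖ zero (suc n) = sym (+-identityˡ _)
 ι-⊖ (suc m) (suc n) = begin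
  ι (suc m O.⊖ suc n) ≡⟨ cong ι (O.[1+m]⊖[1+n]≡m⊖n m n) ⟩
  ι (m O.⊖ n) ≈⟨ ι-⊖ m n ⟩
  m ×ℕ 1# - n ×ℕ 1# ≈⟨ +-congʳ (+-identityˡ _) ⟨
  0# + m ×ℕ 1# - n ×ℕ 1# ≈⟨ +-congʳ (+-congʳ (-‿inverseʳ 1#)) ⟨
  1# - 1# + m ×ℕ 1# - n ×ℕ 1# ≈⟨ +-congʳ (trans (+-assoc _ _ _) (+-congˡ (+-comm _ _))) ⟩
  1# + (m ×ℕ 1# - 1#) - n ×ℕ 1# ≈⟨ trans (+-congʳ (sym (+-assoc _ _ _))) (+-assoc _ _ _) ⟩
  1# + m ×ℕ 1# + (- 1# - n ×ℕ 1#) ≈⟨ +-congˡ (-‿+-comm _ _) ⟩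
  suc m ×ℕ 1# - suc n ×ℕ 1# ∎

 ι-neg : ∀ i -> ι (O.- i) ≈ - ι i
 ι-neg (+ zero) = sym -0#≈0#
 ι-neg (+ suc n) = refl
 ι-neg -[1+ n ] = sym (-‿involutive _)

 ι-+ : ∀ i j -> ι (i O.+ j) ≈ ι i + ι j
 ι-+ (+ m) (+ n) = ×-homo-+ 1# m n
 ι-+ (+ m) -[1+ n ] = ι-⊖ m (suc n)
 ι-+ -[1+ m ] (+ n) = trans (ι-⊖ n (suc m)) (+-comm _ _)
 ι-+ -[1+ m ] -[1+ n ] = begin
  - (suc (suc (m N.+ n)) ×ℕ 1#) ≡⟨ cong (\ k -> - (suc k ×ℕ 1#)) (N.+-suc m n) ⟨
  - ((suc m N.+ suc n) ×ℕ 1#) ≈⟨ -‿cong (×-homo-+ 1# (suc m) (suc n)) ⟩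
  - (suc m ×ℕ 1# + suc n ×ℕ 1#) ≈⟨ -‿+-comm _ _ ⟨
  - (suc m ×ℕ 1#) - suc n ×ℕ 1# ∎

 ι-1 : ι (+ 1) ≈ 1#
 ι-1 = +-identityʳ 1#

 private
  ι-pos* : ∀ m j -> ι (+ m O.* j) ≈ ι (+ m) * ι j
  ι-pos* m (+ n) = trans (ι-cong (J.sym (O.pos-* m n))) (×1-homo-* m n)
  ι-pos* m -[1+ n ] = begin
   ι (+ m O.* -[1+ n ]) ≡⟨ cong ι (O.neg-distribʳ-* (+ m) (+ suc n)) ⟨
   ι (O.- (+ m O.* + suc n)) ≈⟨ ι-neg (+ m O.* + suc n) ⟩
   - ι (+ m O.* + suc n) ≈⟨ -‿cong (ι-pos* m (+ suc n)) ⟩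
   - (ι (+ m) * ι (+ suc n)) ≈⟨ -‿distribʳ-* _ _ ⟩
   ι (+ m) * ι -[1+ n ] ∎

 ι-* : ∀ i j -> ι (i O.* j) ≈ ι i * ι j
 ι-* (+ m) j = ι-pos* m j
 ι-* -[1+ m ] j = begin
  ι (-[1+ m ] O.* j) ≡⟨ cong ι (O.neg-distribˡ-* (+ suc m) j) ⟨
  ι (O.- (+ suc m O.* j)) ≈⟨ ι-neg (+ suc m O.* j) ⟩
  - ι (+ suc m O.* j) ≈⟨ -‿cong (ι-pos* (suc m) j) ⟩
  - (ι (+ suc m) * ι j) ≈⟨ -‿distribˡ-* _ _ ⟩
  ι -[1+ m ] * ι j ∎

ι-ℤ : ∀ i -> Matrices.ι ℤ-ring i ≡ i
ι-ℤ (+ n) = ι-ℕ n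
 where
 ι-ℕ : ∀ n -> Matrices.ι ℤ-ring (+ n) ≡ + n
 ι-ℕ zero = rfl
 ι-ℕ (suc n) = cong O.suc (ι-ℕ n)
ι-ℤ -[1+ n ] = cong O.-_ (ι-ℤ (+ suc n))

open import Algebra.Properties.Semiring.Sum (CommutativeRing.semiring ℤ-ring) public using () renaming (sum to sumZ)

module MatrixAlgebra {c ℓ} (R : CommutativeRing c ℓ) where
 open CommutativeRing R
 open Algebra.Properties.Ring ring
 open Matrices R
 open IntegerScalars R
 open import Algebra.Properties.Semiring.Sum semiring
  using (sum; sum-cong-≋; sum-replicate-zero; ∑-comm; ∑-distrib-+; *-distribˡ-sum; *-distribʳ-sum)

 matrixRing : ℕ -> Ring c ℓ
 matrixRing n = record { Carrier = Matrix n ; _≈_ = _≈ᴹ_ ; _+_ = _+ᴹ_ ; _*_ = _*ᴹ_ ; -_ = \ A i j -> - A i j ; 0# = 0ᴹ ; 1# = 1ᴹ ; isRing = record { +-isAbelianGroup = record { isGroup =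
  record { isMonoid = record { isSemigroup = record { isMagma = record { isEquivalence = record { refl = \ _ _ -> refl ; sym = \ p i j -> sym (p i j) ; trans = \ p q i j -> trans (p i j) (q i
  j) } ; ∙-cong = \ p q i j -> +-cong (p i j) (q i j) } ; assoc = \ A B C i j -> +-assoc _ _ _ } ; identity = (\ A i j -> +-identityˡ _) , (\ A i j -> +-identityʳ _) } ; inverse = (\ A i j ->
  -‿inverseˡ _) , (\ A i j -> -‿inverseʳ _) ; ⁻¹-cong = \ p i j -> -‿cong (p i j) } ; comm = \ A B i j -> +-comm _ _ } ; *-cong = *ᴹ-cong ; *-assoc = *ᴹ-assoc ; *-identity = *ᴹ-identityˡ ,
  *ᴹ-identityʳ ; distrib = (\ A B C i j -> trans (sum-cong-≋ \ k -> distribˡ (A i k) (B k j) (C k j)) (∑-distrib-+ (\ k -> A i k * B k j) (\ k -> A i k * C k j))) , (\ A B C i j -> trans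
  (sum-cong-≋ \ k -> distribʳ (A k j) (B i k) (C i k)) (∑-distrib-+ (\ k -> B i k * A k j) (\ k -> C i k * A k j))) } }

 matrixAction : ∀ n -> ScalarAction R (matrixRing n)
 matrixAction n = record
  { _⊙_ = _·ᴹ_
  ; %-cong = \ p q i j -> *-cong p (q i j)
  ; %-distribr = \ r s A i j -> distribʳ _ _ _
  ; %-distribl = \ r A B i j -> distribˡ _ _ _
  ; %-mul = \ r s A B i j -> begin
  sum (\ k -> r * A i k * (s * B k j)) ≈⟨ sum-cong-≋ (\ k -> interchange r (A i k) s (B k j)) ⟩
  sum (\ k -> r * s * (A i k * B k j)) ≈⟨ *-distribˡ-sum (r * s) (\ k -> A i k * B k j) ⟨
  r * s * sum (\ k -> A i k * B k j) ∎
  ; %-one = \ A i j -> *-identityˡ _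
  }
  where
  open import Algebra.Properties.CommutativeSemigroup *-commutativeSemigroup using (interchange)
  open Reasoning setoid

 scalarAction : ScalarAction R ring
 scalarAction = record { _⊙_ = _*_ ; %-cong = *-cong ; %-distribr = \ r s x -> distribʳ _ _ _ ; %-distribl = distribˡ ; %-mul = \ r s x y -> interchange r x s y ; %-one = *-identityˡ }
  where open import Algebra.Properties.CommutativeSemigroup *-commutativeSemigroup using (interchange)

 private
  module S = AlgebraSolver scalarAction

 solves : ∀ {k} (σ : Vec Carrier k) (e f : Scalar k) -> {S.Valid σ [] (e :% :1) (f :% :1)} -> S.⟦_⟧s σ [] e ≈ S.⟦_⟧s σ [] f
 solves σ e f {v} = trans (sym (*-identityʳ _)) (trans (S.solve σ [] (e :% :1) (f :% :1) {v}) (*-identityʳ _))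

 ιM : ∀ {n} -> Matrices.Matrix ℤ-ring n -> Matrix n
 ιM A i j = ι (A i j)

 ι-sum : ∀ {n} (v : Fin n -> ℤ) -> ι (sumZ v) ≈ sum (\ i -> ι (v i))
 ι-sum {zero} v = refl
 ι-sum {suc n} v = trans (ι-+ (v 0F) _) (+-congˡ (ι-sum (v ∘ F.suc)))

 module _ {n : ℕ} where
  private
   module ℤM = Matrices ℤ-ring

  ιM-cong : ∀ {A B : ℤM.Matrix n} -> A ℤM.≈ᴹ B -> ιM A ≈ᴹ ιM B
  ιM-cong p i j = ι-cong (p i j)

  ιM-+ : ∀ (A B : ℤM.Matrix n) -> ιM (A ℤM.+ᴹ B) ≈ᴹ ιM A +ᴹ ιM B
  ιM-+ A B i j = ι-+ (A i j) (B i j)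

  ιM-· : ∀ k (A : ℤM.Matrix n) -> ιM (k ℤM.·ᴹ A) ≈ᴹ ι k ·ᴹ ιM A
  ιM-· k A i j = ι-* k (A i j)

  ιM-* : ∀ (A B : ℤM.Matrix n) -> ιM (A ℤM.*ᴹ B) ≈ᴹ ιM A *ᴹ ιM B
  ιM-* A B i j = trans (ι-sum \ k -> A i k O.* B k j) (sum-cong-≋ \ k -> ι-* (A i k) (B k j))

  ιM-1 : ιM ℤM.1ᴹ ≈ᴹ 1ᴹ {n}
  ιM-1 i j with does (i F.≟ j)
  ... | true = ι-1
  ... | false = refl

  ιM-0 : ιM ℤM.0ᴹ ≈ᴹ 0ᴹ {n}
  ιM-0 i j = refl

infixr -1 _⟫_
_⟫_ : ∀ {a} {A : Set a} {x y z : A} -> x ≡ y -> y ≡ z -> x ≡ z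
_⟫_ = J.trans

-- Divided powers and exponentials

module RingSums {a m} (A : Ring a m) where
 open Ring A
 open import Algebra.Properties.Semiring.Sum semiring public
  using (sum; sum-cong-≋; sum-replicate-zero; ∑-comm; ∑-distrib-+; *-distribˡ-sum; *-distribʳ-sum)
 open Reasoning setoid

 congl : ∀ x {y z} -> y ≈ z -> x * y ≈ x * z
 congl x = *-congˡ {x}

 congr : ∀ x {y z} -> y ≈ z -> y * x ≈ z * x
 congr x = *-congʳ {x}

 infixr -1 _&_
 _&_ : ∀ {x y z} -> x ≈ y -> y ≈ z -> x ≈ z
 _&_ = trans

 sum<-cong : ∀ N {f g : ℕ -> Carrier} -> (∀ k -> f k ≈ g k) -> sum {N} (f ∘ #) ≈ sum {N} (g ∘ #)
 sum<-cong N p = sum-cong-≋ {N} (\ k -> p (# k))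

 sum-zero : ∀ {n} {v : Fin n -> Carrier} -> (∀ i -> v i ≈ 0#) -> sum v ≈ 0#
 sum-zero {n} p = sum-cong-≋ p & sum-replicate-zero n

 sum-last : ∀ N (f : ℕ -> Carrier) -> sum {suc N} (f ∘ #) ≈ sum {N} (f ∘ #) + f N
 sum-last zero f = +-identityʳ _ & sym (+-identityˡ _)
 sum-last (suc N) f = +-congˡ (sum-last N (f ∘ suc)) & sym (+-assoc _ _ _)

 sum-extend : ∀ N M (f : ℕ -> Carrier) -> (∀ k -> N N.≤ k -> f k ≈ 0#) -> sum {M N.+ N} (f ∘ #) ≈ sum {N} (f ∘ #)
 sum-extend N zero f p = refl
 sum-extend N (suc M) f p = sum-last (M N.+ N) f & +-congˡ (p (M N.+ N) (N.m≤n+m N M)) & +-identityʳ _ & sum-extend N M f p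

 convolution : (a b : ℕ -> Carrier) -> ℕ -> Carrier
 convolution a b k = sum {suc k} \ i -> a (# i) * b (k N.∸ # i)

 cauchy-product : ∀ N (a b : ℕ -> Carrier) -> (∀ i j -> N N.≤ i N.+ j -> a i * b j ≈ 0#) -> sum {N} (convolution a b ∘ #) ≈ sum {N} (a ∘ #) * sum {N} (b ∘ #)
 cauchy-product zero a b p = sym (zeroˡ _)
 cauchy-product (suc N) a b p = begin
  convolution a b 0 + sum {N} (\ k -> a 0 * b (suc (# k)) + convolution a' b (# k))
  ≈⟨ +-cong (+-identityʳ _) (∑-distrib-+ {N} (\ k -> a 0 * b (suc (# k))) (convolution a' b ∘ #)) ⟩
  a 0 * b 0 + (sum {N} (\ k -> a 0 * b (suc (# k))) + sum {N} (convolution a' b ∘ #))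
  ≈⟨ +-assoc _ _ _ ⟨
  a 0 * b 0 + sum {N} (\ k -> a 0 * b (suc (# k))) + sum {N} (convolution a' b ∘ #)
  ≈⟨ +-cong (trans (+-congˡ (sym (*-distribˡ-sum {N} (a 0) (b ∘ suc ∘ #)))) (sym (distribˡ _ _ _)))
  (cauchy-product N a' b \ i j q -> p (suc i) j (s≤s q)) ⟩
  a 0 * sum {suc N} (b ∘ #) + sum {N} (a' ∘ #) * sum {N} (b ∘ #)
  ≈⟨ +-congˡ last-term ⟩
  a 0 * sum {suc N} (b ∘ #) + sum {N} (a' ∘ #) * sum {suc N} (b ∘ #)
  ≈⟨ distribʳ _ _ _ ⟨
  (a 0 + sum {N} (a' ∘ #)) * sum {suc N} (b ∘ #) ∎
  where
  a' = a ∘ suc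
  last-term : sum {N} (a' ∘ #) * sum {N} (b ∘ #) ≈ sum {N} (a' ∘ #) * sum {suc N} (b ∘ #)
  last-term = sym (begin
   sum {N} (a' ∘ #) * sum {suc N} (b ∘ #) ≈⟨ *-congˡ (sum-last N b) ⟩
   sum {N} (a' ∘ #) * (sum {N} (b ∘ #) + b N) ≈⟨ distribˡ _ _ _ ⟩
   sum {N} (a' ∘ #) * sum {N} (b ∘ #) + sum {N} (a' ∘ #) * b N
   ≈⟨ +-congˡ (trans (*-distribʳ-sum {N} (b N) (a' ∘ #))
   (sum-zero {N} \ i -> p (suc (# i)) N (s≤s (N.m≤n+m N (# i))))) ⟩
   sum {N} (a' ∘ #) * sum {N} (b ∘ #) + 0# ≈⟨ +-identityʳ _ ⟩
   sum {N} (a' ∘ #) * sum {N} (b ∘ #) ∎)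

module I where
 open Matrices ℤ-ring public using () renaming (Matrix to Mat)
 open Matrices ℤ-ring public using (_·ᴹ_; [_,_])
 module _ {n : ℕ} where
  open Ring (MatrixAlgebra.matrixRing ℤ-ring n) public
  open Algebra.Properties.Ring (MatrixAlgebra.matrixRing ℤ-ring n) public
  open RingSums (MatrixAlgebra.matrixRing ℤ-ring n) public
  open import Algebra.Properties.Semiring.Exp (Ring.semiring (MatrixAlgebra.matrixRing ℤ-ring n)) public
   using (_^_)
  open ScalarAction (MatrixAlgebra.matrixAction ℤ-ring n) public
   using (%-cong; %-distribr; %-distribl; %-mul; %-one)
  open AlgebraSolver (MatrixAlgebra.matrixAction ℤ-ring n) public

 ·-cancel : ∀ {n} k {A B : Mat n} -> + suc k ·ᴹ A ≈ + suc k ·ᴹ B -> A ≈ B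
 ·-cancel k p i j = O.*-cancelˡ-≡ (+ suc k) _ _ (p i j)

 !-cancel : ∀ {n} k {A B : Mat n} -> + (k !) ·ᴹ A ≈ + (k !) ·ᴹ B -> A ≈ B
 !-cancel k p i j = O.*-cancelˡ-≡ (+ (k !)) _ _ {{N._!≢0 k}} (p i j)

C-factorial : ∀ {k i} -> i N.≤ k -> (k Data.Nat.Combinatorics.C i) N.* (i ! N.* (k N.∸ i) !) ≡ k !
C-factorial {k} {i} i≤k = cong (N._* (i ! N.* (k N.∸ i) !)) (nCk≡n!/k![n-k]! i≤k) ⟫ m/n*n≡m {{i N.!* (k N.∸ i) !≢0}} (k![n∸k]!∣n! i≤k)
 where
 open import Data.Nat.Combinatorics.Specification using (nCk≡n!/k![n-k]!)
 open import Data.Nat.Combinatorics using (k![n∸k]!∣n!)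
 open import Data.Nat.DivMod using (m/n*n≡m)

prev : ∀ {a} {A : Set a} -> A -> (ℕ -> A) -> ℕ -> A
prev z D zero = z
prev z D (suc k) = D k

record DividedPowers {n} (X : I.Mat n) (D : ℕ -> I.Mat n) (N : ℕ) : Set where
 open I
 field
  power : ∀ k -> (+ (k !)) ·ᴹ D k ≈ X ^ k
  vanish : ∀ k -> N N.≤ k -> D k ≈ 0#

 zeroth : D 0 ≈ 1#
 zeroth = trans (sym (%-one _)) (power 0)

 next : ∀ k -> + suc k ·ᴹ D (suc k) ≈ X * D k
 next k = !-cancel k (begin
  + (k !) ·ᴹ (+ suc k ·ᴹ D (suc k)) ≈⟨ solve (+ (k !) :: + suc k :: []) (D (suc k) :: [])
  (s0 :% s1 :% m0) ((s1 *: s0) :% m0) ⟩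
  (+ suc k O.* + (k !)) ·ᴹ D (suc k) ≈⟨ %-cong (J.sym (O.pos-* (suc k) (k !))) refl ⟩
  + (suc k !) ·ᴹ D (suc k) ≈⟨ power (suc k) ⟩
  X * X ^ k ≈⟨ congl X (power k) ⟨
  X * (+ (k !) ·ᴹ D k) ≈⟨ solve (+ (k !) :: []) (X :: D k :: [])
  (m0 :* (s0 :% m1)) (s0 :% (m0 :* m1)) ⟩
  + (k !) ·ᴹ (X * D k) ∎)
  where open Reasoning setoid

 first : D 1 ≈ X
 first = trans (sym (%-one _)) (trans (next 0) (trans (congl X zeroth) (*-identityʳ X)))

 D~ D~~ : ℕ -> I.Mat n
 D~ = prev 0# D
 D~~ = prev 0# D~

 X*D~ : ∀ k -> X * D~ k ≈ + k ·ᴹ D k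
 X*D~ zero = solve [] (X :: D 0 :: []) (m0 :* :0) (0: :% m1)
 X*D~ (suc k) = sym (next k)

 X*D~~ : ∀ k -> X * D~~ k + D~ k ≈ + k ·ᴹ D~ k
 X*D~~ zero = solve [] (X :: []) (m0 :* :0 :+ :0) (0: :% :0)
 X*D~~ (suc k) = trans (+-congʳ (X*D~ k)) (solve (+ k :: []) (D k :: []) (s0 :% m0 :+ m0) ((1: +: s0) :% m0))

 -- X^{(k)} Z = Z X^{(k)} + Z₁ X^{(k-1)} + Z₂ X^{(k-2)}, so that
 -- exp(tX) Z exp(-tX) = Z + t Z₁ + t² Z₂.
 D-commutator : ∀ {Z Z1 Z2} -> X * Z ≈ Z * X + Z1 -> X * Z1 ≈ Z1 * X + (Z2 + Z2) -> X * Z2 ≈ Z2 * X -> ∀ k -> D k * Z ≈ Z * D k + Z1 * D~ k + Z2 * D~~ k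
 D-commutator {Z} {Z1} {Z2} p p1 p2 zero = begin
  D 0 * Z ≈⟨ congr Z zeroth ⟩
  1# * Z ≈⟨ solve [] (Z :: Z1 :: Z2 :: []) (:1 :* m0)
  (m0 :* :1 :+ m1 :* :0 :+ m2 :* :0) ⟩
  Z * 1# + Z1 * 0# + Z2 * 0# ≈⟨ +-congʳ (+-congʳ (congl Z zeroth)) ⟨
  Z * D 0 + Z1 * 0# + Z2 * 0# ∎
  where open Reasoning setoid
 D-commutator {Z} {Z1} {Z2} p p1 p2 (suc k) = ·-cancel k (begin
  + suc k ·ᴹ (D (suc k) * Z)
  ≈⟨ solve (+ suc k :: []) (D (suc k) :: Z :: []) (s0 :% (m0 :* m1)) ((s0 :% m0) :* m1) ⟩
  (+ suc k ·ᴹ D (suc k)) * Z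
  ≈⟨ trans (congr Z (next k)) (*-assoc X (D k) Z) ⟩
  X * (D k * Z)
  ≈⟨ congl X (D-commutator {Z} {Z1} {Z2} p p1 p2 k) ⟩
  X * (Z * D k + Z1 * D~ k + Z2 * D~~ k)
  ≈⟨ solve [] (X :: Z :: Z1 :: Z2 :: D k :: D~ k :: D~~ k :: [])
  (m0 :* (m1 :* m4 :+ m2 :* m5 :+ m3 :* m6))
  ((m0 :* m1) :* m4 :+ (m0 :* m2) :* m5 :+ (m0 :* m3) :* m6) ⟩
  (X * Z) * D k + (X * Z1) * D~ k + (X * Z2) * D~~ k
  ≈⟨ +-cong (+-cong (congr (D k) p) (congr (D~ k) p1)) (congr (D~~ k) p2) ⟩
  (Z * X + Z1) * D k + (Z1 * X + (Z2 + Z2)) * D~ k + (Z2 * X) * D~~ k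
  ≈⟨ solve [] (X :: Z :: Z1 :: Z2 :: D k :: D~ k :: D~~ k :: [])
  ((m1 :* m0 :+ m2) :* m4 :+ (m2 :* m0 :+ (m3 :+ m3)) :* m5 :+ (m3 :* m0) :* m6)
  (m1 :* (m0 :* m4) :+ m2 :* (m0 :* m5 :+ m4) :+ m3 :* ((m0 :* m6 :+ m5) :+ m5)) ⟩
  Z * (X * D k) + Z1 * (X * D~ k + D k) + Z2 * ((X * D~~ k + D~ k) + D~ k)
  ≈⟨ +-cong (+-cong (congl Z (sym (next k))) (congl Z1 (+-congʳ (X*D~ k))))
  (congl Z2 (+-congʳ (X*D~~ k))) ⟩
  Z * (+ suc k ·ᴹ D (suc k)) + Z1 * (+ k ·ᴹ D k + D k) + Z2 * (+ k ·ᴹ D~ k + D~ k)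
  ≈⟨ solve (+ k :: []) (Z :: Z1 :: Z2 :: D (suc k) :: D k :: D~ k :: [])
  (m0 :* ((1: +: s0) :% m3) :+ m1 :* (s0 :% m4 :+ m4) :+ m2 :* (s0 :% m5 :+ m5))
  ((1: +: s0) :% (m0 :* m3 :+ m1 :* m4 :+ m2 :* m5)) ⟩
  + suc k ·ᴹ (Z * D (suc k) + Z1 * D k + Z2 * D~ k) ∎)
  where open Reasoning setoid

 D-central : ∀ {Z} -> X * Z ≈ Z * X -> ∀ k -> D k * Z ≈ Z * D k
 D-central {Z} p k = trans (D-commutator {Z} {0#} {0#} (trans p (sym (+-identityʳ _))) (solve [] (X :: []) (m0 :* :0) (:0 :* m0 :+ (:0 :+ :0))) (solve [] (X :: []) (m0 :* :0) (:0 :* m0)) k)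
  (solve [] (Z :: D k :: D~ k :: D~~ k :: []) (m0 :* m1 :+ :0 :* m2 :+ :0 :* m3) (m0 :* m1))

module _ {n : ℕ} where
 open I
 open Reasoning (setoid {n})
 open import Algebra.Properties.Semiring.Mult (Ring.semiring (MatrixAlgebra.matrixRing ℤ-ring n)) using () renaming (_×_ to _×ℕ_)

 D*D : ∀ {X : Mat n} {D N} -> DividedPowers X D N -> ∀ {k i} -> i N.≤ k -> D i * D (k N.∸ i) ≈ + (k Data.Nat.Combinatorics.C i) ·ᴹ D k
 D*D {X} {D} dp {k} {i} i≤k = !-cancel i (!-cancel (k N.∸ i) (begin
  + (k∸i !) ·ᴹ (+ (i !) ·ᴹ (D i * D k∸i))
  ≈⟨ solve (+ (k∸i !) :: + (i !) :: []) (D i :: D k∸i :: [])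
  (s0 :% s1 :% (m0 :* m1)) ((s1 :% m0) :* (s0 :% m1)) ⟩
  (+ (i !) ·ᴹ D i) * (+ (k∸i !) ·ᴹ D k∸i)
  ≈⟨ *-cong (dp.power i) (dp.power k∸i) ⟩
  X ^ i * X ^ k∸i
  ≈⟨ ^-homo-* X i k∸i ⟨
  X ^ (i N.+ k∸i)
  ≡⟨ cong (X ^_) (N.m+[n∸m]≡n i≤k) ⟩
  X ^ k
  ≈⟨ dp.power k ⟨
  + (k !) ·ᴹ D k
  ≡⟨ cong (\ z -> + z ·ᴹ D k) (C-factorial i≤k) ⟨
  + (C N.* (i ! N.* k∸i !)) ·ᴹ D k
  ≈⟨ %-cong (J.trans (O.pos-* C _) (cong (+ C O.*_) (O.pos-* (i !) (k∸i !)))) refl ⟩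
  (+ C O.* (+ (i !) O.* + (k∸i !))) ·ᴹ D k
  ≈⟨ solve (+ C :: + (i !) :: + (k∸i !) :: []) (D k :: [])
  ((s0 *: (s1 *: s2)) :% m0) (s2 :% s1 :% s0 :% m0) ⟩
  + (k∸i !) ·ᴹ (+ (i !) ·ᴹ (+ C ·ᴹ D k)) ∎))
  where
  module dp = DividedPowers dp
  k∸i = k N.∸ i
  C = k Data.Nat.Combinatorics.C i
  open import Algebra.Properties.Semiring.Exp (Ring.semiring (MatrixAlgebra.matrixRing ℤ-ring n)) using (^-homo-*)

 ×ℕ≈· : ∀ k (A : Mat n) -> k ×ℕ A ≈ + k ·ᴹ A
 ×ℕ≈· zero A = solve [] (A :: []) :0 (0: :% m0)
 ×ℕ≈· (suc k) A = trans (+-congˡ {x = A} (×ℕ≈· k A)) (solve (+ k :: []) (A :: []) (m0 :+ s0 :% m0) ((1: +: s0) :% m0))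

 -- exp(X + X′) = exp(X) exp(X′) for commuting X and X′
 convolution-power : ∀ {X X' : Mat n} {D D' N N'} -> DividedPowers X D N -> DividedPowers X' D' N' -> X * X' ≈ X' * X -> DividedPowers (X + X') (convolution D D') (N N.+ N')
 convolution-power {X} {X'} {D} {D'} {N} {N'} dp dp' comm = record { power = \ k -> sym (trans (Binomial.theorem X X' comm k) (trans (sum-cong-≋ {n} {suc k} (term k)) (sym (scale {suc k} (+
  (k !)) \ i -> D (# i) * D' (k N.∸ # i))))) ; vanish = \ k N+N'≤k -> sum-zero {n} {suc k} \ i -> split k N+N'≤k i (N.≤-total N (# i)) }
  where
  module dp = DividedPowers dp
  module dp' = DividedPowers dp'
  import Algebra.Properties.Semiring.Binomial (Ring.semiring (MatrixAlgebra.matrixRing ℤ-ring n)) as Binomial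

  scale : ∀ {m} r (v : Fin m -> Mat n) -> r ·ᴹ sum v ≈ sum (\ i -> r ·ᴹ v i)
  scale {zero} r v = solve (r :: []) [] (s0 :% :0) :0
  scale {suc m} r v = trans (%-distribl r (v 0F) _) (+-congˡ {x = r ·ᴹ v 0F} (scale r (v ∘ F.suc)))

  term : ∀ k (i : Fin (suc k)) -> Binomial.binomialTerm X X' k i ≈ + (k !) ·ᴹ (D (# i) * D' (k N.∸ # i))
  term k i = begin
   C ×ℕ (X ^ j * X' ^ (k N.∸ j))
   ≈⟨ ×ℕ≈· C _ ⟩
   + C ·ᴹ (X ^ j * X' ^ (k N.∸ j))
   ≈⟨ %-cong {r = + C} rfl (*-cong (dp.power j) (dp'.power (k N.∸ j))) ⟨
   + C ·ᴹ ((+ (j !) ·ᴹ D j) * (+ ((k N.∸ j) !) ·ᴹ D' (k N.∸ j)))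
   ≈⟨ solve (+ C :: + (j !) :: + ((k N.∸ j) !) :: []) (D j :: D' (k N.∸ j) :: [])
   (s0 :% ((s1 :% m0) :* (s2 :% m1))) ((s0 *: (s1 *: s2)) :% (m0 :* m1)) ⟩
   (+ C O.* (+ (j !) O.* + ((k N.∸ j) !))) ·ᴹ (D j * D' (k N.∸ j))
   ≈⟨ %-cong (J.trans (O.pos-* C _) (cong (+ C O.*_) (O.pos-* (j !) ((k N.∸ j) !)))) refl ⟨
   + (C N.* (j ! N.* (k N.∸ j) !)) ·ᴹ (D j * D' (k N.∸ j))
   ≡⟨ cong (\ z -> + z ·ᴹ (D j * D' (k N.∸ j))) (C-factorial (N.s≤s⁻¹ (F.toℕ<n i))) ⟩
   + (k !) ·ᴹ (D j * D' (k N.∸ j)) ∎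
   where
   j = # i
   C = k Data.Nat.Combinatorics.C j

  split : ∀ k -> N N.+ N' N.≤ k -> ∀ (i : Fin (suc k)) -> N N.≤ # i ⊎ # i N.≤ N -> D (# i) * D' (k N.∸ # i) ≈ 0#
  split k le i (inl N≤i) = trans (congr (D' (k N.∸ # i)) (dp.vanish _ N≤i)) (zeroˡ (D' (k N.∸ # i)))
  split k le i (inr i≤N) = trans (congl (D (# i)) (dp'.vanish _ (N.≤-trans (N.m+n≤o⇒m≤o∸n N' (J.subst (N._≤ k) (N.+-comm N N') le)) (N.∸-monoʳ-≤ k i≤N)))) (zeroʳ (D (# i)))

 D-conjugate : ∀ {X Y C : Mat n} {D E N M} -> DividedPowers X D N -> DividedPowers Y E M -> C * X ≈ Y * C -> ∀ k -> C * D k ≈ E k * C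
 D-conjugate {X} {Y} {C} {D} {E} dp dq p k = !-cancel k (begin
  + (k !) ·ᴹ (C * D k) ≈⟨ solve (+ (k !) :: []) (C :: D k :: []) (s0 :% (m0 :* m1)) (m0 :* (s0 :% m1)) ⟩
  C * (+ (k !) ·ᴹ D k) ≈⟨ congl C (DividedPowers.power dp k) ⟩
  C * X ^ k ≈⟨ powers k ⟩
  Y ^ k * C ≈⟨ congr C (DividedPowers.power dq k) ⟨
  (+ (k !) ·ᴹ E k) * C ≈⟨ solve (+ (k !) :: []) (E k :: C :: []) ((s0 :% m0) :* m1) (s0 :% (m0 :* m1)) ⟩
  + (k !) ·ᴹ (E k * C) ∎)
  where
  powers : ∀ k -> C * X ^ k ≈ Y ^ k * C
  powers zero = trans (*-identityʳ C) (sym (*-identityˡ C))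
  powers (suc k) = trans (sym (*-assoc C X _)) (trans (congr (X ^ k) p) (trans (*-assoc Y C _) (trans (congl Y (powers k)) (sym (*-assoc Y _ C)))))

 D-scale : ∀ {X : Mat n} {D N} c -> DividedPowers X D N -> DividedPowers (c ·ᴹ X) (\ k -> (c O.^ k) ·ᴹ D k) N
 D-scale {X} {D} c dp = record { power = \ k -> trans (solve (+ (k !) :: c O.^ k :: []) (D k :: []) (s0 :% s1 :% m0) (s1 :% s0 :% m0)) (trans (%-cong {r = c O.^ k} rfl (DividedPowers.power dp
  k)) (sym (powers k))) ; vanish = \ k N≤k -> trans (%-cong {r = c O.^ k} rfl (DividedPowers.vanish dp k N≤k)) (solve (c O.^ k :: []) [] (s0 :% :0) :0) }
  where
  powers : ∀ k -> (c ·ᴹ X) ^ k ≈ (c O.^ k) ·ᴹ X ^ k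
  powers zero = sym (%-one 1#)
  powers (suc k) = trans (congl (c ·ᴹ X) (powers k)) (solve (c :: c O.^ k :: []) (X :: X ^ k :: []) ((s0 :% m0) :* (s1 :% m1)) ((s0 *: s1) :% (m0 :* m1)))

module Exponential {c ℓ} (R : CommutativeRing c ℓ) where
 open MatrixAlgebra R public
 open IntegerScalars R public
 module S where
  open CommutativeRing R public
  open Algebra.Properties.Ring (CommutativeRing.ring R) public
  open import Algebra.Properties.Semiring.Exp (CommutativeRing.semiring R) public
   using (_^_; ^-congˡ; ^-homo-*)
  open import Algebra.Properties.CommutativeSemiring.Exp (CommutativeRing.commutativeSemiring R) public
   using (^-distrib-*)
  open AlgebraSolver scalarAction public
  open RingSums (CommutativeRing.ring R) public
 module M where
  open Matrices R public using () renaming (Matrix to Mat)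
  module _ {n : ℕ} where
   open Ring (matrixRing n) public
   open Algebra.Properties.Ring (matrixRing n) public
   open RingSums (matrixRing n) public
   open ScalarAction (matrixAction n) public
   open AlgebraSolver (matrixAction n) public
 open S using (_^_)
 open Matrices R using (ι)

 ιM-sum : ∀ {n m} (v : Fin m -> I.Mat n) -> ιM (I.sum v) M.≈ M.sum (\ i -> ιM (v i))
 ιM-sum {m = zero} v = ιM-0
 ιM-sum {m = suc m} v = M.trans (ιM-+ (v 0F) _) (M.+-congˡ {x = ιM (v 0F)} (ιM-sum (v ∘ F.suc)))

 ι-^ : ∀ i k -> ι (i O.^ k) S.≈ ι i ^ k
 ι-^ i zero = ι-1
 ι-^ i (suc k) = ι-* i (i O.^ k) S.& S.*-congˡ (ι-^ i k)

 module _ {n : ℕ} where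
  open M
  open Reasoning (setoid {n})
  private
   Seq = ℕ -> I.Mat n

  series : ℕ -> Seq -> S.Carrier -> Mat n
  series N D t = sum {n} {N} \ k -> (t ^ # k) ⊙ ιM (D (# k))

  series-cong : ∀ N {D E : Seq} {s t} -> (∀ k -> D k I.≈ E k) -> s S.≈ t -> series N D s ≈ series N E t
  series-cong N {D} {E} {s} {t} p q = sum<-cong N {\ k -> (s ^ k) ⊙ ιM (D k)} {\ k -> (t ^ k) ⊙ ιM (E k)} \ k -> %-cong (S.^-congˡ k q) (ιM-cong {A = D k} {E k} (p k))

  series-+ : ∀ N (D E : Seq) t -> series N (\ k -> D k I.+ E k) t ≈ series N D t + series N E t
  series-+ N D E t = (sum<-cong N \ k -> trans (%-cong S.refl (ιM-+ (D k) (E k))) (%-distribl (t ^ k) (ιM (D k)) (ιM (E k)))) & ∑-distrib-+ {n} {N} (\ k -> (t ^ # k) ⊙ ιM (D (# k))) (\ k ->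
   (t ^ # k) ⊙ ιM (E (# k)))

  series-*l : ∀ N (D : Seq) Z t -> series N (\ k -> Z I.* D k) t ≈ ιM Z * series N D t
  series-*l N D Z t = (sum<-cong N \ k -> trans (%-cong S.refl (ιM-* Z (D k))) (solve (t ^ k :: []) (ιM Z :: ιM (D k) :: []) (s0 :% (m0 :* m1)) (m0 :* (s0 :% m1)))) & sym (*-distribˡ-sum {n} {N}
   (ιM Z) (\ k -> (t ^ # k) ⊙ ιM (D (# k))))

  series-*r : ∀ N (D : Seq) Z t -> series N (\ k -> D k I.* Z) t ≈ series N D t * ιM Z
  series-*r N D Z t = (sum<-cong N \ k -> trans (%-cong S.refl (ιM-* (D k) Z)) (solve (t ^ k :: []) (ιM Z :: ιM (D k) :: []) (s0 :% (m1 :* m0)) ((s0 :% m1) :* m0))) & sym (*-distribʳ-sum {n} {N}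
   (ιM Z) (\ k -> (t ^ # k) ⊙ ιM (D (# k))))

  private
   vanishing : ∀ {N} {D : Seq} {t} -> (∀ k -> N N.≤ k -> D k I.≈ I.0#) -> ∀ k -> N N.≤ k -> (t ^ k) ⊙ ιM (D k) ≈ 0#
   vanishing {D = D} {t} p k q = trans (%-cong S.refl (ιM-cong {A = D k} (p k q) & ιM-0)) (solve (t ^ k :: []) [] (s0 :% :0) :0)

  series-extend : ∀ {N} {D : Seq} {t} -> (∀ k -> N N.≤ k -> D k I.≈ I.0#) -> ∀ M -> series (M N.+ N) D t ≈ series N D t
  series-extend {N} {D} {t} p M = sum-extend N M (\ k -> (t ^ k) ⊙ ιM (D k)) (vanishing {D = D} p)

  series-bound : ∀ {N M} {D : Seq} {t} -> (∀ k -> N N.≤ k -> D k I.≈ I.0#) -> (∀ k -> M N.≤ k -> D k I.≈ I.0#) -> series M D t ≈ series N D t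
  series-bound {N} {M} {D} {t} p q = sym (series-extend {D = D} q N) & reflexive (cong (\ k -> series k D t) (N.+-comm N M)) & series-extend {D = D} p M

  series-prev : ∀ N (D : Seq) t -> series (suc N) (prev I.0# D) t ≈ t ⊙ series N D t
  series-prev N D t = +-cong (%-cong S.refl ιM-0 & solve [] [] (1: :% :0) :0) (sum<-cong N \ k -> solve (t :: t ^ k :: []) (ιM (D k) :: []) ((s0 *: s1) :% m0) (s0 :% s1 :% m0)) & +-identityˡ _ &
   sym (scale N (\ k -> (t ^ k) ⊙ ιM (D k)))
   where
   scale : ∀ N (f : ℕ -> Mat n) -> t ⊙ sum {n} {N} (f ∘ #) ≈ sum {n} {N} \ k -> t ⊙ f (# k)
   scale zero f = solve (t :: []) [] (s0 :% :0) :0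
   scale (suc N) f = %-distribl t (f 0) _ & +-congˡ {x = t ⊙ f 0} (scale N (f ∘ suc))

  -- Σ k tᵏ D k = t X Σ tᵏ D k
  series-euler : ∀ {X D N} -> DividedPowers X D N -> ∀ t -> series N (\ k -> + k I.·ᴹ D k) t ≈ t ⊙ (ιM X * series N D t)
  series-euler {X} {D} {N} dp t = begin
   series N (\ k -> + k I.·ᴹ D k) t
   ≈⟨ series-extend {N} {\ k -> + k I.·ᴹ D k} (\ k q -> I.trans (I.%-cong {r = + k} rfl (DividedPowers.vanish dp k q))
   (I.solve (+ k :: []) [] (s0 :% :0) :0)) 1 ⟨
   series (suc N) (\ k -> + k I.·ᴹ D k) t
   ≈⟨ series-cong (suc N) (\ k -> I.sym (DividedPowers.X*D~ dp k)) S.refl ⟩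
   series (suc N) (\ k -> X I.* prev I.0# D k) t
   ≈⟨ series-*l (suc N) (prev I.0# D) X t ⟩
   ιM X * series (suc N) (prev I.0# D) t
   ≈⟨ congl (ιM X) (series-prev N D t) ⟩
   ιM X * (t ⊙ series N D t)
   ≈⟨ solve (t :: []) (ιM X :: series N D t :: []) (m0 :* (s0 :% m1)) (s0 :% (m0 :* m1)) ⟩
   t ⊙ (ιM X * series N D t) ∎

  exp-commutator : ∀ {X D N} -> DividedPowers X D N -> ∀ {Z Z1 Z2} -> X I.* Z I.≈ Z I.* X I.+ Z1 -> X I.* Z1 I.≈ Z1 I.* X I.+ (Z2 I.+ Z2) -> X I.* Z2 I.≈ Z2 I.* X -> ∀ t -> series N D t * ιM Z ≈
   (ιM Z + t ⊙ ιM Z1 + (t S.* t) ⊙ ιM Z2) * series N D t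
  exp-commutator {X} {D} {N} dp {Z} {Z1} {Z2} p p1 p2 t = begin
   series N D t * ιM Z
   ≈⟨ congr (ιM Z) (series-extend {D = D} dp.vanish 2) ⟨
   series (2 N.+ N) D t * ιM Z
   ≈⟨ series-*r (2 N.+ N) D Z t ⟨
   series (2 N.+ N) (\ k -> D k I.* Z) t
   ≈⟨ series-cong (2 N.+ N) (dp.D-commutator {Z} {Z1} {Z2} p p1 p2) S.refl ⟩
   series (2 N.+ N) (\ k -> Z I.* D k I.+ Z1 I.* dp.D~ k I.+ Z2 I.* dp.D~~ k) t
   ≈⟨ trans (series-+ (2 N.+ N) (\ k -> Z I.* D k I.+ Z1 I.* dp.D~ k) (\ k -> Z2 I.* dp.D~~ k) t)
   (+-congʳ (series-+ (2 N.+ N) (\ k -> Z I.* D k) (\ k -> Z1 I.* dp.D~ k) t)) ⟩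
   series (2 N.+ N) (\ k -> Z I.* D k) t + series (2 N.+ N) (\ k -> Z1 I.* dp.D~ k) t
   + series (2 N.+ N) (\ k -> Z2 I.* dp.D~~ k) t
   ≈⟨ +-cong (+-cong
   (trans (series-*l (2 N.+ N) D Z t) (congl (ιM Z) (series-extend {D = D} dp.vanish 2)))
   (trans (series-*l (2 N.+ N) dp.D~ Z1 t) (congl (ιM Z1) (trans (series-prev (1 N.+ N) D t)
   (%-cong S.refl (series-extend {D = D} dp.vanish 1))))))
   (trans (series-*l (2 N.+ N) dp.D~~ Z2 t) (congl (ιM Z2) (trans (series-prev (1 N.+ N) dp.D~ t)
   (%-cong S.refl (series-prev N D t))))) ⟩
   ιM Z * series N D t + ιM Z1 * (t ⊙ series N D t) + ιM Z2 * (t ⊙ t ⊙ series N D t)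
   ≈⟨ solve (t :: []) (ιM Z :: ιM Z1 :: ιM Z2 :: series N D t :: [])
   (m0 :* m3 :+ m1 :* (s0 :% m3) :+ m2 :* (s0 :% s0 :% m3))
   ((m0 :+ s0 :% m1 :+ (s0 *: s0) :% m2) :* m3) ⟩
   (ιM Z + t ⊙ ιM Z1 + (t S.* t) ⊙ ιM Z2) * series N D t ∎
   where module dp = DividedPowers dp

  private
   product-vanishes : ∀ {N N'} {D E : Seq} {s t} -> (∀ k -> N N.≤ k -> D k I.≈ I.0#) -> (∀ k -> N' N.≤ k -> E k I.≈ I.0#) -> ∀ i j -> N N.+ N' N.≤ i N.+ j -> ((s ^ i) ⊙ ιM (D i)) * ((t ^ j) ⊙ ιM (E
    j)) ≈ 0#
   product-vanishes {N} {N'} {D} {E} {s} {t} p q i j le with N.≤-total N i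
   ... | inl N≤i = congr ((t ^ j) ⊙ ιM (E j)) (vanishing {D = D} p i N≤i) & zeroˡ ((t ^ j) ⊙ ιM (E j))
   ... | inr i≤N = congl ((s ^ i) ⊙ ιM (D i)) (vanishing {D = E} q j (N.+-cancelˡ-≤ N N' j (N.≤-trans le (N.+-monoˡ-≤ j i≤N)))) & zeroʳ ((s ^ i) ⊙ ιM (D i))

  series-convolution : ∀ {N N'} {D E : Seq} -> (∀ k -> N N.≤ k -> D k I.≈ I.0#) -> (∀ k -> N' N.≤ k -> E k I.≈ I.0#) -> ∀ t -> series (N N.+ N') (I.convolution D E) t ≈ series N D t * series N' E t
  series-convolution {N} {N'} {D} {E} p q t = begin
   series (N N.+ N') (I.convolution D E) t
   ≈⟨ sum<-cong (N N.+ N') terms≈ ⟩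
   sum {n} {N N.+ N'} (convolution (\ i -> (t ^ i) ⊙ ιM (D i)) (\ i -> (t ^ i) ⊙ ιM (E i)) ∘ #)
   ≈⟨ cauchy-product (N N.+ N') _ _ (product-vanishes {D = D} {E} p q) ⟩
   series (N N.+ N') D t * series (N N.+ N') E t
   ≈⟨ *-cong (trans (reflexive (cong (\ k -> series k D t) (N.+-comm N N'))) (series-extend {D = D} p N'))
   (series-extend {D = E} q N) ⟩
   series N D t * series N' E t ∎
   where
   scale : ∀ r m (v : Fin m -> Mat n) -> r ⊙ sum v ≈ sum \ i -> r ⊙ v i
   scale r zero v = solve (r :: []) [] (s0 :% :0) :0
   scale r (suc m) v = %-distribl r (v 0F) _ & +-congˡ {x = r ⊙ v 0F} (scale r m (v ∘ F.suc))
   terms≈ : ∀ k -> (t ^ k) ⊙ ιM (I.convolution D E k) ≈ convolution (\ i -> (t ^ i) ⊙ ιM (D i)) (\ i -> (t ^ i) ⊙ ιM (E i)) k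
   terms≈ k = %-cong S.refl (ιM-sum {m = suc k} \ i -> D (# i) I.* E (k N.∸ # i)) & (scale (t ^ k) (suc k) \ i -> ιM (D (# i) I.* E (k N.∸ # i))) & (sum-cong-≋ {n} {suc k} \ i -> trans
    (%-cong (S.reflexive (cong (t ^_) (J.sym (N.m+[n∸m]≡n (N.s≤s⁻¹ (F.toℕ<n i))))) S.& S.^-homo-* t (# i) (k N.∸ # i)) (ιM-* (D (# i)) (E (k N.∸ # i)))) (sym (%-mul _ _ (ιM (D (#
    i))) (ιM (E (k N.∸ # i))))))

  exp-+ : ∀ {X D N} -> DividedPowers X D N -> ∀ s t -> series N D (s S.+ t) ≈ series N D s * series N D t
  exp-+ {X} {D} {N} dp s t = begin
   series N D (s S.+ t)
   ≈⟨ series-extend {D = D} dp.vanish N ⟨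
   series (N N.+ N) D (s S.+ t)
   ≈⟨ sum<-cong (N N.+ N) terms≈ ⟩
   sum {n} {N N.+ N} (convolution (\ i -> (s ^ i) ⊙ ιM (D i)) (\ i -> (t ^ i) ⊙ ιM (D i)) ∘ #)
   ≈⟨ cauchy-product (N N.+ N) _ _ (product-vanishes {D = D} {D} dp.vanish dp.vanish) ⟩
   series (N N.+ N) D s * series (N N.+ N) D t
   ≈⟨ *-cong (series-extend {D = D} dp.vanish N) (series-extend {D = D} dp.vanish N) ⟩
   series N D s * series N D t ∎
   where
   module dp = DividedPowers dp
   module B = Data.Nat.Combinatorics
   import Algebra.Properties.CommutativeSemiring.Binomial (CommutativeRing.commutativeSemiring R) as Binomial
   module Rs where
    open S public using (sum)
    open import Algebra.Properties.Semiring.Mult (CommutativeRing.semiring R) public using () renaming (_×_ to _×ℕ_)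
   scale : ∀ m (v : Fin m -> S.Carrier) (Z : Mat n) -> Rs.sum v ⊙ Z ≈ sum \ i -> v i ⊙ Z
   scale zero v Z = solve [] (Z :: []) (0: :% m0) :0
   scale (suc m) v Z = %-distribr (v 0F) _ Z & +-congˡ {x = v 0F ⊙ Z} (scale m (v ∘ F.suc) Z)
   ×ℕ≈ι* : ∀ k x -> k Rs.×ℕ x S.≈ ι (+ k) S.* x
   ×ℕ≈ι* zero x = S.sym (S.zeroˡ x)
   ×ℕ≈ι* (suc k) x = S.+-cong (S.sym (S.*-identityˡ x)) (×ℕ≈ι* k x) S.& S.sym (S.distribʳ x S.1# (ι (+ k)))
   terms≈ : ∀ k -> ((s S.+ t) ^ k) ⊙ ιM (D k) ≈ convolution (\ i -> (s ^ i) ⊙ ιM (D i)) (\ i -> (t ^ i) ⊙ ιM (D i)) k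
   terms≈ k = trans (%-cong (Binomial.theorem k s t) refl)
    (trans (scale (suc k) (Binomial.binomialTerm s t k) (ιM (D k)))
    (sum-cong-≋ {n} {suc k} \ i -> let j = # i ; C = k B.C j in begin
    (C Rs.×ℕ (s ^ j S.* t ^ (k N.∸ j))) ⊙ ιM (D k)
    ≈⟨ %-cong (×ℕ≈ι* C _) refl ⟩
    (ι (+ C) S.* (s ^ j S.* t ^ (k N.∸ j))) ⊙ ιM (D k)
    ≈⟨ solve (ι (+ C) :: s ^ j :: t ^ (k N.∸ j) :: []) (ιM (D k) :: [])
    ((s0 *: (s1 *: s2)) :% m0) ((s1 *: s2) :% s0 :% m0) ⟩
    (s ^ j S.* t ^ (k N.∸ j)) ⊙ (ι (+ C) ⊙ ιM (D k))
    ≈⟨ %-cong S.refl (trans (sym (ιM-· (+ C) (D k)))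
    (trans (ιM-cong {A = + C I.·ᴹ D k} (I.sym (D*D dp (N.s≤s⁻¹ (F.toℕ<n i))))) (ιM-* (D j) (D (k N.∸ j))))) ⟩
    (s ^ j S.* t ^ (k N.∸ j)) ⊙ (ιM (D j) * ιM (D (k N.∸ j)))
    ≈⟨ %-mul _ _ (ιM (D j)) (ιM (D (k N.∸ j))) ⟨
    ((s ^ j) ⊙ ιM (D j)) * ((t ^ (k N.∸ j)) ⊙ ιM (D (k N.∸ j))) ∎))

  exp-0 : ∀ {X D N} -> DividedPowers X D N -> series N D S.0# ≈ 1#
  exp-0 {X} {D} {N} dp = begin
   series N D S.0# ≈⟨ series-extend {D = D} dp.vanish 1 ⟨
   series (suc N) D S.0# ≈⟨ +-cong (trans (%-one _) (trans (ιM-cong {A = D 0} dp.zeroth) ιM-1))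
   (sum-zero {n} {N} \ k -> trans (%-cong (S.zeroˡ _) refl)
   (solve [] (ιM (D (suc (# k))) :: []) (0: :% m0) :0)) ⟩
   1# + 0# ≈⟨ +-identityʳ _ ⟩
   1# ∎
   where module dp = DividedPowers dp

  exp-inverse : ∀ {X D N} -> DividedPowers X D N -> ∀ {s t} -> s S.+ t S.≈ S.0# -> series N D s * series N D t ≈ 1#
  exp-inverse {D = D} {N} dp {s} {t} p = trans (sym (exp-+ dp s t)) (series-cong N {D} {D} (\ _ -> I.refl) p & exp-0 dp)

  series-scale : ∀ N (D : Seq) c t -> series N (\ k -> (c O.^ k) I.·ᴹ D k) t ≈ series N D (ι c S.* t)
  series-scale N D c t = sum<-cong N \ k -> trans (%-cong {r = t ^ k} S.refl (ιM-· (c O.^ k) (D k) & %-cong (ι-^ c k) refl)) (solve (t ^ k :: ι c ^ k :: []) (ιM (D k) :: []) (s0 :% s1 :% m0)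
   ((s1 *: s0) :% m0) & %-cong (S.sym (S.^-distrib-* (ι c) t k)) refl)

  series-conjugate : ∀ N {D E : Seq} {C} -> (∀ k -> C I.* D k I.≈ E k I.* C) -> ∀ t -> ιM C * series N D t ≈ series N E t * ιM C
  series-conjugate N {D} {E} {C} p t = sym (series-*l N D C t) & series-cong N p S.refl & series-*r N E C t

-- The root system

_≟R_ : (α β : Root) -> Dec (α ≡ β)
short s t ≟R short s' t' = map′ (\ { (rfl , rfl) -> rfl }) (\ { rfl -> rfl , rfl })
 ((s Data.Sign.Properties.≟ s') ×-dec (t Data.Sign.Properties.≟ t'))
short _ _ ≟R long _ _ = no \ ()
long _ _ ≟R short _ _ = no \ ()
long i s ≟R long j t = map′ (\ { (rfl , rfl) -> rfl }) (\ { rfl -> rfl , rfl })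
 ((i F.≟ j) ×-dec (s Data.Sign.Properties.≟ t))

root-index : Root -> Fin 8
root-index (short pos pos) = 0F
root-index (short pos neg) = 1F
root-index (short neg pos) = 2F
root-index (short neg neg) = 3F
root-index (long 0F pos) = 4F
root-index (long 0F neg) = 5F
root-index (long 1F pos) = 6F
root-index (long 1F neg) = 7F

roots-index : ∀ γ -> roots (root-index γ) ≡ γ
roots-index (short pos pos) = rfl
roots-index (short pos neg) = rfl
roots-index (short neg pos) = rfl
roots-index (short neg neg) = rfl
roots-index (long 0F pos) = rfl
roots-index (long 0F neg) = rfl
roots-index (long 1F pos) = rfl
roots-index (long 1F neg) = rfl

all-roots? : ∀ {p} {P : Root -> Set p} -> (∀ γ -> Dec (P γ)) -> Dec (∀ γ -> P γ)
all-roots? {P = P} P? = map′ (\ f γ -> J.subst P (roots-index γ) (f (root-index γ))) (\ f k -> f (roots k)) (F.all? \ k -> P? (roots k))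

any-root? : ∀ {p} {P : Root -> Set p} -> (∀ γ -> Dec (P γ)) -> Dec (∃ P)
any-root? {P = P} P? = map′ (\ (k , p) -> roots k , p) (\ (γ , p) -> root-index γ , J.subst P (J.sym (roots-index γ)) p) (F.any? \ k -> P? (roots k))

module W = AbelianGroup Weight

_≟ʷ_ : (μ ν : W.Carrier) -> Dec (μ W.≈ ν)
(a , b) ≟ʷ (c , d) = (a O.≟ c) ×-dec (b O.≟ d)

infix 4 _⊞_≈_
record _⊞_≈_ (α β δ : Root) : Set where
 constructor ⟨_⟩
 field coords-sum : (coords α W.∙ coords β) W.≈ coords δ
open _⊞_≈_ public

_⊞_≟_ : ∀ α β δ -> Dec (α ⊞ β ≈ δ)
α ⊞ β ≟ δ = map′ ⟨_⟩ coords-sum ((coords α W.∙ coords β) ≟ʷ coords δ)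

isRoot? : ∀ μ -> Dec (IsRoot μ)
isRoot? μ = any-root? \ γ -> coords γ ≟ʷ μ

_∸_·_ : Root -> ℕ -> Root -> W.Carrier
β ∸ k · α = coords β W.- ((+ k O.* fst (coords α)) , (+ k O.* snd (coords α)))

chainLength : Root -> Root -> ℕ
chainLength α β = if does (isRoot? (β ∸ 1 · α)) then 1 else 0

private
 root-string : ∀ α β δ -> α ⊞ β ≈ δ -> IsRoot (β ∸ chainLength α β · α) × (∀ (k : Fin 5) -> IsRoot (β ∸ # k · α) -> # k N.≤ chainLength α β)
 root-string = toWitness {a? = all-roots? \ α -> all-roots? \ β -> all-roots? \ δ -> (α ⊞ β ≟ δ) →-dec (isRoot? _ ×-dec F.all? \ k -> isRoot? _ →-dec (_ N.≤? _))} tt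

 coordinate-gaps : ∀ β γ -> O.∣ fst (coords β) O.- fst (coords γ) ∣ N.≤ 4 × O.∣ snd (coords β) O.- snd (coords γ) ∣ N.≤ 4
 coordinate-gaps = toWitness {a? = all-roots? \ β -> all-roots? \ γ -> (_ N.≤? _) ×-dec (_ N.≤? _)} tt

 nonzero-coordinate : ∀ α -> 1 N.≤ O.∣ fst (coords α) ∣ ⊎ 1 N.≤ O.∣ snd (coords α) ∣
 nonzero-coordinate (short pos t) = inl (s≤s z≤n)
 nonzero-coordinate (short neg t) = inl (s≤s z≤n)
 nonzero-coordinate (long 0F pos) = inl (s≤s z≤n)
 nonzero-coordinate (long 0F neg) = inl (s≤s z≤n)
 nonzero-coordinate (long 1F pos) = inr (s≤s z≤n)
 nonzero-coordinate (long 1F neg) = inr (s≤s z≤n)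

 bounded-multiple : ∀ k a b g -> g ≡ b O.- (+ k O.* a) -> 1 N.≤ O.∣ a ∣ -> O.∣ b O.- g ∣ N.≤ 4 -> k N.≤ 4
 bounded-multiple k a b g eq 1≤∣a∣ d = begin
  k ≡⟨ N.*-identityʳ k ⟨
  k N.* 1 ≤⟨ N.*-monoʳ-≤ k 1≤∣a∣ ⟩
  k N.* O.∣ a ∣ ≡⟨ O.∣i*j∣≡∣i∣*∣j∣ (+ k) a ⟨
  O.∣ + k O.* a ∣ ≡⟨ cong O.∣_∣ (J.trans (J.sym (lemma b (+ k O.* a))) (cong (\ z -> b O.- z) (J.sym eq))) ⟩
  O.∣ b O.- g ∣ ≤⟨ d ⟩
  4 ∎
  where
  open N.≤-Reasoning
  lemma : ∀ b c -> b O.- (b O.- c) ≡ c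
  lemma b c = MatrixAlgebra.solves ℤ-ring (b :: c :: []) (s0 -: (s0 -: s1)) (s1)

chain-length : ∀ {α β δ} -> α ⊞ β ≈ δ -> StringLength α β (chainLength α β)
chain-length {α} {β} {δ} p = fst (root-string α β δ p) , \ k r -> check k r (small k r)
 where
 small : ∀ k -> IsRoot (β ∸ k · α) -> k N.≤ 4
 small k (γ , e1 , e2) with nonzero-coordinate α
 ... | inl q = bounded-multiple k (fst (coords α)) (fst (coords β)) _ e1 q (fst (coordinate-gaps β γ))
 ... | inr q = bounded-multiple k (snd (coords α)) (snd (coords β)) _ e2 q (snd (coordinate-gaps β γ))
 check : ∀ k -> IsRoot (β ∸ k · α) -> k N.≤ 4 -> k N.≤ chainLength α β
 check k r k≤4 = J.subst (N._≤ chainLength α β) (F.toℕ-fromℕ< (s≤s k≤4)) (snd (root-string α β δ p) (F.fromℕ< (s≤s k≤4)) (J.subst (\ j -> IsRoot (β ∸ j · α)) (J.sym (F.toℕ-fromℕ< (s≤s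
  k≤4))) r))

abstract
 stringLength : Root -> Root -> ℕ
 stringLength = chainLength

 stringLength≡ : ∀ α β -> stringLength α β ≡ chainLength α β
 stringLength≡ α β = rfl

 string-length : ∀ {α β δ} -> α ⊞ β ≈ δ -> StringLength α β (stringLength α β)
 string-length = chain-length

-- In a string δ, β + δ, 2β + δ the second structure constant is ±2.
double-string : ∀ {β δ ε ζ} -> β ⊞ δ ≈ ε -> β ⊞ ε ≈ ζ -> stringLength β ε ≡ 1
double-string {β} {δ} {ε} {ζ} p q = stringLength≡ β ε ⟫ toWitness {a? = all-roots? \ β -> all-roots? \ δ -> all-roots? \ ε -> (β ⊞ δ ≟ ε) →-dec (any-root? (\ ζ -> β ⊞ ε ≟ ζ) →-dec (chainLength β
 ε N.≟ 1))} tt β δ ε p (ζ , q)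

no-triple-string : ∀ {β δ ε ζ η} -> β ⊞ δ ≈ ε -> β ⊞ ε ≈ ζ -> ¬ (β ⊞ ζ ≈ η)
no-triple-string {β} {δ} {ε} {ζ} {η} p q r = toWitness {a? = all-roots? \ β -> all-roots? \ δ -> all-roots? \ ε -> (β ⊞ δ ≟ ε) →-dec all-roots? \ ζ -> (β ⊞ ε ≟ ζ) →-dec ¬? (any-root? (\ η -> β ⊞
 ζ ≟ η))} tt β δ ε p ζ q (η , r)

opposite-sum : ∀ {β γ} -> ¬ (β ⊞ -ᴿ β ≈ γ)
opposite-sum {β} {γ} = toWitness {a? = all-roots? \ β -> all-roots? \ γ -> ¬? (β ⊞ -ᴿ β ≟ γ)} tt β γ

double-root : ∀ {β γ} -> ¬ (β ⊞ β ≈ γ)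
double-root {β} {γ} = toWitness {a? = all-roots? \ β -> all-roots? \ γ -> ¬? (β ⊞ β ≟ γ)} tt β γ

opposite-distinct : ∀ β -> β ≢ -ᴿ β
opposite-distinct = toWitness {a? = all-roots? \ β -> ¬? (β ≟R (-ᴿ β))} tt

opposite-involutive : ∀ β -> -ᴿ (-ᴿ β) ≡ β
opposite-involutive = toWitness {a? = all-roots? \ β -> (-ᴿ (-ᴿ β)) ≟R β} tt

coords-injective : ∀ {α β} -> coords α W.≈ coords β -> α ≡ β
coords-injective {α} {β} = toWitness {a? = all-roots? \ α -> all-roots? \ β -> (coords α ≟ʷ coords β) →-dec (α ≟R β)} tt α β

⊞-cancell : ∀ {α β γ δ} -> α ⊞ β ≈ δ -> α ⊞ γ ≈ δ -> β ≡ γ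
⊞-cancell {α} {β} {γ} p q = coords-injective (G.∙-cancelˡ (coords α) (coords β) (coords γ) (W.trans (coords-sum p) (W.sym (coords-sum q))))
 where import Algebra.Properties.Group W.group as G

⊞-functional : ∀ {α β γ δ} -> α ⊞ β ≈ γ -> α ⊞ β ≈ δ -> γ ≡ δ
⊞-functional p q = coords-injective (W.trans (W.sym (coords-sum p)) (coords-sum q))

pairing : Root -> Root -> ℤ
pairing β δ = corootCoeff β 0F O.* ⟨ coords δ , simple 0F ^∨⟩ O.+ (corootCoeff β 1F O.* ⟨ coords δ , simple 1F ^∨⟩ O.+ + 0)

-- hval β δ = ⟨δ, β^∨⟩, kept from unfolding
abstract
 hval : Root -> Root -> ℤ
 hval = pairing

 hval≡ : ∀ β δ -> hval β δ ≡ pairing β δ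
 hval≡ β δ = rfl

 hval-self : ∀ β -> hval β β ≡ + 2
 hval-self = toWitness {a? = all-roots? \ β -> hval β β O.≟ + 2} tt

⊞-distinctl : ∀ {β δ} -> ¬ (β ⊞ δ ≈ β)
⊞-distinctl {β} {δ} = toWitness {a? = all-roots? \ β -> all-roots? \ δ -> ¬? (β ⊞ δ ≟ β)} tt β δ

not-opposite : ∀ {β δ ε} -> β ⊞ δ ≈ ε -> δ ≢ -ᴿ β
not-opposite {β} p rfl = opposite-sum {β} p

sum-not-opposite : ∀ {β δ ε} -> β ⊞ δ ≈ ε -> ε ≢ -ᴿ β
sum-not-opposite {β} {δ} {ε} = toWitness {a? = all-roots? \ β -> all-roots? \ δ -> all-roots? \ ε -> (β ⊞ δ ≟ ε) →-dec ¬? (ε ≟R (-ᴿ β))} tt β δ ε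

indicator : Root -> Root -> ℤ
indicator α β = if does (α ≟R β) then + 1 else + 0

indicator-self : ∀ α -> indicator α α ≡ + 1
indicator-self α with α ≟R α
... | yes _ = rfl
... | no ¬p = contradiction rfl ¬p

indicator-≢ : ∀ {α β} -> α ≢ β -> indicator α β ≡ + 0
indicator-≢ {α} {β} p with α ≟R β
... | yes q = contradiction q p
... | no _ = rfl

abstract
 isSum? : ∀ α β -> Dec (∃[ δ ] α ⊞ β ≈ δ)
 isSum? α β = any-root? \ δ -> α ⊞ β ≟ δ

 sum? : ∀ α β δ -> Dec (α ⊞ β ≈ δ)
 sum? = _⊞_≟_

module ℤs where
 open MatrixAlgebra ℤ-ring public using (solves)
 open Algebra.Properties.Ring (CommutativeRing.ring ℤ-ring) public using (+-cancelˡ)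

-- The root vectors together with the H[ γ ] = π(h_γ) span the Lie algebra.
data Basis : Set where
 root cartan : Root -> Basis

-- The coefficient of the root vector of γ, and the value of γ on the Cartan part.
rootCoeff cartanValue : Root -> Basis -> ℤ
rootCoeff γ (root δ) = indicator γ δ
rootCoeff γ (cartan δ) = + 0
cartanValue γ (root δ) = + 0
cartanValue γ (cartan δ) = hval δ γ

module Brackets {n} (π : Representation n) where
 open Representation π public
 open I

 private
  ^M≈^ : ∀ A k -> Matrices._^ᴹ_ ℤ-ring A k ≈ A ^ k
  ^M≈^ A zero = refl {n}
  ^M≈^ A (suc k) = congl A (^M≈^ A k)

 X-divided : ∀ γ -> DividedPowers (X γ) (divPow γ) bound
 X-divided γ = record
  { power = \ k -> trans (divPow-spec γ k) (^M≈^ (X γ) k)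
  ; vanish = \ k bound≤k -> !-cancel k (begin
  + (k !) ·ᴹ divPow γ k ≈⟨ trans (divPow-spec γ k) (^M≈^ (X γ) k) ⟩
  X γ ^ k ≡⟨ cong (X γ ^_) (N.m+[n∸m]≡n bound≤k) ⟨
  X γ ^ (bound N.+ (k N.∸ bound)) ≈⟨ ^-homo-* (X γ) bound (k N.∸ bound) ⟩
  X γ ^ bound * X γ ^ (k N.∸ bound) ≈⟨ congr (X γ ^ (k N.∸ bound))
  (trans (sym (^M≈^ (X γ) bound)) (nilpotent γ)) ⟩
  0# * X γ ^ (k N.∸ bound) ≈⟨ zeroˡ (X γ ^ (k N.∸ bound)) ⟩
  0# ≈⟨ solve (+ (k !) :: []) [] (s0 :% :0) :0 ⟨
  + (k !) ·ᴹ 0# ∎)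
  }
  where
  open Reasoning setoid
  open import Algebra.Properties.Semiring.Exp (Ring.semiring (MatrixAlgebra.matrixRing ℤ-ring n)) using (^-homo-*)

 private
  commutator : ∀ (A B : Mat n) {C} -> [ A , B ] ≈ C -> A * B ≈ B * A + C
  commutator A B p = trans (solve [] (A :: B :: []) (m0 :* m1) (m1 :* m0 :+ (m0 :* m1 :- m1 :* m0))) (+-congˡ {x = B * A} p)

 H[_] : Root -> Mat n
 H[ γ ] = Matrices.∑ᴹ ℤ-ring (\ i -> corootCoeff γ i ·ᴹ H i)

 private
  H-expand : ∀ γ -> H[ γ ] ≈ corootCoeff γ 0F ·ᴹ H 0F + corootCoeff γ 1F ·ᴹ H 1F
  H-expand γ i j = cong (\ z -> corootCoeff γ 0F O.* H 0F i j O.+ z) (O.+-identityʳ _)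

 bracket-opposite : ∀ γ -> X γ * X (-ᴿ γ) ≈ X (-ᴿ γ) * X γ + H[ γ ]
 bracket-opposite γ = commutator (X γ) (X (-ᴿ γ)) ([X,X⁻] γ)

 private
  combine-eigen : ∀ c0 c1 d0 d1 {A B Z : Mat n} -> A * Z ≈ Z * A + d0 ·ᴹ Z -> B * Z ≈ Z * B + d1 ·ᴹ Z -> (c0 ·ᴹ A + c1 ·ᴹ B) * Z ≈ Z * (c0 ·ᴹ A + c1 ·ᴹ B) + (c0 O.* d0 O.+ (c1 O.* d1 O.+ + 0))
   ·ᴹ Z
  combine-eigen c0 c1 d0 d1 {A} {B} {Z} p q = begin
   (c0 ·ᴹ A + c1 ·ᴹ B) * Z
   ≈⟨ solve (c0 :: c1 :: []) (A :: B :: Z :: []) ((s0 :% m0 :+ s1 :% m1) :* m2)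
   (s0 :% (m0 :* m2) :+ s1 :% (m1 :* m2)) ⟩
   c0 ·ᴹ (A * Z) + c1 ·ᴹ (B * Z)
   ≈⟨ +-cong (%-cong {r = c0} rfl p) (%-cong {r = c1} rfl q) ⟩
   c0 ·ᴹ (Z * A + d0 ·ᴹ Z) + c1 ·ᴹ (Z * B + d1 ·ᴹ Z)
   ≈⟨ solve (c0 :: c1 :: d0 :: d1 :: []) (A :: B :: Z :: [])
   (s0 :% (m2 :* m0 :+ s2 :% m2) :+ s1 :% (m2 :* m1 :+ s3 :% m2))
   (m2 :* (s0 :% m0 :+ s1 :% m1) :+ (s0 *: s2 +: (s1 *: s3 +: 0:)) :% m2) ⟩
   Z * (c0 ·ᴹ A + c1 ·ᴹ B) + (c0 O.* d0 O.+ (c1 O.* d1 O.+ + 0)) ·ᴹ Z ∎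
   where open Reasoning (setoid {n})

  combine-commute : ∀ c0 c1 d0 d1 {A B : Mat n} -> A * B ≈ B * A -> (c0 ·ᴹ A + c1 ·ᴹ B) * (d0 ·ᴹ A + d1 ·ᴹ B) ≈ (d0 ·ᴹ A + d1 ·ᴹ B) * (c0 ·ᴹ A + c1 ·ᴹ B)
  combine-commute c0 c1 d0 d1 {A} {B} p = begin
   (c0 ·ᴹ A + c1 ·ᴹ B) * (d0 ·ᴹ A + d1 ·ᴹ B)
   ≈⟨ solve (c0 :: c1 :: d0 :: d1 :: []) (A :: B :: [])
   ((s0 :% m0 :+ s1 :% m1) :* (s2 :% m0 :+ s3 :% m1))
   (((s2 :% m0 :+ s3 :% m1) :* (s0 :% m0 :+ s1 :% m1))
   :+ (s0 *: s3 -: s1 *: s2) :% (m0 :* m1 :- m1 :* m0)) ⟩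
   Y + (c0 O.* d1 O.- c1 O.* d0) ·ᴹ (A * B - B * A)
   ≈⟨ +-congˡ {x = Y} (%-cong {r = c0 O.* d1 O.- c1 O.* d0} rfl (+-congʳ p)) ⟩
   Y + (c0 O.* d1 O.- c1 O.* d0) ·ᴹ (B * A - B * A)
   ≈⟨ solve (c0 O.* d1 O.- c1 O.* d0 :: []) (Y :: B * A :: []) (m0 :+ s0 :% (m1 :- m1)) (m0) ⟩
   Y ∎
   where
   open Reasoning (setoid {n})
   Y = (d0 ·ᴹ A + d1 ·ᴹ B) * (c0 ·ᴹ A + c1 ·ᴹ B)

 bracket-cartan : ∀ β δ -> H[ β ] * X δ ≈ X δ * H[ β ] + hval β δ ·ᴹ X δ
 bracket-cartan β δ = trans (congr (X δ) (H-expand β)) (trans (combine-eigen (corootCoeff β 0F) (corootCoeff β 1F) ⟨ coords δ , simple 0F ^∨⟩ ⟨ coords δ , simple 1F ^∨⟩ {H 0F} {H 1F} {X δ}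
  (commutator (H 0F) (X δ) ([H,X] 0F δ)) (commutator (H 1F) (X δ) ([H,X] 1F δ))) (sym (+-cong (congl (X δ) (H-expand β)) (%-cong {x = X δ} (hval≡ β δ) refl))))

 cartan-commute : ∀ β γ -> H[ β ] * H[ γ ] ≈ H[ γ ] * H[ β ]
 cartan-commute β γ = trans (*-cong (H-expand β) (H-expand γ)) (trans (combine-commute (corootCoeff β 0F) (corootCoeff β 1F) (corootCoeff γ 0F) (corootCoeff γ 1F) {H 0F} {H 1F} (trans
  (commutator (H 0F) (H 1F) ([H,H] 0F 1F)) (+-identityʳ (H 1F * H 0F)))) (sym (*-cong (H-expand γ) (H-expand β))))

 cartan-opposite : ∀ γ -> H[ -ᴿ γ ] ≈ - H[ γ ]
 cartan-opposite γ = begin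
  H[ -ᴿ γ ]
  ≈⟨ H-expand (-ᴿ γ) ⟩
  corootCoeff (-ᴿ γ) 0F ·ᴹ H 0F + corootCoeff (-ᴿ γ) 1F ·ᴹ H 1F
  ≈⟨ +-cong (%-cong (coeffs γ 0F) refl) (%-cong (coeffs γ 1F) refl) ⟩
  (O.- corootCoeff γ 0F) ·ᴹ H 0F + (O.- corootCoeff γ 1F) ·ᴹ H 1F
  ≈⟨ solve (corootCoeff γ 0F :: corootCoeff γ 1F :: []) (H 0F :: H 1F :: [])
  ((-: s0) :% m0 :+ (-: s1) :% m1) (:- (s0 :% m0 :+ s1 :% m1)) ⟩
  - (corootCoeff γ 0F ·ᴹ H 0F + corootCoeff γ 1F ·ᴹ H 1F)
  ≈⟨ -‿cong (H-expand γ) ⟨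
  - H[ γ ] ∎
  where
  open Reasoning (setoid {n})
  coeffs : ∀ γ i -> corootCoeff (-ᴿ γ) i ≡ O.- corootCoeff γ i
  coeffs = toWitness {a? = all-roots? \ γ -> F.all? \ i -> corootCoeff (-ᴿ γ) i O.≟ O.- corootCoeff γ i} tt

 private
  structure : ∀ α β δ -> α ⊞ β ≈ δ -> ∃[ s ] [ X α , X β ] ≈ (s O.◃ suc (stringLength α β)) ·ᴹ X δ
  structure α β δ p with [X,X] α β δ (stringLength α β) (coords-sum p) (string-length p)
  ... | inl q = pos , q
  ... | inr q = neg , q

 abstract
  -- [X α , X β] = N α β δ X δ if α + β = δ
  N : Root -> Root -> Root -> ℤ
  N α β δ with sum? α β δ
  ... | yes p = fst (structure α β δ p) O.◃ suc (stringLength α β)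
  ... | no _ = + 0

  bracket-sum : ∀ {α β δ} -> α ⊞ β ≈ δ -> X α * X β ≈ X β * X α + N α β δ ·ᴹ X δ
  bracket-sum {α} {β} {δ} p with sum? α β δ
  ... | no ¬p = contradiction p ¬p
  ... | yes p = commutator (X α) (X β) (snd (structure α β δ p))

  N-value : ∀ {α β δ} -> α ⊞ β ≈ δ -> ∃[ s ] N α β δ ≡ s O.◃ suc (stringLength α β)
  N-value {α} {β} {δ} p with sum? α β δ
  ... | yes p = fst (structure α β δ p) , rfl
  ... | no ¬p = contradiction p ¬p

 bracket-zero : ∀ {α β} -> β ≢ -ᴿ α -> (∀ δ -> ¬ (α ⊞ β ≈ δ)) -> X α * X β ≈ X β * X α
 bracket-zero {α} {β} p q = trans (commutator (X α) (X β) ([X,X]≈0 α β p \ (δ , e) -> q δ ⟨ W.sym e ⟩)) (+-identityʳ (X β * X α))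

 ⟦_⟧b : Basis -> Mat n
 ⟦ root γ ⟧b = X γ
 ⟦ cartan γ ⟧b = H[ γ ]

 Term = ℤ × Basis

 ⟦_⟧ᵗ : Term -> Mat n
 ⟦ c , b ⟧ᵗ = c ·ᴹ ⟦ b ⟧b

 ad : Root -> Basis -> Term
 ad β (cartan γ) = O.- hval γ β , root β
 ad β (root δ) with δ ≟R (-ᴿ β) | isSum? β δ
 ... | yes _ | _ = + 1 , cartan β
 ... | no _ | yes (ε , _) = N β δ ε , root ε
 ... | no _ | no _ = + 0 , root β

 ad-sound : ∀ β b -> X β * ⟦ b ⟧b ≈ ⟦ b ⟧b * X β + ⟦ ad β b ⟧ᵗ
 ad-sound β (cartan γ) = begin
  X β * H[ γ ]
  ≈⟨ solve (hval γ β :: []) (X β :: H[ γ ] :: []) (m0 :* m1)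
  ((m0 :* m1 :+ s0 :% m0) :+ (-: s0) :% m0) ⟩
  (X β * H[ γ ] + hval γ β ·ᴹ X β) + (O.- hval γ β) ·ᴹ X β
  ≈⟨ +-congʳ (bracket-cartan γ β) ⟨
  H[ γ ] * X β + (O.- hval γ β) ·ᴹ X β ∎
  where open Reasoning (setoid {n})
 ad-sound β (root δ) with δ ≟R (-ᴿ β) | isSum? β δ
 ... | yes rfl | _ = trans (bracket-opposite β) (+-congˡ {x = X (-ᴿ β) * X β} (sym (%-one H[ β ])))
 ... | no _ | yes (ε , p) = bracket-sum p
 ... | no ¬p | no ¬q = trans (bracket-zero ¬p \ ε q -> ¬q (ε , q)) (solve [] (X β :: X δ :: []) (m1 :* m0) (m1 :* m0 :+ 0: :% m0))

 scaled : (Basis -> ℤ) -> Term -> ℤ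
 scaled f (c , b) = c O.* f b

 rootCoeff-ad : ∀ {β δ γ} -> β ⊞ δ ≈ γ -> ∀ b -> scaled (rootCoeff γ) (ad β b) ≡ N β δ γ O.* rootCoeff δ b
 rootCoeff-ad {β} {δ} {γ} p (cartan ζ) rewrite indicator-≢ {γ} {β} (\ { rfl -> ⊞-distinctl {β} p }) =
  J.trans (O.*-zeroʳ (O.- hval ζ β)) (J.sym (O.*-zeroʳ (N β δ γ)))
 rootCoeff-ad {β} {δ} {γ} p (root ζ) with ζ ≟R (-ᴿ β) | isSum? β ζ
 ... | yes rfl | _ rewrite indicator-≢ {δ} { -ᴿ β} (not-opposite {β} p) = J.sym (O.*-zeroʳ (N β δ γ))
 ... | no _ | yes (ε , q) with δ ≟R ζ
 ... | yes rfl with ⊞-functional {β} {ζ} p q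
 ... | rfl = cong (N β ζ ε O.*_) (indicator-self ε)
 rootCoeff-ad {β} {δ} {γ} p (root ζ) | no _ | yes (ε , q) | no ¬r
  rewrite indicator-≢ {γ} {ε} (\ { rfl -> ¬r (⊞-cancell {β} p q) }) =
  J.trans (O.*-zeroʳ (N β ζ ε)) (J.sym (O.*-zeroʳ (N β δ γ)))
 rootCoeff-ad {β} {δ} {γ} p (root ζ) | no _ | no ¬q
  rewrite indicator-≢ {δ} {ζ} (\ { rfl -> ¬q (γ , p) }) = J.sym (O.*-zeroʳ (N β δ γ))

 rootCoeff-ad-zero : ∀ {β γ} -> γ ≢ β -> (∀ δ -> ¬ (β ⊞ δ ≈ γ)) -> ∀ b -> scaled (rootCoeff γ) (ad β b) ≡ + 0
 rootCoeff-ad-zero {β} {γ} p q (cartan ζ) rewrite indicator-≢ p = O.*-zeroʳ (O.- hval ζ β)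
 rootCoeff-ad-zero {β} {γ} p q (root ζ) with ζ ≟R (-ᴿ β) | isSum? β ζ
 ... | yes _ | _ = rfl
 ... | no _ | yes (ε , r) rewrite indicator-≢ {γ} {ε} (\ { rfl -> q ζ r }) = O.*-zeroʳ (N β ζ ε)
 ... | no _ | no _ = rfl

 rootCoeff-ad-self : ∀ β b -> scaled (rootCoeff β) (ad β b) ≡ O.- cartanValue β b
 rootCoeff-ad-self β (cartan γ) rewrite indicator-self β = O.*-identityʳ (O.- hval γ β)
 rootCoeff-ad-self β (root ζ) with ζ ≟R (-ᴿ β) | isSum? β ζ
 ... | yes _ | _ = rfl
 ... | no _ | yes (ε , r) rewrite indicator-≢ {β} {ε} (\ { rfl -> ⊞-distinctl {β} r }) = O.*-zeroʳ (N β ζ ε)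
 ... | no _ | no _ = rfl

 cartanValue-ad : ∀ β γ b -> scaled (cartanValue γ) (ad β b) ≡ hval β γ O.* rootCoeff (-ᴿ β) b
 cartanValue-ad β γ (cartan ζ) = O.*-zeroʳ (O.- hval ζ β) ⟫ J.sym (O.*-zeroʳ (hval β γ))
 cartanValue-ad β γ (root ζ) with ζ ≟R (-ᴿ β) | isSum? β ζ
 ... | yes rfl | _ rewrite indicator-self (-ᴿ β) = O.*-comm (+ 1) (hval β γ)
 ... | no ¬p | yes (ε , r) rewrite indicator-≢ (\ r -> ¬p (J.sym r)) = O.*-zeroʳ (N β ζ ε) ⟫ J.sym (O.*-zeroʳ (hval β γ))
 ... | no ¬p | no _ rewrite indicator-≢ (\ r -> ¬p (J.sym r)) = J.sym (O.*-zeroʳ (hval β γ))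

 private
  scale-ad : ∀ β c b -> X β * (c ·ᴹ ⟦ b ⟧b) ≈ (c ·ᴹ ⟦ b ⟧b) * X β + c ·ᴹ ⟦ ad β b ⟧ᵗ
  scale-ad β c b = trans (solve (c :: []) (X β :: ⟦ b ⟧b :: []) (m0 :* (s0 :% m1)) (s0 :% (m0 :* m1))) (trans (%-cong {r = c} rfl (ad-sound β b)) (solve (c :: []) (X β :: ⟦ b ⟧b :: ⟦ ad β b ⟧ᵗ ::
   []) (s0 :% (m1 :* m0 :+ m2)) ((s0 :% m1) :* m0 :+ s0 :% m2)))

 ad2 : ∀ β b -> Σ Term \ t -> (X β * ⟦ ad β b ⟧ᵗ ≈ ⟦ ad β b ⟧ᵗ * X β + (⟦ t ⟧ᵗ + ⟦ t ⟧ᵗ)) × (X β * ⟦ t ⟧ᵗ ≈ ⟦ t ⟧ᵗ * X β) × (∀ f -> fst (ad β b) O.* scaled f (ad β (snd (ad β b))) ≡ scaled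
  f t O.+ scaled f t)
 ad2 β b = by-cases (ad β b) (ad-cases b)
  where
  data Cases : Term -> Set where
   self : ∀ c -> Cases (c , root β)
   opposite : Cases (+ 1 , cartan β)
   other : ∀ {δ ε} -> β ⊞ δ ≈ ε -> Cases (N β δ ε , root ε)

  ad-cases : ∀ b -> Cases (ad β b)
  ad-cases (cartan γ) = self _
  ad-cases (root δ) with δ ≟R (-ᴿ β) | isSum? β δ
  ... | yes _ | _ = opposite
  ... | no _ | yes (ε , p) = other {δ} p
  ... | no _ | no _ = self _

  Half : Term -> Set
  Half (c , b) = Σ Term \ t -> (X β * ⟦ c , b ⟧ᵗ ≈ ⟦ c , b ⟧ᵗ * X β + (⟦ t ⟧ᵗ + ⟦ t ⟧ᵗ)) × (X β * ⟦ t ⟧ᵗ ≈ ⟦ t ⟧ᵗ * X β) × (∀ f -> c O.* scaled f (ad β b) ≡ scaled f t O.+ scaled f t)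

  half : ∀ c b d b′ -> ad β b ≡ (d , b′) -> ∀ e -> c O.* d ≡ e O.+ e -> X β * ⟦ b′ ⟧b ≈ ⟦ b′ ⟧b * X β -> Half (c , b)
  half c b d b′ eq e eq′ comm = (e , b′) , trans (scale-ad β c b) (+-congˡ {x = (c ·ᴹ ⟦ b ⟧b) * X β} (trans (reflexive (cong (\ t -> c ·ᴹ ⟦ t ⟧ᵗ) eq)) (trans (solve (c :: d :: []) (⟦ b′ ⟧b ::
   []) (s0 :% s1 :% m0) ((s0 *: s1) :% m0)) (trans (%-cong {x = ⟦ b′ ⟧b} eq′ refl) (%-distribr e e ⟦ b′ ⟧b))))) , trans (solve (e :: []) (X β :: ⟦ b′ ⟧b :: []) (m0 :* (s0 :% m1)) (s0 :% (m0 :*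
   m1))) (trans (%-cong {r = e} rfl comm) (solve (e :: []) (X β :: ⟦ b′ ⟧b :: []) (s0 :% (m1 :* m0)) ((s0 :% m1) :* m0))) , \ f -> J.trans (cong (\ t -> c O.* scaled f t) eq) (J.sym (O.*-assoc c
   d (f b′)) ⟫ cong (O._* f b′) eq′ ⟫ O.*-distribʳ-+ (f b′) e e)

  ad-self : ad β (root β) ≡ (+ 0 , root β)
  ad-self with β ≟R (-ᴿ β) | isSum? β β
  ... | yes p | _ = contradiction p (opposite-distinct β)
  ... | no _ | yes (ε , p) = contradiction p (double-root {β} {ε})
  ... | no _ | no _ = rfl

  other-case : ∀ {δ ε} -> β ⊞ δ ≈ ε -> Dec (∃[ ζ ] β ⊞ ε ≈ ζ) -> Half (N β δ ε , root ε)
  other-case {δ} {ε} p (no ¬q) = half (N β δ ε) (root ε) (+ 0) (root β) eq (+ 0) (O.*-zeroʳ (N β δ ε)) refl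
   where
   eq : ad β (root ε) ≡ (+ 0 , root β)
   eq with ε ≟R (-ᴿ β) | isSum? β ε
   ... | yes r | _ = contradiction r (sum-not-opposite {β} {δ} p)
   ... | no _ | yes q = contradiction q ¬q
   ... | no _ | no _ = rfl
  other-case {δ} {ε} p (yes (ζ , q)) = half (N β δ ε) (root ε) (N β ε ζ) (root ζ) eq (N β δ ε O.* (s O.◃ 1)) (cong (N β δ ε O.*_) N≡ ⟫ O.*-distribˡ-+ (N β δ ε) (s O.◃ 1) (s O.◃ 1))
   (bracket-zero (sum-not-opposite {β} {ε} q) (\ η -> no-triple-string {β} {δ} {ε} {ζ} {η} p q))
   where
   eq : ad β (root ε) ≡ (N β ε ζ , root ζ)
   eq with ε ≟R (-ᴿ β) | isSum? β ε
   ... | yes r | _ = contradiction r (sum-not-opposite {β} {δ} p)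
   ... | no _ | no ¬q = contradiction (ζ , q) ¬q
   ... | no _ | yes (ζ' , q') with ⊞-functional {β} {ε} q q'
   ... | rfl = rfl
   s = fst (N-value {β} {ε} {ζ} q)
   doubled : ∀ s -> s O.◃ 2 ≡ (s O.◃ 1) O.+ (s O.◃ 1)
   doubled pos = rfl
   doubled neg = rfl
   N≡ : N β ε ζ ≡ (s O.◃ 1) O.+ (s O.◃ 1)
   N≡ = snd (N-value {β} {ε} {ζ} q) ⟫ cong (\ k -> s O.◃ suc k) (double-string {β} {δ} {ε} {ζ} p q) ⟫ doubled s

  by-cases : ∀ t -> Cases t -> Half t
  by-cases _ (self c) = half c (root β) (+ 0) (root β) ad-self (+ 0) (O.*-zeroʳ c) refl
  by-cases _ opposite = half (+ 1) (cartan β) (O.- hval β β) (root β) rfl -[1+ 0 ] (O.*-identityˡ _ ⟫ cong O.-_ (hval-self β)) refl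
  by-cases _ (other {δ} {ε} p) = other-case {δ} {ε} p (isSum? β ε)

-- Laurent polynomials over ℚ-algebras

record IsℚAlgebra {c ℓ} (K : CommutativeRing c ℓ) : Set (c ⊔ ℓ) where
 open CommutativeRing K
 open Matrices K using (ι)
 field
  ι-inverse : ∀ k -> ∃[ u ] ι (+ suc k) * u ≈ 1#
  nontrivial : ¬ (1# ≈ 0#)

 open IntegerScalars K
 open Algebra.Properties.Ring ring

 ι-regular : ∀ i -> i ≢ + 0 -> ∀ {x} -> x * ι i ≈ 0# -> x ≈ 0#
 ι-regular i i≢0 {x} p = cancel i i≢0 p
  where
  cancel+ : ∀ k -> x * ι (+ suc k) ≈ 0# -> x ≈ 0#
  cancel+ k p = let (u , q) = ι-inverse k in trans (sym (*-identityʳ x)) (trans (*-congˡ (sym q))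
   (trans (sym (*-assoc _ _ _)) (trans (*-congʳ p) (zeroˡ u))))
  cancel : ∀ i -> i ≢ + 0 -> x * ι i ≈ 0# -> x ≈ 0#
  cancel (+ zero) i≢0 p = contradiction rfl i≢0
  cancel (+ suc k) i≢0 p = cancel+ k p
  cancel -[1+ k ] i≢0 p = cancel+ k (trans (sym (-‿involutive _)) (trans (-‿cong (trans (-‿distribʳ-* _ _) p)) -0#≈0#))

 ι-injective0 : ∀ i -> ι i ≈ 0# -> i ≡ + 0
 ι-injective0 i p with i O.≟ + 0
 ... | yes q = q
 ... | no ¬q = contradiction (ι-regular i ¬q (trans (*-identityˡ _) p)) nontrivial

 ι-injective : ∀ i j -> ι i ≈ ι j -> i ≡ j
 ι-injective i j p = O.i-j≡0⇒i≡j i j (ι-injective0 (i O.- j) (trans (ι-+ i (O.- j)) (trans (+-cong p (ι-neg j)) (-‿inverseʳ _))))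

module Units {c ℓ} (R : CommutativeRing c ℓ) where
 open CommutativeRing R
 record Unit : Set (c ⊔ ℓ) where
  constructor unit
  field
   val val~1 : Carrier
   val*val~1 : val * val~1 ≈ 1#
 open Unit public

 _·u_ : Unit -> Unit -> Unit
 unit a a' p ·u unit b b′ q = unit (a * b) (a' * b′) (trans (interchange a b a' b′) (trans (*-cong p q) (*-identityˡ 1#)))
  where open import Algebra.Properties.CommutativeSemigroup *-commutativeSemigroup using (interchange)

 1ᵘ : Unit
 1ᵘ = unit 1# 1# (*-identityˡ 1#)

-- A polynomial vanishing at all units vanishes: compare p(2a) with 2ᴺ p(a).
module PolynomialIdentity {c ℓ} {K : CommutativeRing c ℓ} (isℚ : IsℚAlgebra K) where
 open IsℚAlgebra isℚ
 open Exponential K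
 open S
 open Units K
 open Matrices K using (ι)
 open Reasoning setoid

 private
  two : Unit
  two = unit (ι (+ 2)) (fst (ι-inverse 1)) (snd (ι-inverse 1))

  powers-differ : ∀ {i N} -> i N.< N -> (+ 2) O.^ i O.- (+ 2) O.^ N ≢ + 0
  powers-differ {i} {N} i<N p = N.<⇒≢ (N.^-monoʳ-< 2 (s≤s (s≤s z≤n)) i<N) (O.+-injective (pos-^ i ⟫ O.i-j≡0⇒i≡j _ _ p ⟫ J.sym (pos-^ N)))
   where
   pos-^ : ∀ k -> + (2 N.^ k) ≡ (+ 2) O.^ k
   pos-^ zero = rfl
   pos-^ (suc k) = O.pos-* 2 (2 N.^ k) ⟫ cong (+ 2 O.*_) (pos-^ k)

  powers : ∀ i N a c -> a ^ i * (c * ι ((+ 2) O.^ i O.- (+ 2) O.^ N)) ≈ (ι (+ 2) * a) ^ i * c - ι ((+ 2) O.^ N) * (a ^ i * c)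
  powers i N a c = begin
   a ^ i * (c * ι ((+ 2) O.^ i O.- (+ 2) O.^ N))
   ≈⟨ *-congˡ (*-congˡ (trans (ι-+ ((+ 2) O.^ i) (O.- ((+ 2) O.^ N))) (+-congˡ (ι-neg ((+ 2) O.^ N))))) ⟩
   a ^ i * (c * (ι ((+ 2) O.^ i) - ι ((+ 2) O.^ N)))
   ≈⟨ solves (a ^ i :: c :: ι ((+ 2) O.^ i) :: ι ((+ 2) O.^ N) :: [])
   (s0 *: (s1 *: (s2 -: s3))) (s2 *: s0 *: s1 -: s3 *: (s0 *: s1)) ⟩
   ι ((+ 2) O.^ i) * a ^ i * c - ι ((+ 2) O.^ N) * (a ^ i * c)
   ≈⟨ +-congʳ (*-congʳ (trans (*-congʳ (ι-^ (+ 2) i)) (sym (^-distrib-* (ι (+ 2)) a i)))) ⟩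
   (ι (+ 2) * a) ^ i * c - ι ((+ 2) O.^ N) * (a ^ i * c) ∎

 sum-neg : ∀ {m} (v : Fin m -> Carrier) -> sum (\ i -> - v i) ≈ - sum v
 sum-neg {zero} v = sym -0#≈0#
 sum-neg {suc m} v = trans (+-congˡ (sum-neg (v ∘ F.suc))) (-‿+-comm _ _)

 vanishing-polynomial : ∀ N (f : ℕ -> Carrier) -> (∀ (a : Unit) -> sum {N} (\ k -> val a ^ # k * f (# k)) ≈ 0#) -> ∀ k -> k N.< N -> f k ≈ 0#

 private
  lower : ∀ N (f : ℕ -> Carrier) -> (∀ (a : Unit) -> sum {suc N} (\ k -> val a ^ # k * f (# k)) ≈ 0#) -> ∀ k -> k N.< N -> f k ≈ 0#
  lower N f p k k<N = ι-regular ((+ 2) O.^ k O.- (+ 2) O.^ N) (powers-differ k<N) (vanishing-polynomial N (\ k -> f k * ι ((+ 2) O.^ k O.- (+ 2) O.^ N)) differences k k<N)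
   where
   differences : ∀ (a : Unit) -> sum {N} (\ k -> val a ^ # k * (f (# k) * ι ((+ 2) O.^ # k O.- (+ 2) O.^ N))) ≈ 0#
   differences a = begin
    sum {N} (g ∘ #)
    ≈⟨ trans (sym (+-identityʳ _)) (+-congˡ (sym top)) ⟩
    sum {N} (g ∘ #) + g N
    ≈⟨ sum-last N g ⟨
    sum {suc N} (g ∘ #)
    ≈⟨ sum<-cong (suc N) (\ k -> powers k N (val a) (f k)) ⟩
    sum {suc N} (\ k -> (ι (+ 2) * val a) ^ # k * f (# k) - e * (val a ^ # k * f (# k)))
    ≈⟨ trans (∑-distrib-+ {suc N} (\ k -> (ι (+ 2) * val a) ^ # k * f (# k)) (\ k -> - (e * (val a ^ # k * f (# k)))))
    (+-cong (p (two ·u a)) (trans (sum-neg {suc N} \ k -> e * (val a ^ # k * f (# k)))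
    (-‿cong (trans (sym (*-distribˡ-sum {suc N} e (\ k -> val a ^ # k * f (# k)))) (*-congˡ (p a)))))) ⟩
    0# - e * 0#
    ≈⟨ solves (e :: []) (0: -: s0 *: 0:) 0: ⟩
    0# ∎
    where
    e = ι ((+ 2) O.^ N)
    g = \ k -> val a ^ k * (f k * ι ((+ 2) O.^ k O.- (+ 2) O.^ N))
    top : g N ≈ 0#
    top = trans (*-congˡ (trans (*-congˡ (ι-cong (O.+-inverseʳ ((+ 2) O.^ N)))) (zeroʳ _))) (zeroʳ _)

 vanishing-polynomial (suc N) f p k k<1+N with k N.≟ N
 ... | no k≢N = lower N f p k (N.≤∧≢⇒< (N.s≤s⁻¹ k<1+N) k≢N)
 ... | yes rfl = begin
  f N ≈⟨ trans (sym (*-identityˡ _)) (*-congʳ (sym (one^ N))) ⟩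
  1# ^ N * f N ≈⟨ +-identityˡ _ ⟨
  0# + 1# ^ N * f N ≈⟨ +-congʳ (sum-zero {N} (\ k -> trans (*-congˡ (lower N f p (# k) (F.toℕ<n k))) (zeroʳ _))) ⟨
  sum {N} (\ k -> 1# ^ # k * f (# k)) + 1# ^ N * f N
  ≈⟨ sum-last N (\ k -> 1# ^ k * f k) ⟨
  sum {suc N} (\ k -> 1# ^ # k * f (# k)) ≈⟨ p 1ᵘ ⟩
  0# ∎
  where
  one^ : ∀ k -> 1# ^ k ≈ 1#
  one^ zero = refl
  one^ (suc k) = trans (*-identityˡ _) (one^ k)

-- Root subgroups and the maximal torus

module RootSubgroups {c ℓ} (R : CommutativeRing c ℓ) {n} (π : Representation n) where
 open Exponential R public
 open Brackets π public
 open Units R public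
 open M
 open S using () renaming (_+_ to _+R_; _*_ to _*R_; -_ to -R'_; 1# to 1ᴿ; 0# to 0ᴿ; _≈_ to _≈R_)
 open Matrices R using (ι)
 open Reasoning (setoid {n})

 x : Root -> S.Carrier -> Mat n
 x γ t = series bound (divPow γ) t

 private
  sum-entry : ∀ {m} (v : Fin m -> Mat n) i j -> sum v i j S.≈ S.sum (\ k -> v k i j)
  sum-entry {zero} v i j = S.refl
  sum-entry {suc m} v i j = S.+-congˡ (sum-entry (v ∘ F.suc) i j)

 x≈rootElement : ∀ γ t -> x γ t ≈ rootElement R π γ t
 x≈rootElement γ t i j = sum-entry {bound} (\ k -> (t S.^ # k) ⊙ ιM (divPow γ (# k))) i j

 x-cong : ∀ γ {s t} -> s ≈R t -> x γ s ≈ x γ t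
 x-cong γ = series-cong bound {divPow γ} {divPow γ} (\ _ -> I.refl)

 x-+ : ∀ γ s t -> x γ (s +R t) ≈ x γ s * x γ t
 x-+ γ = exp-+ (X-divided γ)

 x-inverse : ∀ γ {s t} -> s +R t ≈R 0ᴿ -> x γ s * x γ t ≈ 1#
 x-inverse γ = exp-inverse (X-divided γ)

 x-0 : ∀ γ -> x γ 0ᴿ ≈ 1#
 x-0 γ = exp-0 (X-divided γ)

 -- Conj g A B says that g A g⁻¹ = B.
 Conj : Mat n -> Mat n -> Mat n -> Set ℓ
 Conj g A B = g * A ≈ B * g

 conj-∘ : ∀ {h g A B C} -> Conj h B C -> Conj g A B -> Conj (h * g) A C
 conj-∘ {h} {g} {A} {B} {C} q p = *-assoc h g A & congl h p & sym (*-assoc h B g) & congr g q & *-assoc C h g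

 conj-+ : ∀ {g A B A' B'} -> Conj g A B -> Conj g A' B' -> Conj g (A + A') (B + B')
 conj-+ {g} {A} {B} {A'} {B'} p q = distribˡ g A A' & +-cong p q & sym (distribʳ g B B')

 conj-% : ∀ r {g A B} -> Conj g A B -> Conj g (r ⊙ A) (r ⊙ B)
 conj-% r {g} {A} {B} p = solve (r :: []) (g :: A :: []) (m0 :* (s0 :% m1)) (s0 :% (m0 :* m1)) & %-cong S.refl p & solve (r :: []) (B :: g :: []) (s0 :% (m0 :* m1)) ((s0 :% m0) :* m1)

 conj-resp : ∀ {g A A' B B'} -> A ≈ A' -> B ≈ B' -> Conj g A B -> Conj g A' B'
 conj-resp {g} p q r = congl g (sym p) & r & congr g q

 x-conj-basis : ∀ β b t -> let (t2 , _) = ad2 β b in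
  Conj (x β t) (ιM ⟦ b ⟧b) (ιM ⟦ b ⟧b + t ⊙ ιM ⟦ ad β b ⟧ᵗ + (t *R t) ⊙ ιM ⟦ t2 ⟧ᵗ)
 x-conj-basis β b t = let (t2 , p , q , _) = ad2 β b in
  exp-commutator (X-divided β) {⟦ b ⟧b} {⟦ ad β b ⟧ᵗ} {⟦ t2 ⟧ᵗ} (ad-sound β b) p q t

 module SL2 (γ : Root) where
  Xγ Yγ Hγ : Mat n
  Xγ = ιM (X γ)
  Yγ = ιM (X (-ᴿ γ))
  Hγ = ιM H[ γ ]

  private
   ι-neg' : ∀ (A : I.Mat n) -> ιM (I.- A) ≈ - ιM A
   ι-neg' A i j = ι-neg (A i j)

   bracket-H : ∀ β -> X β I.* H[ β ] I.≈ H[ β ] I.* X β I.+ I.- (X β I.+ X β)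
   bracket-H β = I.solve [] (X β :: H[ β ] :: []) (m0 :* m1) ((m0 :* m1 :+ (m0 :+ m0)) :- (m0 :+ m0)) I.& I.+-congʳ (I.+-congˡ {x = X β I.* H[ β ]} (I.solve [] (X β :: []) (m0 :+ m0) ((1: +:
    1:) :% m0) I.& I.%-cong {x = X β} (J.sym (hval-self β)) I.refl) I.& I.sym (bracket-cartan β β))

   half-Y : ∀ β -> X β I.* H[ β ] I.≈ H[ β ] I.* X β I.+ (I.- X β I.+ I.- X β)
   half-Y β = bracket-H β I.& I.solve [] (H[ β ] :: X β :: []) (m0 :* m1 :+ :- (m1 :+ m1)) (m0 :* m1 :+ (:- m1 :+ :- m1))

   self-neg : ∀ β -> X β I.* (I.- X β) I.≈ (I.- X β) I.* X β
   self-neg β = I.solve [] (X β :: []) (m0 :* (:- m0)) ((:- m0) :* m0)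

   self-neg2 : ∀ β -> X β I.* (I.- (X β I.+ X β)) I.≈ (I.- (X β I.+ X β)) I.* X β I.+ (I.0# I.+ I.0#)
   self-neg2 β = I.solve [] (X β :: []) (m0 :* (:- (m0 :+ m0))) ((:- (m0 :+ m0)) :* m0 :+ (:0 :+ :0))

   self-0 : ∀ (A : I.Mat n) -> A I.* I.0# I.≈ I.0# I.* A
   self-0 A = I.solve [] (A :: []) (m0 :* :0) (:0 :* m0)

   self-1 : ∀ (A : I.Mat n) -> A I.* A I.≈ A I.* A I.+ I.0#
   self-1 A = I.solve [] (A :: []) (m0 :* m0) (m0 :* m0 :+ :0)

   self-2 : ∀ (A : I.Mat n) -> A I.* I.0# I.≈ I.0# I.* A I.+ (I.0# I.+ I.0#)
   self-2 A = I.solve [] (A :: []) (m0 :* :0) (:0 :* m0 :+ (:0 :+ :0))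

  x-Y : ∀ t -> Conj (x γ t) Yγ (Yγ + t ⊙ Hγ - (t *R t) ⊙ Xγ)
  x-Y t = exp-commutator (X-divided γ) {X (-ᴿ γ)} {H[ γ ]} {I.- X γ} (bracket-opposite γ) (half-Y γ) (self-neg γ) t & congr (x γ t) (+-congˡ {x = Yγ + t ⊙ Hγ} (%-cong S.refl (ι-neg' (X γ)) &
   solve (t :: []) (Xγ :: []) ((s0 *: s0) :% (:- m0)) (:- ((s0 *: s0) :% m0))))

  x-H : ∀ t -> Conj (x γ t) Hγ (Hγ - (t ⊙ Xγ + t ⊙ Xγ))
  x-H t = exp-commutator (X-divided γ) {H[ γ ]} {I.- (X γ I.+ X γ)} {I.0#} (bracket-H γ) (self-neg2 γ) (self-0 (X γ)) t & congr (x γ t) (+-cong (+-congˡ {x = Hγ} (%-cong S.refl (ι-neg' (X γ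
   I.+ X γ) & -‿cong (ιM-+ (X γ) (X γ))))) (%-cong S.refl ιM-0) & solve (t :: []) (Hγ :: Xγ :: []) (m0 :+ s0 :% (:- (m1 :+ m1)) :+ (s0 *: s0) :% :0) (m0 :- (s0 :% m1 :+ s0 :% m1)))

  x-X : ∀ t -> Conj (x γ t) Xγ Xγ
  x-X t = exp-commutator (X-divided γ) {X γ} {I.0#} {I.0#} (self-1 (X γ)) (self-2 (X γ)) (self-0 (X γ)) t & congr (x γ t) (+-cong (+-congˡ {x = Xγ} (%-cong S.refl ιM-0)) (%-cong S.refl ιM-0)
   & solve (t :: []) (Xγ :: []) (m0 :+ s0 :% :0 :+ (s0 *: s0) :% :0) (m0))

 module Torus (γ : Root) where
  open SL2 γ public
  module Opp = SL2 (-ᴿ γ)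

  private
   H~ : Opp.Hγ ≈ - Hγ
   H~ = ιM-cong {A = H[ -ᴿ γ ]} (cartan-opposite γ) & (\ i j -> ι-neg (H[ γ ] i j))

   Y~ : Opp.Yγ ≈ Xγ
   Y~ = reflexive (cong (\ δ -> ιM (X δ)) (opposite-involutive γ))

  y : S.Carrier -> Mat n
  y = x (-ᴿ γ)

  y-X : ∀ t -> Conj (y t) Xγ (Xγ - t ⊙ Hγ - (t *R t) ⊙ Yγ)
  y-X t = conj-resp {y t} Y~ (+-congʳ (+-cong Y~ (%-cong S.refl H~)) & solve (t :: []) (Xγ :: Yγ :: Hγ :: []) (m0 :+ s0 :% (:- m2) :- (s0 *: s0) :% m1) (m0 :- s0 :% m2 :- (s0 *: s0) :% m1))
   (Opp.x-Y t)

  y-H : ∀ t -> Conj (y t) Hγ (Hγ + (t ⊙ Yγ + t ⊙ Yγ))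
  y-H t = conj-resp {y t} (%-cong S.refl H~ & solve [] (Hγ :: []) ((-: 1:) :% (:- m0)) (m0)) (%-cong S.refl (+-congʳ H~) & solve (t :: []) (Hγ :: Yγ :: []) ((-: 1:) :% (:- m0 :- (s0 :% m1 :+ s0
   :% m1))) (m0 :+ (s0 :% m1 :+ s0 :% m1))) (conj-% (S.- 1ᴿ) {y t} {Opp.Hγ} (Opp.x-H t))

  y-Y : ∀ t -> Conj (y t) Yγ Yγ
  y-Y t = Opp.x-X t

  w : Unit -> Mat n
  w a = x γ (val a) * y (S.- val~1 a) * x γ (val a)

  private
   -- Scalar identities in the unit a are applied with a a⁻¹ written as e and e = 1.
   module Step (a : Unit) where
    s = val a
    r = val~1 a
    e≈1 : s *R r ≈R 1ᴿ
    e≈1 = val*val~1 a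

    combine : ∀ {g A B C} (α β δ : S.Carrier) -> Conj g Xγ A -> Conj g Yγ B -> Conj g Hγ C -> Conj g (α ⊙ Xγ + β ⊙ Yγ + δ ⊙ Hγ) (α ⊙ A + β ⊙ B + δ ⊙ C)
    combine {g} {A} {B} {C} α β δ p q o = conj-+ {g} {α ⊙ Xγ + β ⊙ Yγ} {α ⊙ A + β ⊙ B} {δ ⊙ Hγ} {δ ⊙ C} (conj-+ {g} {α ⊙ Xγ} {α ⊙ A} {β ⊙ Yγ} {β ⊙ B} (conj-% α {g} {Xγ} {A} p) (conj-% β {g}
     {Yγ} {B} q)) (conj-% δ {g} {Hγ} {C} o)

    combined : ∀ α β δ -> Mat n
    combined α β δ = α ⊙ Xγ + β ⊙ Yγ + δ ⊙ Hγ

    x-combined : ∀ α β δ -> Conj (x γ s) (combined α β δ) (combined (α S.- β *R (s *R s) S.- (δ *R s +R δ *R s)) β (δ +R β *R s))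
    x-combined α β δ = conj-resp {x γ s} refl (solve (α :: β :: δ :: s :: []) (Xγ :: Yγ :: Hγ :: []) (s0 :% m0 :+ s1 :% (m1 :+ s3 :% m2 :- (s3 *: s3) :% m0) :+ s2 :% (m2 :- (s3 :% m0 :+ s3 :% m0)))
     ((s0 -: s1 *: (s3 *: s3) -: (s2 *: s3 +: s2 *: s3)) :% m0 :+ s1 :% m1 :+ (s2 +: s1 *: s3) :% m2)) (combine {x γ s} α β δ (x-X s) (x-Y s) (x-H s))

    y-combined : ∀ α β δ -> Conj (y (S.- r)) (combined α β δ) (combined α (β S.- α *R (r *R r) S.- (δ *R r +R δ *R r)) (δ +R α *R r))
    y-combined α β δ = conj-resp {y (S.- r)} refl (solve (α :: β :: δ :: r :: []) (Xγ :: Yγ :: Hγ :: []) (s0 :% (m0 :- (-: s3) :% m2 :- ((-: s3) *: (-: s3)) :% m1) :+ s1 :% m1 :+ s2 :% (m2 :+ ((-: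
     s3) :% m1 :+ (-: s3) :% m1))) (s0 :% m0 :+ (s1 -: s0 *: (s3 *: s3) -: (s2 *: s3 +: s2 *: s3)) :% m1 :+ (s2 +: s0 *: s3) :% m2)) (combine {y (S.- r)} α β δ (y-X _) (y-Y _) (y-H _))

    w-combined : ∀ {α β δ α1 δ₁ β₂ δ₂ α3 δ3} -> α S.- β *R (s *R s) S.- (δ *R s +R δ *R s) ≈R α1 -> δ +R β *R s ≈R δ₁ -> β S.- α1 *R (r *R r) S.- (δ₁ *R r +R δ₁ *R r) ≈R β₂ -> δ₁ +R α1 *R r ≈R
     δ₂ -> α1 S.- β₂ *R (s *R s) S.- (δ₂ *R s +R δ₂ *R s) ≈R α3 -> δ₂ +R β₂ *R s ≈R δ3 -> Conj (w a) (combined α β δ) (combined α3 β₂ δ3)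
    w-combined {α} {β} {δ} {α1} {δ₁} {β₂} {δ₂} {α3} {δ3} p1 q1 p2 q2 p3 q3 = conj-∘ {x γ s * y (S.- r)} {x γ s} {combined α β δ} {combined α1 β δ₁} {combined α3 β₂ δ3} (conj-∘ {x γ s} {y
     (S.- r)} {combined α1 β δ₁} {combined α1 β₂ δ₂} {combined α3 β₂ δ3} (conj-resp {x γ s} {combined α1 β₂ δ₂} refl (+-cong (+-cong (%-cong p3 refl) refl) (%-cong q3 refl)) (x-combined α1
     β₂ δ₂)) (conj-resp {y (S.- r)} {combined α1 β δ₁} refl (+-cong (+-cong refl (%-cong p2 refl)) (%-cong q2 refl)) (y-combined α1 β δ₁))) (conj-resp {x γ s} {combined α β δ} refl (+-cong
     (+-cong (%-cong p1 refl) refl) (%-cong q1 refl)) (x-combined α β δ))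

    only-X : ∀ α -> combined α 0ᴿ 0ᴿ ≈ α ⊙ Xγ
    only-X α = solve (α :: []) (Xγ :: Yγ :: Hγ :: []) (s0 :% m0 :+ 0: :% m1 :+ 0: :% m2) (s0 :% m0)
    only-Y : ∀ β -> combined 0ᴿ β 0ᴿ ≈ β ⊙ Yγ
    only-Y β = solve (β :: []) (Xγ :: Yγ :: Hγ :: []) (0: :% m0 :+ s0 :% m1 :+ 0: :% m2) (s0 :% m1)
    only-H : ∀ δ -> combined 0ᴿ 0ᴿ δ ≈ δ ⊙ Hγ
    only-H δ = solve (δ :: []) (Xγ :: Yγ :: Hγ :: []) (0: :% m0 :+ 0: :% m1 :+ s0 :% m2) (s0 :% m2)

    unit-identity : ∀ {k} (σ : Vec S.Carrier k) (f g h : Scalar (suc (suc k))) -> {S.Valid (s :: r :: σ) [] (f :% :1) ((g +: h *: (s0 *: s1 -: 1:)) :% :1)} -> S.⟦_⟧s (s :: r :: σ) [] f ≈R S.⟦_⟧s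
     (s :: r :: σ) [] g
    unit-identity σ f g h {v} = solves (s :: r :: σ) f (g +: h *: (s0 *: s1 -: 1:)) {v} S.& S.+-congˡ (S.*-congˡ (S.+-congʳ e≈1 S.& S.-‿inverseʳ _)) S.& S.+-congˡ (S.zeroʳ _) S.& S.+-identityʳ
     _

  private
   module Syntax where
    S T : Scalar 2
    S = s0
    T = s1

  w-X : ∀ a -> Conj (w a) Xγ (- ((val~1 a *R val~1 a) ⊙ Yγ))
  w-X a = conj-resp {w a} (only-X 1ᴿ & %-one _) (only-Y _ & solve (r :: []) (Yγ :: []) ((-: (s0 *: s0)) :% m0) (:- ((s0 *: s0) :% m0))) (w-combined {1ᴿ} {0ᴿ} {0ᴿ} {1ᴿ} {0ᴿ} {S.- (r *R r)} {r}
   {0ᴿ} {0ᴿ} (unit-identity [] (1: -: 0: *: (S *: S) -: (0: *: S +: 0: *: S)) 1: 0:) (unit-identity [] (0: +: 0: *: S) 0: 0:) (unit-identity [] (0: -: 1: *: (T *: T) -: (0: *: T +: 0: *: T))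
   (-: (T *: T)) 0:) (unit-identity [] (0: +: 1: *: T) T 0:) (unit-identity [] (1: -: (-: (T *: T)) *: (S *: S) -: (T *: S +: T *: S)) 0: (S *: T -: 1:)) (unit-identity [] (T +: (-: (T *:
   T)) *: S) 0: (-: T)))
   where
   open Step a
   open Syntax

  w-Y : ∀ a -> Conj (w a) Yγ (- ((val a *R val a) ⊙ Xγ))
  w-Y a = conj-resp {w a} (only-Y 1ᴿ & %-one _) (only-X _ & solve (s :: []) (Xγ :: []) ((-: (s0 *: s0)) :% m0) (:- ((s0 *: s0) :% m0))) (w-combined {0ᴿ} {1ᴿ} {0ᴿ} {S.- (s *R s)} {s} {0ᴿ} {0ᴿ}
   {S.- (s *R s)} {0ᴿ} (unit-identity [] (0: -: 1: *: (S *: S) -: (0: *: S +: 0: *: S)) (-: (S *: S)) 0:) (unit-identity [] (0: +: 1: *: S) S 0:) (unit-identity [] (1: -: (-: (S *: S)) *: (T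
   *: T) -: (S *: T +: S *: T)) 0: (S *: T -: 1:)) (unit-identity [] (S +: (-: (S *: S)) *: T) 0: (-: S)) (unit-identity [] ((-: (S *: S)) -: 0: *: (S *: S) -: (0: *: S +: 0: *: S)) (-: (S
   *: S)) 0:) (unit-identity [] (0: +: 0: *: S) 0: 0:))
   where
   open Step a
   open Syntax

  w-H : ∀ a -> Conj (w a) Hγ (- Hγ)
  w-H a = conj-resp {w a} (only-H 1ᴿ & %-one _) (only-H _ & solve [] (Hγ :: []) ((-: 1:) :% m0) (:- m0)) (w-combined {0ᴿ} {0ᴿ} {1ᴿ} {S.- (s +R s)} {1ᴿ} {0ᴿ} {S.- 1ᴿ} {0ᴿ} {S.- 1ᴿ}
   (unit-identity [] (0: -: 0: *: (S *: S) -: (1: *: S +: 1: *: S)) (-: (S +: S)) 0:) (unit-identity [] (1: +: 0: *: S) 1: 0:) (unit-identity [] (0: -: (-: (S +: S)) *: (T *: T) -: (1: *: T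
   +: 1: *: T)) 0: (T +: T)) (unit-identity [] (1: +: (-: (S +: S)) *: T) (-: 1:) (-: (1: +: 1:))) (unit-identity [] ((-: (S +: S)) -: 0: *: (S *: S) -: ((-: 1:) *: S +: (-: 1:) *: S)) 0:
   0:) (unit-identity [] ((-: 1:) +: 0: *: S) (-: 1:) 0:))
   where
   open Step a
   open Syntax

  -1u : Unit
  -1u = unit (S.- 1ᴿ) (S.- 1ᴿ) (solves [] (-: 1: *: -: 1:) 1:)
   where open Syntax

  h : Unit -> Mat n
  h a = w a * w -1u

  h-X : ∀ a -> Conj (h a) Xγ ((val a *R val a) ⊙ Xγ)
  h-X a = conj-resp {h a} {Xγ} refl (solve (val a :: []) (Xγ :: []) ((-: ((-: 1:) *: (-: 1:))) :% (:- ((s0 *: s0) :% m0))) ((s0 *: s0) :% m0)) (conj-∘ {w a} {w -1u} {Xγ} (conj-% _ {w a} {Yγ}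
   (w-Y a)) (conj-resp {w -1u} {Xγ} refl (solve [] (Yγ :: []) (:- (((-: 1:) *: (-: 1:)) :% m0)) ((-: ((-: 1:) *: (-: 1:))) :% m0)) (w-X -1u)))

  h-H : ∀ a -> Conj (h a) Hγ Hγ
  h-H a = conj-resp {h a} {Hγ} refl (solve [] (Hγ :: []) ((-: 1:) :% (:- m0)) (m0)) (conj-∘ {w a} {w -1u} {Hγ} (conj-% (S.- 1ᴿ) {w a} {Hγ} (w-H a)) (conj-resp {w -1u} {Hγ} refl (solve [] (Hγ
   :: []) (:- m0) ((-: 1:) :% m0)) (w-H -1u)))

  w-inverse : ∀ a b -> val a +R val b ≈R 0ᴿ -> val~1 a +R val~1 b ≈R 0ᴿ -> w a * w b ≈ 1#
  w-inverse a b p q = begin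
   (x γ s * y (S.- s') * x γ s) * (x γ t * y (S.- t') * x γ t)
   ≈⟨ solve [] (x γ s :: y (S.- s') :: x γ t :: y (S.- t') :: [])
   ((m0 :* m1 :* m0) :* (m2 :* m3 :* m2)) (m0 :* (m1 :* (m0 :* m2) :* m3) :* m2) ⟩
   x γ s * (y (S.- s') * (x γ s * x γ t) * y (S.- t')) * x γ t
   ≈⟨ congr (x γ t) (congl (x γ s) (trans (congr (y (S.- t'))
   (trans (congl (y (S.- s')) (x-inverse γ p)) (*-identityʳ _)))
   (x-inverse (-ᴿ γ) (S.trans (S.-‿+-comm _ _) (S.trans (S.-‿cong q) S.-0#≈0#))))) ⟩
   x γ s * 1# * x γ t
   ≈⟨ congr (x γ t) (*-identityʳ (x γ s)) ⟩
   x γ s * x γ t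
   ≈⟨ x-inverse γ p ⟩
   1# ∎
   where
   s = val a
   s' = val~1 a
   t = val b
   t' = val~1 b

-- Weight projections

module IntegerPoints {c ℓ} (R : CommutativeRing c ℓ) {n} (π : Representation n) where
 open RootSubgroups R π
 private
  module Z = RootSubgroups ℤ-ring π
 open M
 open Matrices R using (ι)

 private
  ^≡^ : ∀ s k -> (s Z.S.^ k) ≡ (s O.^ k)
  ^≡^ s zero = rfl
  ^≡^ s (suc k) = cong (s O.*_) (^≡^ s k)

 x-ι : ∀ γ s -> ιM (Z.x γ s) ≈ x γ (ι s)
 x-ι γ s = (ιM-sum {m = bound} \ k -> (s Z.S.^ # k) I.·ᴹ Z.ιM (divPow γ (# k))) & (sum<-cong bound \ k -> trans (ιM-· (s Z.S.^ k) (Z.ιM (divPow γ k))) (%-cong (S.reflexive (cong ι (^≡^ s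
  k)) S.& ι-^ s k) (\ i j -> ι-cong (ι-ℤ (divPow γ k i j)))))

module LaurentMatrices {n : ℕ} where
 -- (p , m , C) stands for the monomial aᵖ a⁻ᵐ C
 Monomial : Set
 Monomial = ℕ × ℕ × I.Mat n

 mulMonomial : Monomial -> Monomial -> Monomial
 mulMonomial (p , m , C) (p' , m' , C') = p N.+ p' , m N.+ m' , C I.* C'

 mulLaurent : List Monomial -> List Monomial -> List Monomial
 mulLaurent [] M = []
 mulLaurent (t :: L) M = map (mulMonomial t) M ++ mulLaurent L M

 select : ∀ {p} {P : Set p} -> Dec P -> I.Mat n -> I.Mat n
 select (yes _) C = C
 select (no _) C = I.0#

 select-yes : ∀ {p} {P : Set p} (P? : Dec P) -> P -> ∀ C -> select P? C ≡ C
 select-yes (yes _) _ C = rfl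
 select-yes (no ¬p) p C = contradiction p ¬p

 select-no : ∀ {p} {P : Set p} (P? : Dec P) -> ¬ P -> ∀ C -> select P? C ≡ I.0#
 select-no (yes p) ¬p C = contradiction p ¬p
 select-no (no _) _ C = rfl

 component : List Monomial -> ℕ -> ℕ -> I.Mat n
 component [] B d = I.0#
 component ((p , m , C) :: L) B d = select (p N.+ B N.≟ m N.+ d) C I.+ component L B d

 positiveDegree negativeDegree : List Monomial -> ℕ
 positiveDegree [] = 0
 positiveDegree ((p , m , C) :: L) = p N.+ positiveDegree L
 negativeDegree [] = 0
 negativeDegree ((p , m , C) :: L) = m N.+ negativeDegree L

module LaurentEvaluation {c ℓ} (R : CommutativeRing c ℓ) {n : ℕ} where
 open LaurentMatrices {n}
 open Exponential R
 open Units R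
 open M
 open Matrices R using (ι)
 open Reasoning (setoid {n})

 module _ (a : Unit) where
  monomial : Monomial -> S.Carrier
  monomial (p , m , _) = (val a S.^ p) S.* (val~1 a S.^ m)

  exponent : Monomial -> ℤ
  exponent (p , m , _) = + p O.- + m

  weighted : (ℤ -> ℤ) -> Monomial -> Mat n
  weighted g t = (ι (g (exponent t)) S.* monomial t) ⊙ ιM (snd (snd t))

  evaluate : (ℤ -> ℤ) -> List Monomial -> Mat n
  evaluate g [] = 0#
  evaluate g (t :: L) = weighted g t + evaluate g L

  one = \ (_ : ℤ) -> + 1

  evaluate-++ : ∀ g L M -> evaluate g (L ++ M) ≈ evaluate g L + evaluate g M
  evaluate-++ g [] M = sym (+-identityˡ _)
  evaluate-++ g (t :: L) M = +-congˡ {x = weighted g t} (evaluate-++ g L M) & sym (+-assoc _ _ _)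

  private
   monomial-mul : ∀ t s -> monomial (mulMonomial t s) S.≈ monomial t S.* monomial s
   monomial-mul (p , m , _) (p' , m' , _) = S.*-cong (S.^-homo-* (val a) p p') (S.^-homo-* (val~1 a) m m') S.& solves (val a S.^ p :: val a S.^ p' :: val~1 a S.^ m :: val~1 a S.^ m' :: []) (s0
    *: s1 *: (s2 *: s3)) (s0 *: s2 *: (s1 *: s3))

   exponent-mul : ∀ t s -> exponent (mulMonomial t s) ≡ exponent t O.+ exponent s
   exponent-mul (p , m , _) (p' , m' , _) = ℤs.solves (+ p :: + p' :: + m :: + m' :: []) (s0 +: s1 -: (s2 +: s3)) (s0 -: s2 +: (s1 -: s3))

  evaluate-* : ∀ L M -> evaluate one (mulLaurent L M) ≈ evaluate one L * evaluate one M
  evaluate-* [] M = sym (zeroˡ (evaluate one M))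
  evaluate-* (t :: L) M = evaluate-++ one (map (mulMonomial t) M) _ & +-cong (first M) (evaluate-* L M) & sym (distribʳ (evaluate one M) _ _)
   where
   C = ιM (snd (snd t))
   first : ∀ M -> evaluate one (map (mulMonomial t) M) ≈ weighted one t * evaluate one M
   first [] = sym (zeroʳ (weighted one t))
   first (s :: M) = +-cong (%-cong (S.*-cong ι-1 (monomial-mul t s)) (ιM-* (snd (snd t)) (snd (snd s))) & solve (monomial t :: monomial s :: []) (C :: ιM (snd (snd s)) :: []) ((1: *:
    (s0 *: s1)) :% (m0 :* m1)) (((1: *: s0) :% m0) :* ((1: *: s1) :% m1)) & sym (*-cong (%-cong (S.*-congʳ ι-1) refl) (%-cong (S.*-congʳ ι-1) refl))) (first M) & sym (distribˡ (weighted one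
    t) _ _)

  evaluate-derivation : ∀ L M -> evaluate id (mulLaurent L M) ≈ evaluate id L * evaluate one M + evaluate one L * evaluate id M
  evaluate-derivation [] M = sym (solve [] (evaluate one M :: evaluate id M :: []) (:0 :* m0 :+ :0 :* m1) :0)
  evaluate-derivation (t :: L) M = evaluate-++ id (map (mulMonomial t) M) _ & +-cong (first M) (evaluate-derivation L M) & solve [] (weighted id t :: weighted one t :: evaluate one M :: evaluate
   id M :: evaluate id L :: evaluate one L :: []) (m0 :* m2 :+ m1 :* m3 :+ (m4 :* m2 :+ m5 :* m3)) ((m0 :+ m4) :* m2 :+ (m1 :+ m5) :* m3)
   where
   C = ιM (snd (snd t))
   first : ∀ M -> evaluate id (map (mulMonomial t) M) ≈ weighted id t * evaluate one M + weighted one t * evaluate id M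
   first [] = sym (solve [] (weighted id t :: weighted one t :: []) (m0 :* :0 :+ m1 :* :0) :0)
   first (s :: M) = let D = ιM (snd (snd s)) in trans (+-cong
    (trans (%-cong (S.*-cong (S.trans (S.reflexive (cong ι (exponent-mul t s))) (ι-+ (exponent t) (exponent s))) (monomial-mul t s))
    (ιM-* (snd (snd t)) (snd (snd s))))
    (trans (solve (monomial t :: monomial s :: ι (exponent t) :: ι (exponent s) :: []) (C :: D :: [])
    (((s2 +: s3) *: (s0 *: s1)) :% (m0 :* m1))
    (((s2 *: s0) :% m0) :* ((1: *: s1) :% m1) :+ ((1: *: s0) :% m0) :* ((s3 *: s1) :% m1)))
    (sym (+-cong (congl (weighted id t) (%-cong (S.*-congʳ ι-1) refl)) (congr (weighted id s) (%-cong (S.*-congʳ ι-1) refl))))))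
    (first M))
    (solve [] (weighted id t :: weighted one t :: weighted one s :: weighted id s :: evaluate one M :: evaluate id M :: [])
    (m0 :* m2 :+ m1 :* m3 :+ (m0 :* m4 :+ m1 :* m5))
    (m0 :* (m2 :+ m4) :+ m1 :* (m3 :+ m5)))

  evaluate-tabulate : ∀ g {N} (f : Fin N -> Monomial) -> evaluate g (Data.List.Base.tabulate f) ≈ sum (\ k -> weighted g (f k))
  evaluate-tabulate g {zero} f = refl
  evaluate-tabulate g {suc N} f = +-congˡ {x = weighted g (f 0F)} (evaluate-tabulate g (f ∘ F.suc))

  sum-only : ∀ {K} (v : Fin K -> Mat n) i -> (∀ j -> j ≢ i -> v j ≈ 0#) -> sum v ≈ v i
  sum-only {suc K} v F.zero p = +-congˡ {x = v 0F} (sum-zero {n} {K} \ j -> p (F.suc j) \ ()) & +-identityʳ (v 0F)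
  sum-only {suc K} v (F.suc i) p = +-cong (p 0F \ ()) (sum-only (v ∘ F.suc) i \ j q -> p (F.suc j) (q ∘ F.suc-injective)) & +-identityˡ _

  -- collecting the terms of each degree d − B
  evaluate-components : ∀ g B K L -> All (\ (p , m , _) -> p N.+ B N.< K × m N.≤ B) L -> evaluate g L ≈ (val~1 a S.^ B) ⊙ sum {n} {K} (\ d -> (ι (g (+ # d O.- + B)) S.* (val a S.^ # d)) ⊙ ιM
   (component L B (# d)))
  evaluate-components g B K [] [] = sym (%-cong S.refl (sum-zero {n} {K} \ d -> trans (%-cong S.refl ιM-0) (solve (coefficient (# d) :: []) [] (s0 :% :0) :0)) & solve (val~1 a S.^ B :: []) []
   (s0 :% :0) :0)
   where coefficient = \ d -> ι (g (+ d O.- + B)) S.* (val a S.^ d)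
  evaluate-components g B K ((p , m , C) :: L) ((p+B<K , m≤B) :: bounds) = begin
   weighted g (p , m , C) + evaluate g L
   ≈⟨ +-cong (trans (%-cong scalar refl) (solve (val~1 a S.^ B :: coefficient d0 :: []) (ιM C :: [])
   ((s0 *: s1) :% m0) (s0 :% s1 :% m0))) (evaluate-components g B K L bounds) ⟩
   (val~1 a S.^ B) ⊙ (coefficient d0 ⊙ ιM C) + (val~1 a S.^ B) ⊙ sum {n} {K} (\ d -> coefficient (# d) ⊙ ιM (component L B (# d)))
   ≈⟨ %-distribl _ _ _ ⟨
   (val~1 a S.^ B) ⊙ (coefficient d0 ⊙ ιM C + sum {n} {K} (\ d -> coefficient (# d) ⊙ ιM (component L B (# d))))
   ≈⟨ %-cong S.refl (+-congʳ (trans (sym at-d0) (sym (sum-only term i₀ elsewhere)))) ⟩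
   (val~1 a S.^ B) ⊙ (sum term + sum {n} {K} (\ d -> coefficient (# d) ⊙ ιM (component L B (# d))))
   ≈⟨ %-cong S.refl (trans (sym (∑-distrib-+ term _)) (sum-cong-≋ {n} {K} \ d ->
   trans (sym (%-distribl _ _ _)) (%-cong S.refl (sym (ιM-+ (selected (# d)) (component L B (# d))))))) ⟩
   (val~1 a S.^ B) ⊙ sum {n} {K} (\ d -> coefficient (# d) ⊙ ιM (component ((p , m , C) :: L) B (# d))) ∎
   where
   coefficient = \ d -> ι (g (+ d O.- + B)) S.* (val a S.^ d)
   selected : ℕ -> I.Mat n
   selected d = select (p N.+ B N.≟ m N.+ d) C
   term : Fin K -> Mat n
   term d = coefficient (# d) ⊙ ιM (selected (# d))
   d0 = p N.+ B N.∸ m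
   d0<K : d0 N.< K
   d0<K = N.≤-<-trans (N.m∸n≤m (p N.+ B) m) p+B<K
   i₀ = F.fromℕ< d0<K
   m+d0 : p N.+ B ≡ m N.+ d0
   m+d0 = J.sym (N.m+[n∸m]≡n (N.≤-trans m≤B (N.m≤n+m B p)))
   select-d0 : selected d0 ≡ C
   select-d0 = select-yes (p N.+ B N.≟ m N.+ d0) m+d0 C
   at-d0 : term i₀ ≈ coefficient d0 ⊙ ιM C
   at-d0 = reflexive (cong (\ d -> coefficient d ⊙ ιM (selected d)) (F.toℕ-fromℕ< d0<K) ⟫ cong (\ D -> coefficient d0 ⊙ ιM D) select-d0)
   elsewhere : ∀ j -> j ≢ i₀ -> term j ≈ 0#
   elsewhere j j≢i0 = %-cong S.refl (reflexive (cong ιM (select-no (p N.+ B N.≟ m N.+ # j) (\ q -> j≢i0 (F.toℕ-injective (N.+-cancelˡ-≡ m _ _ (J.sym q ⟫ m+d0) ⟫ J.sym (F.toℕ-fromℕ< d0<K))))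
    C)) & ιM-0) & solve (coefficient (# j) :: []) [] (s0 :% :0) :0
   exponents : + p O.- + m ≡ + d0 O.- + B
   exponents = ℤs.solves (+ p :: + m :: + B :: []) (s0 -: s1) ((s0 +: s2) -: s1 -: s2) ⟫ cong (\ z -> + z O.- + m O.- + B) m+d0 ⟫ ℤs.solves (+ m :: + d0 :: + B :: []) ((s0 +: s1) -: s0 -: s2) (s1
    -: s2)
   inverse-power : ∀ k -> (val a S.^ k) S.* (val~1 a S.^ k) S.≈ S.1#
   inverse-power zero = S.*-identityˡ S.1#
   inverse-power (suc k) = solves (val a :: val~1 a :: val a S.^ k :: val~1 a S.^ k :: []) (s0 *: s2 *: (s1 *: s3)) (s0 *: s1 *: (s2 *: s3)) S.& S.*-cong (val*val~1 a) (inverse-power k) S.&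
    S.*-identityˡ S.1#
   s = val a
   r = val~1 a
   power-identity : (s S.^ p) S.* (r S.^ m) S.≈ (r S.^ B) S.* (s S.^ d0)
   power-identity = (S.sym (S.*-identityʳ _) S.& S.*-congˡ (S.sym (inverse-power B))) S.& solves (s S.^ p :: r S.^ m :: s S.^ B :: r S.^ B :: []) (s0 *: s1 *: (s2 *: s3)) (s0 *: s2 *: s1 *: s3)
    S.& S.*-congʳ (S.*-congʳ (S.sym (S.^-homo-* s p B) S.& S.reflexive (cong (s S.^_) m+d0) S.& S.^-homo-* s m d0)) S.& solves (s S.^ m :: s S.^ d0 :: r S.^ m :: r S.^ B :: []) (s0 *: s1 *: s2
    *: s3) (s0 *: s2 *: (s3 *: s1)) S.& S.*-congʳ (inverse-power m) S.& S.*-identityˡ _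
   scalar : ι (g (+ p O.- + m)) S.* ((s S.^ p) S.* (r S.^ m)) S.≈ (r S.^ B) S.* coefficient d0
   scalar = S.*-cong (S.reflexive (cong (\ z -> ι (g z)) exponents)) power-identity S.& solves (ι (g (+ d0 O.- + B)) :: r S.^ B :: s S.^ d0 :: []) (s0 *: (s1 *: s2)) (s1 *: (s0 *: s2))

 degree-bounds : ∀ L B P -> positiveDegree L N.≤ P -> negativeDegree L N.≤ B -> All (\ (p , m , _) -> p N.+ B N.< suc (P N.+ B) × m N.≤ B) L
 degree-bounds [] B P p q = []
 degree-bounds ((k , m , C) :: L) B P p q = (s≤s (N.+-monoˡ-≤ B (N.≤-trans (N.m≤m+n k _) p)) , N.≤-trans (N.m≤m+n m _) q) :: degree-bounds L B P (N.≤-trans (N.m≤n+m _ k) p) (N.≤-trans (N.m≤n+m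
  _ m) q)

record WeightGrading {n} (H : I.Mat n) : Set where
 open I
 field
  size offset : ℕ
  P : ℕ -> Mat n
  eigenl : ∀ d -> d N.< size -> H * P d ≈ (+ d O.- + offset) ·ᴹ P d
  eigenr : ∀ d -> d N.< size -> P d * H ≈ (+ d O.- + offset) ·ᴹ P d
  total : sum {n} {size} (P ∘ #) ≈ 1#

 eigen-zero : ∀ {Z k} -> H * Z ≈ Z * H + k ·ᴹ Z -> ∀ {d e} -> d N.< size -> e N.< size -> + d ≢ + e O.+ k -> P d * (Z * P e) ≈ 0#
 eigen-zero {Z} {k} p {d} {e} d<s e<s d≢e+k i j = cancel (scaled-zero i j)
  where
  open Reasoning (setoid {n})
  Q = P d * (Z * P e)
  m = + d O.- + offset
  l = + e O.- + offset
  equal : m ·ᴹ Q ≈ (l O.+ k) ·ᴹ Q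
  equal = begin
   m ·ᴹ Q ≈⟨ solve (m :: []) (P d :: Z :: P e :: []) (s0 :% (m0 :* (m1 :* m2))) ((s0 :% m0) :* m1 :* m2) ⟩
   (m ·ᴹ P d) * Z * P e ≈⟨ congr (P e) (congr Z (eigenr d d<s)) ⟨
   (P d * H) * Z * P e ≈⟨ solve [] (P d :: H :: Z :: P e :: []) (m0 :* m1 :* m2 :* m3) (m0 :* (m1 :* m2) :* m3) ⟩
   P d * (H * Z) * P e ≈⟨ congr (P e) (congl (P d) p) ⟩
   P d * (Z * H + k ·ᴹ Z) * P e ≈⟨ solve (k :: []) (P d :: H :: Z :: P e :: []) (m0 :* (m2 :* m1 :+ s0 :% m2) :* m3)
   (m0 :* m2 :* (m1 :* m3) :+ s0 :% (m0 :* m2 :* m3)) ⟩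
   P d * Z * (H * P e) + k ·ᴹ (P d * Z * P e) ≈⟨ +-congʳ (congl (P d * Z) (eigenl e e<s)) ⟩
   P d * Z * (l ·ᴹ P e) + k ·ᴹ (P d * Z * P e) ≈⟨ solve (l :: k :: []) (P d :: Z :: P e :: [])
   (m0 :* m1 :* (s0 :% m2) :+ s1 :% (m0 :* m1 :* m2))
   ((s0 +: s1) :% (m0 :* (m1 :* m2))) ⟩
   (l O.+ k) ·ᴹ Q ∎
  scaled-zero : (m O.- (l O.+ k)) ·ᴹ Q ≈ 0#
  scaled-zero = solve (m :: l O.+ k :: []) (Q :: []) ((s0 -: s1) :% m0) (s0 :% m0 :- s1 :% m0) & +-congʳ equal & -‿inverseʳ ((l O.+ k) ·ᴹ Q)
  cancel : ∀ {z} -> (m O.- (l O.+ k)) O.* z ≡ + 0 -> z ≡ + 0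
  cancel {z} q with O.i*j≡0⇒i≡0∨j≡0 (m O.- (l O.+ k)) q
  ... | inr z≡0 = z≡0
  ... | inl eq = contradiction (O.i-j≡0⇒i≡j (+ d) (+ e O.+ k) (ℤs.solves (+ d :: + e :: + offset :: k :: []) (s0 -: (s1 +: s3)) ((s0 -: s2) -: ((s1 -: s2) +: s3)) ⟫ eq)) d≢e+k

 decompose : ∀ Z -> Z ≈ sum {n} {size} \ d -> sum {n} {size} \ e -> P (# d) * (Z * P (# e))
 decompose Z = begin
  Z ≈⟨ solve [] (Z :: []) (m0) (:1 :* (m0 :* :1)) ⟩
  1# * (Z * 1#) ≈⟨ *-cong total (congl Z total) ⟨
  sum {n} {size} (P ∘ #) * (Z * sum {n} {size} (P ∘ #))
  ≈⟨ congl (sum {n} {size} (P ∘ #)) (*-distribˡ-sum {n} {size} Z (P ∘ #)) ⟩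
  sum {n} {size} (P ∘ #) * sum {n} {size} (\ e -> Z * P (# e))
  ≈⟨ *-distribʳ-sum {n} {size} (sum {n} {size} (\ e -> Z * P (# e))) (P ∘ #) ⟩
  sum {n} {size} (\ d -> P (# d) * sum {n} {size} (\ e -> Z * P (# e)))
  ≈⟨ sum-cong-≋ {n} {size} (\ d -> *-distribˡ-sum {n} {size} (P (# d)) (\ e -> Z * P (# e))) ⟩
  sum {n} {size} (\ d -> sum {n} {size} \ e -> P (# d) * (Z * P (# e))) ∎
  where open Reasoning (setoid {n})

 graded : ℤ -> Mat n -> Mat n
 graded k Z = sum {n} {size} \ d -> sum {n} {size} \ e -> P (# d) * (LaurentMatrices.select (+ # d O.≟ + # e O.+ k) Z * P (# e))

 graded-same : ∀ {Z k} -> H * Z ≈ Z * H + k ·ᴹ Z -> graded k Z ≈ Z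
 graded-same {Z} {k} p = (sum-cong-≋ {n} {size} \ d -> sum-cong-≋ {n} {size} \ e -> same d e (+ # d O.≟ + # e O.+ k)) & sym (decompose Z)
  where
  same : ∀ d e (dec : Dec (+ # d ≡ + # e O.+ k)) -> P (# d) * (LaurentMatrices.select dec Z * P (# e)) ≈ P (# d) * (Z * P (# e))
  same d e (yes _) = refl
  same d e (no ¬q) = solve [] (P (# d) :: P (# e) :: []) (m0 :* (:0 :* m1)) :0 & sym (eigen-zero {Z} {k} p (F.toℕ<n d) (F.toℕ<n e) ¬q)

 graded-other : ∀ {Z k l} -> H * Z ≈ Z * H + l ·ᴹ Z -> k ≢ l -> graded k Z ≈ 0#
 graded-other {Z} {k} {l} p k≢l = sum-zero {n} {size} \ d -> sum-zero {n} {size} \ e -> other d e (+ # d O.≟ + # e O.+ k)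
  where
  other : ∀ (d e : Fin size) (dec : Dec (+ # d ≡ + # e O.+ k)) -> P (# d) * (LaurentMatrices.select dec Z * P (# e)) ≈ 0#
  other d e (no _) = solve [] (P (# d) :: P (# e) :: []) (m0 :* (:0 :* m1)) :0
  other d e (yes q) = eigen-zero {Z} {l} p (F.toℕ<n d) (F.toℕ<n e) (\ r -> k≢l (ℤs.+-cancelˡ (+ # e) k l (J.sym q ⟫ r)))

module IntegerMatrices {c ℓ} {K : CommutativeRing c ℓ} (isℚ : IsℚAlgebra K) where
 open Exponential K
 open IsℚAlgebra isℚ
 open PolynomialIdentity isℚ
 open Units K
 open Matrices K using (ι)

 ιM-injective : ∀ {n} {A B : I.Mat n} -> ιM A M.≈ ιM B -> A I.≈ B
 ιM-injective {A = A} {B} p i j = ι-injective (A i j) (B i j) (p i j)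

 private
  sum-entry : ∀ {n m} (v : Fin m -> M.Mat n) i j -> M.sum v i j S.≈ S.sum (\ k -> v k i j)
  sum-entry {m = zero} v i j = S.refl
  sum-entry {m = suc m} v i j = S.+-congˡ (sum-entry (v ∘ F.suc) i j)

 vanishing-matrix-polynomial : ∀ {n} N (C : ℕ -> I.Mat n) -> (∀ (a : Unit) -> M.sum {n} {N} (\ k -> (val a S.^ # k) M.⊙ ιM (C (# k))) M.≈ M.0#) -> ∀ k -> k N.< N -> C k I.≈ I.0#
 vanishing-matrix-polynomial {n} N C p k k<N i j = ι-injective0 (C k i j) (vanishing-polynomial N (\ k -> ι (C k i j)) (\ a -> S.sym (sum-entry {n} {N} _ i j) S.& p a i j) k k<N)

module TorusProjections {c ℓ} {K : CommutativeRing c ℓ} (isℚ : IsℚAlgebra K) {n} (π : Representation n) (γ : Root) where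
 open RootSubgroups K π
 open Torus γ
 open IntegerMatrices isℚ
 open LaurentMatrices {n}
 open LaurentEvaluation K {n}
 open M
 open Matrices K using (ι)
 open Reasoning (setoid {n})
 private
  module Z = RootSubgroups ℤ-ring π
  module ZT = Z.Torus γ
 open IntegerPoints K π

 w₋ : I.Mat n
 w₋ = ZT.w ZT.-1u

 private
  ι-minus-one : ι (-[1+ 0 ]) S.≈ S.- S.1#
  ι-minus-one = S.-‿cong ι-1

  w₋-ι : ιM w₋ ≈ w -1u
  w₋-ι = ιM-* (Z.x γ -[1+ 0 ] I.* Z.x (-ᴿ γ) (+ 1)) (Z.x γ -[1+ 0 ]) & *-cong (ιM-* (Z.x γ -[1+ 0 ]) (Z.x (-ᴿ γ) (+ 1)) & *-cong (x-ι γ -[1+ 0 ] & x-cong γ ι-minus-one) (x-ι (-ᴿ γ) (+ 1) &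
   x-cong (-ᴿ γ) (ι-1 S.& S.sym (S.-‿involutive _)))) (x-ι γ -[1+ 0 ] & x-cong γ ι-minus-one)

  xs ys L : List Monomial
  xs = Data.List.Base.tabulate {n = bound} \ k -> # k , 0 , divPow γ (# k)
  ys = Data.List.Base.tabulate {n = bound} \ k -> 0 , # k , (-[1+ 0 ] O.^ # k) I.·ᴹ divPow (-ᴿ γ) (# k)
  L = mulLaurent (mulLaurent (mulLaurent xs ys) xs) ((0 , 0 , w₋) :: [])

  module _ (a : Unit) where
   s = val a
   r = val~1 a

   evaluate-x : evaluate a (one a) xs ≈ x γ s
   evaluate-x = (evaluate-tabulate a (one a) {bound} \ k -> # k , 0 , divPow γ (# k)) & (sum<-cong bound \ k -> trans (%-cong (S.*-congʳ ι-1) refl) (solve (s S.^ k :: []) (ιM (divPow γ k) ::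
    []) ((1: *: (s0 *: 1:)) :% m0) (s0 :% m0)))

   derive-x : evaluate a id xs ≈ s ⊙ (Xγ * x γ s)
   derive-x = (evaluate-tabulate a id {bound} \ k -> # k , 0 , divPow γ (# k)) & (sum<-cong bound \ k -> trans (%-cong (S.*-congʳ (ι-cong (O.+-identityʳ (+ k)))) refl) (solve (ι (+ k) :: s
    S.^ k :: []) (ιM (divPow γ k) :: []) ((s0 *: (s1 *: 1:)) :% m0) (s1 :% s0 :% m0) & %-cong S.refl (sym (ιM-· (+ k) (divPow γ k))))) & series-euler (X-divided γ) s

   Y-signed : DividedPowers (-[1+ 0 ] I.·ᴹ X (-ᴿ γ)) (\ k -> (-[1+ 0 ] O.^ k) I.·ᴹ divPow (-ᴿ γ) k) bound
   Y-signed = D-scale -[1+ 0 ] (X-divided (-ᴿ γ))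

   series-y : series bound (\ k -> (-[1+ 0 ] O.^ k) I.·ᴹ divPow (-ᴿ γ) k) r ≈ y (S.- r)
   series-y = series-scale bound (divPow (-ᴿ γ)) -[1+ 0 ] r & x-cong (-ᴿ γ) (S.*-congʳ ι-minus-one S.& S.-1*x≈-x r)

   evaluate-y : evaluate a (one a) ys ≈ y (S.- r)
   evaluate-y = (evaluate-tabulate a (one a) {bound} \ k -> 0 , # k , (-[1+ 0 ] O.^ # k) I.·ᴹ divPow (-ᴿ γ) (# k)) & (sum<-cong bound \ k -> trans (%-cong (S.*-congʳ ι-1) refl) (solve (r
    S.^ k :: []) (ιM ((-[1+ 0 ] O.^ k) I.·ᴹ divPow (-ᴿ γ) k) :: []) ((1: *: (1: *: s0)) :% m0) (s0 :% m0))) & series-y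

   derive-y : evaluate a id ys ≈ r ⊙ (Yγ * y (S.- r))
   derive-y = (evaluate-tabulate a id {bound} \ k -> 0 , # k , (-[1+ 0 ] O.^ # k) I.·ᴹ divPow (-ᴿ γ) (# k)) & (sum<-cong bound \ k -> trans (%-cong (S.*-congʳ (ι-cong (O.+-identityˡ (O.-
    + k)) S.& ι-neg (+ k))) refl) (solve (ι (+ k) :: r S.^ k :: []) (ιM (D k) :: []) (((-: s0) *: (1: *: s1)) :% m0) (s1 :% s0 :% (:- m0)) & %-cong S.refl (%-cong S.refl (-‿cong (ιM-· (-[1+ 0 ]
    O.^ k) (divPow (-ᴿ γ) k)) & solve (ι (-[1+ 0 ] O.^ k) :: []) (ιM (divPow (-ᴿ γ) k) :: []) (:- (s0 :% m0)) ((-: 1:) :% s0 :% m0) & %-cong {x = ι (-[1+ 0 ] O.^ k) ⊙ ιM (divPow (-ᴿ γ) k)}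
    (S.sym ι-minus-one) (sym (ιM-· (-[1+ 0 ] O.^ k) (divPow (-ᴿ γ) k)))) & %-cong S.refl (sym (ιM-· -[1+ 0 ] (D k))) & sym (ιM-· (+ k) (-[1+ 0 ] I.·ᴹ D k))))) & (sum<-cong bound \ k -> %-cong
    {r = r S.^ k} S.refl (ιM-cong {A = + k I.·ᴹ (-[1+ 0 ] I.·ᴹ D k)} { -[1+ 0 ] I.·ᴹ (+ k I.·ᴹ D k)} (I.solve (+ k :: -[1+ 0 ] :: []) (D k :: []) (s0 :% s1 :% m0) (s1 :% s0 :% m0)))) &
    (sum<-cong bound \ k -> trans (%-cong {r = r S.^ k} S.refl (ιM-· -[1+ 0 ] (+ k I.·ᴹ D k) & %-cong ι-minus-one refl)) (solve (r S.^ k :: []) (ιM (+ k I.·ᴹ D k) :: []) (s0 :% (-: 1:) :% m0)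
    (:- (s0 :% m0)))) & sum-neg bound (\ k -> (r S.^ k) ⊙ ιM (+ k I.·ᴹ D k)) & -‿cong (series-euler Y-signed r & %-cong S.refl (*-cong (ιM-· -[1+ 0 ] (X (-ᴿ γ)) & %-cong ι-minus-one refl)
    series-y)) & solve (r :: []) (Yγ :: y (S.- r) :: []) (:- (s0 :% (((-: 1:) :% m0) :* m1))) (s0 :% (m0 :* m1))
    where
    D = \ k -> (-[1+ 0 ] O.^ k) I.·ᴹ divPow (-ᴿ γ) k
    sum-neg : ∀ N (f : ℕ -> Mat n) -> sum {n} {N} (\ k -> - f (# k)) ≈ - sum {n} {N} (f ∘ #)
    sum-neg zero f = solve [] [] :0 (:- :0)
    sum-neg (suc N) f = +-congˡ {x = - f 0} (sum-neg N (f ∘ suc)) & -‿+-comm (f 0) _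

   evaluate-w₋ : evaluate a (one a) ((0 , 0 , w₋) :: []) ≈ w -1u
   evaluate-w₋ = +-identityʳ _ & %-cong (S.*-congʳ ι-1) w₋-ι & solve [] (w -1u :: []) ((1: *: (1: *: 1:)) :% m0) (m0)

   derive-w₋ : evaluate a id ((0 , 0 , w₋) :: []) ≈ 0#
   derive-w₋ = solve [] (ιM w₋ :: []) ((0: *: (1: *: 1:)) :% m0 :+ :0) :0

   evaluate-xy : evaluate a (one a) (mulLaurent xs ys) ≈ x γ s * y (S.- r)
   evaluate-xy = evaluate-* a xs ys & *-cong evaluate-x evaluate-y

   evaluate-w : evaluate a (one a) (mulLaurent (mulLaurent xs ys) xs) ≈ w a
   evaluate-w = evaluate-* a (mulLaurent xs ys) xs & *-cong evaluate-xy evaluate-x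

   evaluate-h : evaluate a (one a) L ≈ h a
   evaluate-h = evaluate-* a (mulLaurent (mulLaurent xs ys) xs) _ & *-cong evaluate-w evaluate-w₋

   derive-w : evaluate a id (mulLaurent (mulLaurent xs ys) xs) ≈ Hγ * w a
   derive-w = begin
    evaluate a id (mulLaurent (mulLaurent xs ys) xs)
    ≈⟨ trans (evaluate-derivation a (mulLaurent xs ys) xs) (+-cong
    (*-cong (trans (evaluate-derivation a xs ys) (+-cong (*-cong derive-x evaluate-y) (*-cong evaluate-x derive-y))) evaluate-x)
    (*-cong evaluate-xy derive-x)) ⟩
    ((s ⊙ (Xγ * x₁)) * y1 + x₁ * (r ⊙ (Yγ * y1))) * x₁ + (x₁ * y1) * (s ⊙ (Xγ * x₁))
    ≈⟨ solve (s :: r :: []) (Xγ :: Yγ :: x₁ :: y1 :: [])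
    (((s0 :% (m0 :* m2)) :* m3 :+ m2 :* (s1 :% (m1 :* m3))) :* m2 :+ (m2 :* m3) :* (s0 :% (m0 :* m2)))
    (s0 :% (m0 :* (m2 :* m3 :* m2)) :+ s1 :% ((m2 :* m1) :* (m3 :* m2)) :+ s0 :% (m2 :* m3 :* (m0 :* m2))) ⟩
    s ⊙ (Xγ * w a) + r ⊙ ((x₁ * Yγ) * (y1 * x₁)) + s ⊙ (x₁ * y1 * (Xγ * x₁))
    ≈⟨ +-cong (+-congˡ {x = s ⊙ (Xγ * w a)} (%-cong S.refl (congr (y1 * x₁) (x-Y s))))
    (%-cong S.refl (trans (congl (x₁ * y1) (sym (x-X s))) (trans (sym (*-assoc (x₁ * y1) x₁ Xγ)) (w-X a)))) ⟩
    s ⊙ (Xγ * w a) + r ⊙ (((Yγ + s ⊙ Hγ - (s S.* s) ⊙ Xγ) * x₁) * (y1 * x₁)) + s ⊙ (- ((r S.* r) ⊙ Yγ) * w a)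
    ≈⟨ solve (s :: r :: []) (Xγ :: Yγ :: Hγ :: x₁ :: y1 :: [])
    (s0 :% (m0 :* W) :+ s1 :% (((m1 :+ s0 :% m2 :- (s0 *: s0) :% m0) :* m3) :* (m4 :* m3))
    :+ s0 :% ((:- ((s1 *: s1) :% m1)) :* W))
    ((s0 *: s1) :% (m2 :* W) :+ (1: -: s0 *: s1) :% ((s0 :% m0 :+ s1 :% m1) :* W)) ⟩
    (s S.* r) ⊙ (Hγ * w a) + (S.1# S.- s S.* r) ⊙ ((s ⊙ Xγ + r ⊙ Yγ) * w a)
    ≈⟨ +-cong (%-cong (val*val~1 a) refl) (%-cong (S.+-congˡ (S.-‿cong (val*val~1 a))) refl) ⟩
    S.1# ⊙ (Hγ * w a) + (S.1# S.- S.1#) ⊙ ((s ⊙ Xγ + r ⊙ Yγ) * w a)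
    ≈⟨ solve [] (Hγ * w a :: (s ⊙ Xγ + r ⊙ Yγ) * w a :: []) (1: :% m0 :+ (1: -: 1:) :% m1) (m0) ⟩
    Hγ * w a ∎
    where
    x₁ = x γ s
    y1 = y (S.- r)
    W : Expr 2 5
    W = m3 :* m4 :* m3

   derive-h : evaluate a id L ≈ Hγ * h a
   derive-h = evaluate-derivation a (mulLaurent (mulLaurent xs ys) xs) ((0 , 0 , w₋) :: []) & +-cong (*-cong derive-w evaluate-w₋) (*-cong evaluate-w derive-w₋) & solve [] (Hγ :: w a :: w -1u ::
    []) ((m0 :* m1) :* m2 :+ m1 :* :0) (m0 :* (m1 :* m2))

  B = negativeDegree L
  S = suc (positiveDegree L N.+ B)
  P = component L B

  bounds = degree-bounds L B (positiveDegree L) N.≤-refl N.≤-refl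

  powers-sum : Unit -> Mat n
  powers-sum a = sum {n} {S} (\ d -> (val a S.^ # d) ⊙ ιM (P (# d)))

  h-sum : ∀ a -> h a ≈ (val~1 a S.^ B) ⊙ powers-sum a
  h-sum a = sym (evaluate-h a) & evaluate-components a (one a) B S L bounds & %-cong S.refl (sum<-cong S \ d -> %-cong {s = val a S.^ d} {x = ιM (P d)} (S.*-congʳ ι-1 S.& S.*-identityˡ _)
   refl)

  power-cancel : ∀ a k -> (val a S.^ k) S.* (val~1 a S.^ k) S.≈ S.1#
  power-cancel a zero = S.*-identityˡ S.1#
  power-cancel a (suc k) = solves (val a :: val~1 a :: val a S.^ k :: val~1 a S.^ k :: []) (s0 *: s2 *: (s1 *: s3)) (s0 *: s1 *: (s2 *: s3)) S.& S.*-cong (val*val~1 a) (power-cancel a k) S.&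
   S.*-identityˡ S.1#

  sum-h : ∀ a -> powers-sum a ≈ (val a S.^ B) ⊙ h a
  sum-h a = sym (%-cong (power-cancel a B) refl & %-one _) & solve (val a S.^ B :: val~1 a S.^ B :: []) (powers-sum a :: []) ((s0 *: s1) :% m0) (s0 :% s1 :% m0) & %-cong S.refl (sym (h-sum a))

  vanishing : (C : ℕ -> I.Mat n) -> (∀ a -> series S C (val a) ≈ 0#) -> ∀ d -> d N.< S -> C d I.≈ I.0#
  vanishing C = vanishing-matrix-polynomial S C

  difference : ∀ (C D : ℕ -> I.Mat n) -> (∀ a -> series S C (val a) ≈ series S D (val a)) -> ∀ d -> d N.< S -> C d I.≈ D d
  difference C D p d d<S = I.x∙y⁻¹≈ε⇒x≈y (C d) (D d) (vanishing (\ k -> C k I.+ I.- D k) (\ a -> begin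
   series S (\ k -> C k I.+ I.- D k) (val a)
   ≈⟨ series-+ S C (\ k -> I.- D k) (val a) ⟩
   series S C (val a) + series S (\ k -> I.- D k) (val a)
   ≈⟨ +-cong (p a) (trans (series-cong S {\ k -> I.- D k} {\ k -> (I.- I.1#) I.* D k} (\ k -> I.sym (I.-1*x≈-x (D k))) S.refl)
   (trans (series-*l S D (I.- I.1#) (val a)) (congr (series S D (val a)) (\ i j -> S.trans (ι-neg (I.1# i j)) (S.-‿cong (ιM-1 i j)))))) ⟩
   series S D (val a) + (- 1#) * series S D (val a)
   ≈⟨ solve [] (series S D (val a) :: []) (m0 :+ (:- :1) :* m0) :0 ⟩
   0# ∎) d d<S)

  derived-sum : ∀ a -> series S (\ d -> (+ d O.- + B) I.·ᴹ P d) (val a) ≈ (val a S.^ B) ⊙ evaluate a id L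
  derived-sum a = sym (%-cong S.refl (evaluate-components a id B S L bounds) & (solve (val a S.^ B :: val~1 a S.^ B :: []) (Q :: []) (s0 :% s1 :% m0) ((s0 *: s1) :% m0) & %-cong (power-cancel a
   B) refl & %-one _) & (sum<-cong S \ d -> trans (solve (ι (+ d O.- + B) :: val a S.^ d :: []) (ιM (P d) :: []) ((s0 *: s1) :% m0) (s1 :% s0 :% m0)) (%-cong S.refl (sym (ιM-· (+ d O.- + B) (P
   d))))))
   where Q = sum {n} {S} (\ d -> (ι (+ # d O.- + B) S.* (val a S.^ # d)) ⊙ ιM (P (# d)))

  eigenl : ∀ d -> d N.< S -> H[ γ ] I.* P d I.≈ (+ d O.- + B) I.·ᴹ P d
  eigenl = difference (\ d -> H[ γ ] I.* P d) (\ d -> (+ d O.- + B) I.·ᴹ P d) \ a -> begin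
   series S (\ d -> H[ γ ] I.* P d) (val a) ≈⟨ series-*l S P H[ γ ] (val a) ⟩
   Hγ * powers-sum a ≈⟨ congl Hγ (sum-h a) ⟩
   Hγ * ((val a S.^ B) ⊙ h a) ≈⟨ solve (val a S.^ B :: []) (Hγ :: h a :: []) (m0 :* (s0 :% m1)) (s0 :% (m0 :* m1)) ⟩
   (val a S.^ B) ⊙ (Hγ * h a) ≈⟨ %-cong S.refl (derive-h a) ⟨
   (val a S.^ B) ⊙ evaluate a id L ≈⟨ derived-sum a ⟨
   series S (\ d -> (+ d O.- + B) I.·ᴹ P d) (val a) ∎

  commutes : ∀ d -> d N.< S -> P d I.* H[ γ ] I.≈ H[ γ ] I.* P d
  commutes = difference (\ d -> P d I.* H[ γ ]) (\ d -> H[ γ ] I.* P d) \ a -> begin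
   series S (\ d -> P d I.* H[ γ ]) (val a) ≈⟨ series-*r S P H[ γ ] (val a) ⟩
   powers-sum a * Hγ ≈⟨ congr Hγ (sum-h a) ⟩
   ((val a S.^ B) ⊙ h a) * Hγ ≈⟨ solve (val a S.^ B :: []) (h a :: Hγ :: []) ((s0 :% m0) :* m1) (s0 :% (m0 :* m1)) ⟩
   (val a S.^ B) ⊙ (h a * Hγ) ≈⟨ %-cong S.refl (h-H a) ⟩
   (val a S.^ B) ⊙ (Hγ * h a) ≈⟨ solve (val a S.^ B :: []) (h a :: Hγ :: []) (s0 :% (m1 :* m0)) (m1 :* (s0 :% m0)) ⟩
   Hγ * ((val a S.^ B) ⊙ h a) ≈⟨ congl Hγ (sum-h a) ⟨
   Hγ * powers-sum a ≈⟨ series-*l S P H[ γ ] (val a) ⟨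
   series S (\ d -> H[ γ ] I.* P d) (val a) ∎

  one-power : ∀ k -> S.1# S.^ k S.≈ S.1#
  one-power zero = S.refl
  one-power (suc k) = S.*-identityˡ _ S.& one-power k

  total : I.sum {n} {S} (P ∘ #) I.≈ I.1#
  total = ιM-injective (begin
   ιM (I.sum {n} {S} (P ∘ #)) ≈⟨ ιM-sum {m = S} (P ∘ #) ⟩
   sum {n} {S} (\ d -> ιM (P (# d))) ≈⟨ sum<-cong S (\ d -> trans (%-cong (one-power d) refl) (%-one (ιM (P d)))) ⟨
   powers-sum 1ᵘ ≈⟨ sum-h 1ᵘ ⟩
   (S.1# S.^ B) ⊙ h 1ᵘ ≈⟨ %-cong (one-power B) (w-inverse 1ᵘ -1u (S.-‿inverseʳ _) (S.-‿inverseʳ _)) ⟩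
   S.1# ⊙ 1# ≈⟨ trans (%-one _) (sym ιM-1) ⟩
   ιM I.1# ∎)

 abstract
  grading : WeightGrading H[ γ ]
  grading = record { size = S ; offset = B ; P = P ; eigenl = eigenl ; eigenr = \ d d<S -> I.trans (commutes d d<S) (eigenl d d<S) ; total = total }

  h-expansion : ∀ a -> h a ≈ (val~1 a S.^ WeightGrading.offset grading) ⊙ series (WeightGrading.size grading) (WeightGrading.P grading) (val a)
  h-expansion = h-sum

-- Coordinate functionals on the Lie algebra

module Trace {c ℓ} (R : CommutativeRing c ℓ) where
 open Exponential R
 open S using (_≈_)
 open M using (Mat)

 tr : ∀ {n} -> Mat n -> S.Carrier
 tr A = S.sum \ i -> A i i

 tr-cong : ∀ {n} {A B : Mat n} -> A M.≈ B -> tr A ≈ tr B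
 tr-cong p = S.sum-cong-≋ \ i -> p i i

 tr-comm : ∀ {n} (A B : Mat n) -> tr (A M.* B) ≈ tr (B M.* A)
 tr-comm A B = (S.∑-comm \ i k -> A i k S.* B k i) S.& (S.sum-cong-≋ \ k -> S.sum-cong-≋ \ i -> S.*-comm (A i k) (B k i))

 tr-+ : ∀ {n} (A B : Mat n) -> tr (A M.+ B) ≈ tr A S.+ tr B
 tr-+ A B = S.∑-distrib-+ (\ i -> A i i) (\ i -> B i i)

 tr-% : ∀ {n} r (A : Mat n) -> tr (r M.⊙ A) ≈ r S.* tr A
 tr-% r A = S.sym (S.*-distribˡ-sum r (\ i -> A i i))

 tr-0 : ∀ {n} -> tr (M.0# {n}) ≈ S.0#
 tr-0 {n} = S.sum-zero {n} \ _ -> S.refl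

 ⟪_,_⟫ : ∀ {n} -> I.Mat n -> Mat n -> S.Carrier
 ⟪ Λ , N ⟫ = tr (ιM Λ M.* N)

 module _ {n} (Λ : I.Mat n) where
  ⟪⟫-cong : ∀ {A B} -> A M.≈ B -> ⟪ Λ , A ⟫ ≈ ⟪ Λ , B ⟫
  ⟪⟫-cong p = tr-cong (M.congl (ιM Λ) p)

  ⟪⟫-+ : ∀ A B -> ⟪ Λ , A M.+ B ⟫ ≈ ⟪ Λ , A ⟫ S.+ ⟪ Λ , B ⟫
  ⟪⟫-+ A B = tr-cong (M.distribˡ (ιM Λ) A B) S.& tr-+ (ιM Λ M.* A) (ιM Λ M.* B)

  ⟪⟫-% : ∀ r A -> ⟪ Λ , r M.⊙ A ⟫ ≈ r S.* ⟪ Λ , A ⟫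
  ⟪⟫-% r A = tr-cong (M.solve (r :: []) (ιM Λ :: A :: []) (m0 :* (s0 :% m1)) (s0 :% (m0 :* m1))) S.& tr-% r (ιM Λ M.* A)

  ⟪⟫-sandwich : ∀ A N B -> ⟪ B I.* (Λ I.* A) , N ⟫ ≈ ⟪ Λ , ιM A M.* (N M.* ιM B) ⟫
  ⟪⟫-sandwich A N B = tr-cong (M.congr N (ιM-* B (Λ I.* A) M.& M.congl (ιM B) (ιM-* Λ A)) M.& M.solve [] (ιM B :: ιM Λ :: ιM A :: N :: []) ((m0 :* (m1 :* m2)) :* m3) (m0 :* (m1 :* m2 :* m3)))
   S.& tr-comm (ιM B) (ιM Λ M.* ιM A M.* N) S.& tr-cong (M.solve [] (ιM B :: ιM Λ :: ιM A :: N :: []) ((m1 :* m2 :* m3) :* m0) (m1 :* (m2 :* (m3 :* m0))))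

 ⟪⟫-+l : ∀ {n} (Λ Λ' : I.Mat n) N -> ⟪ Λ I.+ Λ' , N ⟫ ≈ ⟪ Λ , N ⟫ S.+ ⟪ Λ' , N ⟫
 ⟪⟫-+l Λ Λ' N = tr-cong (M.congr N (ιM-+ Λ Λ') M.& M.distribʳ N (ιM Λ) (ιM Λ')) S.& tr-+ (ιM Λ M.* N) (ιM Λ' M.* N)

 ⟪⟫-·l : ∀ {n} k (Λ : I.Mat n) N -> ⟪ k I.·ᴹ Λ , N ⟫ ≈ Matrices.ι R k S.* ⟪ Λ , N ⟫
 ⟪⟫-·l k Λ N = tr-cong (M.congr N (ιM-· k Λ) M.& M.solve (Matrices.ι R k :: []) (ιM Λ :: N :: []) ((s0 :% m0) :* m1) (s0 :% (m0 :* m1))) S.& tr-% _ (ιM Λ M.* N)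

module ℤT where
 open import Algebra.Properties.Semiring.Sum (CommutativeRing.semiring ℤ-ring) public
  using () renaming (sum-cong-≋ to sumZ-cong; ∑-comm to ∑Z-comm; ∑-distrib-+ to ∑Z-distrib-+; *-distribˡ-sum to *-distribl-sumZ; sum-replicate-zero to sumZ-replicate-zero)
 open I using (Mat)

 trZ : ∀ {n} -> Mat n -> ℤ
 trZ A = sumZ \ i -> A i i

 ⟪_,_⟫Z : ∀ {n} -> Mat n -> Mat n -> ℤ
 ⟪ Λ , N ⟫Z = trZ (Λ I.* N)

 ⟪⟫Z-cong : ∀ {n} (Λ : Mat n) {A B} -> A I.≈ B -> ⟪ Λ , A ⟫Z ≡ ⟪ Λ , B ⟫Z
 ⟪⟫Z-cong Λ p = sumZ-cong \ i -> I.congl Λ p i i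

 ⟪⟫Z-+ : ∀ {n} (Λ A B : Mat n) -> ⟪ Λ , A I.+ B ⟫Z ≡ ⟪ Λ , A ⟫Z O.+ ⟪ Λ , B ⟫Z
 ⟪⟫Z-+ Λ A B = (sumZ-cong \ i -> I.distribˡ Λ A B i i) ⟫ ∑Z-distrib-+ (\ i -> (Λ I.* A) i i) (\ i -> (Λ I.* B) i i)

 ⟪⟫Z-· : ∀ {n} (Λ : Mat n) k A -> ⟪ Λ , k I.·ᴹ A ⟫Z ≡ k O.* ⟪ Λ , A ⟫Z
 ⟪⟫Z-· Λ k A = (sumZ-cong \ i -> I.solve (k :: []) (Λ :: A :: []) (m0 :* (s0 :% m1)) (s0 :% (m0 :* m1)) i i) ⟫ J.sym (*-distribl-sumZ k (\ i -> (Λ I.* A) i i))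

 trZ-comm : ∀ {n} (A B : Mat n) -> trZ (A I.* B) ≡ trZ (B I.* A)
 trZ-comm A B = (∑Z-comm \ i k -> A i k O.* B k i) ⟫ (sumZ-cong \ k -> sumZ-cong \ i -> O.*-comm (A i k) (B k i))

 ⟪⟫Z-0 : ∀ {n} (Λ : Mat n) -> ⟪ Λ , I.0# ⟫Z ≡ + 0
 ⟪⟫Z-0 Λ = ⟪⟫Z-cong Λ (I.solve [] [] :0 (0: :% :0)) ⟫ ⟪⟫Z-· Λ (+ 0) I.0#

module _ {c ℓ} (R : CommutativeRing c ℓ) where
 open Exponential R
 ⟪⟫-ι : ∀ {n} (Λ N : I.Mat n) -> Trace.⟪_,_⟫ R Λ (ιM N) S.≈ Matrices.ι R (ℤT.⟪ Λ , N ⟫Z)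
 ⟪⟫-ι Λ N = Trace.tr-cong R (M.sym (ιM-* Λ N)) S.& S.sym (ι-sum \ i -> (Λ I.* N) i i)

Multiple : ℕ -> ℤ -> Set
Multiple g a = ∃[ z ] a ≡ z O.* + g

Bezout : ∀ {m} -> (Fin m -> ℤ) -> Set
Bezout {m} v = Σ ℕ \ g -> (Σ (Fin m -> ℤ) \ c -> sumZ (\ i -> c i O.* v i) ≡ + g) × (∀ i -> Multiple g (v i))

private
 bezout-ℕ : ∀ m n -> Σ ℕ \ g -> (∃[ x ] ∃[ y ] x O.* + m O.+ y O.* + n ≡ + g) × Multiple g (+ m) × Multiple g (+ n)
 bezout-ℕ m n = gcd m n , coefficients (Bézout.identity (gcd-GCD m n)) , multiple (gcd[m,n]∣m m n) , multiple (gcd[m,n]∣n m n)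
  where
  open import Data.Nat.GCD using (gcd; gcd-GCD; gcd[m,n]∣m; gcd[m,n]∣n; module Bézout)
  open import Data.Nat.Divisibility using (_∣_; divides)
  multiple : ∀ {k} -> gcd m n ∣ k -> Multiple (gcd m n) (+ k)
  multiple (divides q eq) = + q , J.trans (cong +_ eq) (O.pos-* q (gcd m n))
  integral : ∀ {d x m y n} -> d N.+ y N.* n ≡ x N.* m -> + x O.* + m O.+ (O.- + y) O.* + n ≡ + d
  integral {d} {x} {m} {y} {n} eq = cong (O._+ (O.- + y) O.* + n) (J.sym (O.pos-* x m) ⟫ cong +_ (J.sym eq) ⟫ cong (\ z -> + d O.+ z) (O.pos-* y n)) ⟫ ℤs.solves (+ d :: + y :: + n :: []) (s0 +:
   s1 *: s2 +: (-: s1) *: s2) (s0)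
  coefficients : Bézout.Identity (gcd m n) m n -> ∃[ x ] ∃[ y ] x O.* + m O.+ y O.* + n ≡ + gcd m n
  coefficients (Bézout.+- x y eq) = + x , O.- + y , integral {x = x} {m} {y} {n} eq
  coefficients (Bézout.-+ x y eq) = O.- + x , + y , J.trans (O.+-comm ((O.- + x) O.* + m) (+ y O.* + n)) (integral {x = y} {n} {x} {m} eq)

 signed : ∀ a -> ∃[ σ ] σ O.* a ≡ + O.∣ a ∣ × a ≡ σ O.* + O.∣ a ∣
 signed (+ n) = + 1 , O.*-identityˡ (+ n) , J.sym (O.*-identityˡ (+ n))
 signed -[1+ n ] = -[1+ 0 ] , O.-1*i≡-i -[1+ n ] , J.sym (O.-1*i≡-i (+ suc n))

 bezout-ℤ : ∀ a b -> Σ ℕ \ g -> (∃[ x ] ∃[ y ] x O.* a O.+ y O.* b ≡ + g) × Multiple g a × Multiple g b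
 bezout-ℤ a b with signed a | signed b | bezout-ℕ O.∣ a ∣ O.∣ b ∣
 ... | σ , p , p' | τ , q , q' | g , (x , y , eq) , (z , zeq) , (w , weq) = g , (x O.* σ , y O.* τ , J.trans (cong₂ O._+_ (O.*-assoc x σ a ⟫ cong (x O.*_) p) (O.*-assoc y τ b ⟫ cong (y O.*_)
  q)) eq) , (σ O.* z , J.trans p' (cong (σ O.*_) zeq ⟫ J.sym (O.*-assoc σ z (+ g)))) , (τ O.* w , J.trans q' (cong (τ O.*_) weq ⟫ J.sym (O.*-assoc τ w (+ g))))

bezout : ∀ {m} (v : Fin m -> ℤ) -> Bezout v
bezout {zero} v = 0 , ((\ ()) , rfl) , \ ()
bezout {suc m} v with bezout (v ∘ F.suc)
... | g , (e , eq) , mult with bezout-ℤ (v 0F) (+ g)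
... | d , (x , y , eq′) , m₀ , (w , weq) =
 d , ((\ { F.zero -> x ; (F.suc i) -> y O.* e i })
 , J.trans (cong (\ z -> x O.* v 0F O.+ z) (J.trans (sumZ-cong \ i -> O.*-assoc y (e i) (v (F.suc i)))
 (J.trans (J.sym (*-distribl-sumZ y (\ i -> e i O.* v (F.suc i)))) (cong (y O.*_) eq)))) eq′)
 , \ { F.zero -> m₀ ; (F.suc i) -> let (z , zeq) = mult i in
 z O.* w , J.trans zeq (J.trans (cong (z O.*_) weq) (J.sym (O.*-assoc z w (+ d)))) }
 where open ℤT

matrix-bezout : ∀ {n} (A : I.Mat n) -> Σ ℕ \ g -> (Σ (I.Mat n) \ Λ -> ℤT.⟪ Λ , A ⟫Z ≡ + g) × (∀ i j -> Multiple g (A i j))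
matrix-bezout {n} A = g , ((\ i k -> e i O.* c i k) , value) , \ i j ->
 let (z , zeq) = snd (snd (columns j)) i ; (w , weq) = snd (snd total) j in
 z O.* w , J.trans zeq (J.trans (cong (z O.*_) weq) (J.sym (O.*-assoc z w (+ g))))
 where
 open ℤT
 columns : ∀ i -> Bezout (\ k -> A k i)
 columns i = bezout (\ k -> A k i)
 total : Bezout (\ i -> + fst (columns i))
 total = bezout (\ i -> + fst (columns i))
 g = fst total
 e : Fin n -> ℤ
 e = fst (fst (snd total))
 c : Fin n -> Fin n -> ℤ
 c i = fst (fst (snd (columns i)))
 value : ℤT.⟪ (\ i k -> e i O.* c i k) , A ⟫Z ≡ + g
 value = (sumZ-cong \ i -> J.trans (sumZ-cong \ k -> O.*-assoc (e i) (c i k) (A k i)) (J.sym (*-distribl-sumZ (e i) (\ k -> c i k O.* A k i)) ⟫ cong (e i O.*_) (snd (fst (snd (columns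
  i)))))) ⟫ snd (fst (snd total))

module Primitivity {n} (π : Representation n) where
 open Brackets π
 open I
 open Reasoning (setoid {n})

 N-unit : ∀ {α β δ} -> α ⊞ β ≈ δ -> chainLength α β ≡ 0 -> N α β δ O.* N α β δ ≡ + 1
 N-unit {α} {β} {δ} p q with N-value p
 ... | s , eq = cong₂ O._*_ N≡ N≡ ⟫ square s
  where
  N≡ : N α β δ ≡ s O.◃ 1
  N≡ = eq ⟫ cong (\ k -> s O.◃ suc k) (stringLength≡ α β ⟫ q)
  square : ∀ s -> (s O.◃ 1) O.* (s O.◃ 1) ≡ + 1
  square pos = rfl
  square neg = rfl

 N-two : ∀ {α β δ} -> α ⊞ β ≈ δ -> chainLength α β ≡ 1 -> ∃[ σ ] σ O.* σ ≡ + 1 × N α β δ ≡ σ O.* + 2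
 N-two {α} {β} {δ} p q with N-value p
 ... | s , eq = sign-unit s (eq ⟫ cong (\ k -> s O.◃ suc k) (stringLength≡ α β ⟫ q))
  where
  sign-unit : ∀ {N} s -> N ≡ s O.◃ 2 -> ∃[ σ ] σ O.* σ ≡ + 1 × N ≡ σ O.* + 2
  sign-unit pos eq = + 1 , rfl , eq
  sign-unit neg eq = -[1+ 0 ] , rfl , eq

 record Divides (q : ℕ) (A : Mat n) : Set where
  constructor by
  field
   quotient : Mat n
   multiple : A ≈ + q ·ᴹ quotient

 private
  divides-1 : ∀ A -> Divides 1 A
  divides-1 A = by A (sym (%-one A))

  divides-weaken : ∀ {q A} r -> Divides (q N.* r) A -> Divides q A
  divides-weaken {q} r (by B p) = by (+ r ·ᴹ B) (trans p (trans (%-cong {x = B} (O.pos-* q r) refl) (solve (+ q :: + r :: []) (B :: []) ((s0 *: s1) :% m0) (s0 :% s1 :% m0))))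

  divides-bracket : ∀ {q r A B C} -> A * B ≈ B * A + C -> Divides q A -> Divides r B -> Divides (q N.* r) C
  divides-bracket {q} {r} {A} {B} {C} p (by A' a) (by B' b) = by (A' * B' - B' * A') (begin
   C ≈⟨ solve [] (B * A :: C :: []) (m1) ((m0 :+ m1) :- m0) ⟩
   B * A + C - B * A ≈⟨ +-congʳ p ⟨
   A * B - B * A ≈⟨ +-cong (*-cong a b) (-‿cong (*-cong b a)) ⟩
   (+ q ·ᴹ A') * (+ r ·ᴹ B') - (+ r ·ᴹ B') * (+ q ·ᴹ A')
   ≈⟨ solve (+ q :: + r :: []) (A' :: B' :: [])
   ((s0 :% m0) :* (s1 :% m1) :- (s1 :% m1) :* (s0 :% m0))
   ((s0 *: s1) :% (m0 :* m1 :- m1 :* m0)) ⟩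
   (+ q O.* + r) ·ᴹ (A' * B' - B' * A') ≈⟨ %-cong {x = A' * B' - B' * A'} (J.sym (O.pos-* q r)) refl ⟩
   + (q N.* r) ·ᴹ (A' * B' - B' * A') ∎)

  divides-unit : ∀ {q u A} -> u O.* u ≡ + 1 -> Divides q (u ·ᴹ A) -> Divides q A
  divides-unit {q} {u} {A} p (by B eq) = by (u ·ᴹ B) (begin
   A ≈⟨ %-one A ⟨
   + 1 ·ᴹ A ≈⟨ %-cong {x = A} (J.sym p) refl ⟩
   (u O.* u) ·ᴹ A ≈⟨ solve (u :: []) (A :: []) ((s0 *: s0) :% m0) (s0 :% s0 :% m0) ⟩
   u ·ᴹ (u ·ᴹ A) ≈⟨ %-cong {r = u} rfl eq ⟩
   u ·ᴹ (+ q ·ᴹ B) ≈⟨ solve (u :: + q :: []) (B :: []) (s0 :% s1 :% m0) (s1 :% s0 :% m0) ⟩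
   + q ·ᴹ (u ·ᴹ B) ∎)

  even-or-odd : ∀ u -> ∃[ v ] (+ u ≡ v O.+ v ⊎ + u ≡ + 1 O.+ (v O.+ v))
  even-or-odd zero = + 0 , inl rfl
  even-or-odd (suc u) with even-or-odd u
  ... | v , inl eq = v , inr (cong O.suc eq)
  ... | v , inr eq = + 1 O.+ v , inl (cong O.suc eq ⟫ ℤs.solves (v :: []) (1: +: (1: +: (s0 +: s0))) ((1: +: s0) +: (1: +: s0)))

  halve : ∀ u {x z} -> + 2 O.* x ≡ (+ u O.* + u) O.* z -> ∃[ w ] x ≡ + u O.* w
  halve u {x} {z} eq with even-or-odd u
  ... | v , inl p = v O.* z , O.*-cancelˡ-≡ (+ 2) x (+ u O.* (v O.* z)) (eq ⟫ cong (\ y -> (+ u O.* y) O.* z) p ⟫ ℤs.solves (+ u :: v :: z :: []) (s0 *: (s1 +: s1) *: s2) ((1: +: 1:) *: (s0 *: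
   (s1 *: s2))))
  ... | v , inr p = + u O.* z' , O.*-cancelˡ-≡ (+ 2) x (+ u O.* (+ u O.* z')) (eq ⟫ cong (\ y -> (+ u O.* + u) O.* y) z≡ ⟫ ℤs.solves (+ u :: z' :: []) (s0 *: s0 *: (s1 +: s1)) ((1: +: 1:) *:
   (s0 *: (s0 *: s1))))
   where
   z' = x O.- (v O.* v O.+ v O.* v O.+ (v O.+ v)) O.* z
   z≡ : z ≡ z' O.+ z'
   z≡ = ℤs.solves (v :: z :: []) (s1) ((1: +: (s0 +: s0)) *: (1: +: (s0 +: s0)) *: s1 -: (1: +: 1:) *: ((s0 *: s0 +: s0 *: s0 +: (s0 +: s0)) *: s1)) ⟫ cong (\ y -> (y O.* y) O.* z O.- (+ 2) O.*
    ((v O.* v O.+ v O.* v O.+ (v O.+ v)) O.* z)) (J.sym p) ⟫ cong (\ y -> y O.- (+ 2) O.* ((v O.* v O.+ v O.* v O.+ (v O.+ v)) O.* z)) (J.sym eq) ⟫ ℤs.solves (x :: (v O.* v O.+ v O.* v O.+ (v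
    O.+ v)) O.* z :: []) ((1: +: 1:) *: s0 -: (1: +: 1:) *: s1) ((s0 -: s1) +: (s0 -: s1))

  divides-half : ∀ {u A} -> Divides (u N.* u) (+ 2 ·ᴹ A) -> Divides u A
  divides-half {u} {A} (by B eq) = by (\ i j -> fst (half i j)) (\ i j -> snd (half i j))
   where
   half : ∀ i j -> ∃[ w ] A i j ≡ + u O.* w
   half i j = halve u (eq i j ⟫ cong (O._* B i j) (O.pos-* u u))

  long-from-short : ∀ {q} -> (∀ s t -> Divides q (X (short s t))) -> ∀ i s -> Divides q (X (long i s))
  long-from-short {q} d i s = from i s
   where
   from-sum : ∀ {α β δ} -> α ⊞ β ≈ δ -> chainLength α β ≡ 1 -> Divides q (X α) -> Divides q (X β) -> Divides q (X δ)
   from-sum {α} {β} {δ} p c a b with N-two {α} {β} {δ} p c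
   ... | σ , σσ , eq = divides-half {q} {X δ} (divides-unit {q N.* q} {σ} {+ 2 ·ᴹ X δ} σσ
    (let (by B e) = divides-bracket {q} {q} {X α} {X β} {N α β δ ·ᴹ X δ} (bracket-sum p) a b in
    by B (trans (solve (σ :: + 2 :: []) (X δ :: []) (s0 :% s1 :% m0) ((s0 *: s1) :% m0))
    (trans (%-cong {x = X δ} (J.sym eq) refl) e))))
   from : ∀ i s -> Divides q (X (long i s))
   from 0F pos = from-sum {short pos pos} {short pos neg} ⟨ rfl , rfl ⟩ rfl (d pos pos) (d pos neg)
   from 0F neg = from-sum {short neg pos} {short neg neg} ⟨ rfl , rfl ⟩ rfl (d neg pos) (d neg neg)
   from 1F pos = from-sum {short pos pos} {short neg pos} ⟨ rfl , rfl ⟩ rfl (d pos pos) (d neg pos)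
   from 1F neg = from-sum {short pos neg} {short neg neg} ⟨ rfl , rfl ⟩ rfl (d pos neg) (d neg neg)

  divides-cartan : ∀ {q r} γ -> Divides q (X γ) -> Divides r (X (-ᴿ γ)) -> Divides (q N.* r) H[ γ ]
  divides-cartan γ = divides-bracket (bracket-opposite γ)

  short-from-cartan : ∀ {q r} i s a b -> Divides q H[ long i s ] -> Divides r (X (short a b)) -> Divides (q N.* r) (X (short a b))
  short-from-cartan i s a b h x = divides-unit {u = hval (long i s) (short a b)} (square-one i s a b) (divides-bracket (bracket-cartan (long i s) (short a b)) h x)
   where
   square-one : ∀ i s a b -> hval (long i s) (short a b) O.* hval (long i s) (short a b) ≡ + 1
   square-one i s a b = cong₂ O._*_ (hval≡ (long i s) (short a b)) (hval≡ (long i s) (short a b)) ⟫ cases i s a b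
    where
    cases : ∀ i s a b -> pairing (long i s) (short a b) O.* pairing (long i s) (short a b) ≡ + 1
    cases 0F pos pos pos = rfl
    cases 0F pos pos neg = rfl
    cases 0F pos neg pos = rfl
    cases 0F pos neg neg = rfl
    cases 0F neg pos pos = rfl
    cases 0F neg pos neg = rfl
    cases 0F neg neg pos = rfl
    cases 0F neg neg neg = rfl
    cases 1F pos pos pos = rfl
    cases 1F pos pos neg = rfl
    cases 1F pos neg pos = rfl
    cases 1F pos neg neg = rfl
    cases 1F neg pos pos = rfl
    cases 1F neg pos neg = rfl
    cases 1F neg neg pos = rfl
    cases 1F neg neg neg = rfl

  DividesAll : ℕ -> Set
  DividesAll q = ∀ γ -> Divides q (X γ)

  all-from-short : ∀ {q} -> (∀ s t -> Divides q (X (short s t))) -> DividesAll q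
  all-from-short d (short s t) = d s t
  all-from-short d (long i s) = long-from-short d i s

  all-from-one : ∀ {q} γ -> Divides q (X γ) -> DividesAll q
  all-from-one {q} (long i s) d = all-from-short \ a b -> divides-weaken {q} {X (short a b)} 1 (divides-weaken {q N.* 1} {X (short a b)} 1 (short-from-cartan i s a b (divides-cartan {q} {1}
   (long i s) d (divides-1 _)) (divides-1 _)))
  all-from-one {q} (short s t) d = all-from-short \ a b -> turn2 a t b (turn1 s t a d)
   where
   turn : ∀ {α β δ} -> α ⊞ β ≈ δ -> chainLength α β ≡ 0 -> Divides q (X α) -> Divides q (X δ)
   turn {α} {β} {δ} p c a = divides-weaken {q} {X δ} 1 (divides-unit {q N.* 1} {N α β δ} {X δ} (N-unit {α} {β} p c) (divides-bracket {q} {1} {X α} {X β} (bracket-sum p) a (divides-1 (X β))))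
   turn1 : ∀ s t s' -> Divides q (X (short s t)) -> Divides q (X (short s' t))
   turn1 pos t pos d = d
   turn1 neg t neg d = d
   turn1 pos pos neg d = turn {short pos pos} {long 0F neg} ⟨ rfl , rfl ⟩ rfl d
   turn1 pos neg neg d = turn {short pos neg} {long 0F neg} ⟨ rfl , rfl ⟩ rfl d
   turn1 neg pos pos d = turn {short neg pos} {long 0F pos} ⟨ rfl , rfl ⟩ rfl d
   turn1 neg neg pos d = turn {short neg neg} {long 0F pos} ⟨ rfl , rfl ⟩ rfl d
   turn2 : ∀ s t t' -> Divides q (X (short s t)) -> Divides q (X (short s t'))
   turn2 s pos pos d = d
   turn2 s neg neg d = d
   turn2 pos pos neg d = turn {short pos pos} {long 1F neg} ⟨ rfl , rfl ⟩ rfl d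
   turn2 neg pos neg d = turn {short neg pos} {long 1F neg} ⟨ rfl , rfl ⟩ rfl d
   turn2 pos neg pos d = turn {short pos neg} {long 1F pos} ⟨ rfl , rfl ⟩ rfl d
   turn2 neg neg pos d = turn {short neg neg} {long 1F pos} ⟨ rfl , rfl ⟩ rfl d

  square : ∀ {q} -> DividesAll q -> DividesAll (q N.* q)
  square {q} d = all-from-short \ s t -> divides-weaken {q N.* q} {X (short s t)} q (short-from-cartan 0F pos s t (divides-cartan (long 0F pos) (d (long 0F pos)) (d (-ᴿ long 0F pos))) (d
   (short s t)))

  unbounded : ∀ {q} -> 2 N.≤ q -> DividesAll q -> ∀ k -> ∃[ r ] k N.< r × DividesAll r
  unbounded {q} 2≤q d k = let (r , k<r , _ , e) = powers k in r , k<r , e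
   where
   powers : ∀ k -> ∃[ r ] k N.< r × 2 N.≤ r × DividesAll r
   powers zero = q , N.≤-trans (s≤s z≤n) 2≤q , 2≤q , d
   powers (suc k) with powers k
   ... | r , k<r , 2≤r , e = r N.* r , k+1<rr , N.≤-trans 2≤r (N.m≤m*n r r {{N.>-nonZero (N.≤-trans (s≤s z≤n) 2≤r)}}) , square e
    where
    k+1<rr : suc k N.< r N.* r
    k+1<rr = N.≤-trans (s≤s k<r) (N.≤-trans (N.+-monoˡ-≤ r (N.≤-trans (s≤s z≤n) 2≤r)) (N.≤-trans (N.≤-reflexive (cong (r N.+_) (J.sym (N.+-identityʳ r)))) (N.*-monoˡ-≤ r 2≤r)))

  X-zero : ∀ γ {q} -> 2 N.≤ q -> Divides q (X γ) -> X γ ≈ 0#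
  X-zero γ {q} 2≤q d i j with X γ i j O.≟ + 0
  ... | yes p = p
  ... | no ¬p with unbounded 2≤q (all-from-one γ d) O.∣ X γ i j ∣
  ... | r , k<r , e = contradiction k<r (N.≤⇒≯ (N.≤-trans (N.m≤m*n r O.∣ Divides.quotient (e γ) i j ∣ {{N.≢-nonZero nz}}) (N.≤-reflexive (J.sym abs-eq))))
   where
   abs-eq : O.∣ X γ i j ∣ ≡ r N.* O.∣ Divides.quotient (e γ) i j ∣
   abs-eq = cong O.∣_∣ (Divides.multiple (e γ) i j) ⟫ O.∣i*j∣≡∣i∣*∣j∣ (+ r) (Divides.quotient (e γ) i j)
   nz : O.∣ Divides.quotient (e γ) i j ∣ ≢ 0
   nz z = ¬p (O.∣i∣≡0⇒i≡0 (abs-eq ⟫ cong (r N.*_) z ⟫ N.*-zeroʳ r))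

 X≉0 : ∀ γ -> ¬ (X γ ≈ 0#)
 X≉0 γ p = contradiction (J.sym (indicator-self γ) ⟫ snd (faithful (\ _ -> + 0) (indicator γ) vanish) γ) \ ()
  where
  term : ∀ δ i j -> indicator γ δ O.* X δ i j ≡ + 0
  term δ i j with γ ≟R δ
  ... | yes rfl = O.*-identityˡ _ ⟫ p i j
  ... | no _ = rfl
  vanish : ∀ i j -> sumZ (\ k -> + 0 O.* H k i j) O.+ sumZ (\ k -> indicator γ (roots k) O.* X (roots k) i j) ≡ + 0
  vanish i j = cong₂ O._+_ ((ℤT.sumZ-cong \ k -> O.*-zeroˡ (H k i j)) ⟫ ℤT.sumZ-replicate-zero 2) ((ℤT.sumZ-cong \ k -> term (roots k) i j) ⟫ ℤT.sumZ-replicate-zero 8)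

 -- The root vectors are primitive: a common divisor of one of them divides the
 -- whole Lie algebra, and then so do its powers.
 abstract
  X-primitive : ∀ γ -> Σ (Mat n) \ Λ -> ℤT.⟪ Λ , X γ ⟫Z ≡ + 1
  X-primitive γ with matrix-bezout (X γ)
  ... | 1 , (Λ , eq) , _ = Λ , eq
  ... | zero , _ , mult = contradiction (\ i j -> let (z , e) = mult i j in J.trans e (O.*-zeroʳ z)) (X≉0 γ)
  ... | suc (suc g) , _ , mult = contradiction (X-zero γ {suc (suc g)} (s≤s (s≤s z≤n)) (by (\ i j -> fst (mult i j)) \ i j -> J.trans (snd (mult i j)) (O.*-comm (fst (mult i j)) (+ suc
   (suc g))))) (X≉0 γ)

module Coordinates {c ℓ} {K : CommutativeRing c ℓ} (isℚ : IsℚAlgebra K) {n} (π : Representation n) where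
 open Brackets π
 open Primitivity π using (X-primitive)
 open I
 open ℤT
 open LaurentMatrices using (select)

 q-root b-root : Root
 q-root = long 0F pos
 b-root = long 1F pos

 module Gq = WeightGrading (TorusProjections.grading isℚ π q-root)
 module Gb = WeightGrading (TorusProjections.grading isℚ π b-root)

 private
  -- the transpose of WeightGrading.graded under the trace form
  module Transpose {H : Mat n} (G : WeightGrading H) where
   open WeightGrading G
   gradedᵗ : ℤ -> Mat n -> Mat n
   gradedᵗ k Λ = sum {n} {size} \ d -> sum {n} {size} \ e -> P (# e) * (select (+ # d O.≟ + # e O.+ k) Λ * P (# d))

   tr-sum : ∀ {m} Λ (v : Fin m -> Mat n) -> ⟪ Λ , sum v ⟫Z ≡ sumZ (\ i -> ⟪ Λ , v i ⟫Z)
   tr-sum {zero} Λ v = ⟪⟫Z-0 Λ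
   tr-sum {suc m} Λ v = ⟪⟫Z-+ Λ (v 0F) (sum (v ∘ F.suc)) ⟫ cong (\ z -> ⟪ Λ , v 0F ⟫Z O.+ z) (tr-sum Λ (v ∘ F.suc))

   swap : ∀ (Λ N : Mat n) -> ⟪ Λ , N ⟫Z ≡ ⟪ N , Λ ⟫Z
   swap Λ N = trZ-comm Λ N

   tr-suml : ∀ {m} (v : Fin m -> Mat n) N -> ⟪ sum v , N ⟫Z ≡ sumZ (\ i -> ⟪ v i , N ⟫Z)
   tr-suml v N = swap (sum v) N ⟫ tr-sum N v ⟫ (sumZ-cong \ i -> swap N (v i))

   gradedᵗ-adjoint : ∀ k Λ N -> ⟪ gradedᵗ k Λ , N ⟫Z ≡ ⟪ Λ , graded k N ⟫Z
   gradedᵗ-adjoint k Λ N = tr-suml {size} (\ d -> sum {n} {size} \ e -> left d e) N ⟫ (sumZ-cong {size} \ d -> J.trans (tr-suml {size} (left d) N) ((sumZ-cong {size} \ e -> term d e (+ # d O.≟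
    + # e O.+ k)) ⟫ J.sym (tr-sum {size} Λ (right d)))) ⟫ J.sym (tr-sum {size} Λ (\ d -> sum {n} {size} \ e -> right d e))
    where
    left right : Fin size -> Fin size -> Mat n
    left d e = P (# e) * (select (+ # d O.≟ + # e O.+ k) Λ * P (# d))
    right d e = P (# d) * (select (+ # d O.≟ + # e O.+ k) N * P (# e))
    term : ∀ d e (dec : Dec (+ # d ≡ + # e O.+ k)) -> ⟪ P (# e) * (select dec Λ * P (# d)) , N ⟫Z ≡ ⟪ Λ , P (# d) * (select dec N * P (# e)) ⟫Z
    term d e (yes _) = let A = P (# e) ; B = P (# d) in
     J.trans (⟪⟫Z-assoc (solve [] (A :: Λ :: B :: N :: []) ((m0 :* (m1 :* m2)) :* m3) (m0 :* (m1 :* m2 :* m3))))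
     (J.trans (trZ-comm A (Λ * B * N))
     (⟪⟫Z-assoc (solve [] (A :: Λ :: B :: N :: []) ((m1 :* m2 :* m3) :* m0) (m1 :* (m2 :* (m3 :* m0))))))
     where
     ⟪⟫Z-assoc : ∀ {A B : Mat n} -> A ≈ B -> trZ A ≡ trZ B
     ⟪⟫Z-assoc p = sumZ-cong \ i -> p i i
    term d e (no _) = swap (P (# e) * (0# * P (# d))) N ⟫ ⟪⟫Z-cong N (solve [] (P (# e) :: P (# d) :: []) (m0 :* (:0 :* m1)) :0) ⟫ ⟪⟫Z-0 N ⟫ J.sym (⟪⟫Z-cong Λ (solve [] (P (# d) :: P
     (# e) :: []) (m0 :* (:0 :* m1)) :0) ⟫ ⟪⟫Z-0 Λ)

  module Tq = Transpose (TorusProjections.grading isℚ π q-root)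
  module Tb = Transpose (TorusProjections.grading isℚ π b-root)

 private
  weight : Root -> Basis -> ℤ
  weight β (root δ) = hval β δ
  weight β (cartan δ) = + 0

  basis-eigen : ∀ β b -> H[ β ] * ⟦ b ⟧b ≈ ⟦ b ⟧b * H[ β ] + weight β b ·ᴹ ⟦ b ⟧b
  basis-eigen β (root δ) = bracket-cartan β δ
  basis-eigen β (cartan δ) = trans (cartan-commute β δ) (solve [] (H[ δ ] :: H[ β ] :: []) (m0 :* m1) (m0 :* m1 :+ 0: :% m0))

  weights-separate : ∀ γ b -> hval q-root γ ≡ weight q-root b -> hval b-root γ ≡ weight b-root b -> b ≡ root γ
  weights-separate γ (root δ) p q = cong root (J.sym (separate γ δ (J.sym (hval≡ q-root γ) ⟫ p ⟫ hval≡ q-root δ) (J.sym (hval≡ b-root γ) ⟫ q ⟫ hval≡ b-root δ)))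
   where
   separate : ∀ γ δ -> pairing q-root γ ≡ pairing q-root δ -> pairing b-root γ ≡ pairing b-root δ -> γ ≡ δ
   separate = toWitness {a? = all-roots? \ γ -> all-roots? \ δ -> (pairing q-root γ O.≟ pairing q-root δ) →-dec ((pairing b-root γ O.≟ pairing b-root δ) →-dec (γ ≟R δ))} tt
  weights-separate γ (cartan δ) p q = contradiction (J.sym (hval≡ b-root γ) ⟫ q) (nonzero γ (J.sym (hval≡ q-root γ) ⟫ p))
   where
   nonzero : ∀ γ -> pairing q-root γ ≡ + 0 -> ¬ (pairing b-root γ ≡ + 0)
   nonzero = toWitness {a? = all-roots? \ γ -> (pairing q-root γ O.≟ + 0) →-dec ¬? (pairing b-root γ O.≟ + 0)} tt

  graded-zero : ∀ {H : Mat n} (G : WeightGrading H) k {A} -> A ≈ 0# -> WeightGrading.graded G k A ≈ 0#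
  graded-zero {H} G k {A} p = trans (sum-cong-≋ {n} {size} \ d -> sum-cong-≋ {n} {size} \ e -> congl (P (# d)) (congr (P (# e)) (select-cong (+ # d O.≟ + # e O.+ k)))) (graded-other
   {0#} {k} {k O.+ + 1} (solve (k O.+ + 1 :: []) (H :: []) (m0 :* :0) (:0 :* m0 :+ s0 :% :0)) \ eq -> contradiction (ℤs.+-cancelˡ k (+ 0) (+ 1) (O.+-identityʳ k ⟫ eq)) \ ())
   where
   open WeightGrading G
   select-cong : ∀ {P : Set} (d : Dec P) -> select d A ≈ select d 0#
   select-cong (yes _) = p
   select-cong (no _) = refl

  graded-cong : ∀ {H : Mat n} (G : WeightGrading H) k {A B} -> A ≈ B -> WeightGrading.graded G k A ≈ WeightGrading.graded G k B
  graded-cong G k {A} {B} p = sum-cong-≋ {n} {size} \ d -> sum-cong-≋ {n} {size} \ e -> congl (P (# d)) (congr (P (# e)) (select-cong (+ # d O.≟ + # e O.+ k)))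
   where
   open WeightGrading G
   select-cong : ∀ {P : Set} (d : Dec P) -> select d A ≈ select d B
   select-cong (yes _) = p
   select-cong (no _) = refl

 -- φ γ reads off the coefficient of X γ, κ γ the value of γ on the Cartan part.
 abstract
  φ κ : Root -> Mat n
  φ γ = Tb.gradedᵗ (hval b-root γ) (Tq.gradedᵗ (hval q-root γ) (fst (X-primitive γ)))
  κ γ = X γ * φ γ + - (φ γ * X γ)

  φ-graded : ∀ γ N -> ⟪ φ γ , N ⟫Z ≡ ⟪ fst (X-primitive γ) , Gq.graded (hval q-root γ) (Gb.graded (hval b-root γ) N) ⟫Z
  φ-graded γ N = Tb.gradedᵗ-adjoint (hval b-root γ) (Tq.gradedᵗ (hval q-root γ) (fst (X-primitive γ))) N ⟫ Tq.gradedᵗ-adjoint (hval q-root γ) (fst (X-primitive γ)) (Gb.graded (hval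
   b-root γ) N)

  κ-expand : ∀ γ N -> ⟪ κ γ , N ⟫Z ≡ ⟪ φ γ , N * X γ ⟫Z O.- ⟪ φ γ , X γ * N ⟫Z
  κ-expand γ N = (sumZ-cong \ i -> solve [] (X γ :: φ γ :: N :: []) ((m0 :* m1 :+ :- (m1 :* m0)) :* m2) (m0 :* (m1 :* m2) :+ (:- :1) :* (m1 :* (m0 :* m2))) i i) ⟫ ∑Z-distrib-+ (\ i -> (X γ * (φ γ
   * N)) i i) (\ i -> ((- 1#) * (φ γ * (X γ * N))) i i) ⟫ cong₂ O._+_ (trZ-comm (X γ) (φ γ * N) ⟫ (sumZ-cong \ i -> *-assoc (φ γ) N (X γ) i i)) ((sumZ-cong \ i -> J.trans (-1*x≈-x (φ γ * (X γ *
   N)) i i) (J.sym (O.-1*i≡-i _))) ⟫ J.sym (*-distribl-sumZ -[1+ 0 ] (\ i -> (φ γ * (X γ * N)) i i)) ⟫ O.-1*i≡-i _)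

 φ-basis : ∀ γ b -> ⟪ φ γ , ⟦ b ⟧b ⟫Z ≡ rootCoeff γ b
 φ-basis γ b = φ-graded γ ⟦ b ⟧b ⟫ cases (hval q-root γ O.≟ weight q-root b) (hval b-root γ O.≟ weight b-root b)
  where
  Λ = fst (X-primitive γ)
  inner = Gb.graded (hval b-root γ) ⟦ b ⟧b

  off-diagonal : b ≢ root γ -> rootCoeff γ b ≡ + 0
  off-diagonal = off b
   where
   off : ∀ b -> b ≢ root γ -> rootCoeff γ b ≡ + 0
   off (root δ) p = indicator-≢ {γ} {δ} \ { rfl -> p rfl }
   off (cartan δ) p = rfl

  cases : Dec (hval q-root γ ≡ weight q-root b) -> Dec (hval b-root γ ≡ weight b-root b) -> ⟪ Λ , Gq.graded (hval q-root γ) inner ⟫Z ≡ rootCoeff γ b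
  cases _ (no ¬p) = J.trans (⟪⟫Z-cong Λ (graded-zero (TorusProjections.grading isℚ π q-root) (hval q-root γ)
   (Gb.graded-other {⟦ b ⟧b} {hval b-root γ} {weight b-root b} (basis-eigen b-root b) ¬p)))
   (J.trans (⟪⟫Z-0 Λ) (J.sym (off-diagonal \ { rfl -> ¬p rfl })))
  cases (no ¬p) (yes q) = J.trans (⟪⟫Z-cong Λ (trans
   (graded-cong (TorusProjections.grading isℚ π q-root) (hval q-root γ) inner≈)
   (Gq.graded-other {⟦ b ⟧b} {hval q-root γ} {weight q-root b} (basis-eigen q-root b) ¬p)))
   (J.trans (⟪⟫Z-0 Λ) (J.sym (off-diagonal \ { rfl -> ¬p rfl })))
   where
   inner≈ : inner ≈ ⟦ b ⟧b
   inner≈ = trans (reflexive (cong (\ k -> Gb.graded k ⟦ b ⟧b) q)) (Gb.graded-same {⟦ b ⟧b} {weight b-root b} (basis-eigen b-root b))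
  cases (yes p) (yes q) with weights-separate γ b p q
  ... | rfl = ⟪⟫Z-cong Λ (trans (graded-cong (TorusProjections.grading isℚ π q-root) (hval q-root γ) (Gb.graded-same {X γ} {hval b-root γ} (bracket-cartan b-root γ))) (Gq.graded-same {X γ}
   {hval q-root γ} (bracket-cartan q-root γ))) ⟫ snd (X-primitive γ) ⟫ J.sym (indicator-self γ)

 κ-basis : ∀ γ b -> ⟪ κ γ , ⟦ b ⟧b ⟫Z ≡ cartanValue γ b
 κ-basis γ b = κ-expand γ ⟦ b ⟧b ⟫ cong (\ z -> ⟪ φ γ , ⟦ b ⟧b * X γ ⟫Z O.- z) (⟪⟫Z-cong (φ γ) (ad-sound γ b) ⟫ ⟪⟫Z-+ (φ γ) (⟦ b ⟧b * X γ) ⟦ ad γ b ⟧ᵗ) ⟫ ℤs.solves (⟪ φ γ , ⟦ b ⟧b * X γ ⟫Z ::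
  ⟪ φ γ , ⟦ ad γ b ⟧ᵗ ⟫Z :: []) (s0 -: (s0 +: s1)) (-: s1) ⟫ cong O.-_ (⟪⟫Z-· (φ γ) (fst (ad γ b)) ⟦ snd (ad γ b) ⟧b ⟫ cong (fst (ad γ b) O.*_) (φ-basis γ (snd (ad γ b))) ⟫
  rootCoeff-ad-self γ b) ⟫ O.neg-involutive (cartanValue γ b)

-- Conjugation by root elements in coordinates

module RootConjugation {c ℓ} (R : CommutativeRing c ℓ) {n} (π : Representation n) where
 open RootSubgroups R π
 open Primitivity π using (N-two)
 open M
 open Matrices R using (ι)

 XR : Root -> Mat n
 XR γ = ιM (X γ)

 conj-fixed : ∀ {β δ} -> δ ≢ -ᴿ β -> (∀ ε -> ¬ (β ⊞ δ ≈ ε)) -> ∀ t -> Conj (x β t) (XR δ) (XR δ)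
 conj-fixed {β} {δ} p q t = exp-commutator (X-divided β) {X δ} {I.0#} {I.0#} (bracket-zero p q I.& I.sym (I.+-identityʳ (X δ I.* X β))) (I.solve [] (X β :: []) (m0 :* :0) (:0 :* m0 :+ (:0 :+
  :0))) (I.solve [] (X β :: []) (m0 :* :0) (:0 :* m0)) t & congr (x β t) (+-cong (+-congˡ {x = XR δ} (%-cong S.refl ιM-0)) (%-cong S.refl ιM-0) & solve (t :: []) (XR δ :: []) (m0 :+ s0 :% :0 :+
  (s0 *: s0) :% :0) (m0))

 conj-step : ∀ {β δ ε} -> β ⊞ δ ≈ ε -> (∀ ζ -> ¬ (β ⊞ ε ≈ ζ)) -> ∀ t -> Conj (x β t) (XR δ) (XR δ + (t S.* ι (N β δ ε)) ⊙ XR ε)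
 conj-step {β} {δ} {ε} p q t = exp-commutator (X-divided β) {X δ} {N β δ ε I.·ᴹ X ε} {I.0#} (bracket-sum p) (I.solve (N β δ ε :: []) (X β :: X ε :: []) (m0 :* (s0 :% m1)) (s0 :% (m0 :* m1)) I.&
  I.%-cong {r = N β δ ε} rfl (bracket-zero (sum-not-opposite {β} {δ} p) q) I.& I.solve (N β δ ε :: []) (X β :: X ε :: []) (s0 :% (m1 :* m0)) ((s0 :% m1) :* m0 :+ (:0 :+ :0))) (I.solve [] (X β ::
  []) (m0 :* :0) (:0 :* m0)) t & congr (x β t) (+-cong (+-congˡ {x = XR δ} (%-cong S.refl (ιM-· (N β δ ε) (X ε)))) (%-cong S.refl ιM-0) & solve (t :: ι (N β δ ε) :: []) (XR δ :: XR ε :: []) (m0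
  :+ s0 :% s1 :% m1 :+ (s0 *: s0) :% :0) (m0 :+ (s0 *: s1) :% m1))

-- half the product of the structure constants of a string δ, β + δ, 2β + δ
module DoubleStrings {n} (π : Representation n) where
 open Brackets π
 open Primitivity π

 module _ {β δ ε ζ} (p : β ⊞ δ ≈ ε) (q : β ⊞ ε ≈ ζ) where
  private
   two = N-two q (J.sym (stringLength≡ β ε) ⟫ double-string {β} {δ} {ε} {ζ} p q)

  halfN : ℤ
  halfN = N β δ ε O.* fst two

  halfN-double : N β δ ε O.* N β ε ζ ≡ halfN O.+ halfN
  halfN-double = cong (N β δ ε O.*_) (snd (snd two)) ⟫ ℤs.solves (N β δ ε :: fst two :: []) (s0 *: (s1 *: (1: +: 1:))) (s0 *: s1 +: s0 *: s1)

  halfN-unit : chainLength β δ ≡ 0 -> halfN O.* halfN ≡ + 1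
  halfN-unit r = ℤs.solves (N β δ ε :: fst two :: []) (s0 *: s1 *: (s0 *: s1)) ((s0 *: s0) *: (s1 *: s1)) ⟫ cong₂ O._*_ (N-unit p r) (fst (snd two))

module RootConjugation2 {c ℓ} (R : CommutativeRing c ℓ) {n} (π : Representation n) where
 open RootSubgroups R π
 open RootConjugation R π
 open DoubleStrings π
 open M
 open Matrices R using (ι)

 conj-two-steps : ∀ {β δ ε ζ} (p : β ⊞ δ ≈ ε) (q : β ⊞ ε ≈ ζ) -> ∀ t -> Conj (x β t) (XR δ) (XR δ + (t S.* ι (N β δ ε)) ⊙ XR ε + (t S.* t S.* ι (halfN p q)) ⊙ XR ζ)
 conj-two-steps {β} {δ} {ε} {ζ} p q t = exp-commutator (X-divided β) {X δ} {N β δ ε I.·ᴹ X ε} {halfN p q I.·ᴹ X ζ} (bracket-sum p) (I.solve (N β δ ε :: []) (X β :: X ε :: []) (m0 :* (s0 :% m1))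
  (s0 :% (m0 :* m1)) I.& I.%-cong {r = N β δ ε} rfl (bracket-sum q) I.& I.solve (N β δ ε :: N β ε ζ :: []) (X β :: X ε :: X ζ :: []) (s0 :% (m1 :* m0 :+ s1 :% m2)) ((s0 :% m1) :* m0 :+ (s0 *: s1)
  :% m2) I.& I.+-congˡ {x = (N β δ ε I.·ᴹ X ε) I.* X β} (I.%-cong {x = X ζ} (halfN-double p q) I.refl I.& I.%-distribr (halfN p q) (halfN p q) (X ζ))) (I.solve (halfN p q :: []) (X β :: X ζ ::
  []) (m0 :* (s0 :% m1)) (s0 :% (m0 :* m1)) I.& I.%-cong {r = halfN p q} rfl (bracket-zero (sum-not-opposite {β} {ε} q) \ η -> no-triple-string {β} {δ} {ε} {ζ} {η} p q) I.& I.solve (halfN p q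
  :: []) (X β :: X ζ :: []) (s0 :% (m1 :* m0)) ((s0 :% m1) :* m0)) t & congr (x β t) (+-cong (+-congˡ {x = XR δ} (%-cong S.refl (ιM-· (N β δ ε) (X ε)))) (%-cong S.refl (ιM-· (halfN p q) (X ζ)))
  & solve (t :: ι (N β δ ε) :: ι (halfN p q) :: []) (XR δ :: XR ε :: XR ζ :: []) (m0 :+ s0 :% s1 :% m1 :+ (s0 *: s0) :% s2 :% m2) (m0 :+ (s0 *: s1) :% m1 :+ (s0 *: s0 *: s2) :% m2))

-- The elements of the R-span of the Lie algebra, and the effect of conjugation by
-- a root element on the functionals.
module LieSpan {c ℓ} (R : CommutativeRing c ℓ) {n} (π : Representation n) where
 open RootSubgroups R π
 open Trace R
 open M
 open Matrices R using (ι)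

 data Lie : Mat n -> Set (c ⊔ ℓ) where
  basis : ∀ b -> Lie (ιM ⟦ b ⟧b)
  _⊹_ : ∀ {A B} -> Lie A -> Lie B -> Lie (A + B)
  _⊛_ : ∀ r {A} -> Lie A -> Lie (r ⊙ A)
  resp : ∀ {A B} -> A ≈ B -> Lie A -> Lie B

 Represents : I.Mat n -> (Basis -> ℤ) -> Set
 Represents Λ f = ∀ b -> ℤT.⟪ Λ , ⟦ b ⟧b ⟫Z ≡ f b

 term-value : ∀ {Λ f} -> Represents Λ f -> ∀ t -> ⟪ Λ , ιM ⟦ t ⟧ᵗ ⟫ S.≈ ι (scaled f t)
 term-value {Λ} {f} rep (k , b) = ⟪⟫-ι R Λ (k I.·ᴹ ⟦ b ⟧b) S.& ι-cong (ℤT.⟪⟫Z-· Λ k ⟦ b ⟧b ⟫ cong (k O.*_) (rep b))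

 conjugate : Root -> S.Carrier -> Mat n -> Mat n
 conjugate β t A = x β t * (A * x β (S.- t))

 conj⇒conjugate : ∀ {β t A B} -> Conj (x β t) A B -> conjugate β t A ≈ B
 conj⇒conjugate {β} {t} {A} {B} p = trans (sym (*-assoc (x β t) A (x β (S.- t)))) (trans (congr (x β (S.- t)) p) (trans (*-assoc B (x β t) (x β (S.- t))) (trans (congl B (x-inverse β
  (S.-‿inverseʳ t))) (*-identityʳ B))))

 conjugate-cong : ∀ β t {A B} -> A ≈ B -> conjugate β t A ≈ conjugate β t B
 conjugate-cong β t p = congl (x β t) (congr (x β (S.- t)) p)

 conjugate-+ : ∀ β t A B -> conjugate β t (A + B) ≈ conjugate β t A + conjugate β t B
 conjugate-+ β t A B = solve [] (x β t :: x β (S.- t) :: A :: B :: []) (m0 :* ((m2 :+ m3) :* m1)) (m0 :* (m2 :* m1) :+ m0 :* (m3 :* m1))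

 conjugate-% : ∀ β t r A -> conjugate β t (r ⊙ A) ≈ r ⊙ conjugate β t A
 conjugate-% β t r A = solve (r :: []) (x β t :: x β (S.- t) :: A :: []) (m0 :* ((s0 :% m2) :* m1)) (s0 :% (m0 :* (m2 :* m1)))

 Lie-conjugate : ∀ β t {A} -> Lie A -> Lie (conjugate β t A)
 Lie-conjugate β t (basis b) = resp (sym (conj⇒conjugate {β} {t} {ιM ⟦ b ⟧b} (x-conj-basis β b t))) ((basis b ⊹ (t ⊛ Lie-term (ad β b))) ⊹ ((t S.* t) ⊛ Lie-term (fst (ad2 β b))))
  where
  Lie-term : ∀ s -> Lie (ιM ⟦ s ⟧ᵗ)
  Lie-term (k , b) = resp (sym (ιM-· k ⟦ b ⟧b)) (ι k ⊛ basis b)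
 Lie-conjugate β t (_⊹_ {A} {B} p q) = resp (sym (conjugate-+ β t A B)) (Lie-conjugate β t p ⊹ Lie-conjugate β t q)
 Lie-conjugate β t (_⊛_ r {A} p) = resp (sym (conjugate-% β t r A)) (r ⊛ Lie-conjugate β t p)
 Lie-conjugate β t (resp p q) = resp (conjugate-cong β t p) (Lie-conjugate β t q)

 row : ∀ {Λ Λ1 Λ2 f g k} β -> Represents Λ f -> Represents Λ1 g -> Represents Λ2 k -> (∀ b -> scaled f (ad β b) ≡ g b) -> (∀ b -> scaled g (ad β b) ≡ k b O.+ k b) -> ∀ t {A} -> Lie A -> ⟪ Λ ,
  conjugate β t A ⟫ S.≈ ⟪ Λ , A ⟫ S.+ t S.* ⟪ Λ1 , A ⟫ S.+ t S.* t S.* ⟪ Λ2 , A ⟫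
 row {Λ} {Λ1} {Λ2} {f} {g} {k} β rep rep1 rep2 first second t = induct
  where
  open Reasoning S.setoid
  RHS : Mat n -> S.Carrier
  RHS A = ⟪ Λ , A ⟫ S.+ t S.* ⟪ Λ1 , A ⟫ S.+ t S.* t S.* ⟪ Λ2 , A ⟫
  second-value : ∀ b -> scaled f (fst (ad2 β b)) ≡ k b
  second-value b = O.*-cancelˡ-≡ (+ 2) _ _ (double (scaled f t2) ⟫ J.sym (halves f) ⟫ cong (fst (ad β b) O.*_) (first (snd (ad β b))) ⟫ second b ⟫ J.sym (double (k b)))
   where
   t2 = fst (ad2 β b)
   halves = snd (snd (snd (ad2 β b)))
   double : ∀ z -> + 2 O.* z ≡ z O.+ z
   double z = ℤs.solves (z :: []) ((1: +: 1:) *: s0) (s0 +: s0)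
  induct : ∀ {A} -> Lie A -> ⟪ Λ , conjugate β t A ⟫ S.≈ RHS A
  induct (basis b) = begin
   ⟪ Λ , conjugate β t B ⟫
   ≈⟨ ⟪⟫-cong Λ (conj⇒conjugate {β} {t} {B} (x-conj-basis β b t)) ⟩
   ⟪ Λ , B + t ⊙ ιM ⟦ ad β b ⟧ᵗ + (t S.* t) ⊙ ιM ⟦ fst (ad2 β b) ⟧ᵗ ⟫
   ≈⟨ S.trans (⟪⟫-+ Λ (B + t ⊙ ιM ⟦ ad β b ⟧ᵗ) _) (S.+-cong (S.trans (⟪⟫-+ Λ B _) (S.+-congˡ (⟪⟫-% Λ t _))) (⟪⟫-% Λ (t S.* t) _)) ⟩
   ⟪ Λ , B ⟫ S.+ t S.* ⟪ Λ , ιM ⟦ ad β b ⟧ᵗ ⟫ S.+ t S.* t S.* ⟪ Λ , ιM ⟦ fst (ad2 β b) ⟧ᵗ ⟫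
   ≈⟨ S.+-cong (S.+-congˡ (S.*-congˡ (same {Λ1} rep1 (ad β b) b (first b)))) (S.*-congˡ (same {Λ2} rep2 (fst (ad2 β b)) b (second-value b))) ⟩
   RHS B ∎
   where
   B = ιM ⟦ b ⟧b
   same : ∀ {Λ' f'} -> Represents Λ' f' -> ∀ s b -> scaled f s ≡ f' b -> ⟪ Λ , ιM ⟦ s ⟧ᵗ ⟫ S.≈ ⟪ Λ' , ιM ⟦ b ⟧b ⟫
   same {Λ'} rep' s b eq = term-value {Λ} {f} rep s S.& ι-cong (eq ⟫ J.sym (rep' b)) S.& S.sym (⟪⟫-ι R Λ' ⟦ b ⟧b)
  induct (_⊹_ {A} {B} p q) = begin
   ⟪ Λ , conjugate β t (A + B) ⟫
   ≈⟨ S.trans (⟪⟫-cong Λ (conjugate-+ β t A B)) (S.trans (⟪⟫-+ Λ _ _) (S.+-cong (induct p) (induct q))) ⟩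
   RHS A S.+ RHS B
   ≈⟨ solves (⟪ Λ , A ⟫ :: ⟪ Λ , B ⟫ :: ⟪ Λ1 , A ⟫ :: ⟪ Λ1 , B ⟫ :: ⟪ Λ2 , A ⟫ :: ⟪ Λ2 , B ⟫ :: t :: [])
   ((s0 +: s6 *: s2 +: s6 *: s6 *: s4) +: (s1 +: s6 *: s3 +: s6 *: s6 *: s5))
   ((s0 +: s1) +: s6 *: (s2 +: s3) +: s6 *: s6 *: (s4 +: s5)) ⟩
   (⟪ Λ , A ⟫ S.+ ⟪ Λ , B ⟫) S.+ t S.* (⟪ Λ1 , A ⟫ S.+ ⟪ Λ1 , B ⟫) S.+ t S.* t S.* (⟪ Λ2 , A ⟫ S.+ ⟪ Λ2 , B ⟫)
   ≈⟨ S.+-cong (S.+-cong (⟪⟫-+ Λ A B) (S.*-congˡ (⟪⟫-+ Λ1 A B))) (S.*-congˡ (⟪⟫-+ Λ2 A B)) ⟨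
   RHS (A + B) ∎
  induct (_⊛_ r {A} p) = begin
   ⟪ Λ , conjugate β t (r ⊙ A) ⟫
   ≈⟨ S.trans (⟪⟫-cong Λ (conjugate-% β t r A)) (S.trans (⟪⟫-% Λ r _) (S.*-congˡ (induct p))) ⟩
   r S.* RHS A
   ≈⟨ solves (⟪ Λ , A ⟫ :: ⟪ Λ1 , A ⟫ :: ⟪ Λ2 , A ⟫ :: t :: r :: [])
   (s4 *: (s0 +: s3 *: s1 +: s3 *: s3 *: s2))
   (s4 *: s0 +: s3 *: (s4 *: s1) +: s3 *: s3 *: (s4 *: s2)) ⟩
   r S.* ⟪ Λ , A ⟫ S.+ t S.* (r S.* ⟪ Λ1 , A ⟫) S.+ t S.* t S.* (r S.* ⟪ Λ2 , A ⟫)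
   ≈⟨ S.+-cong (S.+-cong (⟪⟫-% Λ r A) (S.*-congˡ (⟪⟫-% Λ1 r A))) (S.*-congˡ (⟪⟫-% Λ2 r A)) ⟨
   RHS (r ⊙ A) ∎
  induct (resp {A} {B} p q) = ⟪⟫-cong Λ (conjugate-cong β t (sym p)) S.& induct q S.& S.+-cong (S.+-cong (⟪⟫-cong Λ p) (S.*-congˡ (⟪⟫-cong Λ1 p))) (S.*-congˡ (⟪⟫-cong Λ2 p))

-- A matrix over R is Lie-like if it satisfies the integral linear equations of the
-- Lie algebra.
module LieLikeMatrices {c ℓ} (R : CommutativeRing c ℓ) {n} (π : Representation n) where
 open RootSubgroups R π
 open Trace R
 open LieSpan R π using (Represents; conjugate)
 open M
 private
  module Z = LieSpan ℤ-ring π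
  module ZS = RootSubgroups ℤ-ring π
  module ZT = Trace ℤ-ring
 open IntegerPoints R π

 LieLike : Mat n -> Set ℓ
 LieLike A = ∀ Λ -> (∀ b -> ℤT.⟪ Λ , ⟦ b ⟧b ⟫Z ≡ + 0) -> ⟪ Λ , A ⟫ S.≈ S.0#

 functional-≈ : ∀ (Λ Λ' : I.Mat n) -> (∀ b -> ℤT.⟪ Λ , ⟦ b ⟧b ⟫Z ≡ ℤT.⟪ Λ' , ⟦ b ⟧b ⟫Z) -> ∀ {A} -> LieLike A -> ⟪ Λ , A ⟫ S.≈ ⟪ Λ' , A ⟫
 functional-≈ Λ Λ' eq {A} lie = S.x∙y⁻¹≈ε⇒x≈y _ _ (S.+-congˡ (S.sym (S.-1*x≈-x _) S.& S.*-congʳ (S.sym (S.-‿cong ι-1)) S.& S.sym (⟪⟫-·l -[1+ 0 ] Λ' A)) S.& S.sym (⟪⟫-+l Λ (-[1+ 0 ] I.·ᴹ Λ')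
  A) S.& (lie (Λ I.+ -[1+ 0 ] I.·ᴹ Λ') \ b -> J.trans (difference b) (cong (O._- ℤT.⟪ Λ' , ⟦ b ⟧b ⟫Z) (eq b) ⟫ (O.+-inverseʳ ℤT.⟪ Λ' , ⟦ b ⟧b ⟫Z))))
  where
  difference : ∀ b -> ℤT.⟪ Λ I.+ -[1+ 0 ] I.·ᴹ Λ' , ⟦ b ⟧b ⟫Z ≡ ℤT.⟪ Λ , ⟦ b ⟧b ⟫Z O.- ℤT.⟪ Λ' , ⟦ b ⟧b ⟫Z
  difference b = ℤT.trZ-comm (Λ I.+ -[1+ 0 ] I.·ᴹ Λ') ⟦ b ⟧b ⟫ ℤT.⟪⟫Z-+ ⟦ b ⟧b Λ (-[1+ 0 ] I.·ᴹ Λ') ⟫ cong₂ O._+_ (ℤT.trZ-comm ⟦ b ⟧b Λ) (ℤT.⟪⟫Z-· ⟦ b ⟧b -[1+ 0 ] Λ' ⟫ O.-1*i≡-i _ ⟫ cong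
   O.-_ (ℤT.trZ-comm ⟦ b ⟧b Λ'))

 sandwichZ : ∀ (Λ A N B : I.Mat n) -> ℤT.⟪ B I.* (Λ I.* A) , N ⟫Z ≡ ℤT.⟪ Λ , A I.* (N I.* B) ⟫Z
 sandwichZ Λ A N B = (ℤT.sumZ-cong \ i -> I.solve [] (B :: Λ :: A :: N :: []) ((m0 :* (m1 :* m2)) :* m3) (m0 :* (m1 :* m2 :* m3)) i i) ⟫ ℤT.trZ-comm B (Λ I.* A I.* N) ⟫ (ℤT.sumZ-cong \ i ->
  I.solve [] (B :: Λ :: A :: N :: []) ((m1 :* m2 :* m3) :* m0) (m1 :* (m2 :* (m3 :* m0))) i i)

 private
  ιM-ℤ : ∀ (A : I.Mat n) -> ZS.ιM A I.≈ A
  ιM-ℤ A i j = ι-ℤ (A i j)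

  pairing-ℤ : ∀ (Λ A : I.Mat n) -> ZT.⟪ Λ , A ⟫ ≡ ℤT.⟪ Λ , A ⟫Z
  pairing-ℤ Λ A = ℤT.sumZ-cong \ i -> I.congr A (ιM-ℤ Λ) i i

 -- the case t = 1 of LieSpan.row for Lie-like matrices
 row1 : ∀ {Λ Λ1 Λ2 f g k} β -> Represents Λ f -> Represents Λ1 g -> Represents Λ2 k -> (∀ b -> scaled f (ad β b) ≡ g b) -> (∀ b -> scaled g (ad β b) ≡ k b O.+ k b) -> ∀ {A} -> LieLike A -> ⟪ Λ ,
  conjugate β S.1# A ⟫ S.≈ ⟪ Λ , A ⟫ S.+ ⟪ Λ1 , A ⟫ S.+ ⟪ Λ2 , A ⟫
 row1 {Λ} {Λ1} {Λ2} {f} {g} {k} β rep rep1 rep2 first second {A} lie = (⟪⟫-cong Λ (*-cong (sym C≈) (congl A (sym C~≈))) S.& S.sym (⟪⟫-sandwich Λ C A C~)) S.& functional-≈ (C~ I.* (Λ I.* C))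
  (Λ I.+ Λ1 I.+ Λ2) on-basis lie S.& ⟪⟫-+l (Λ I.+ Λ1) Λ2 A S.& S.+-congʳ (⟪⟫-+l Λ Λ1 A)
  where
  C C~ : I.Mat n
  C = ZS.x β (+ 1)
  C~ = ZS.x β -[1+ 0 ]
  C≈ : ιM C ≈ x β S.1#
  C≈ = trans (x-ι β (+ 1)) (x-cong β ι-1)
  C~≈ : ιM C~ ≈ x β (S.- S.1#)
  C~≈ = trans (x-ι β -[1+ 0 ]) (x-cong β (S.-‿cong ι-1))
  on-basis : ∀ b -> ℤT.⟪ C~ I.* (Λ I.* C) , ⟦ b ⟧b ⟫Z ≡ ℤT.⟪ Λ I.+ Λ1 I.+ Λ2 , ⟦ b ⟧b ⟫Z
  on-basis b = sandwichZ Λ C ⟦ b ⟧b C~ ⟫ ℤT.⟪⟫Z-cong Λ (I.congl C (I.congr C~ (I.sym (ιM-ℤ ⟦ b ⟧b)))) ⟫ J.sym (pairing-ℤ Λ (Z.conjugate β (+ 1) (ZS.ιM ⟦ b ⟧b))) ⟫ Z.row {Λ} {Λ1} {Λ2} {f} {g}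
   {k} β rep rep1 rep2 first second (+ 1) (Z.basis b) ⟫ ℤs.solves (ZT.⟪ Λ , ZS.ιM ⟦ b ⟧b ⟫ :: ZT.⟪ Λ1 , ZS.ιM ⟦ b ⟧b ⟫ :: ZT.⟪ Λ2 , ZS.ιM ⟦ b ⟧b ⟫ :: []) (s0 +: 1: *: s1 +: 1: *: 1: *: s2) (s0
   +: s1 +: s2) ⟫ cong₂ O._+_ (cong₂ O._+_ (value Λ) (value Λ1)) (value Λ2) ⟫ J.sym (swapped-+ (Λ I.+ Λ1) Λ2 ⟫ cong (O._+ ℤT.⟪ Λ2 , ⟦ b ⟧b ⟫Z) (swapped-+ Λ Λ1))
   where
   value : ∀ (Λ : I.Mat n) -> ZT.⟪ Λ , ZS.ιM ⟦ b ⟧b ⟫ ≡ ℤT.⟪ Λ , ⟦ b ⟧b ⟫Z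
   value Λ = pairing-ℤ Λ (ZS.ιM ⟦ b ⟧b) ⟫ ℤT.⟪⟫Z-cong Λ (ιM-ℤ ⟦ b ⟧b)
   swapped-+ : ∀ (Λ Λ' : I.Mat n) -> ℤT.⟪ Λ I.+ Λ' , ⟦ b ⟧b ⟫Z ≡ ℤT.⟪ Λ , ⟦ b ⟧b ⟫Z O.+ ℤT.⟪ Λ' , ⟦ b ⟧b ⟫Z
   swapped-+ Λ Λ' = ℤT.trZ-comm (Λ I.+ Λ') ⟦ b ⟧b ⟫ ℤT.⟪⟫Z-+ ⟦ b ⟧b Λ Λ' ⟫ cong₂ O._+_ (ℤT.trZ-comm ⟦ b ⟧b Λ) (ℤT.trZ-comm ⟦ b ⟧b Λ')

 bracket-row : ∀ {Λ Λ1 f g} β -> Represents Λ f -> Represents Λ1 g -> (∀ b -> scaled f (ad β b) ≡ g b) -> ∀ {A} -> LieLike A -> ⟪ Λ , ιM (X β) * A ⟫ S.≈ ⟪ Λ , A * ιM (X β) ⟫ S.+ ⟪ Λ1 , A ⟫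
 bracket-row {Λ} {Λ1} {f} {g} β rep rep1 first {A} lie = side (X β) I.1# (trans (congl (ιM (X β)) (trans (congl A ιM-1) (*-identityʳ A))) refl) S.& functional-≈ (I.1# I.* (Λ I.* X β)) (X β
  I.* (Λ I.* I.1#) I.+ Λ1) on-basis lie S.& ⟪⟫-+l (X β I.* (Λ I.* I.1#)) Λ1 A S.& S.+-congʳ (S.sym (side I.1# (X β) (trans (congr (A * ιM (X β)) ιM-1) (*-identityˡ (A * ιM (X β))))))
  where
  side : ∀ B C {D} -> ιM B * (A * ιM C) ≈ D -> ⟪ Λ , D ⟫ S.≈ ⟪ C I.* (Λ I.* B) , A ⟫
  side B C p = ⟪⟫-cong Λ (sym p) S.& S.sym (⟪⟫-sandwich Λ B A C)
  on-basis : ∀ b -> ℤT.⟪ I.1# I.* (Λ I.* X β) , ⟦ b ⟧b ⟫Z ≡ ℤT.⟪ X β I.* (Λ I.* I.1#) I.+ Λ1 , ⟦ b ⟧b ⟫Z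
  on-basis b = sandwichZ Λ (X β) ⟦ b ⟧b I.1# ⟫ ℤT.⟪⟫Z-cong Λ (I.congl (X β) (I.*-identityʳ ⟦ b ⟧b) I.& ad-sound β b) ⟫ ℤT.⟪⟫Z-+ Λ (⟦ b ⟧b I.* X β) ⟦ ad β b ⟧ᵗ ⟫ cong₂ O._+_ (ℤT.⟪⟫Z-cong Λ
   (I.sym (I.*-identityˡ (⟦ b ⟧b I.* X β))) ⟫ J.sym (sandwichZ Λ I.1# ⟦ b ⟧b (X β))) (ℤT.⟪⟫Z-· Λ (fst (ad β b)) ⟦ snd (ad β b) ⟧b ⟫ cong (fst (ad β b) O.*_) (rep (snd (ad β b))) ⟫
   first b ⟫ J.sym (rep1 b)) ⟫ J.sym (ℤT.trZ-comm (X β I.* (Λ I.* I.1#) I.+ Λ1) ⟦ b ⟧b ⟫ ℤT.⟪⟫Z-+ ⟦ b ⟧b (X β I.* (Λ I.* I.1#)) Λ1 ⟫ cong₂ O._+_ (ℤT.trZ-comm ⟦ b ⟧b (X β I.* (Λ I.* I.1#)))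
   (ℤT.trZ-comm ⟦ b ⟧b Λ1))

module Rows {c ℓ} (R : CommutativeRing c ℓ) {c' ℓ′} {K : CommutativeRing c' ℓ′} (isℚ : IsℚAlgebra K)
 {n} (π : Representation n) where
 open RootSubgroups R π
 open Coordinates isℚ π using (φ; κ; φ-basis; κ-basis)
 open Trace R
 open LieSpan R π
 open LieLikeMatrices R π
 open DoubleStrings π
 open Matrices R using (ι)

 private
  zero-represents : Represents I.0# (\ _ -> + 0)
  zero-represents b = ℤT.trZ-comm I.0# ⟦ b ⟧b ⟫ ℤT.⟪⟫Z-0 ⟦ b ⟧b

  scale-represents : ∀ k {Λ f} -> Represents Λ f -> Represents (k I.·ᴹ Λ) (\ b -> k O.* f b)
  scale-represents k {Λ} rep b = ℤT.trZ-comm (k I.·ᴹ Λ) ⟦ b ⟧b ⟫ ℤT.⟪⟫Z-· ⟦ b ⟧b k Λ ⟫ cong (k O.*_) (ℤT.trZ-comm ⟦ b ⟧b Λ ⟫ rep b)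

  scaled-scale : ∀ k f t -> scaled (\ b -> k O.* f b) t ≡ k O.* scaled f t
  scaled-scale k f (m , b) = ℤs.solves (k :: m :: f b :: []) (s1 *: (s0 *: s2)) (s0 *: (s1 *: s2))

  scaled-zero : ∀ t -> scaled (\ _ -> + 0) t ≡ + 0
  scaled-zero (m , b) = O.*-zeroʳ m

  zero⟪⟫ : ∀ (A : M.Mat n) -> ⟪ I.0# , A ⟫ S.≈ S.0#
  zero⟪⟫ A = tr-cong (M.congr A ιM-0 M.& M.zeroˡ A) S.& tr-0 {n}

 record Row (β : Root) (Λ : I.Mat n) : Set where
  field
   f g k : Basis -> ℤ
   Λ1 Λ2 : I.Mat n
   represents : Represents Λ f
   represents1 : Represents Λ1 g
   represents2 : Represents Λ2 k
   first : ∀ b -> scaled f (ad β b) ≡ g b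
   second : ∀ b -> scaled g (ad β b) ≡ k b O.+ k b

 open Row

 φ-fixed : ∀ {β γ} -> γ ≢ β -> (∀ δ -> ¬ (β ⊞ δ ≈ γ)) -> Row β (φ γ)
 φ-fixed {β} {γ} p q = record { Λ1 = I.0# ; Λ2 = I.0# ; represents = φ-basis γ ; represents1 = zero-represents ; represents2 = zero-represents ; first = rootCoeff-ad-zero p q ; second = \ b
  -> scaled-zero (ad β b) }

 φ-step : ∀ {β δ γ} -> β ⊞ δ ≈ γ -> δ ≢ β -> (∀ ζ -> ¬ (β ⊞ ζ ≈ δ)) -> Row β (φ γ)
 φ-step {β} {δ} {γ} p q r = record { Λ1 = N β δ γ I.·ᴹ φ δ ; Λ2 = I.0# ; represents = φ-basis γ ; represents1 = scale-represents (N β δ γ) {φ δ} {rootCoeff δ} (φ-basis δ) ; represents2 =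
  zero-represents ; first = rootCoeff-ad p ; second = \ b -> J.trans (scaled-scale (N β δ γ) (rootCoeff δ) (ad β b)) (cong (N β δ γ O.*_) (rootCoeff-ad-zero q r b) ⟫ O.*-zeroʳ (N β δ γ)) }

 φ-two-steps : ∀ {β ζ δ γ} -> β ⊞ ζ ≈ δ -> β ⊞ δ ≈ γ -> Row β (φ γ)
 φ-two-steps {β} {ζ} {δ} {γ} p q = record { Λ1 = N β δ γ I.·ᴹ φ δ ; Λ2 = halfN p q I.·ᴹ φ ζ ; represents = φ-basis γ ; represents1 = scale-represents (N β δ γ) {φ δ} {rootCoeff δ} (φ-basis
  δ) ; represents2 = scale-represents (halfN p q) {φ ζ} {rootCoeff ζ} (φ-basis ζ) ; first = rootCoeff-ad q ; second = \ b -> J.trans (scaled-scale (N β δ γ) (rootCoeff δ) (ad β b)) (cong (N β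
  δ γ O.*_) (rootCoeff-ad p b) ⟫ ℤs.solves (N β δ γ :: N β ζ δ :: rootCoeff ζ b :: []) (s0 *: (s1 *: s2)) ((s1 *: s0) *: s2) ⟫ cong (O._* rootCoeff ζ b) (halfN-double p q) ⟫ O.*-distribʳ-+
  (rootCoeff ζ b) (halfN p q) (halfN p q)) }

 φ-self : ∀ β -> Row β (φ β)
 φ-self β = record { Λ1 = -[1+ 0 ] I.·ᴹ κ β ; Λ2 = -[1+ 0 ] I.·ᴹ φ (-ᴿ β) ; represents = φ-basis β ; represents1 = scale-represents -[1+ 0 ] {κ β} {cartanValue β} (κ-basis β) ; represents2 =
  scale-represents -[1+ 0 ] {φ (-ᴿ β)} {rootCoeff (-ᴿ β)} (φ-basis (-ᴿ β)) ; first = \ b -> J.trans (rootCoeff-ad-self β b) (J.sym (O.-1*i≡-i _)) ; second = \ b -> J.trans (scaled-scale -[1+ 0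
  ] (cartanValue β) (ad β b)) (cong (-[1+ 0 ] O.*_) (cartanValue-ad β β b ⟫ cong (O._* rootCoeff (-ᴿ β) b) (hval-self β)) ⟫ ℤs.solves (-[1+ 0 ] :: rootCoeff (-ᴿ β) b :: []) (s0 *: ((1: +: 1:)
  *: s1)) (s0 *: s1 +: s0 *: s1)) }

 private
  no-opposite-target : ∀ {β δ} -> ¬ (β ⊞ δ ≈ -ᴿ β)
  no-opposite-target {β} {δ} = toWitness {a? = all-roots? \ β -> all-roots? \ δ -> ¬? (β ⊞ δ ≟ (-ᴿ β))} tt β δ

 κ-row : ∀ β γ -> Row β (κ γ)
 κ-row β γ = record { Λ1 = hval β γ I.·ᴹ φ (-ᴿ β) ; Λ2 = I.0# ; represents = κ-basis γ ; represents1 = scale-represents (hval β γ) {φ (-ᴿ β)} {rootCoeff (-ᴿ β)} (φ-basis (-ᴿ β)) ;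
  represents2 = zero-represents ; first = cartanValue-ad β γ ; second = \ b -> J.trans (scaled-scale (hval β γ) (rootCoeff (-ᴿ β)) (ad β b)) (cong (hval β γ O.*_) (rootCoeff-ad-zero {β} { -ᴿ
  β} (\ e -> opposite-distinct β (J.sym e)) (\ δ -> no-opposite-target {β} {δ}) b) ⟫ O.*-zeroʳ (hval β γ)) }

 apply : ∀ {β Λ} (ρ : Row β Λ) t {A} -> Lie A -> ⟪ Λ , conjugate β t A ⟫ S.≈ ⟪ Λ , A ⟫ S.+ t S.* ⟪ Λ1 ρ , A ⟫ S.+ t S.* t S.* ⟪ Λ2 ρ , A ⟫
 apply {β} {Λ} ρ = row {Λ} {Λ1 ρ} {Λ2 ρ} {f ρ} {g ρ} {k ρ} β (represents ρ) (represents1 ρ) (represents2 ρ) (first ρ) (second ρ)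

 apply1 : ∀ {β Λ} (ρ : Row β Λ) {A} -> LieLike A -> ⟪ Λ , conjugate β S.1# A ⟫ S.≈ ⟪ Λ , A ⟫ S.+ ⟪ Λ1 ρ , A ⟫ S.+ ⟪ Λ2 ρ , A ⟫
 apply1 {β} {Λ} ρ = row1 {Λ} {Λ1 ρ} {Λ2 ρ} {f ρ} {g ρ} {k ρ} β (represents ρ) (represents1 ρ) (represents2 ρ) (first ρ) (second ρ)

 module _ {A} (lie : Lie A) where
  fixed-φ : ∀ {β γ} -> γ ≢ β -> (∀ δ -> ¬ (β ⊞ δ ≈ γ)) -> ∀ t -> ⟪ φ γ , conjugate β t A ⟫ S.≈ ⟪ φ γ , A ⟫
  fixed-φ {β} {γ} p q t = apply (φ-fixed {β} {γ} p q) t lie S.& S.+-cong (S.+-congˡ (S.*-congˡ (zero⟪⟫ A))) (S.*-congˡ (zero⟪⟫ A)) S.& solves (⟪ φ γ , A ⟫ :: t :: []) (s0 +: s1 *: 0: +: s1 *: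
   s1 *: 0:) (s0)

  step-φ : ∀ {β δ γ} -> β ⊞ δ ≈ γ -> δ ≢ β -> (∀ ζ -> ¬ (β ⊞ ζ ≈ δ)) -> ∀ t -> ⟪ φ γ , conjugate β t A ⟫ S.≈ ⟪ φ γ , A ⟫ S.+ t S.* (ι (N β δ γ) S.* ⟪ φ δ , A ⟫)
  step-φ {β} {δ} {γ} p q r t = apply (φ-step {β} {δ} {γ} p q r) t lie S.& S.+-cong (S.+-congˡ (S.*-congˡ (⟪⟫-·l (N β δ γ) (φ δ) A))) (S.*-congˡ (zero⟪⟫ A)) S.& solves (⟪ φ γ , A ⟫ :: t :: ι (N
   β δ γ) S.* ⟪ φ δ , A ⟫ :: []) (s0 +: s1 *: s2 +: s1 *: s1 *: 0:) (s0 +: s1 *: s2)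

  step-κ : ∀ β γ t -> ⟪ κ γ , conjugate β t A ⟫ S.≈ ⟪ κ γ , A ⟫ S.+ t S.* (ι (hval β γ) S.* ⟪ φ (-ᴿ β) , A ⟫)
  step-κ β γ t = apply (κ-row β γ) t lie S.& S.+-cong (S.+-congˡ (S.*-congˡ (⟪⟫-·l (hval β γ) (φ (-ᴿ β)) A))) (S.*-congˡ (zero⟪⟫ A)) S.& solves (⟪ κ γ , A ⟫ :: t :: ι (hval β γ) S.* ⟪ φ (-ᴿ β)
   , A ⟫ :: []) (s0 +: s1 *: s2 +: s1 *: s1 *: 0:) (s0 +: s1 *: s2)

 module _ {A} (lie : LieLike A) where
  fixed-φ1 : ∀ {β γ} -> γ ≢ β -> (∀ δ -> ¬ (β ⊞ δ ≈ γ)) -> ⟪ φ γ , conjugate β S.1# A ⟫ S.≈ ⟪ φ γ , A ⟫ S.+ S.0#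
  fixed-φ1 {β} {γ} p q = apply1 (φ-fixed {β} {γ} p q) lie S.& S.+-cong (S.+-congˡ (zero⟪⟫ A)) (zero⟪⟫ A) S.& S.+-identityʳ _

  step-φ1 : ∀ {β δ γ} -> β ⊞ δ ≈ γ -> δ ≢ β -> (∀ ζ -> ¬ (β ⊞ ζ ≈ δ)) -> ⟪ φ γ , conjugate β S.1# A ⟫ S.≈ ⟪ φ γ , A ⟫ S.+ ι (N β δ γ) S.* ⟪ φ δ , A ⟫
  step-φ1 {β} {δ} {γ} p q r = apply1 (φ-step {β} {δ} {γ} p q r) lie S.& S.+-cong (S.+-congˡ (⟪⟫-·l (N β δ γ) (φ δ) A)) (zero⟪⟫ A) S.& S.+-identityʳ _

  two-steps-φ1 : ∀ {β ζ δ γ} (p : β ⊞ ζ ≈ δ) (q : β ⊞ δ ≈ γ) -> ⟪ φ γ , conjugate β S.1# A ⟫ S.≈ ⟪ φ γ , A ⟫ S.+ (ι (N β δ γ) S.* ⟪ φ δ , A ⟫ S.+ ι (halfN p q) S.* ⟪ φ ζ , A ⟫)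
  two-steps-φ1 {β} {ζ} {δ} {γ} p q = apply1 (φ-two-steps p q) lie S.& S.+-cong (S.+-congˡ (⟪⟫-·l (N β δ γ) (φ δ) A)) (⟪⟫-·l (halfN p q) (φ ζ) A) S.& S.+-assoc _ _ _

  self-φ1 : ∀ β -> ⟪ φ β , conjugate β S.1# A ⟫ S.≈ ⟪ φ β , A ⟫ S.+ (S.- ⟪ κ β , A ⟫ S.- ⟪ φ (-ᴿ β) , A ⟫)
  self-φ1 β = apply1 (φ-self β) lie S.& S.+-cong (S.+-congˡ (minus (κ β))) (minus (φ (-ᴿ β))) S.& S.+-assoc _ _ _
   where
   minus : ∀ Λ -> ⟪ -[1+ 0 ] I.·ᴹ Λ , A ⟫ S.≈ S.- ⟪ Λ , A ⟫
   minus Λ = ⟪⟫-·l -[1+ 0 ] Λ A S.& S.*-congʳ (S.-‿cong ι-1) S.& S.-1*x≈-x _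

  step-κ1 : ∀ β γ -> ⟪ κ γ , conjugate β S.1# A ⟫ S.≈ ⟪ κ γ , A ⟫ S.+ ι (hval β γ) S.* ⟪ φ (-ᴿ β) , A ⟫
  step-κ1 β γ = apply1 (κ-row β γ) lie S.& S.+-cong (S.+-congˡ (⟪⟫-·l (hval β γ) (φ (-ᴿ β)) A)) (zero⟪⟫ A) S.& S.+-identityʳ _

  bracket-φ : ∀ {β δ γ} -> β ⊞ δ ≈ γ -> ⟪ φ γ , ιM (X β) M.* A ⟫ S.≈ ⟪ φ γ , A M.* ιM (X β) ⟫ S.+ ι (N β δ γ) S.* ⟪ φ δ , A ⟫
  bracket-φ {β} {δ} {γ} p = bracket-row {φ γ} {N β δ γ I.·ᴹ φ δ} β (φ-basis γ) (scale-represents (N β δ γ) {φ δ} {rootCoeff δ} (φ-basis δ)) (rootCoeff-ad p) lie S.& S.+-congˡ (⟪⟫-·l (N β δ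
   γ) (φ δ) A)

 φ-X : ∀ γ δ -> ⟪ φ γ , ιM (X δ) ⟫ S.≈ ι (indicator γ δ)
 φ-X γ δ = ⟪⟫-ι R (φ γ) (X δ) S.& ι-cong (φ-basis γ (root δ))

 κ-X : ∀ γ δ -> ⟪ κ γ , ιM (X δ) ⟫ S.≈ S.0#
 κ-X γ δ = ⟪⟫-ι R (κ γ) (X δ) S.& ι-cong (κ-basis γ (root δ))

 -- For a Lie-like matrix whose only nonvanishing coordinate is that of X δ, the Cartan
 -- part being killed by β, conjugation by x β 1 acts as on a multiple of X δ.
 module _ {A} (lie : LieLike A) {β δ : Root} {r : S.Carrier}
  (at-δ : ⟪ φ δ , A ⟫ S.≈ r) (off-δ : ∀ γ -> γ ≢ δ -> ⟪ φ γ , A ⟫ S.≈ S.0#) (κ≈0 : ⟪ κ β , A ⟫ S.≈ S.0#) where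
  private
   module ZS = RootSubgroups ℤ-ring π
   module ZL = LieSpan ℤ-ring π
   open IntegerPoints R π

   C C~ : I.Mat n
   C = ZS.x β (+ 1)
   C~ = ZS.x β -[1+ 0 ]

   D : I.Mat n -> I.Mat n
   D B = C I.* (B I.* C~) I.+ I.- B

   sumZ-only : ∀ {m} (v : Fin m -> ℤ) i -> (∀ j -> j ≢ i -> v j ≡ + 0) -> sumZ v ≡ v i
   sumZ-only {suc m} v F.zero p = cong (\ z -> v 0F O.+ z) ((ℤT.sumZ-cong \ j -> p (F.suc j) \ ()) ⟫ ℤT.sumZ-replicate-zero m) ⟫ O.+-identityʳ (v 0F)
   sumZ-only {suc m} v (F.suc i) p = cong₂ O._+_ (p 0F \ ()) (sumZ-only (v ∘ F.suc) i \ j q -> p (F.suc j) (q ∘ F.suc-injective)) ⟫ O.+-identityˡ _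

   index-roots : ∀ k -> root-index (roots k) ≡ k
   index-roots = toWitness {a? = F.all? \ k -> root-index (roots k) F.≟ k} tt

   expand : I.Mat n -> I.Mat n
   expand Λ = I.sum (\ k -> ℤT.⟪ Λ , D (X (roots k)) ⟫Z I.·ᴹ φ (roots k)) I.+ (O.- ℤT.⟪ Λ , X β ⟫Z) I.·ᴹ κ β

   ιM-ℤ : ∀ (B : I.Mat n) -> ZS.ιM B I.≈ B
   ιM-ℤ B i j = ι-ℤ (B i j)

   swapped-+ : ∀ (Λ Λ' B : I.Mat n) -> ℤT.⟪ Λ I.+ Λ' , B ⟫Z ≡ ℤT.⟪ Λ , B ⟫Z O.+ ℤT.⟪ Λ' , B ⟫Z
   swapped-+ Λ Λ' B = ℤT.trZ-comm (Λ I.+ Λ') B ⟫ ℤT.⟪⟫Z-+ B Λ Λ' ⟫ cong₂ O._+_ (ℤT.trZ-comm B Λ) (ℤT.trZ-comm B Λ')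

   swapped-sum : ∀ {m} (v : Fin m -> I.Mat n) B -> ℤT.⟪ I.sum v , B ⟫Z ≡ sumZ (\ k -> ℤT.⟪ v k , B ⟫Z)
   swapped-sum {zero} v B = zero-pairing
    where
    zero-pairing : ℤT.⟪ I.0# , B ⟫Z ≡ + 0
    zero-pairing = ℤT.trZ-comm I.0# B ⟫ ℤT.⟪⟫Z-0 B
   swapped-sum {suc m} v B = swapped-+ (v 0F) (I.sum (v ∘ F.suc)) B ⟫ cong (\ z -> ℤT.⟪ v 0F , B ⟫Z O.+ z) (swapped-sum (v ∘ F.suc) B)

   expand-basis : ∀ Λ b -> ℤT.⟪ expand Λ , ⟦ b ⟧b ⟫Z ≡ ℤT.⟪ Λ , D ⟦ b ⟧b ⟫Z
   expand-basis Λ b = swapped-+ (I.sum (\ k -> z k I.·ᴹ φ (roots k))) _ ⟦ b ⟧b ⟫ cong₂ O._+_ (swapped-sum (\ k -> z k I.·ᴹ φ (roots k)) ⟦ b ⟧b ⟫ (ℤT.sumZ-cong \ k -> scale-represents (z k) {φ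
    (roots k)} {rootCoeff (roots k)} (φ-basis (roots k)) b)) (scale-represents (O.- ℤT.⟪ Λ , X β ⟫Z) {κ β} {cartanValue β} (κ-basis β) b) ⟫ on b
    where
    z : Fin 8 -> ℤ
    z k = ℤT.⟪ Λ , D (X (roots k)) ⟫Z
    on : ∀ b -> sumZ (\ k -> z k O.* rootCoeff (roots k) b) O.+ (O.- ℤT.⟪ Λ , X β ⟫Z) O.* cartanValue β b ≡ ℤT.⟪ Λ , D ⟦ b ⟧b ⟫Z
    on (root ζ) = cong₂ O._+_ (sumZ-only (\ k -> z k O.* indicator (roots k) ζ) (root-index ζ) (\ j j≢ -> cong (z j O.*_) (indicator-≢ \ e -> j≢ (J.sym (index-roots j) ⟫ cong root-index e)) ⟫
     O.*-zeroʳ (z j))) (O.*-zeroʳ (O.- ℤT.⟪ Λ , X β ⟫Z)) ⟫ O.+-identityʳ _ ⟫ value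
     where
     value : z (root-index ζ) O.* indicator (roots (root-index ζ)) ζ ≡ ℤT.⟪ Λ , D (X ζ) ⟫Z
     value = cong (\ ξ -> ℤT.⟪ Λ , D (X ξ) ⟫Z O.* indicator ξ ζ) (roots-index ζ) ⟫ cong (ℤT.⟪ Λ , D (X ζ) ⟫Z O.*_) (indicator-self ζ) ⟫ O.*-identityʳ _
    on (cartan γ) = cong (O._+ (O.- ℤT.⟪ Λ , X β ⟫Z) O.* hval γ β) ((ℤT.sumZ-cong \ k -> O.*-zeroʳ (z k)) ⟫ ℤT.sumZ-replicate-zero 8) ⟫ ℤs.solves (ℤT.⟪ Λ , X β ⟫Z :: hval γ β :: []) (0: +: (-:
     s0) *: s1) ((-: s1) *: s0) ⟫ J.sym (ℤT.⟪⟫Z-cong Λ D≈ ⟫ ℤT.⟪⟫Z-· Λ (O.- hval γ β) (X β))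
     where
     D≈ : D H[ γ ] I.≈ (O.- hval γ β) I.·ᴹ X β
     D≈ = I.+-congʳ (I.congl C (I.congr C~ (I.sym (ιM-ℤ H[ γ ]))) I.& ZL.conj⇒conjugate {β} {+ 1} {ZS.ιM H[ γ ]} {ZS.ιM H[ γ ] I.+ + 1 I.·ᴹ ZS.ιM ((O.- hval γ β) I.·ᴹ X β) I.+ (+ 1 O.* + 1)
      I.·ᴹ ZS.ιM (+ 0 I.·ᴹ X β)} (ZS.x-conj-basis β (cartan γ) (+ 1))) I.& I.+-congʳ (I.+-cong (I.+-cong (ιM-ℤ H[ γ ]) (I.%-cong {r = + 1} rfl (ιM-ℤ ((O.- hval γ β) I.·ᴹ X β)))) (I.%-cong {r
      = + 1 O.* + 1} rfl (ιM-ℤ ((+ 0) I.·ᴹ X β)))) I.& I.solve (hval γ β :: []) (H[ γ ] :: X β :: []) (m0 :+ 1: :% (-: s0) :% m1 :+ (1: *: 1:) :% 0: :% m1 :+ :- m0) ((-: s0) :% m1)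

   unitMatrix : Fin n -> Fin n -> I.Mat n
   unitMatrix i j k l = (if does (k F.≟ j) then + 1 else + 0) O.* (if does (i F.≟ l) then + 1 else + 0)

   entry-value : ∀ i j (B : M.Mat n) -> ⟪ unitMatrix i j , B ⟫ S.≈ B i j
   entry-value i j B = (S.sum-cong-≋ \ k -> S.trans (S.sum-cong-≋ \ l -> S.trans (S.*-congʳ (ι-* (δ₁ k) (δ₂ l))) (S.*-assoc _ _ _)) (S.sym (S.*-distribˡ-sum (ι (δ₁ k)) (\ l -> ι (δ₂ l) S.* B l
    k)) S.& S.*-congˡ ((S.sum-cong-≋ \ l -> S.*-congʳ (ιδ (does (i F.≟ l)))) S.& M.*-identityˡ B i k))) S.& (S.sum-cong-≋ \ k -> S.trans (S.*-comm _ _) (S.*-congˡ (ιδ (does (k F.≟ j))))) S.&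
    M.*-identityʳ B i j
    where
    δ₁ δ₂ : Fin n -> ℤ
    δ₁ k = if does (k F.≟ j) then + 1 else + 0
    δ₂ l = if does (i F.≟ l) then + 1 else + 0
    ιδ : ∀ d -> ι (if d then + 1 else + 0) S.≈ (if d then S.1# else S.0#)
    ιδ true = ι-1
    ιδ false = S.refl

   C≈ : ιM C M.≈ x β S.1#
   C≈ = x-ι β (+ 1) M.& x-cong β ι-1
   C~≈ : ιM C~ M.≈ x β (S.- S.1#)
   C~≈ = x-ι β -[1+ 0 ] M.& x-cong β (S.-‿cong ι-1)

   sum⟪⟫ : ∀ {m} (v : Fin m -> I.Mat n) -> ⟪ I.sum v , A ⟫ S.≈ S.sum (\ k -> ⟪ v k , A ⟫)
   sum⟪⟫ {zero} v = zero⟪⟫ A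
   sum⟪⟫ {suc m} v = ⟪⟫-+l (v 0F) _ A S.& S.+-congˡ (sum⟪⟫ (v ∘ F.suc))

   sumR-only : ∀ {m} (v : Fin m -> S.Carrier) i -> (∀ j -> j ≢ i -> v j S.≈ S.0#) -> S.sum v S.≈ v i
   sumR-only {suc m} v F.zero p = S.+-congˡ (S.sum-zero {m} \ j -> p (F.suc j) \ ()) S.& S.+-identityʳ _
   sumR-only {suc m} v (F.suc i) p = S.+-cong (p 0F \ ()) (sumR-only (v ∘ F.suc) i \ j q -> p (F.suc j) (q ∘ F.suc-injective)) S.& S.+-identityˡ _

   expand-value : ∀ Λ -> ⟪ expand Λ , A ⟫ S.≈ r S.* ⟪ Λ , ιM (D (X δ)) ⟫
   expand-value Λ = ⟪⟫-+l (I.sum (\ k -> z k I.·ᴹ φ (roots k))) _ A S.& S.+-cong (sum⟪⟫ (\ k -> z k I.·ᴹ φ (roots k)) S.& (S.sum-cong-≋ \ k -> ⟪⟫-·l (z k) (φ (roots k)) A) S.& (sumR-only (\ k ->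
    ι (z k) S.* ⟪ φ (roots k) , A ⟫) (root-index δ) \ j j≢ -> S.trans (S.*-congˡ (off-δ (roots j) \ e -> j≢ (J.sym (index-roots j) ⟫ cong root-index e))) (S.zeroʳ _))) (⟪⟫-·l (O.- ℤT.⟪ Λ , X β
    ⟫Z) (κ β) A S.& S.*-congˡ κ≈0 S.& S.zeroʳ _) S.& S.+-identityʳ _ S.& S.reflexive (cong (\ ζ -> ι (ℤT.⟪ Λ , D (X ζ) ⟫Z) S.* ⟪ φ ζ , A ⟫) (roots-index δ)) S.& S.*-cong (S.sym (⟪⟫-ι R Λ (D
    (X δ)))) at-δ S.& S.*-comm _ _
    where
    z : Fin 8 -> ℤ
    z k = ℤT.⟪ Λ , D (X (roots k)) ⟫Z

   D-value : ∀ Λ -> ⟪ Λ , conjugate β S.1# A ⟫ S.≈ ⟪ Λ , A ⟫ S.+ r S.* ⟪ Λ , ιM (D (X δ)) ⟫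
   D-value Λ = ⟪⟫-cong Λ (M.*-cong (M.sym C≈) (M.congl A (M.sym C~≈))) S.& S.sym (⟪⟫-sandwich Λ C A C~) S.& functional-≈ (C~ I.* (Λ I.* C)) (Λ I.+ expand Λ) on-basis lie S.& ⟪⟫-+l Λ (expand
    Λ) A S.& S.+-congˡ (expand-value Λ)
    where
    on-basis : ∀ b -> ℤT.⟪ C~ I.* (Λ I.* C) , ⟦ b ⟧b ⟫Z ≡ ℤT.⟪ Λ I.+ expand Λ , ⟦ b ⟧b ⟫Z
    on-basis b = sandwichZ Λ C ⟦ b ⟧b C~ ⟫ J.sym (swapped-+ Λ (expand Λ) ⟦ b ⟧b ⟫ cong (\ y -> ℤT.⟪ Λ , ⟦ b ⟧b ⟫Z O.+ y) (expand-basis Λ b) ⟫ J.sym (ℤT.⟪⟫Z-+ Λ ⟦ b ⟧b (D ⟦ b ⟧b)) ⟫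
     ℤT.⟪⟫Z-cong Λ (I.solve [] (⟦ b ⟧b :: C I.* (⟦ b ⟧b I.* C~) :: []) (m0 :+ (m1 :+ :- m0)) (m1)))

  conjugate-single : conjugate β S.1# A M.≈ A M.+ r M.⊙ (conjugate β S.1# (ιM (X δ)) M.- ιM (X δ))
  conjugate-single i j = S.sym (entry-value i j (conjugate β S.1# A)) S.& D-value (unitMatrix i j) S.& S.+-cong (entry-value i j A) (S.*-congˡ (entry-value i j (ιM (D (X δ))) S.& D≈ i j))
   where
   D≈ : ιM (D (X δ)) M.≈ conjugate β S.1# (ιM (X δ)) M.- ιM (X δ)
   D≈ = ιM-+ (C I.* (X δ I.* C~)) (I.- X δ) M.& M.+-cong (ιM-* C (X δ I.* C~) M.& M.*-cong C≈ (ιM-* (X δ) C~ M.& M.congl (ιM (X δ)) C~≈)) (\ i j -> ι-neg (X δ i j))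

-- The centralizer of the root elements commuting with the highest root subgroup

qr br ar pr : Root
qr = long 0F pos
br = long 1F pos
ar = short pos neg
pr = short pos pos

no-sum : ∀ β δ -> {False (any-root? \ ε -> β ⊞ δ ≟ ε)} -> ∀ ε -> ¬ (β ⊞ δ ≈ ε)
no-sum β δ {f} ε p = toWitnessFalse f (ε , p)

no-source : ∀ β γ -> {False (any-root? \ δ -> β ⊞ δ ≟ γ)} -> ∀ δ -> ¬ (β ⊞ δ ≈ γ)
no-source β γ {f} δ p = toWitnessFalse f (δ , p)

module Conjugates {c ℓ} (R : CommutativeRing c ℓ) {c' ℓ′} {K : CommutativeRing c' ℓ′} (isℚ : IsℚAlgebra K)
 {n} (π : Representation n) where
 open RootSubgroups R π
 open RootConjugation R π
 open RootConjugation2 R π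
 open Coordinates isℚ π using (φ; κ)
 open Rows R isℚ π
 open Trace R
 open LieSpan R π using (conjugate; conj⇒conjugate)
 open LieLikeMatrices R π
 open Primitivity π using (N-unit; N-two)
 open DoubleStrings π
 open Matrices R using (ι)
 open S using (_≈_; _+_; _*_; -_; 0#; 1#)

 -- g centralizes the root elements x β 1 of the list, and conjugates of Lie algebra
 -- elements are Lie-like.
 record Centralizing (g g~ : M.Mat n) : Set (ℓ ⊔ c) where
  field
   inverseʳ : g M.* g~ M.≈ M.1#
   inverseˡ : g~ M.* g M.≈ M.1#
   lieLike : ∀ δ -> LieLike (g M.* (XR δ M.* g~))
   commutes : ∀ {β} -> β ≡ qr ⊎ β ≡ br ⊎ β ≡ (-ᴿ br) ⊎ β ≡ ar ⊎ β ≡ pr -> g M.* x β 1# M.≈ x β 1# M.* g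

 module Equations {g g~} (cz : Centralizing g g~) where
  open Centralizing cz
  private
   at-q : qr ≡ qr ⊎ qr ≡ br ⊎ qr ≡ (-ᴿ br) ⊎ qr ≡ ar ⊎ qr ≡ pr
   at-q = inl rfl
   at-b : br ≡ qr ⊎ br ≡ br ⊎ br ≡ (-ᴿ br) ⊎ br ≡ ar ⊎ br ≡ pr
   at-b = inr (inl rfl)
   at-b~ : (-ᴿ br) ≡ qr ⊎ (-ᴿ br) ≡ br ⊎ (-ᴿ br) ≡ (-ᴿ br) ⊎ (-ᴿ br) ≡ ar ⊎ (-ᴿ br) ≡ pr
   at-b~ = inr (inr (inl rfl))
   at-a : ar ≡ qr ⊎ ar ≡ br ⊎ ar ≡ (-ᴿ br) ⊎ ar ≡ ar ⊎ ar ≡ pr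
   at-a = inr (inr (inr (inl rfl)))
   at-p : pr ≡ qr ⊎ pr ≡ br ⊎ pr ≡ (-ᴿ br) ⊎ pr ≡ ar ⊎ pr ≡ pr
   at-p = inr (inr (inr (inr rfl)))

  Ad : Root -> M.Mat n
  Ad δ = g M.* (XR δ M.* g~)

  v w : Root -> Root -> S.Carrier
  v γ δ = ⟪ φ γ , Ad δ ⟫
  w γ δ = ⟪ κ γ , Ad δ ⟫

  private
   transport : ∀ {β A B} -> g M.* x β 1# M.≈ x β 1# M.* g -> conjugate β 1# A M.≈ B -> conjugate β 1# (g M.* (A M.* g~)) M.≈ g M.* (B M.* g~)
   transport {β} {A} {B} comm p = M.solve [] (x β 1# :: x β (- 1#) :: g :: g~ :: A :: []) (m0 :* (m2 :* (m4 :* m3) :* m1)) ((m0 :* m2) :* m4 :* (m3 :* m1)) M.& M.*-cong (M.congr A (M.sym comm))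
    swapped M.& M.solve [] (x β 1# :: x β (- 1#) :: g :: g~ :: A :: []) ((m2 :* m0) :* m4 :* (m1 :* m3)) (m2 :* ((m0 :* (m4 :* m1)) :* m3)) M.& M.congl g (M.congr g~ p)
    where
    y = x β 1#
    y~ = x β (- 1#)
    y-g~ : y M.* g~ M.≈ g~ M.* y
    y-g~ = M.sym (M.*-identityˡ (y M.* g~)) M.& M.congr (y M.* g~) (M.sym inverseˡ) M.& M.solve [] (y :: g :: g~ :: []) (m2 :* m1 :* (m0 :* m2)) (m2 :* (m1 :* m0) :* m2) M.& M.congr g~ (M.congl
     g~ comm) M.& M.solve [] (y :: g :: g~ :: []) (m2 :* (m0 :* m1) :* m2) (m2 :* m0 :* (m1 :* m2)) M.& M.congl (g~ M.* y) inverseʳ M.& M.*-identityʳ (g~ M.* y)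
    swapped : g~ M.* y~ M.≈ y~ M.* g~
    swapped = M.sym (M.sym (M.congl (y~ M.* g~) (x-inverse β (S.-‿inverseʳ 1#)) M.& M.*-identityʳ (y~ M.* g~)) M.& M.solve [] (y :: y~ :: g~ :: []) (m1 :* m2 :* (m0 :* m1)) (m1 :* (m2 :* m0) :*
     m1) M.& M.congr y~ (M.congl y~ (M.sym y-g~)) M.& M.solve [] (y :: y~ :: g~ :: []) (m1 :* (m0 :* m2) :* m1) ((m1 :* m0) :* (m2 :* m1)) M.& M.congr (g~ M.* y~) (x-inverse β (S.-‿inverseˡ
     1#)) M.& M.*-identityˡ (g~ M.* y~))

   cancelˡ : ∀ {u s t} -> u + s ≈ u + t -> s ≈ t
   cancelˡ {u} {s} {t} = S.+-cancelˡ u s t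

   fixed-eq : ∀ {β δ} -> g M.* x β 1# M.≈ x β 1# M.* g -> δ ≢ -ᴿ β -> (∀ ε -> ¬ (β ⊞ δ ≈ ε)) -> ∀ Λ {rest} -> ⟪ Λ , conjugate β 1# (Ad δ) ⟫ ≈ ⟪ Λ , Ad δ ⟫ + rest -> rest ≈ 0#
   fixed-eq {β} {δ} comm p q Λ eq = cancelˡ (S.sym eq S.& ⟪⟫-cong Λ (transport {β} {XR δ} comm (conj⇒conjugate {β} {1#} {XR δ} (conj-fixed p q 1#))) S.& S.sym (S.+-identityʳ _))

   step-matrix : ∀ {β δ ε} -> g M.* x β 1# M.≈ x β 1# M.* g -> β ⊞ δ ≈ ε -> (∀ ζ -> ¬ (β ⊞ ε ≈ ζ)) -> conjugate β 1# (Ad δ) M.≈ Ad δ M.+ ι (N β δ ε) M.⊙ Ad ε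
   step-matrix {β} {δ} {ε} comm p q = transport {β} {XR δ} comm (conj⇒conjugate {β} {1#} {XR δ} (conj-step p q 1#)) M.& M.solve (ι (N β δ ε) :: []) (g :: g~ :: XR δ :: XR ε :: []) (m0 :* ((m2 :+
    (1: *: s0) :% m3) :* m1)) (m0 :* (m2 :* m1) :+ s0 :% (m0 :* (m3 :* m1)))

   step-eq : ∀ {β δ ε} -> g M.* x β 1# M.≈ x β 1# M.* g -> β ⊞ δ ≈ ε -> (∀ ζ -> ¬ (β ⊞ ε ≈ ζ)) -> ∀ Λ {rest} -> ⟪ Λ , conjugate β 1# (Ad δ) ⟫ ≈ ⟪ Λ , Ad δ ⟫ + rest -> rest ≈ ι (N β δ ε) * ⟪ Λ , Ad
    ε ⟫
   step-eq {β} {δ} {ε} comm p q Λ eq = cancelˡ (S.sym eq S.& ⟪⟫-cong Λ (step-matrix comm p q) S.& ⟪⟫-+ Λ (Ad δ) _ S.& S.+-congˡ (⟪⟫-% Λ _ (Ad ε)))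

   two-eq : ∀ {β δ ε ζ} -> g M.* x β 1# M.≈ x β 1# M.* g -> (p : β ⊞ δ ≈ ε) (q : β ⊞ ε ≈ ζ) -> ∀ Λ {rest} -> ⟪ Λ , conjugate β 1# (Ad δ) ⟫ ≈ ⟪ Λ , Ad δ ⟫ + rest -> rest ≈ ι (N β δ ε) * ⟪ Λ , Ad ε
    ⟫ + ι (halfN p q) * ⟪ Λ , Ad ζ ⟫
   two-eq {β} {δ} {ε} {ζ} comm p q Λ eq = cancelˡ (S.sym eq S.& ⟪⟫-cong Λ (transport {β} {XR δ} comm (conj⇒conjugate {β} {1#} {XR δ} (conj-two-steps p q 1#)) M.& M.solve (ι (N β δ ε) :: ι
    (halfN p q) :: []) (g :: g~ :: XR δ :: XR ε :: XR ζ :: []) (m0 :* ((m2 :+ (1: *: s0) :% m3 :+ (1: *: 1: *: s1) :% m4) :* m1)) (m0 :* (m2 :* m1) :+ (s0 :% (m0 :* (m3 :* m1)) :+ s1 :% (m0 :* (m4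
    :* m1))))) S.& ⟪⟫-+ Λ (Ad δ) _ S.& S.+-congˡ (⟪⟫-+ Λ (ι (N β δ ε) M.⊙ Ad ε) _ S.& S.+-cong (⟪⟫-% Λ _ (Ad ε)) (⟪⟫-% Λ _ (Ad ζ))))

   unit-cancel : ∀ {u} -> u O.* u ≡ + 1 -> ∀ {s t} -> ι u * s ≈ ι u * t -> s ≈ t
   unit-cancel {u} p {s} {t} eq = expand s S.& S.*-congˡ eq S.& S.sym (expand t)
    where
    expand : ∀ s -> s ≈ ι u * (ι u * s)
    expand s = S.sym (S.*-identityˡ s) S.& S.*-congʳ (S.sym ι-1 S.& ι-cong (J.sym p) S.& ι-* u u) S.& S.*-assoc _ _ _

   unit-zero : ∀ {u} -> u O.* u ≡ + 1 -> ∀ {s} -> 0# ≈ ι u * s -> s ≈ 0#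
   unit-zero {u} p eq = unit-cancel {u} p (S.sym eq S.& S.sym (S.zeroʳ _))

   times-zero : ∀ {s t} -> t ≈ 0# -> s * t ≈ 0#
   times-zero p = S.*-congˡ p S.& S.zeroʳ _

   hval-zero : ∀ {β γ s} -> pairing β γ ≡ + 0 -> ι (hval β γ) * s ≈ 0#
   hval-zero {β} {γ} p = S.*-congʳ (ι-cong (hval≡ β γ ⟫ p)) S.& S.zeroˡ _

   -- Ad p has no component outside the image of ad q, and ad(-b), ad b connect p and a.
   q-a≈p : qr ⊞ -ᴿ ar ≈ pr
   q-a≈p = ⟨ rfl , rfl ⟩
   -b+p≈a : -ᴿ br ⊞ pr ≈ ar
   -b+p≈a = ⟨ rfl , rfl ⟩

   from-Ad-a~ : ∀ Λ {rest} -> ⟪ Λ , conjugate qr 1# (Ad (-ᴿ ar)) ⟫ ≈ ⟪ Λ , Ad (-ᴿ ar) ⟫ + rest -> rest ≈ 0# -> ⟪ Λ , Ad pr ⟫ ≈ 0#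
   from-Ad-a~ Λ eq r≈0 = unit-zero {N qr (-ᴿ ar) pr} (N-unit q-a≈p rfl) (S.sym r≈0 S.& step-eq (commutes at-q) q-a≈p (no-sum qr pr) Λ eq)

   v-b-p : v br pr ≈ 0#
   v-b-p = from-Ad-a~ (φ br) (fixed-φ1 (lieLike (-ᴿ ar)) (\ ()) (no-source qr br)) S.refl

   v-a~-p : v (-ᴿ ar) pr ≈ 0#
   v-a~-p = from-Ad-a~ (φ (-ᴿ ar)) (fixed-φ1 (lieLike (-ᴿ ar)) (\ ()) (no-source qr (-ᴿ ar))) S.refl

   w-b~-p : w (-ᴿ br) pr ≈ 0#
   w-b~-p = from-Ad-a~ (κ (-ᴿ br)) (step-κ1 (lieLike (-ᴿ ar)) qr (-ᴿ br)) (hval-zero rfl)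

   from-Ad-p : ∀ Λ {rest} -> ⟪ Λ , conjugate (-ᴿ br) 1# (Ad pr) ⟫ ≈ ⟪ Λ , Ad pr ⟫ + rest -> rest ≈ 0# -> ⟪ Λ , Ad ar ⟫ ≈ 0#
   from-Ad-p Λ eq r≈0 = unit-zero {N (-ᴿ br) pr ar} (N-unit -b+p≈a rfl) (S.sym r≈0 S.& step-eq (commutes at-b~) -b+p≈a (no-sum (-ᴿ br) ar) Λ eq)

  scalar : S.Carrier
  scalar = v ar ar

  private
   off-a : ∀ γ -> γ ≢ ar -> v γ ar ≈ 0#
   off-a (short pos neg) p = contradiction rfl p
   off-a (short pos pos) p = from-Ad-p (φ pr) (fixed-φ1 (lieLike pr) (\ ()) (no-source (-ᴿ br) pr)) S.refl
   off-a (short neg pos) p = from-Ad-p (φ (-ᴿ ar)) (fixed-φ1 (lieLike pr) (\ ()) (no-source (-ᴿ br) (-ᴿ ar))) S.refl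
   off-a (short neg neg) p = from-Ad-p (φ (-ᴿ pr)) (step-φ1 (lieLike pr) { -ᴿ br} { -ᴿ ar} ⟨ rfl , rfl ⟩ (\ ()) (no-source (-ᴿ br) (-ᴿ ar))) (times-zero v-a~-p)
   off-a (long 0F pos) p = from-Ad-p (φ qr) (fixed-φ1 (lieLike pr) (\ ()) (no-source (-ᴿ br) qr)) S.refl
   off-a (long 0F neg) p = from-Ad-p (φ (-ᴿ qr)) (fixed-φ1 (lieLike pr) (\ ()) (no-source (-ᴿ br) (-ᴿ qr))) S.refl
   off-a (long 1F pos) p = from-Ad-p (φ br) (fixed-φ1 (lieLike pr) (\ ()) (no-source (-ᴿ br) br)) S.refl
   off-a (long 1F neg) p = from-Ad-p (φ (-ᴿ br)) (self-φ1 (lieLike pr) (-ᴿ br)) (S.+-cong (S.-‿cong w-b~-p) (S.-‿cong v-b-p) S.& solves [] (-: 0: -: 0:) 0:)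

   w-b-a : w br ar ≈ 0#
   w-b-a = from-Ad-p (κ br) (step-κ1 (lieLike pr) (-ᴿ br) br) (times-zero v-b-p)

  w-a-a : w ar ar ≈ 0#
  w-a-a = from-Ad-p (κ ar) (step-κ1 (lieLike pr) (-ᴿ br) ar) (times-zero v-b-p)

  private
   matrix-cancel : ∀ {u} {A B : M.Mat n} -> u O.* u ≡ + 1 -> ι u M.⊙ A M.≈ ι u M.⊙ B -> A M.≈ B
   matrix-cancel {u} p eq i j = unit-cancel {u} p (eq i j)

   +-cancel : ∀ {A B C : M.Mat n} -> A M.+ B M.≈ A M.+ C -> B M.≈ C
   +-cancel {A} {B} {C} = M.+-cancelˡ A B C

   b+a≈p : br ⊞ ar ≈ pr
   b+a≈p = ⟨ rfl , rfl ⟩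

  Ad-p : Ad pr M.≈ scalar M.⊙ XR pr
  Ad-p = matrix-cancel {N br ar pr} {Ad pr} {scalar M.⊙ XR pr} (N-unit b+a≈p rfl) (+-cancel {Ad ar} (M.sym (step-matrix (commutes at-b) b+a≈p (no-sum br pr)) M.& conjugate-single (lieLike
   ar) {br} {ar} {scalar} S.refl off-a w-b-a M.& M.+-congˡ {x = Ad ar} (M.%-cong S.refl (M.+-congʳ (conj⇒conjugate {br} {1#} {XR ar} (conj-step b+a≈p (no-sum br pr) 1#))) M.& M.solve (scalar
   :: ι (N br ar pr) :: []) (XR ar :: XR pr :: []) (s0 :% (m0 :+ (1: *: s1) :% m1 :- m0)) (s1 :% s0 :% m1))))

  Ad-a : Ad ar M.≈ scalar M.⊙ XR ar
  Ad-a = matrix-cancel {N (-ᴿ br) pr ar} {Ad ar} {scalar M.⊙ XR ar} (N-unit -b+p≈a rfl) (+-cancel {Ad pr} (M.sym (step-matrix (commutes at-b~) -b+p≈a (no-sum (-ᴿ br) ar)) M.&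
   LieSpan.conjugate-cong R π (-ᴿ br) 1# Ad-p M.& LieSpan.conjugate-% R π (-ᴿ br) 1# scalar (XR pr) M.& M.%-cong S.refl (conj⇒conjugate { -ᴿ br} {1#} {XR pr} (conj-step -b+p≈a (no-sum (-ᴿ
   br) ar) 1#)) M.& M.solve (scalar :: ι (N (-ᴿ br) pr ar) :: []) (XR ar :: XR pr :: []) (s0 :% (m1 :+ (1: *: s1) :% m0)) (s0 :% m1 :+ s1 :% s0 :% m0) M.& M.+-congʳ (M.sym Ad-p)))

  module WithUnitScalar {s'} (scalar-unit : scalar * s' ≈ 1#) where
   private
    scalar-cancel : ∀ {s t} -> scalar * s ≈ scalar * t -> s ≈ t
    scalar-cancel {s} {t} eq = expand s S.& S.*-congˡ eq S.& S.sym (expand t)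
     where
     expand : ∀ s -> s ≈ s' * (scalar * s)
     expand s = S.sym (S.*-identityˡ s) S.& S.*-congʳ (S.sym scalar-unit S.& S.*-comm _ _) S.& S.*-assoc _ _ _

    p-b≈a : pr ⊞ -ᴿ br ≈ ar
    p-b≈a = ⟨ rfl , rfl ⟩
    p+a≈q : pr ⊞ ar ≈ qr
    p+a≈q = ⟨ rfl , rfl ⟩

    -- [Ad p, Ad(-b)] = N Ad a
    bracket-eq : ∀ Λ {rest} -> ⟪ Λ , XR pr M.* Ad (-ᴿ br) ⟫ ≈ ⟪ Λ , Ad (-ᴿ br) M.* XR pr ⟫ + rest -> scalar * rest ≈ ι (N pr (-ᴿ br) ar) * ⟪ Λ , Ad ar ⟫
    bracket-eq Λ {rest} eq = cancelˡ {scalar * ⟪ Λ , B M.* XR pr ⟫} (S.sym (S.distribˡ _ _ _) S.& S.*-congˡ (S.sym eq) S.& S.sym (⟪⟫-% Λ scalar (XR pr M.* B)) S.& ⟪⟫-cong Λ matrices S.& ⟪⟫-+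
     Λ (scalar M.⊙ (B M.* XR pr)) _ S.& S.+-cong (⟪⟫-% Λ scalar (B M.* XR pr)) (⟪⟫-% Λ _ (Ad ar)))
     where
     B = Ad (-ᴿ br)
     ν = ι (N pr (-ᴿ br) ar)
     product : ∀ δ ε -> Ad δ M.* Ad ε M.≈ g M.* ((XR δ M.* XR ε) M.* g~)
     product δ ε = M.solve [] (g :: g~ :: XR δ :: XR ε :: []) ((m0 :* (m2 :* m1)) :* (m0 :* (m3 :* m1))) (m0 :* m2 :* (m1 :* m0) :* m3 :* m1) M.& M.congr g~ (M.congr (XR ε) (M.congl (g M.* XR δ)
      inverseˡ M.& M.*-identityʳ (g M.* XR δ))) M.& M.solve [] (g :: g~ :: XR δ :: XR ε :: []) (m0 :* m2 :* m3 :* m1) (m0 :* ((m2 :* m3) :* m1))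
     bracketR : XR pr M.* XR (-ᴿ br) M.≈ XR (-ᴿ br) M.* XR pr M.+ ν M.⊙ XR ar
     bracketR = M.sym (ιM-* (X pr) (X (-ᴿ br))) M.& ιM-cong {A = X pr I.* X (-ᴿ br)} (bracket-sum p-b≈a) M.& ιM-+ (X (-ᴿ br) I.* X pr) _ M.& M.+-cong (ιM-* (X (-ᴿ br)) (X pr)) (ιM-· (N pr
      (-ᴿ br) ar) (X ar))
     matrices : scalar M.⊙ (XR pr M.* B) M.≈ scalar M.⊙ (B M.* XR pr) M.+ ν M.⊙ Ad ar
     matrices = M.solve (scalar :: []) (XR pr :: B :: []) (s0 :% (m0 :* m1)) ((s0 :% m0) :* m1) M.& M.congr B (M.sym Ad-p) M.& product pr (-ᴿ br) M.& M.congl g (M.congr g~ bracketR) M.& M.solve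
      (ν :: []) (g :: g~ :: XR (-ᴿ br) M.* XR pr :: XR ar :: []) (m0 :* ((m2 :+ s0 :% m3) :* m1)) (m0 :* (m2 :* m1) :+ s0 :% (m0 :* (m3 :* m1))) M.& M.+-congʳ (M.sym (product (-ᴿ br) pr) M.&
      M.congl B Ad-p M.& M.solve (scalar :: []) (XR pr :: B :: []) (m1 :* (s0 :% m0)) (s0 :% (m1 :* m0)))

    v-b~-b~ : v (-ᴿ br) (-ᴿ br) ≈ 1#
    v-b~-b~ = scalar-cancel (unit-cancel {N pr (-ᴿ br) ar} (N-unit p-b≈a rfl) (solves (scalar :: ι (N pr (-ᴿ br) ar) :: v (-ᴿ br) (-ᴿ br) :: []) (s1 *: (s0 *: s2)) (s0 *: (s1 *: s2)) S.&
     bracket-eq (φ ar) (bracket-φ (lieLike (-ᴿ br)) p-b≈a) S.& S.*-congˡ (S.sym (S.*-identityʳ scalar))))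

    v-a-b~ : ι (N pr ar qr) * v ar (-ᴿ br) ≈ 0#
    v-a-b~ = scalar-cancel (bracket-eq (φ qr) (bracket-φ (lieLike (-ᴿ br)) p+a≈q) S.& times-zero (off-a qr \ ()) S.& S.sym (S.zeroʳ scalar))

   v-a-q : v ar qr ≈ 0#
   v-a-q = unit-zero {N br ar pr} (N-unit b+a≈p rfl) (S.sym (fixed-eq {br} {qr} (commutes at-b) (\ ()) (no-sum br qr) (φ pr) (step-φ1 (lieLike qr) b+a≈p (\ ()) (no-source br ar))))

   v-p-q : v pr qr ≈ 0#
   v-p-q = unit-zero {N (-ᴿ br) pr ar} (N-unit -b+p≈a rfl) (S.sym (fixed-eq { -ᴿ br} {qr} (commutes at-b~) (\ ()) (no-sum (-ᴿ br) qr) (φ ar) (step-φ1 (lieLike qr) -b+p≈a (\ ()) (no-source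
    (-ᴿ br) pr))))

   scalar≈1 : scalar ≈ 1#
   scalar≈1 = S.sym (S.sym v-b~-b~ S.& unit-cancel {N pr (-ᴿ br) ar} (N-unit p-b≈a rfl) (two-eq (commutes at-p) p-b≈a p+a≈q (φ ar) (step-φ1 (lieLike (-ᴿ br)) p-b≈a (\ ()) (no-source pr (-ᴿ
    br))) S.& S.+-congˡ (times-zero v-a-q) S.& S.+-identityʳ _))

   v-q-q : v qr qr ≈ 1#
   v-q-q = S.sym (S.sym v-b~-b~ S.& unit-cancel {halfN p-b≈a p+a≈q} (halfN-unit p-b≈a p+a≈q rfl) (S.sym (S.+-congʳ v-a-b~ S.& S.+-identityˡ _) S.& two-eq (commutes at-p) p-b≈a p+a≈q (φ qr)
    (two-steps-φ1 (lieLike (-ᴿ br)) p-b≈a p+a≈q) S.& S.+-congʳ (times-zero (off-a qr \ ())) S.& S.+-identityˡ _))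

   w-a-q : w ar qr ≈ 0#
   w-a-q = unit-zero {halfN p-b≈a p+a≈q} (halfN-unit p-b≈a p+a≈q rfl) (S.sym (hval-zero {pr} {ar} rfl) S.& two-eq (commutes at-p) p-b≈a p+a≈q (κ ar) (step-κ1 (lieLike (-ᴿ br)) pr ar) S.&
    S.+-congʳ (times-zero w-a-a) S.& S.+-identityˡ _)

   private
    Ad-p-value : ∀ γ -> v γ pr ≈ ι (indicator γ pr)
    Ad-p-value γ = ⟪⟫-cong (φ γ) Ad-p S.& ⟪⟫-% (φ γ) scalar (XR pr) S.& S.*-cong scalar≈1 (φ-X γ pr) S.& S.*-identityˡ _

    q-p≈a : qr ⊞ -ᴿ pr ≈ ar
    q-p≈a = ⟨ rfl , rfl ⟩

   v-q-p : v qr pr ≈ 0#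
   v-q-p = Ad-p-value qr
   v-p-p : v pr pr ≈ 1#
   v-p-p = Ad-p-value pr S.& ι-1
   v-a-p : v ar pr ≈ 0#
   v-a-p = Ad-p-value ar

   v-p~-p~ : v (-ᴿ pr) (-ᴿ pr) ≈ 1#
   v-p~-p~ = unit-cancel {N qr (-ᴿ pr) ar} (N-unit q-p≈a rfl) (step-eq (commutes at-q) q-p≈a (no-sum qr ar) (φ ar) (step-φ1 (lieLike (-ᴿ pr)) q-p≈a (\ ()) (no-source qr (-ᴿ pr)))) S.&
    scalar≈1

   v-a~-p~ : v (-ᴿ ar) (-ᴿ pr) ≈ 0#
   v-a~-p~ = unit-zero {N qr (-ᴿ ar) pr} (N-unit q-a≈p rfl) (S.sym (step-eq (commutes at-q) q-p≈a (no-sum qr ar) (φ pr) (step-φ1 (lieLike (-ᴿ pr)) q-a≈p (\ ()) (no-source qr (-ᴿ ar))) S.&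
    times-zero (off-a pr \ ())))

   v-q~-p~ : v (-ᴿ qr) (-ᴿ pr) ≈ 0#
   v-q~-p~ = (S.sym (S.*-identityˡ _) S.& S.*-congʳ (S.sym ι-1 S.& ι-cong (J.sym (hval≡ qr ar)))) S.& step-eq (commutes at-q) q-p≈a (no-sum qr ar) (κ ar) (step-κ1 (lieLike (-ᴿ pr)) qr ar)
    S.& times-zero w-a-a

   v-p~-q~ : v (-ᴿ pr) (-ᴿ qr) ≈ 0#
   v-p~-q~ = unit-zero {N br (-ᴿ pr) (-ᴿ ar)} (N-unit {br} { -ᴿ pr} ⟨ rfl , rfl ⟩ rfl) (S.sym (fixed-eq {br} { -ᴿ qr} (commutes at-b) (\ ()) (no-sum br (-ᴿ qr)) (φ (-ᴿ ar)) (step-φ1 (lieLike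
    (-ᴿ qr)) {br} { -ᴿ pr} ⟨ rfl , rfl ⟩ (\ ()) (no-source br (-ᴿ pr)))))

   v-a~-q~ : v (-ᴿ ar) (-ᴿ qr) ≈ 0#
   v-a~-q~ = unit-zero {N (-ᴿ br) (-ᴿ ar) (-ᴿ pr)} (N-unit { -ᴿ br} { -ᴿ ar} ⟨ rfl , rfl ⟩ rfl) (S.sym (fixed-eq { -ᴿ br} { -ᴿ qr} (commutes at-b~) (\ ()) (no-sum (-ᴿ br) (-ᴿ qr)) (φ (-ᴿ
    pr)) (step-φ1 (lieLike (-ᴿ qr)) { -ᴿ br} { -ᴿ ar} ⟨ rfl , rfl ⟩ (\ ()) (no-source (-ᴿ br) (-ᴿ ar)))))

   private
    v-p~-b~ : v (-ᴿ pr) (-ᴿ br) ≈ 0#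
    v-p~-b~ = unit-zero {N qr (-ᴿ pr) ar} (N-unit q-p≈a rfl) (S.sym (fixed-eq {qr} { -ᴿ br} (commutes at-q) (\ ()) (no-sum qr (-ᴿ br)) (φ ar) (step-φ1 (lieLike (-ᴿ br)) q-p≈a (\ ())
     (no-source qr (-ᴿ pr)))))

    a-q≈-p : ar ⊞ -ᴿ qr ≈ -ᴿ pr
    a-q≈-p = ⟨ rfl , rfl ⟩
    a-p≈-b : ar ⊞ -ᴿ pr ≈ -ᴿ br
    a-p≈-b = ⟨ rfl , rfl ⟩

   v-q~-q~ : v (-ᴿ qr) (-ᴿ qr) ≈ 1#
   v-q~-q~ = unit-cancel {N ar (-ᴿ qr) (-ᴿ pr)} (N-unit a-q≈-p rfl) (two-eq (commutes at-a) a-q≈-p a-p≈-b (φ (-ᴿ pr)) (step-φ1 (lieLike (-ᴿ qr)) a-q≈-p (\ ()) (no-source ar (-ᴿ qr))) S.&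
    S.+-congˡ (times-zero v-p~-b~) S.& S.+-identityʳ _) S.& v-p~-p~

 module _ {g g~} (cz : Centralizing g g~) (cz~ : Centralizing g~ g) where
  private
   module E = Equations cz
   module E~ = Equations cz~

  scalars-inverse : E.scalar * E~.scalar ≈ 1#
  scalars-inverse = (S.*-congˡ (S.refl {E~.scalar}) S.& S.sym (⟪⟫-% (φ ar) E.scalar (E~.Ad ar))) S.& ⟪⟫-cong (φ ar) (M.solve (E.scalar :: []) (g :: g~ :: XR ar :: []) (s0 :% (m1 :* (m2 :* m0)))
   (m1 :* ((s0 :% m2) :* m0)) M.& M.congl g~ (M.congr g (M.sym E.Ad-a)) M.& M.solve [] (g :: g~ :: XR ar :: []) (m1 :* ((m0 :* (m2 :* m1)) :* m0)) ((m1 :* m0) :* m2 :* (m1 :* m0)) M.& M.*-cong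
   (M.congr (XR ar) (Centralizing.inverseˡ cz)) (Centralizing.inverseˡ cz) M.& M.solve [] (XR ar :: []) (:1 :* m0 :* :1) (m0)) S.& φ-X ar ar S.& ι-cong (indicator-self ar) S.& ι-1

-- Determinants

-- Elements of the exterior algebra of Aⁿ are families indexed by the subsets of the
-- basis, and L v is left multiplication by the vector v.
module ExteriorAlgebra {a} {A : Set a} (_+_ _*_ : A -> A -> A) (-_ : A -> A) (0# 1# : A) where
 Form : ℕ -> Set a
 Form n = Vec Bool n -> A

 L : ∀ {n} -> (Fin n -> A) -> Form n -> Form n
 L v f [] = 0#
 L v f (false :: s) = L (v ∘ F.suc) (\ s -> f (false :: s)) s
 L v f (true :: s) = (v 0F * f (false :: s)) + (- L (v ∘ F.suc) (\ s -> f (true :: s)) s)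

 empty : ∀ {n} -> Form n
 empty [] = 1#
 empty (false :: s) = empty s
 empty (true :: s) = 0#

 wedge : ∀ {m n} -> (Fin m -> Fin n -> A) -> Form n
 wedge {zero} r = empty
 wedge {suc m} r = L (r 0F) (wedge (r ∘ F.suc))

 full : ∀ n -> Vec Bool n
 full zero = []
 full (suc n) = true :: full n

 det : ∀ {n} -> (Fin n -> Fin n -> A) -> A
 det {n} r = wedge r (full n)

 alternate : ℕ -> A -> A
 alternate zero x = x
 alternate (suc k) x = - alternate k x

 adjugate : ∀ {n} -> (Fin n -> Fin n -> A) -> Fin n -> Fin n -> A
 adjugate {suc n} r j i = alternate (# i) (L (\ k -> if does (j F.≟ k) then 1# else 0#) (wedge (r ∘ punchIn i)) (full (suc n)))

module Determinant {c ℓ} (S : CommutativeRing c ℓ) where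
 open Exponential S
 open S
 open ExteriorAlgebra _+_ _*_ (-_) 0# 1# public
 open Reasoning setoid

 infix 4 _≈ᶠ_
 _≈ᶠ_ : ∀ {n} -> Form n -> Form n -> Set ℓ
 f ≈ᶠ g = ∀ s -> f s ≈ g s

 L-cong : ∀ {n} {u v : Fin n -> Carrier} {f g : Form n} -> (∀ i -> u i ≈ v i) -> f ≈ᶠ g -> L u f ≈ᶠ L v g
 L-cong p q [] = refl
 L-cong p q (false :: s) = L-cong (p ∘ F.suc) (\ s -> q (false :: s)) s
 L-cong p q (true :: s) = +-cong (*-cong (p 0F) (q (false :: s))) (-‿cong (L-cong (p ∘ F.suc) (\ s -> q (true :: s)) s))

 L-form : ∀ {n} (v : Fin n -> Carrier) r (f g : Form n) -> L v (\ s -> r * f s + g s) ≈ᶠ \ s -> r * L v f s + L v g s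
 L-form v r f g [] = solves (r :: []) 0: (s0 *: 0: +: 0:)
 L-form v r f g (false :: s) = L-form (v ∘ F.suc) r (\ s -> f (false :: s)) (\ s -> g (false :: s)) s
 L-form v r f g (true :: s) = +-congˡ (-‿cong (L-form (v ∘ F.suc) r (\ s -> f (true :: s)) (\ s -> g (true :: s)) s)) & solves (v 0F :: r :: f (false :: s) :: g (false :: s) :: L (v ∘ F.suc) (\ s -> f
  (true :: s)) s :: L (v ∘ F.suc) (\ s -> g (true :: s)) s :: []) (s0 *: (s1 *: s2 +: s3) +: (-: (s1 *: s4 +: s5))) (s1 *: (s0 *: s2 +: (-: s4)) +: (s0 *: s3 +: (-: s5)))

 L-vector : ∀ {n} r (u v : Fin n -> Carrier) (f : Form n) -> L (\ i -> r * u i + v i) f ≈ᶠ \ s -> r * L u f s + L v f s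
 L-vector r u v f [] = solves (r :: []) 0: (s0 *: 0: +: 0:)
 L-vector r u v f (false :: s) = L-vector r (u ∘ F.suc) (v ∘ F.suc) (\ s -> f (false :: s)) s
 L-vector r u v f (true :: s) = +-congˡ (-‿cong (L-vector r (u ∘ F.suc) (v ∘ F.suc) (\ s -> f (true :: s)) s)) & solves (u 0F :: v 0F :: r :: f (false :: s) :: L (u ∘ F.suc) (\ s -> f (true :: s)) s ::
  L (v ∘ F.suc) (\ s -> f (true :: s)) s :: []) ((s2 *: s0 +: s1) *: s3 +: (-: (s2 *: s4 +: s5))) (s2 *: (s0 *: s3 +: (-: s4)) +: (s1 *: s3 +: (-: s5)))

 L-zero : ∀ {n} (f : Form n) -> L (\ _ -> 0#) f ≈ᶠ \ _ -> 0#
 L-zero f [] = refl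
 L-zero f (false :: s) = L-zero (\ s -> f (false :: s)) s
 L-zero f (true :: s) = +-congˡ (-‿cong (L-zero (\ s -> f (true :: s)) s)) & solves (f (false :: s) :: []) (0: *: s0 +: (-: 0:)) 0:

 L-null : ∀ {n} (v : Fin n -> Carrier) {f : Form n} -> (f ≈ᶠ \ _ -> 0#) -> L v f ≈ᶠ \ _ -> 0#
 L-null v p [] = refl
 L-null v p (false :: s) = L-null (v ∘ F.suc) (\ s -> p (false :: s)) s
 L-null v p (true :: s) = +-cong (*-congˡ (p (false :: s))) (-‿cong (L-null (v ∘ F.suc) (\ s -> p (true :: s)) s)) & solves (v 0F :: []) (s0 *: 0: +: (-: 0:)) 0:

 L-sum : ∀ {m n} (k : Fin m -> Carrier) (w : Fin m -> Fin n -> Carrier) (f : Form n) -> L (\ j -> sum (\ i -> k i * w i j)) f ≈ᶠ \ s -> sum (\ i -> k i * L (w i) f s)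
 L-sum {zero} k w f s = L-zero f s
 L-sum {suc m} k w f s = L-vector (k 0F) (w 0F) (\ j -> sum (\ i -> k (F.suc i) * w (F.suc i) j)) f s & +-congˡ (L-sum (k ∘ F.suc) (w ∘ F.suc) f s)

 private
  expand : ∀ {n} (u v : Fin (suc n) -> Carrier) (f : Form (suc n)) s -> L u (L v f) (true :: s) ≈ u 0F * L (v ∘ F.suc) (\ s -> f (false :: s)) s - (v 0F * L (u ∘ F.suc) (\ s -> f (false :: s)) s -
   L (u ∘ F.suc) (L (v ∘ F.suc) (\ s -> f (true :: s))) s)
  expand u v f s = +-congˡ (-‿cong (L-form (u ∘ F.suc) (v 0F) (\ s -> f (false :: s)) (\ s -> - L (v ∘ F.suc) (\ s -> f (true :: s)) s) s & +-congˡ (L-cong (\ _ -> refl) (\ s -> sym (-1*x≈-x _) &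
   sym (+-identityʳ _)) s & L-form (u ∘ F.suc) (- 1#) (L (v ∘ F.suc) (\ s -> f (true :: s))) (\ _ -> 0#) s & +-cong (-1*x≈-x _) (L-null (u ∘ F.suc) (\ _ -> refl) s) & +-identityʳ _)))

 L-square : ∀ {n} (v : Fin n -> Carrier) (f : Form n) -> L v (L v f) ≈ᶠ \ _ -> 0#
 L-square v f [] = refl
 L-square v f (false :: s) = L-square (v ∘ F.suc) (\ s -> f (false :: s)) s
 L-square v f (true :: s) = expand v v f s & +-congˡ (-‿cong (+-congˡ (-‿cong (L-square (v ∘ F.suc) (\ s -> f (true :: s)) s)))) & solves (v 0F :: L (v ∘ F.suc) (\ s -> f (false :: s)) s :: []) (s0
  *: s1 -: (s0 *: s1 -: 0:)) 0:

 L-swap : ∀ {n} (u v : Fin n -> Carrier) (f : Form n) -> L u (L v f) ≈ᶠ \ s -> - L v (L u f) s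
 L-swap u v f [] = sym -0#≈0#
 L-swap u v f (false :: s) = L-swap (u ∘ F.suc) (v ∘ F.suc) (\ s -> f (false :: s)) s
 L-swap u v f (true :: s) = expand u v f s & +-congˡ (-‿cong (+-congˡ (-‿cong (L-swap (u ∘ F.suc) (v ∘ F.suc) (\ s -> f (true :: s)) s)))) & solves (u 0F :: v 0F :: L (u ∘ F.suc) (\ s -> f (false
  :: s)) s :: L (v ∘ F.suc) (\ s -> f (false :: s)) s :: L (v ∘ F.suc) (L (u ∘ F.suc) (\ s -> f (true :: s))) s :: []) (s0 *: s3 -: (s1 *: s2 -: (-: s4))) (-: (s1 *: s2 -: (s0 *: s3 -: s4))) &
  -‿cong (sym (expand v u f s))

 wedge-cong : ∀ {m n} {r r' : Fin m -> Fin n -> Carrier} -> (∀ i j -> r i j ≈ r' i j) -> wedge r ≈ᶠ wedge r'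
 wedge-cong {zero} p s = refl
 wedge-cong {suc m} p s = L-cong (p 0F) (wedge-cong (\ i -> p (F.suc i))) s

 det-cong : ∀ {n} {r r' : Fin n -> Fin n -> Carrier} -> (∀ i j -> r i j ≈ r' i j) -> det r ≈ det r'
 det-cong p = wedge-cong p _

 private
  L-neg : ∀ {n} (v : Fin n -> Carrier) (f : Form n) -> L v (\ s -> - f s) ≈ᶠ \ s -> - L v f s
  L-neg v f s = L-cong (\ _ -> refl) (\ s -> sym (-1*x≈-x _) & sym (+-identityʳ _)) s & L-form v (- 1#) f (\ _ -> 0#) s & +-cong (-1*x≈-x _) (L-null v (\ _ -> refl) s) & +-identityʳ _

 wedge-repeat : ∀ {m n} (r : Fin m -> Fin n -> Carrier) j -> L (r j) (wedge r) ≈ᶠ \ _ -> 0#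
 wedge-repeat {suc m} r F.zero s = L-square (r 0F) (wedge (r ∘ F.suc)) s
 wedge-repeat {suc m} r (F.suc j) s = L-swap (r (F.suc j)) (r 0F) (wedge (r ∘ F.suc)) s & -‿cong (L-null (r 0F) (wedge-repeat (r ∘ F.suc) j) s) & -0#≈0#

 wedge-insert : ∀ {m n} (r : Fin (suc m) -> Fin n -> Carrier) i -> L (r i) (wedge (r ∘ punchIn i)) ≈ᶠ \ s -> alternate (# i) (wedge r s)
 wedge-insert r F.zero s = refl
 wedge-insert {suc m} r (F.suc i) s = L-swap (r (F.suc i)) (r 0F) (wedge ((r ∘ F.suc) ∘ punchIn i)) s & -‿cong (L-cong (\ _ -> refl) (wedge-insert (r ∘ F.suc) i) s & L-alternate (# i) s)
  where
  L-alternate : ∀ k -> L (r 0F) (\ s -> alternate k (wedge (r ∘ F.suc) s)) ≈ᶠ \ s -> alternate k (L (r 0F) (wedge (r ∘ F.suc)) s)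
  L-alternate zero s = refl
  L-alternate (suc k) s = L-neg (r 0F) (\ s -> alternate k (wedge (r ∘ F.suc) s)) s & -‿cong (L-alternate k s)

 alternate-cong : ∀ k {x y} -> x ≈ y -> alternate k x ≈ alternate k y
 alternate-cong zero p = p
 alternate-cong (suc k) p = -‿cong (alternate-cong k p)

 private
  alternate-twice : ∀ k x -> alternate k (alternate k x) ≈ x
  alternate-twice zero x = refl
  alternate-twice (suc k) x = -‿cong (alternate-neg k (alternate k x)) & -‿involutive _ & alternate-twice k x
   where
   alternate-neg : ∀ k x -> alternate k (- x) ≈ - alternate k x
   alternate-neg zero x = refl
   alternate-neg (suc k) x = -‿cong (alternate-neg k x)

  alternate-* : ∀ k c x -> alternate k (c * x) ≈ c * alternate k x
  alternate-* zero c x = refl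
  alternate-* (suc k) c x = -‿cong (alternate-* k c x) & -‿distribʳ-* c _

  sum-only : ∀ {m} (v : Fin m -> Carrier) i -> (∀ j -> j ≢ i -> v j ≈ 0#) -> sum v ≈ v i
  sum-only {suc m} v F.zero p = +-congˡ (sum-zero {m} \ j -> p (F.suc j) \ ()) & +-identityʳ _
  sum-only {suc m} v (F.suc i) p = +-cong (p 0F \ ()) (sum-only (v ∘ F.suc) i \ j q -> p (F.suc j) (q ∘ F.suc-injective)) & +-identityˡ _

 -- Cramer's rule: e_j is the combination of the rows of r given by the j-th row of r⁻.
 adjugate-inverse : ∀ {n} (r r~ : M.Mat n) -> r~ M.* r M.≈ M.1# -> ∀ j i -> adjugate r j i ≈ r~ j i * det r
 adjugate-inverse {suc n} r r~ inverse j i = begin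
  alternate (# i) (L (\ k -> if does (j F.≟ k) then 1# else 0#) (wedge (r ∘ punchIn i)) top)
  ≈⟨ alternate-cong (# i) (trans (L-cong {f = wedge (r ∘ punchIn i)} (\ k -> sym (inverse j k)) (\ _ -> refl) top) (L-sum (r~ j) r (wedge (r ∘ punchIn i)) top)) ⟩
  alternate (# i) (sum (\ l -> r~ j l * L (r l) (wedge (r ∘ punchIn i)) top))
  ≈⟨ alternate-cong (# i) (sum-only _ i others) ⟩
  alternate (# i) (r~ j i * L (r i) (wedge (r ∘ punchIn i)) top)
  ≈⟨ alternate-* (# i) _ _ ⟩
  r~ j i * alternate (# i) (L (r i) (wedge (r ∘ punchIn i)) top)
  ≈⟨ *-congˡ (trans (alternate-cong (# i) (wedge-insert r i top)) (alternate-twice (# i) _)) ⟩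
  r~ j i * det r ∎
  where
  top = full (suc n)
  others : ∀ l -> l ≢ i -> r~ j l * L (r l) (wedge (r ∘ punchIn i)) top ≈ 0#
  others l l≢i = *-congˡ (reflexive (cong (\ m -> L (r m) (wedge (r ∘ punchIn i)) top) (J.sym (F.punchIn-punchOut (l≢i ∘ J.sym)))) & wedge-repeat (r ∘ punchIn i) (punchOut (l≢i ∘ J.sym)) top)
   & zeroʳ _

 private
  -- the algebra homomorphism of exterior algebras induced by a matrix
  Φ : ∀ {m n} -> (Fin m -> Fin n -> Carrier) -> Form m -> Form n
  Φ {zero} w f s = f [] * empty s
  Φ {suc m} w f s = Φ (w ∘ F.suc) (\ s -> f (false :: s)) s + L (w 0F) (Φ (w ∘ F.suc) (\ s -> f (true :: s))) s

  Φ-cong : ∀ {m n} (w : Fin m -> Fin n -> Carrier) {f g : Form m} -> f ≈ᶠ g -> Φ w f ≈ᶠ Φ w g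
  Φ-cong {zero} w p s = *-congʳ (p [])
  Φ-cong {suc m} w p s = +-cong (Φ-cong (w ∘ F.suc) (\ s -> p (false :: s)) s) (L-cong (\ _ -> refl) (Φ-cong (w ∘ F.suc) (\ s -> p (true :: s))) s)

  Φ-linear : ∀ {m n} (w : Fin m -> Fin n -> Carrier) r (f g : Form m) -> Φ w (\ s -> r * f s + g s) ≈ᶠ \ s -> r * Φ w f s + Φ w g s
  Φ-linear {zero} w r f g s = solves (r :: f [] :: g [] :: empty s :: []) ((s0 *: s1 +: s2) *: s3) (s0 *: (s1 *: s3) +: s2 *: s3)
  Φ-linear {suc m} w r f g s = +-cong (Φ-linear (w ∘ F.suc) r (\ s -> f (false :: s)) (\ s -> g (false :: s)) s) (L-cong (\ _ -> refl) (Φ-linear (w ∘ F.suc) r (\ s -> f (true :: s)) (\ s -> g (true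
   :: s))) s & L-form (w 0F) r _ _ s) & solves (r :: Φ (w ∘ F.suc) (\ s -> f (false :: s)) s :: Φ (w ∘ F.suc) (\ s -> g (false :: s)) s :: L (w 0F) (Φ (w ∘ F.suc) (\ s -> f (true :: s))) s :: L (w 0F)
   (Φ (w ∘ F.suc) (\ s -> g (true :: s))) s :: []) (s0 *: s1 +: s2 +: (s0 *: s3 +: s4)) (s0 *: (s1 +: s3) +: (s2 +: s4))

  Φ-null : ∀ {m n} (w : Fin m -> Fin n -> Carrier) {f : Form m} -> (f ≈ᶠ \ _ -> 0#) -> Φ w f ≈ᶠ \ _ -> 0#
  Φ-null {zero} w p s = *-congʳ (p []) & zeroˡ _
  Φ-null {suc m} w p s = +-cong (Φ-null (w ∘ F.suc) (\ s -> p (false :: s)) s) (L-null (w 0F) (Φ-null (w ∘ F.suc) (\ s -> p (true :: s))) s) & +-identityˡ _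

  Φ-L : ∀ {m n} (w : Fin m -> Fin n -> Carrier) v (f : Form m) -> Φ w (L v f) ≈ᶠ L (\ j -> sum (\ i -> v i * w i j)) (Φ w f)
  Φ-L {zero} w v f s = zeroˡ _ & sym (L-zero (Φ w f) s)
  Φ-L {suc m} w v f s = begin
   Φ w' (L v' f0) s + L w0 (Φ w' (\ s -> v 0F * f0 s - L v' f1 s)) s
   ≈⟨ +-cong (Φ-L w' v' f0 s) (trans (L-cong (\ _ -> refl) (\ s -> trans (Φ-linear w' (v 0F) f0 (\ s -> - L v' f1 s) s)
   (+-congˡ (trans (Φ-neg (L v' f1) s) (-‿cong (Φ-L w' v' f1 s))))) s)
   (trans (L-form w0 (v 0F) (Φ w' f0) (\ s -> - L u (Φ w' f1) s) s) (+-congˡ (trans (L-neg w0 (L u (Φ w' f1)) s)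
   (-‿cong (L-swap w0 u (Φ w' f1) s)))))) ⟩
   L u (Φ w' f0) s + (v 0F * L w0 (Φ w' f0) s - - L u (L w0 (Φ w' f1)) s)
   ≈⟨ solves (L u (Φ w' f0) s :: v 0F :: L w0 (Φ w' f0) s :: L u (L w0 (Φ w' f1)) s :: [])
   (s0 +: (s1 *: s2 -: (-: s3))) ((s1 *: s2 +: s0) +: (s1 *: 0: +: s3)) ⟩
   (v 0F * L w0 (Φ w' f0) s + L u (Φ w' f0) s) + (v 0F * 0# + L u (L w0 (Φ w' f1)) s)
   ≈⟨ +-cong (L-vector (v 0F) w0 u (Φ w' f0) s) (trans (L-vector (v 0F) w0 u (L w0 (Φ w' f1)) s) (+-congʳ (*-congˡ (L-square w0 (Φ w' f1) s)))) ⟨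
   L V (Φ w' f0) s + L V (L w0 (Φ w' f1)) s
   ≈⟨ trans (trans (sym (+-congʳ (*-identityˡ _))) (sym (L-form V 1# (Φ w' f0) (L w0 (Φ w' f1)) s)))
   (L-cong (\ _ -> refl) (\ s -> +-congʳ (*-identityˡ _)) s) ⟩
   L V (Φ w f) s ∎
   where
   w' = w ∘ F.suc
   w0 = w 0F
   v' = v ∘ F.suc
   f0 f1 : Form m
   f0 s = f (false :: s)
   f1 s = f (true :: s)
   u = \ j -> sum (\ i -> v' i * w' i j)
   V = \ j -> v 0F * w0 j + u j
   Φ-neg : ∀ g s -> Φ w' (\ s -> - g s) s ≈ - Φ w' g s
   Φ-neg g s = Φ-cong w' (\ s -> sym (-1*x≈-x _) & sym (+-identityʳ _)) s & Φ-linear w' (- 1#) g (\ _ -> 0#) s & +-cong (-1*x≈-x _) (Φ-null w' (\ _ -> refl) s) & +-identityʳ _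

  Φ-empty : ∀ {m n} (w : Fin m -> Fin n -> Carrier) -> Φ w empty ≈ᶠ empty
  Φ-empty {zero} w s = *-identityˡ _
  Φ-empty {suc m} w s = +-cong (Φ-empty (w ∘ F.suc) s) (L-null (w 0F) (Φ-null (w ∘ F.suc) (\ _ -> refl)) s) & +-identityʳ _

  Φ-wedge : ∀ {k m n} (w : Fin m -> Fin n -> Carrier) (r : Fin k -> Fin m -> Carrier) -> Φ w (wedge r) ≈ᶠ wedge (\ i j -> sum (\ l -> r i l * w l j))
  Φ-wedge {zero} w r s = Φ-empty w s
  Φ-wedge {suc k} w r s = Φ-L w (r 0F) (wedge (r ∘ F.suc)) s & L-cong (\ _ -> refl) (Φ-wedge w (r ∘ F.suc)) s

  size : ∀ {n} -> Vec Bool n -> ℕ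
  size [] = 0
  size (true :: s) = suc (size s)
  size (false :: s) = size s

  L-graded : ∀ {n} k (v : Fin n -> Carrier) (f : Form n) -> (∀ s -> size s ≢ k -> f s ≈ 0#) -> ∀ s -> size s ≢ suc k -> L v f s ≈ 0#
  L-graded k v f p [] q = refl
  L-graded k v f p (false :: s) q = L-graded k (v ∘ F.suc) (\ s -> f (false :: s)) (\ s -> p (false :: s)) s q
  L-graded k v f p (true :: s) q = +-cong (*-congˡ (p (false :: s) (\ e -> q (cong suc e))) & zeroʳ _) (-‿cong (lower k p q)) & +-identityˡ _ & -0#≈0#
   where
   lower : ∀ k -> (∀ s -> size s ≢ k -> f s ≈ 0#) -> suc (size s) ≢ suc k -> L (v ∘ F.suc) (\ s -> f (true :: s)) s ≈ 0#
   lower zero p q = L-null (v ∘ F.suc) (\ s -> p (true :: s) \ ()) s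
   lower (suc k) p q = L-graded k (v ∘ F.suc) (\ s -> f (true :: s)) (\ s r -> p (true :: s) (r ∘ N.suc-injective)) s (q ∘ cong suc)

  wedge-graded : ∀ {m n} (r : Fin m -> Fin n -> Carrier) s -> size s ≢ m -> wedge r s ≈ 0#
  wedge-graded {zero} r s p = empty-graded s p
   where
   empty-graded : ∀ {n} (s : Vec Bool n) -> size s ≢ 0 -> empty s ≈ 0#
   empty-graded [] p = contradiction rfl p
   empty-graded (false :: s) p = empty-graded s p
   empty-graded (true :: s) p = refl
  wedge-graded {suc m} r s p = L-graded m (r 0F) (wedge (r ∘ F.suc)) (wedge-graded (r ∘ F.suc)) s p

  size≤ : ∀ {n} (s : Vec Bool n) -> size s N.≤ n
  size≤ [] = z≤n
  size≤ (true :: s) = s≤s (size≤ s)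
  size≤ (false :: s) = N.m≤n⇒m≤1+n (size≤ s)

  Φ-full : ∀ {m n} (w : Fin m -> Fin n -> Carrier) (f : Form m) -> (∀ s -> size s ≢ m -> f s ≈ 0#) -> Φ w f ≈ᶠ \ s -> f (full m) * wedge w s
  Φ-full {zero} w f p s = refl
  Φ-full {suc m} w f p s = +-cong (Φ-null (w ∘ F.suc) (\ s -> p (false :: s) \ e -> N.<-irrefl e (s≤s (size≤ s))) s) (L-cong (\ _ -> refl) (\ s -> Φ-full (w ∘ F.suc) (\ s -> f (true :: s)) (\ s q ->
   p (true :: s) (q ∘ N.suc-injective)) s & sym (+-identityʳ _)) s & L-form (w 0F) (f (full (suc m))) (wedge (w ∘ F.suc)) (\ _ -> 0#) s & +-congˡ (L-null (w 0F) (\ _ -> refl) s)) & +-identityˡ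
   _ & +-identityʳ _

 det-* : ∀ {n} (A B : M.Mat n) -> det (A M.* B) ≈ det A * det B
 det-* {n} A B = sym (Φ-wedge B A (full n)) & Φ-full B (wedge A) (wedge-graded A) (full n)

 det-1 : ∀ {n} -> det (M.1# {n}) ≈ 1#
 det-1 {zero} = refl
 det-1 {suc n} = +-cong (*-identityˡ _ & (wedge-cong identity-rows (false :: full n) & fst (lower' (M.1# {n}) (full n))) & det-1 {n}) (-‿cong (L-cong {u = \ i -> M.1# {suc n} 0F (F.suc i)}
  {v = \ _ -> 0#} (\ _ -> refl) (\ _ -> refl) (full n) & L-zero _ (full n))) & +-congˡ -0#≈0# & +-identityʳ _
  where
  cons : (Fin n -> Carrier) -> Fin (suc n) -> Carrier
  cons v F.zero = 0#
  cons v (F.suc j) = v j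
  shift : ∀ {m} -> (Fin m -> Fin n -> Carrier) -> Fin m -> Fin (suc n) -> Carrier
  shift r i = cons (r i)
  lower' : ∀ {m} (r : Fin m -> Fin n -> Carrier) s -> (wedge (shift r) (false :: s) ≈ wedge r s) × (wedge (shift r) (true :: s) ≈ 0#)
  lower' {zero} r s = refl , refl
  lower' {suc m} r s = L-cong (\ _ -> refl) (\ s -> fst (lower' (r ∘ F.suc) s)) s , trans (+-cong (zeroˡ _) (-‿cong (L-null (r 0F) (\ s -> snd (lower' (r ∘ F.suc) s)) s))) (+-identityˡ _ &
   -0#≈0#)
  identity-rows : ∀ i j -> M.1# {suc n} (F.suc i) j ≈ shift (M.1# {n}) i j
  identity-rows i F.zero = refl
  identity-rows i (F.suc j) = refl

-- Integer polynomials in the matrix entries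

module PolynomialSyntax {n : ℕ} where
 negᴾ : Poly n -> Poly n
 negᴾ p = con -[1+ 0 ] ⊗ p

 open ExteriorAlgebra {A = Poly n} _⊕_ _⊗_ negᴾ (con (+ 0)) (con (+ 1)) using (L; wedge; adjugate; alternate; empty; det) public

 sumᴾ : ∀ {m} -> (Fin m -> Poly n) -> Poly n
 sumᴾ {zero} v = con (+ 0)
 sumᴾ {suc m} v = v 0F ⊕ sumᴾ (v ∘ F.suc)

 PolyMatrix : Set
 PolyMatrix = Fin n -> Fin n -> Poly n

 infixl 7 _⊡_
 _⊡_ : PolyMatrix -> PolyMatrix -> PolyMatrix
 (P ⊡ Q) i j = sumᴾ \ k -> P i k ⊗ Q k j

 conM : I.Mat n -> PolyMatrix
 conM A i j = con (A i j)

 ⟪_,_⟫ᴾ : I.Mat n -> PolyMatrix -> Poly n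
 ⟪ Λ , P ⟫ᴾ = sumᴾ \ i -> (conM Λ ⊡ P) i i

 inverseᴾ : PolyMatrix
 inverseᴾ = adjugate entry

module PolynomialEvaluation {c ℓ} (S : CommutativeRing c ℓ) {n : ℕ} (A : Matrices.Matrix S n) where
 open Determinant S hiding (L-cong; wedge-cong; alternate-cong; det-cong)
 open Determinant S using (L-cong; wedge-cong; alternate-cong; det-cong)
 open Exponential S
 open S
 open Trace S
 private
  module P = PolynomialSyntax {n}
  eval : Poly n -> Carrier
  eval = evalPoly S A

 evalM : P.PolyMatrix -> M.Mat n
 evalM P i j = eval (P i j)

 eval-neg : ∀ p -> eval (P.negᴾ p) ≈ - eval p
 eval-neg p = *-congʳ (-‿cong ι-1) & -1*x≈-x _

 eval-sum : ∀ {m} (v : Fin m -> Poly n) -> eval (P.sumᴾ v) ≈ sum (eval ∘ v)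
 eval-sum {zero} v = refl
 eval-sum {suc m} v = +-congˡ (eval-sum (v ∘ F.suc))

 eval-⊡ : ∀ P Q -> evalM (P P.⊡ Q) M.≈ evalM P M.* evalM Q
 eval-⊡ P Q i j = eval-sum \ k -> P i k ⊗ Q k j

 eval-⟪⟫ : ∀ Λ P -> eval P.⟪ Λ , P ⟫ᴾ ≈ ⟪ Λ , evalM P ⟫
 eval-⟪⟫ Λ P = (eval-sum \ i -> (P.conM Λ P.⊡ P) i i) & (sum-cong-≋ \ i -> eval-⊡ (P.conM Λ) P i i)

 private
  eval-L : ∀ {m} (v : Fin m -> Poly n) f -> (\ s -> eval (P.L v f s)) ≈ᶠ L (eval ∘ v) (eval ∘ f)
  eval-L v f [] = refl
  eval-L v f (false :: s) = eval-L (v ∘ F.suc) (\ s -> f (false :: s)) s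
  eval-L v f (true :: s) = +-congˡ (eval-neg (P.L (v ∘ F.suc) (\ s -> f (true :: s)) s) & -‿cong (eval-L (v ∘ F.suc) (\ s -> f (true :: s)) s))

  eval-wedge : ∀ {k m} (r : Fin k -> Fin m -> Poly n) -> (\ s -> eval (P.wedge r s)) ≈ᶠ wedge (\ i j -> eval (r i j))
  eval-wedge {zero} r s = eval-empty s
   where
   eval-empty : ∀ {m} (s : Vec Bool m) -> eval (P.empty s) ≈ empty s
   eval-empty [] = ι-1
   eval-empty (false :: s) = eval-empty s
   eval-empty (true :: s) = refl
  eval-wedge {suc k} r s = eval-L (r 0F) (P.wedge (r ∘ F.suc)) s & L-cong (\ _ -> refl) (eval-wedge (r ∘ F.suc)) s

  eval-alternate : ∀ k p -> eval (P.alternate k p) ≈ alternate k (eval p)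
  eval-alternate zero p = refl
  eval-alternate (suc k) p = eval-neg (P.alternate k p) & -‿cong (eval-alternate k p)

 eval-det : eval (P.det entry) ≈ det A
 eval-det = eval-wedge entry (full n)

 private
  eval-adjugate : ∀ {m} (r : Fin m -> Fin m -> Poly n) j i -> eval (P.adjugate r j i) ≈ adjugate (\ i j -> eval (r i j)) j i
  eval-adjugate {suc m} r j i = eval-alternate (# i) _ & alternate-cong (# i) (eval-L (\ k -> if does (j F.≟ k) then con (+ 1) else con (+ 0)) (P.wedge (r ∘ punchIn i)) (full (suc m)) &
   L-cong {f = eval ∘ P.wedge (r ∘ punchIn i)} {g = wedge (\ k l -> eval (r (punchIn i k) l))} (\ k -> eval-if (does (j F.≟ k))) (eval-wedge (r ∘ punchIn i)) (full (suc m)))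
   where
   eval-if : ∀ b -> eval (if b then con (+ 1) else con (+ 0)) ≈ (if b then 1# else 0#)
   eval-if true = ι-1
   eval-if false = refl

 eval-inverse : ∀ A~ -> A~ M.* A M.≈ M.1# -> det A ≈ 1# -> evalM P.inverseᴾ M.≈ A~
 eval-inverse A~ p d j i = eval-adjugate entry j i & adjugate-inverse A A~ p j i & *-congˡ d & *-identityʳ _

-- R-points at which all integer polynomials vanishing on the elementary group over K
-- vanish
module Points {c' ℓ′} {K : CommutativeRing c' ℓ′} (isℚ : IsℚAlgebra K) {n} (π : Representation n) where
 open RootSubgroups K π
 open LieSpan K π using (Lie; Lie-conjugate; basis; _⊹_; _⊛_; conjugate)
 open Determinant K using (det; det-*; det-1; det-cong)
 open Matrices K using (ι; Invertible; mat; mat⁻¹; invˡ; invʳ)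
 open IsℚAlgebra isℚ
 private
  module P = PolynomialSyntax {n}
  open import Algebra.Properties.Semiring.Exp (Ring.semiring (matrixRing n)) using () renaming (_^_ to _^ᵏ_)

 module _ (γ : Root) {C : M.Mat n} {r : S.Carrier} (p : C M.* ιM (X γ) M.≈ r M.⊙ (ιM (X γ) M.* C)) where
  private
   powers : ∀ k -> C M.* ιM (X γ) ^ᵏ k M.≈ (r S.^ k) M.⊙ (ιM (X γ) ^ᵏ k M.* C)
   powers zero = M.solve [] (C :: []) (m0 :* :1) (1: :% (:1 :* m0))
   powers (suc k) = M.sym (M.*-assoc C (ιM (X γ)) (ιM (X γ) ^ᵏ k)) M.& M.congr (ιM (X γ) ^ᵏ k) p M.& M.solve (r :: []) (ιM (X γ) :: C :: ιM (X γ) ^ᵏ k :: []) ((s0 :% (m0 :* m1)) :* m2) (s0 :%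
    (m0 :* (m1 :* m2))) M.& M.%-cong S.refl (M.congl (ιM (X γ)) (powers k)) M.& M.solve (r :: r S.^ k :: []) (ιM (X γ) :: C :: ιM (X γ) ^ᵏ k :: []) (s0 :% (m0 :* (s1 :% (m2 :* m1)))) ((s0 *: s1)
    :% ((m0 :* m2) :* m1))

   ιM-^ : ∀ (A : I.Mat n) k -> ιM (A I.^ k) M.≈ ιM A ^ᵏ k
   ιM-^ A zero = ιM-1
   ιM-^ A (suc k) = ιM-* A (A I.^ k) M.& M.congl (ιM A) (ιM-^ A k)

   divided : ∀ k -> C M.* ιM (divPow γ k) M.≈ (r S.^ k) M.⊙ (ιM (divPow γ k) M.* C)
   divided k i j = S.x∙y⁻¹≈ε⇒x≈y _ _ (ι-regular (+ (k !)) (\ p -> N.≢-nonZero⁻¹ (k !) {{k N.!≢0}} (O.+-injective p)) (S.distribʳ _ _ _ S.& S.+-cong (S.*-comm _ _ S.& times-k! i j) (S.sym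
    (S.-‿distribˡ-* _ _) S.& S.-‿cong (S.*-comm _ _)) S.& S.-‿inverseʳ _))
    where
    D = ιM (divPow γ k)
    k!-D : ι (+ (k !)) M.⊙ D M.≈ ιM (X γ) ^ᵏ k
    k!-D = M.sym (ιM-· (+ (k !)) (divPow γ k)) M.& ιM-cong {A = (+ (k !)) I.·ᴹ divPow γ k} {X γ I.^ k} (DividedPowers.power (X-divided γ) k) M.& ιM-^ (X γ) k
    times-k! : ι (+ (k !)) M.⊙ (C M.* D) M.≈ ι (+ (k !)) M.⊙ ((r S.^ k) M.⊙ (D M.* C))
    times-k! = M.solve (ι (+ (k !)) :: []) (C :: D :: []) (s0 :% (m0 :* m1)) (m0 :* (s0 :% m1)) M.& M.congl C k!-D M.& powers k M.& M.%-cong S.refl (M.congr C (M.sym k!-D)) M.& M.solve (ι (+ (k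
     !)) :: r S.^ k :: []) (C :: D :: []) (s1 :% ((s0 :% m1) :* m0)) (s0 :% s1 :% (m1 :* m0))

  conjugate-x : ∀ t -> C M.* x γ t M.≈ x γ (r S.* t) M.* C
  conjugate-x t = M.*-distribˡ-sum {n} {bound} C (\ k -> (t S.^ # k) M.⊙ ιM (divPow γ (# k))) M.& (M.sum-cong-≋ {n} {bound} \ k -> term (# k)) M.& M.sym (M.*-distribʳ-sum {n} {bound} C
   (\ k -> ((r S.* t) S.^ # k) M.⊙ ιM (divPow γ (# k))))
   where
   term : ∀ k -> C M.* ((t S.^ k) M.⊙ ιM (divPow γ k)) M.≈ (((r S.* t) S.^ k) M.⊙ ιM (divPow γ k)) M.* C
   term k = M.solve (t S.^ k :: []) (C :: ιM (divPow γ k) :: []) (m0 :* (s0 :% m1)) (s0 :% (m0 :* m1)) M.& M.%-cong S.refl (divided k) M.& M.solve (t S.^ k :: r S.^ k :: []) (C :: ιM (divPow γ k)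
    :: []) (s0 :% s1 :% (m1 :* m0)) (((s1 *: s0) :% m1) :* m0) M.& M.congr C (M.%-cong (S.sym (S.^-distrib-* r t k)) M.refl)

 -- h(2) conjugates x(t) to x(4t), hence x(3t) has determinant 1.
 module _ (γ : Root) where
  open Torus γ
  private
   two : Unit
   two = unit (ι (+ 2)) (fst (ι-inverse 1)) (snd (ι-inverse 1))
   four = val two S.* val two

   h-x : ∀ t -> h two M.* x γ t M.≈ x γ (four S.* t) M.* h two
   h-x = conjugate-x γ {h two} {four} (h-X two M.& M.solve (four :: []) (Xγ :: h two :: []) ((s0 :% m0) :* m1) (s0 :% (m0 :* m1)))

   unit-cancel : ∀ {u v s} -> u S.* v S.≈ S.1# -> u S.* s S.≈ u -> s S.≈ S.1#
   unit-cancel {u} {v} {s} p q = S.sym (S.*-identityˡ s) S.& S.*-congʳ (S.sym p S.& S.*-comm u v) S.& S.*-assoc v u s S.& S.*-congˡ q S.& S.*-comm v u S.& p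

   inverse-det : ∀ {A B : M.Mat n} -> A M.* B M.≈ M.1# -> det A S.* det B S.≈ S.1#
   inverse-det {A} {B} p = S.sym (det-* A B) S.& det-cong p S.& det-1 {n}

   det-x-inverse : ∀ t -> det (x γ t) S.* det (x γ (S.- t)) S.≈ S.1#
   det-x-inverse t = inverse-det {x γ t} (x-inverse γ (S.-‿inverseʳ t))

   det-h : ∃[ v ] det (h two) S.* v S.≈ S.1#
   det-h = _ , inverse-det {h two} {w (-u -1u) M.* w (-u two)} (M.solve [] (w two :: w -1u :: w (-u -1u) :: w (-u two) :: []) ((m0 :* m1) :* (m2 :* m3)) (m0 :* (m1 :* m2) :* m3) M.& M.congr (w
    (-u two)) (M.congl (w two) (w-inverse -1u (-u -1u) (S.-‿inverseʳ _) (S.-‿inverseʳ _))) M.& M.congr (w (-u two)) (M.*-identityʳ (w two)) M.& w-inverse two (-u two) (S.-‿inverseʳ _)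
    (S.-‿inverseʳ _))
    where
    -u_ : Unit -> Unit
    -u (unit a b p) = unit (S.- a) (S.- b) (solves (a :: b :: []) ((-: s0) *: (-: s1)) (s0 *: s1) S.& p)

   det-three : ∀ t -> det (x γ (ι (+ 3) S.* t)) S.≈ S.1#
   det-three t = unit-cancel (det-x-inverse t) (S.sym (det-* (x γ t) (x γ (ι (+ 3) S.* t))) S.& det-cong (M.sym (x-+ γ t (ι (+ 3) S.* t)) M.& x-cong γ (solves (t :: []) (s0 +: ((1: +: (1: +:
    (1: +: 0:))) *: s0)) ((1: +: (1: +: 0:)) *: (1: +: (1: +: 0:)) *: s0))) S.& (S.sym (S.*-identityʳ _) S.& S.*-congˡ (S.sym (snd det-h))) S.& S.sym (S.*-assoc _ _ _) S.& S.*-congʳ (S.sym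
    (det-* (x γ (four S.* t)) (h two)) S.& det-cong (M.sym (h-x t)) S.& det-* (h two) (x γ t) S.& S.*-comm _ _) S.& S.*-assoc _ _ _ S.& S.*-congˡ (snd det-h) S.& S.*-identityʳ _)

  det-x : ∀ t -> det (x γ t) S.≈ S.1#
  det-x t = let (u , p) = ι-inverse 2 in S.trans (det-cong (x-cong γ (S.trans (S.sym (S.*-identityˡ t))
   (S.trans (S.*-congʳ (S.sym p)) (S.*-assoc _ _ _))))) (det-three (u S.* t))

 private
  E : Invertible n -> Set _
  E = Elementary K π

 det-elementary : ∀ {h} -> E h -> det (mat h) S.≈ S.1#
 det-elementary (gen (γ , t , p)) = det-cong (p M.& M.sym (x≈rootElement γ t)) S.& det-x γ t
 det-elementary unit = det-1 {n}
 det-elementary (mul {g} {h} p q) = det-* (mat g) (mat h) S.& S.*-cong (det-elementary p) (det-elementary q) S.& S.*-identityˡ _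
 det-elementary (inv {g} p) = (S.sym (S.*-identityˡ _) S.& S.*-congʳ (S.sym (det-elementary p))) S.& S.sym (det-* (mat g) (mat⁻¹ g)) S.& det-cong (invʳ g) S.& det-1 {n}
 det-elementary (resp p q) = det-cong (M.sym p) S.& det-elementary q

 Lie-elementary : ∀ {h} -> E h -> ∀ {A} -> Lie A -> Lie (mat h M.* (A M.* mat⁻¹ h)) × Lie (mat⁻¹ h M.* (A M.* mat h))
 Lie-elementary {h} (gen (γ , t , p)) {A} lie = Lie.resp (M.*-cong (M.sym h≈) (M.congl A (M.sym h~≈))) (Lie-conjugate γ t lie) , Lie.resp (M.*-cong (M.sym h~≈) (M.congl A (x-cong γ
  (S.-‿involutive t) M.& M.sym h≈))) (Lie-conjugate γ (S.- t) lie)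
  where
  h≈ : mat h M.≈ x γ t
  h≈ = p M.& M.sym (x≈rootElement γ t)
  h~≈ : mat⁻¹ h M.≈ x γ (S.- t)
  h~≈ = (M.sym (M.*-identityʳ (mat⁻¹ h)) M.& M.congl (mat⁻¹ h) (M.sym (M.congr (x γ (S.- t)) h≈ M.& x-inverse γ (S.-‿inverseʳ t)))) M.& M.sym (M.*-assoc (mat⁻¹ h) (mat h) (x γ (S.- t))) M.&
   M.congr (x γ (S.- t)) (invˡ h) M.& M.*-identityˡ (x γ (S.- t))
 Lie-elementary unit {A} lie = Lie.resp same lie , Lie.resp same lie
  where
  same : A M.≈ M.1# M.* (A M.* M.1#)
  same = M.solve [] (A :: []) (m0) (:1 :* (m0 :* :1))
 Lie-elementary (mul {g} {h} p q) {A} lie = Lie.resp (M.solve [] (mat g :: mat h :: mat⁻¹ g :: mat⁻¹ h :: A :: []) (m0 :* (m1 :* (m4 :* m3) :* m2)) ((m0 :* m1) :* (m4 :* (m3 :* m2)))) (fst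
  (Lie-elementary p (fst (Lie-elementary q lie)))) , Lie.resp (M.solve [] (mat g :: mat h :: mat⁻¹ g :: mat⁻¹ h :: A :: []) (m3 :* (m2 :* (m4 :* m0) :* m1)) ((m3 :* m2) :* (m4 :* (m0 :* m1))))
  (snd (Lie-elementary q (snd (Lie-elementary p lie))))
 Lie-elementary (inv p) lie = let (a , b) = Lie-elementary p lie in b , a
 Lie-elementary (resp {g} {h} p q) {A} lie = let (a , b) = Lie-elementary q lie in
  Lie.resp (M.*-cong p (M.congl A p~)) a , Lie.resp (M.*-cong p~ (M.congl A p)) b
  where
  p~ : mat⁻¹ g M.≈ mat⁻¹ h
  p~ = Group.⁻¹-cong (Matrices.GL K n) {g} {h} p

 module _ {c ℓ} (R : CommutativeRing c ℓ) where
  private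
   module Rs = RootSubgroups R π
   module MR = Rs.M
   module GR = Matrices R
  open CommutativeRing R using () renaming (_≈_ to _≈ʳ_)

  Point : GR.Invertible n -> Set _
  Point g = ∀ (p : Poly n) -> (∀ h -> E h -> evalPoly K (mat h) p S.≈ S.0#) -> evalPoly R (GR.mat g) p ≈ʳ CommutativeRing.0# R

 module AtPoint {c ℓ} {R : CommutativeRing c ℓ} {g : Matrices.Invertible R n} (point : Point R g) where
  private
   module Rs = RootSubgroups R π
   module MR = Rs.M
   module GR = Matrices R
   module EK (h : Invertible n) = PolynomialEvaluation K (mat h)
   module ER = PolynomialEvaluation R (GR.mat g)
   module RR = Rs.S
  open LieLikeMatrices R π using (LieLike)

  transfer : ∀ p q -> (∀ h -> E h -> evalPoly K (mat h) p S.≈ evalPoly K (mat h) q) -> evalPoly R (GR.mat g) p RR.≈ evalPoly R (GR.mat g) q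
  transfer p q eq = RR.x∙y⁻¹≈ε⇒x≈y _ _ (RR.trans (RR.+-congˡ (RR.sym (ER.eval-neg q))) (point (p ⊕ P.negᴾ q) \ h e -> S.trans (S.+-cong (eq h e) (EK.eval-neg h q)) (S.-‿inverseʳ _)))

  inverse-value : ER.evalM P.inverseᴾ MR.≈ GR.mat⁻¹ g
  inverse-value = ER.eval-inverse (GR.mat⁻¹ g) (GR.invˡ g) (RR.trans (RR.sym ER.eval-det) (RR.trans (transfer (P.det entry) (con (+ 1)) \ h e -> S.trans (EK.eval-det h) (det-elementary e S.&
   S.sym ι-1)) Rs.ι-1))

  inverse-elementary : ∀ h -> E h -> EK.evalM h P.inverseᴾ M.≈ mat⁻¹ h
  inverse-elementary h e = EK.eval-inverse h (mat⁻¹ h) (invˡ h) (det-elementary e)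

  lieLike-point : ∀ δ -> LieLike (GR.mat g MR.* (Rs.ιM (X δ) MR.* GR.mat⁻¹ g)) × LieLike (GR.mat⁻¹ g MR.* (Rs.ιM (X δ) MR.* GR.mat g))
  lieLike-point δ = (\ Λ p -> RR.trans (TR.⟪⟫-cong Λ (MR.sym (valuer entry P.inverseᴾ {GR.mat g} {GR.mat⁻¹ g} (\ _ _ -> RR.refl) inverse-value))) (vanish Λ p entry P.inverseᴾ (\ h -> mat h) (\
   h -> mat⁻¹ h) (\ h _ _ _ -> S.refl) inverse-elementary \ h e lie -> fst (Lie-elementary e lie))) , (\ Λ p -> RR.trans (TR.⟪⟫-cong Λ (MR.sym (valuer P.inverseᴾ entry {GR.mat⁻¹ g} {GR.mat g}
   inverse-value (\ _ _ -> RR.refl)))) (vanish Λ p P.inverseᴾ entry (\ h -> mat⁻¹ h) (\ h -> mat h) inverse-elementary (\ h _ _ _ -> S.refl) \ h e lie -> snd (Lie-elementary e lie)))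
   where
   module TR = Trace R
   module TK = Trace K
   open LieSpan K π using (Represents)
   valuer : ∀ A B {A' B' : MR.Mat n} -> ER.evalM A MR.≈ A' -> ER.evalM B MR.≈ B' -> ER.evalM (A P.⊡ (P.conM (X δ) P.⊡ B)) MR.≈ A' MR.* (Rs.ιM (X δ) MR.* B')
   valuer A B {A'} {B'} p q = MR.trans (ER.eval-⊡ A (P.conM (X δ) P.⊡ B)) (MR.*-cong {x = ER.evalM A} {A'} p (MR.trans (ER.eval-⊡ (P.conM (X δ)) B) (MR.*-congˡ {x = Rs.ιM (X δ)} {ER.evalM B}
    {B'} q)))
   zero-on-Lie : ∀ {Λ} -> (∀ b -> ℤT.⟪ Λ , ⟦ b ⟧b ⟫Z ≡ + 0) -> ∀ {A} -> Lie A -> TK.⟪ Λ , A ⟫ S.≈ S.0#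
   zero-on-Lie {Λ} p (basis b) = ⟪⟫-ι K Λ ⟦ b ⟧b S.& ι-cong (p b)
   zero-on-Lie {Λ} p (_⊹_ {A} {B} a b) = TK.⟪⟫-+ Λ A B S.& S.+-cong (zero-on-Lie {Λ} p a) (zero-on-Lie {Λ} p b) S.& S.+-identityˡ _
   zero-on-Lie {Λ} p (_⊛_ r {A} a) = TK.⟪⟫-% Λ r A S.& S.*-congˡ (zero-on-Lie {Λ} p a) S.& S.zeroʳ r
   zero-on-Lie {Λ} p (Lie.resp q a) = TK.⟪⟫-cong Λ (M.sym q) S.& zero-on-Lie {Λ} p a
   vanish : ∀ Λ -> (∀ b -> ℤT.⟪ Λ , ⟦ b ⟧b ⟫Z ≡ + 0) -> ∀ A B (A' B' : Invertible n -> M.Mat n) -> (∀ h -> E h -> EK.evalM h A M.≈ A' h) -> (∀ h -> E h -> EK.evalM h B M.≈ B' h) -> (∀ h -> E h -> ∀ {C} ->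
    Lie C -> Lie (A' h M.* (C M.* B' h))) -> TR.⟪ Λ , ER.evalM (A P.⊡ (P.conM (X δ) P.⊡ B)) ⟫ RR.≈ RR.0#
   vanish Λ p A B A' B' a b lie = RR.trans (RR.sym (ER.eval-⟪⟫ Λ Q)) (point P.⟪ Λ , Q ⟫ᴾ \ h e -> S.trans (EK.eval-⟪⟫ h Λ Q) (TK.⟪⟫-cong Λ (value h e) S.& zero-on-Lie {Λ} p (lie h e (basis
    (root δ)))))
    where
    Q = A P.⊡ (P.conM (X δ) P.⊡ B)
    value : ∀ h -> E h -> EK.evalM h Q M.≈ A' h M.* (ιM (X δ) M.* B' h)
    value h e = EK.eval-⊡ h A (P.conM (X δ) P.⊡ B) M.& M.*-cong {x = EK.evalM h A} {A' h} (a h e) (EK.eval-⊡ h (P.conM (X δ)) B M.& M.*-congˡ {x = ιM (X δ)} {EK.evalM h B} {B' h} (b h e))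

-- Density of the big cell

module TorusWeights {c ℓ} {K : CommutativeRing c ℓ} (isℚ : IsℚAlgebra K) {n} (π : Representation n) where
 open RootSubgroups K π
 open M
 open Matrices K using (ι)

 _^ᶻ_ : Unit -> ℤ -> S.Carrier
 a ^ᶻ (+ k) = val a S.^ k
 a ^ᶻ -[1+ k ] = val~1 a S.^ suc k

 power-inverse : ∀ a k -> (val a S.^ k) S.* (val~1 a S.^ k) S.≈ S.1#
 power-inverse a zero = S.*-identityˡ _
 power-inverse a (suc k) = solves (val a :: val~1 a :: val a S.^ k :: val~1 a S.^ k :: []) (s0 *: s2 *: (s1 *: s3)) (s0 *: s1 *: (s2 *: s3)) S.& S.*-cong (val*val~1 a) (power-inverse a k) S.&
  S.*-identityˡ _

 module _ (γ : Root) where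
  open Torus γ using (h)
  open WeightGrading (TorusProjections.grading isℚ π γ)

  private
   S : S.Carrier -> Mat n
   S = series size P

   total' : sum {n} {size} (\ d -> ιM (P (# d))) ≈ 1#
   total' = sym (ιM-sum {m = size} (P ∘ #)) & ιM-cong {A = I.sum {n} {size} (P ∘ #)} {I.1#} total & ιM-1

  weight-shift : ∀ {Z k l m} -> H[ γ ] I.* Z I.≈ Z I.* H[ γ ] I.+ k I.·ᴹ Z -> k ≡ + m O.- + l -> ∀ s -> (s S.^ l) ⊙ (S s * ιM Z) ≈ (s S.^ m) ⊙ (ιM Z * S s)
  weight-shift {Z} {k} {l} {m} p k≡ s = begin
   (s S.^ l) ⊙ (S s * ιM Z)
   ≈⟨ trans (solve (s S.^ l :: []) (S s :: ιM Z :: []) (s0 :% (m0 :* m1)) (m0 :* ((s0 :% m1) :* :1)))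
   (congl (S s) (congl Y (sym total'))) ⟩
   S s * (Y * sum {n} {size} (\ e -> F (# e)))
   ≈⟨ *-distribʳ-sum {n} {size} (Y * sum {n} {size} (\ e -> F (# e))) (\ d -> (s S.^ # d) ⊙ F (# d)) ⟩
   sum {n} {size} (\ d -> ((s S.^ # d) ⊙ F (# d)) * (Y * sum {n} {size} (\ e -> F (# e))))
   ≈⟨ sum-cong-≋ {n} {size} (\ d -> trans (congl ((s S.^ # d) ⊙ F (# d)) (*-distribˡ-sum {n} {size} Y (\ e -> F (# e))))
   (trans (*-distribˡ-sum {n} {size} ((s S.^ # d) ⊙ F (# d)) (\ e -> Y * F (# e)))
   (trans (sum-cong-≋ {n} {size} (term d))
   (trans (sym (*-distribˡ-sum {n} {size} (F (# d)) (\ e -> Y' * ((s S.^ # e) ⊙ F (# e)))))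
   (congl (F (# d)) (sym (*-distribˡ-sum {n} {size} Y' (\ e -> (s S.^ # e) ⊙ F (# e))))))))) ⟩
   sum {n} {size} (\ d -> F (# d) * (Y' * S s))
   ≈⟨ *-distribʳ-sum {n} {size} (Y' * S s) (\ d -> F (# d)) ⟨
   sum {n} {size} (\ d -> F (# d)) * (Y' * S s)
   ≈⟨ trans (congr (Y' * S s) total')
   (solve (s S.^ m :: []) (ιM Z :: S s :: []) (:1 :* ((s0 :% m0) :* m1)) (s0 :% (m0 :* m1))) ⟩
   (s S.^ m) ⊙ (ιM Z * S s) ∎
   where
   open Reasoning (setoid {n})
   F : ℕ -> Mat n
   F d = ιM (P d)
   Y Y' : Mat n
   Y = (s S.^ l) ⊙ ιM Z
   Y' = (s S.^ m) ⊙ ιM Z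
   term : ∀ (d e : Fin size) -> ((s S.^ # d) ⊙ F (# d)) * (Y * F (# e)) ≈ F (# d) * (Y' * ((s S.^ # e) ⊙ F (# e)))
   term d e with (# d N.+ l) N.≟ (# e N.+ m)
   ... | yes q = solve (s S.^ # d :: s S.^ l :: []) (F (# d) :: ιM Z :: F (# e) :: []) ((s0 :% m0) :* ((s1 :% m1) :* m2)) ((s0 *: s1) :% (m0 :* (m1 :* m2))) & %-cong (S.sym (S.^-homo-* s
    (# d) l) S.& S.reflexive (cong (s S.^_) q) S.& S.^-homo-* s (# e) m) refl & solve (s S.^ # e :: s S.^ m :: []) (F (# d) :: ιM Z :: F (# e) :: []) ((s0 *: s1) :% (m0 :* (m1 :* m2)))
    (m0 :* ((s1 :% m1) :* (s0 :% m2)))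
   ... | no ¬q = solve (s S.^ # d :: s S.^ l :: []) (F (# d) :: ιM Z :: F (# e) :: []) ((s0 :% m0) :* ((s1 :% m1) :* m2)) ((s0 *: s1) :% (m0 :* (m1 :* m2))) & %-cong S.refl zero-product &
    solve (s S.^ # d :: s S.^ l :: s S.^ # e :: s S.^ m :: []) [] ((s0 *: s1) :% :0) ((s2 *: s3) :% :0) & %-cong S.refl (sym zero-product) & solve (s S.^ # e :: s S.^ m :: []) (F (# d) ::
    ιM Z :: F (# e) :: []) ((s0 *: s1) :% (m0 :* (m1 :* m2))) (m0 :* ((s1 :% m1) :* (s0 :% m2)))
    where
    zero-product : F (# d) * (ιM Z * F (# e)) ≈ 0#
    zero-product = sym (ιM-* (P (# d)) (Z I.* P (# e)) & congl (F (# d)) (ιM-* Z (P (# e)))) & ιM-cong {A = P (# d) I.* (Z I.* P (# e))} {I.0#} (eigen-zero {Z} {k} p (F.toℕ<n d)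
     (F.toℕ<n e) \ r -> ¬q (O.+-injective (O.pos-+ (# d) l ⟫ cong (\ z -> z O.+ + l) (r ⟫ cong (\ z -> + # e O.+ z) k≡) ⟫ ℤs.solves (+ # e :: + m :: + l :: []) (s0 +: (s1 -: s2) +: s2) (s0
     +: s1) ⟫ J.sym (O.pos-+ (# e) m)))) & ιM-0

  torus-weight : ∀ {Z k} -> H[ γ ] I.* Z I.≈ Z I.* H[ γ ] I.+ k I.·ᴹ Z -> ∀ a -> h a * ιM Z ≈ (a ^ᶻ k) ⊙ (ιM Z * h a)
  torus-weight {Z} {k} p a = congr (ιM Z) h≈ & solve (r :: []) (S s :: ιM Z :: []) ((s0 :% m0) :* m1) (s0 :% (m0 :* m1)) & %-cong S.refl (shift k p) & solve (r :: a ^ᶻ k :: []) (ιM Z :: S s :: [])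
   (s0 :% s1 :% (m0 :* m1)) (s1 :% (m0 :* (s0 :% m1))) & %-cong S.refl (congl (ιM Z) (sym h≈))
   where
   s = val a
   r = val~1 a S.^ offset
   h≈ : h a ≈ r ⊙ S s
   h≈ = TorusProjections.h-expansion isℚ π γ a
   shift : ∀ k -> H[ γ ] I.* Z I.≈ Z I.* H[ γ ] I.+ k I.·ᴹ Z -> S s * ιM Z ≈ (a ^ᶻ k) ⊙ (ιM Z * S s)
   shift (+ m) p = sym (%-one _) & weight-shift {Z} {+ m} {0} {m} p (J.sym (O.+-identityʳ (+ m))) s
   shift -[1+ l ] p = (sym (%-one _) & %-cong {y = S s * ιM Z} (S.sym (power-inverse a (suc l)) S.& S.*-comm _ _) refl) & solve (val~1 a S.^ suc l :: s S.^ suc l :: []) (S s * ιM Z :: []) ((s0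
    *: s1) :% m0) (s0 :% s1 :% m0) & %-cong S.refl (weight-shift {Z} { -[1+ l ]} {suc l} {0} p rfl s & %-one _)

  torus-X : ∀ δ a -> Conj (h a) (ιM (X δ)) ((a ^ᶻ pairing γ δ) ⊙ ιM (X δ))
  torus-X δ a = torus-weight {X δ} {hval γ δ} (bracket-cartan γ δ) a & %-cong (S.reflexive (cong (a ^ᶻ_) (hval≡ γ δ))) refl & solve (a ^ᶻ pairing γ δ :: []) (ιM (X δ) :: h a :: []) (s0 :% (m0
   :* m1)) ((s0 :% m0) :* m1)

  torus-H : ∀ δ a -> Conj (h a) (ιM H[ δ ]) (ιM H[ δ ])
  torus-H δ a = torus-weight {H[ δ ]} {+ 0} (cartan-commute γ δ I.& I.solve [] (H[ γ ] :: H[ δ ] :: []) (m1 :* m0) (m1 :* m0 :+ 0: :% m1)) a & %-one _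

-- Functions with values in a ring that are polynomial after multiplication with a
-- power of the parameter, and their Euler derivatives (t d/dt)
module EulerDerivatives {c ℓ} {K : CommutativeRing c ℓ} (isℚ : IsℚAlgebra K) where
 open Exponential K
 open S
 open Units K
 open PolynomialIdentity isℚ using (vanishing-polynomial)
 open IsℚAlgebra isℚ using (ι-regular)
 open Matrices K using (ι)
 open Reasoning setoid

 evaluate euler : List Carrier -> Carrier -> Carrier
 evaluate [] t = 0#
 evaluate (c :: cs) t = c + t * evaluate cs t
 euler [] t = 0#
 euler (c :: cs) t = t * (evaluate cs t + euler cs t)

 private
  coefficient : List Carrier -> ℕ -> Carrier
  coefficient [] k = 0#
  coefficient (c :: cs) zero = c
  coefficient (c :: cs) (suc k) = coefficient cs k

  _+l_ _*l_ : List Carrier -> List Carrier -> List Carrier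
  [] +l ds = ds
  (c :: cs) +l [] = c :: cs
  (c :: cs) +l (d :: ds) = c + d :: cs +l ds

  scalel : Carrier -> List Carrier -> List Carrier
  scalel c = map (c *_)

  [] *l ds = []
  (c :: cs) *l ds = scalel c ds +l (0# :: cs *l ds)

  shiftl : ℕ -> List Carrier -> List Carrier
  shiftl zero cs = cs
  shiftl (suc k) cs = 0# :: shiftl k cs

  evaluate-+ : ∀ cs ds t -> evaluate (cs +l ds) t ≈ evaluate cs t + evaluate ds t
  evaluate-+ [] ds t = sym (+-identityˡ _)
  evaluate-+ (c :: cs) [] t = sym (+-identityʳ _)
  evaluate-+ (c :: cs) (d :: ds) t = +-congˡ (*-congˡ (evaluate-+ cs ds t)) & solves (c :: d :: t :: evaluate cs t :: evaluate ds t :: []) (s0 +: s1 +: s2 *: (s3 +: s4)) (s0 +: s2 *: s3 +: (s1 +: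
   s2 *: s4))

  euler-+ : ∀ cs ds t -> euler (cs +l ds) t ≈ euler cs t + euler ds t
  euler-+ [] ds t = sym (+-identityˡ _)
  euler-+ (c :: cs) [] t = sym (+-identityʳ _)
  euler-+ (c :: cs) (d :: ds) t = *-congˡ (+-cong (evaluate-+ cs ds t) (euler-+ cs ds t)) & solves (t :: evaluate cs t :: evaluate ds t :: euler cs t :: euler ds t :: []) (s0 *: (s1 +: s2 +: (s3 +:
   s4))) (s0 *: (s1 +: s3) +: s0 *: (s2 +: s4))

  evaluate-scale : ∀ c ds t -> evaluate (scalel c ds) t ≈ c * evaluate ds t
  evaluate-scale c [] t = sym (zeroʳ c)
  evaluate-scale c (d :: ds) t = +-congˡ (*-congˡ (evaluate-scale c ds t)) & solves (c :: d :: t :: evaluate ds t :: []) (s0 *: s1 +: s2 *: (s0 *: s3)) (s0 *: (s1 +: s2 *: s3))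

  euler-scale : ∀ c ds t -> euler (scalel c ds) t ≈ c * euler ds t
  euler-scale c [] t = sym (zeroʳ c)
  euler-scale c (d :: ds) t = *-congˡ (+-cong (evaluate-scale c ds t) (euler-scale c ds t)) & solves (c :: t :: evaluate ds t :: euler ds t :: []) (s1 *: (s0 *: s2 +: s0 *: s3)) (s0 *: (s1 *: (s2
   +: s3)))

  evaluate-* : ∀ cs ds t -> evaluate (cs *l ds) t ≈ evaluate cs t * evaluate ds t
  evaluate-* [] ds t = sym (zeroˡ _)
  evaluate-* (c :: cs) ds t = evaluate-+ (scalel c ds) _ t & +-cong (evaluate-scale c ds t) (+-congˡ (*-congˡ (evaluate-* cs ds t))) & solves (c :: t :: evaluate cs t :: evaluate ds t :: []) (s0
   *: s3 +: (0: +: s1 *: (s2 *: s3))) ((s0 +: s1 *: s2) *: s3)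

  euler-* : ∀ cs ds t -> euler (cs *l ds) t ≈ euler cs t * evaluate ds t + evaluate cs t * euler ds t
  euler-* [] ds t = solves (evaluate ds t :: euler ds t :: []) 0: (0: *: s0 +: 0: *: s1)
  euler-* (c :: cs) ds t = euler-+ (scalel c ds) _ t & +-cong (euler-scale c ds t) (*-congˡ (+-cong (evaluate-* cs ds t) (euler-* cs ds t))) & solves (c :: t :: evaluate cs t :: evaluate ds t ::
   euler cs t :: euler ds t :: []) (s0 *: s5 +: s1 *: (s2 *: s3 +: (s4 *: s3 +: s2 *: s5))) (s1 *: (s2 +: s4) *: s3 +: (s0 +: s1 *: s2) *: s5)

  evaluate-shift : ∀ k cs t -> evaluate (shiftl k cs) t ≈ t ^ k * evaluate cs t
  evaluate-shift zero cs t = sym (*-identityˡ _)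
  evaluate-shift (suc k) cs t = +-identityˡ _ & *-congˡ (evaluate-shift k cs t) & sym (*-assoc _ _ _)

  euler-shift : ∀ k cs t -> euler (shiftl k cs) t ≈ t ^ k * (ι (+ k) * evaluate cs t + euler cs t)
  euler-shift zero cs t = sym (*-identityˡ _ & +-congʳ (zeroˡ _) & +-identityˡ _)
  euler-shift (suc k) cs t = *-congˡ (+-cong (evaluate-shift k cs t) (euler-shift k cs t)) & solves (t :: t ^ k :: ι (+ k) :: evaluate cs t :: euler cs t :: []) (s0 *: (s1 *: s3 +: s1 *: (s2 *:
   s3 +: s4))) (s0 *: s1 *: ((1: +: s2) *: s3 +: s4))

  evaluate-sum : ∀ cs t -> evaluate cs t ≈ sum {length cs} (\ k -> t ^ # k * coefficient cs (# k))
  evaluate-sum [] t = refl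
  evaluate-sum (c :: cs) t = +-cong (sym (*-identityˡ c)) (*-congˡ (evaluate-sum cs t) & *-distribˡ-sum {length cs} t (\ k -> t ^ # k * coefficient cs (# k)) & (sum-cong-≋ {length cs} \ k
   -> sym (*-assoc _ _ _)))

  beyond : ∀ cs k -> length cs N.≤ k -> coefficient cs k ≈ 0#
  beyond [] k p = refl
  beyond (c :: cs) (suc k) (s≤s p) = beyond cs k p

  coefficients-vanish : ∀ cs -> (∀ (a : Unit) -> evaluate cs (val a) ≈ 0#) -> ∀ k -> coefficient cs k ≈ 0#
  coefficients-vanish cs p k with k N.<? length cs
  ... | yes q = vanishing-polynomial (length cs) (coefficient cs) (\ a -> sym (evaluate-sum cs (val a)) & p a) k q
  ... | no ¬q = beyond cs k (N.≮⇒≥ ¬q)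

  evaluate-null : ∀ cs -> (∀ k -> coefficient cs k ≈ 0#) -> ∀ t -> evaluate cs t ≈ 0#
  evaluate-null [] p t = refl
  evaluate-null (c :: cs) p t = +-cong (p 0) (*-congˡ (evaluate-null cs (p ∘ suc) t) & zeroʳ t) & +-identityˡ _

  euler-null : ∀ cs -> (∀ k -> coefficient cs k ≈ 0#) -> ∀ t -> euler cs t ≈ 0#
  euler-null [] p t = refl
  euler-null (c :: cs) p t = *-congˡ (+-cong (evaluate-null cs (p ∘ suc) t) (euler-null cs (p ∘ suc) t) & +-identityˡ _) & zeroʳ t

  eulerl : List Carrier -> List Carrier
  eulerl [] = []
  eulerl (c :: cs) = 0# :: cs +l eulerl cs

  evaluate-euler : ∀ cs t -> evaluate (eulerl cs) t ≈ euler cs t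
  evaluate-euler [] t = refl
  evaluate-euler (c :: cs) t = +-identityˡ _ & *-congˡ (evaluate-+ cs (eulerl cs) t & +-congˡ (evaluate-euler cs t))

  coefficient-+ : ∀ cs ds k -> coefficient (cs +l ds) k ≈ coefficient cs k + coefficient ds k
  coefficient-+ [] ds k = sym (+-identityˡ _)
  coefficient-+ (c :: cs) [] k = sym (+-identityʳ _)
  coefficient-+ (c :: cs) (d :: ds) zero = refl
  coefficient-+ (c :: cs) (d :: ds) (suc k) = coefficient-+ cs ds k

  coefficient-scale : ∀ c ds k -> coefficient (scalel c ds) k ≈ c * coefficient ds k
  coefficient-scale c [] k = sym (zeroʳ c)
  coefficient-scale c (d :: ds) zero = refl
  coefficient-scale c (d :: ds) (suc k) = coefficient-scale c ds k

  coefficient-euler : ∀ cs k -> coefficient (eulerl cs) k ≈ ι (+ k) * coefficient cs k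
  coefficient-euler [] k = sym (zeroʳ _)
  coefficient-euler (c :: cs) zero = sym (zeroˡ c)
  coefficient-euler (c :: cs) (suc k) = coefficient-+ cs (eulerl cs) k & +-congˡ (coefficient-euler cs k) & solves (coefficient cs k :: ι (+ k) :: []) (s0 +: s1 *: s0) ((1: +: s1) *: s0)

  coefficients-unique : ∀ cs ds -> (∀ (a : Unit) -> evaluate cs (val a) ≈ evaluate ds (val a)) -> ∀ k -> coefficient cs k ≈ coefficient ds k
  coefficients-unique cs ds p k = x∙y⁻¹≈ε⇒x≈y _ _ (+-congˡ (sym (-1*x≈-x _) & sym (coefficient-scale (- 1#) ds k)) & sym (coefficient-+ cs (scalel (- 1#) ds) k) & coefficients-vanish (cs +l
   scalel (- 1#) ds) (\ a -> evaluate-+ cs (scalel (- 1#) ds) (val a) & +-cong (p a) (evaluate-scale (- 1#) ds (val a) & -1*x≈-x _) & -‿inverseʳ _) k)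

 -- t^M F is a polynomial and F′ is the Euler derivative of F
 record Euler {t} {T : Set t} (v : T -> Carrier) (M : ℕ) (F F' : T -> Carrier) : Set (c ⊔ ℓ ⊔ t) where
  constructor eulerian
  field
   coefficients : List Carrier
   value : ∀ a -> v a ^ M * F a ≈ evaluate coefficients (v a)
   derivative : ∀ a -> v a ^ M * F' a ≈ euler coefficients (v a) - ι (+ M) * evaluate coefficients (v a)

 module _ {t} {T : Set t} {v : T -> Carrier} where
  euler-const : ∀ r -> Euler v 0 (\ _ -> r) (\ _ -> 0#)
  euler-const r = eulerian (r :: []) (\ a -> solves (r :: v a :: []) (1: *: s0) (s0 +: s1 *: 0:)) (\ a -> solves (r :: v a :: []) (1: *: 0:) (s1 *: (0: +: 0:) -: 0: *: (s0 +: s1 *: 0:)))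

  Euler-+ : ∀ {M N F F' G G'} -> Euler v M F F' -> Euler v N G G' -> Euler v (M N.+ N) (\ a -> F a + G a) (\ a -> F' a + G' a)
  Euler-+ {M} {N} {F} {F'} {G} {G'} (eulerian cs p p') (eulerian ds q q') = eulerian (shiftl N cs +l shiftl M ds) (\ a -> *-congʳ (^-homo-* (v a) M N) & solves (v a ^ M :: v a ^ N :: F a :: G a
   :: []) (s0 *: s1 *: (s2 +: s3)) (s1 *: (s0 *: s2) +: s0 *: (s1 *: s3)) & +-cong (*-congˡ (p a)) (*-congˡ (q a)) & sym (evaluate' a)) (\ a -> *-congʳ (^-homo-* (v a) M N) & solves (v a ^ M ::
   v a ^ N :: F' a :: G' a :: []) (s0 *: s1 *: (s2 +: s3)) (s1 *: (s0 *: s2) +: s0 *: (s1 *: s3)) & +-cong (*-congˡ (p' a)) (*-congˡ (q' a)) & solves (v a ^ M :: v a ^ N :: euler cs (v a) :: euler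
   ds (v a) :: ι (+ M) :: ι (+ N) :: evaluate cs (v a) :: evaluate ds (v a) :: []) (s1 *: (s2 -: s4 *: s6) +: s0 *: (s3 -: s5 *: s7)) (s1 *: (s5 *: s6 +: s2) +: s0 *: (s4 *: s7 +: s3) -: (s4 +:
   s5) *: (s1 *: s6 +: s0 *: s7)) & sym (+-cong (euler-+ (shiftl N cs) _ (v a) & +-cong (euler-shift N cs (v a)) (euler-shift M ds (v a))) (-‿cong (*-cong (ι-+ (+ M) (+ N)) (evaluate' a)))))
   where
   evaluate' : ∀ a -> evaluate (shiftl N cs +l shiftl M ds) (v a) ≈ v a ^ N * evaluate cs (v a) + v a ^ M * evaluate ds (v a)
   evaluate' a = evaluate-+ (shiftl N cs) _ (v a) & +-cong (evaluate-shift N cs (v a)) (evaluate-shift M ds (v a))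

  Euler-* : ∀ {M N F F' G G'} -> Euler v M F F' -> Euler v N G G' -> Euler v (M N.+ N) (\ a -> F a * G a) (\ a -> F' a * G a + F a * G' a)
  Euler-* {M} {N} {F} {F'} {G} {G'} (eulerian cs p p') (eulerian ds q q') = eulerian (cs *l ds) (\ a -> *-congʳ (^-homo-* (v a) M N) & solves (v a ^ M :: v a ^ N :: F a :: G a :: []) (s0 *: s1 *:
   (s2 *: s3)) (s0 *: s2 *: (s1 *: s3)) & *-cong (p a) (q a) & sym (evaluate-* cs ds (v a))) (\ a -> *-congʳ (^-homo-* (v a) M N) & solves (v a ^ M :: v a ^ N :: F a :: G a :: F' a :: G' a :: [])
   (s0 *: s1 *: (s4 *: s3 +: s2 *: s5)) (s0 *: s4 *: (s1 *: s3) +: s0 *: s2 *: (s1 *: s5)) & +-cong (*-cong (p' a) (q a)) (*-cong (p a) (q' a)) & solves (euler cs (v a) :: euler ds (v a) :: ι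
   (+ M) :: ι (+ N) :: evaluate cs (v a) :: evaluate ds (v a) :: []) ((s0 -: s2 *: s4) *: s5 +: s4 *: (s1 -: s3 *: s5)) (s0 *: s5 +: s4 *: s1 -: (s2 +: s3) *: (s4 *: s5)) & sym (+-cong (euler-*
   cs ds (v a)) (-‿cong (*-cong (ι-+ (+ M) (+ N)) (evaluate-* cs ds (v a))))))

  Euler-cong : ∀ {M F F' G G'} -> (∀ a -> F a ≈ G a) -> (∀ a -> F' a ≈ G' a) -> Euler v M F F' -> Euler v M G G'
  Euler-cong p q (eulerian cs r r') = eulerian cs (\ a -> *-congˡ (sym (p a)) & r a) (\ a -> *-congˡ (sym (q a)) & r' a)

  Euler-sum : ∀ {M m} {F F' : Fin m -> T -> Carrier} -> (∀ i -> Euler v M (F i) (F' i)) -> Euler v (m N.* M) (\ a -> sum (\ i -> F i a)) (\ a -> sum (\ i -> F' i a))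
  Euler-sum {m = zero} p = euler-const 0#
  Euler-sum {m = suc m} p = Euler-+ (p 0F) (Euler-sum (p ∘ F.suc))

  private
   tabulated : ℕ -> (ℕ -> Carrier) -> List Carrier
   tabulated zero f = []
   tabulated (suc N) f = f 0 :: tabulated N (f ∘ suc)

  -- a polynomial curve divided by t^M
  Euler-series : ∀ M N (f : ℕ -> Carrier) {F F'} -> (∀ a -> v a ^ M * F a ≈ sum {N} (\ k -> v a ^ # k * f (# k))) -> (∀ a -> v a ^ M * F' a ≈ sum {N} (\ k -> v a ^ # k * (ι (+ # k O.- + M)
   * f (# k)))) -> Euler v M F F'
  Euler-series M N f p p' = eulerian (tabulated N f) (\ a -> p a & evaluate-tabulated N f (v a)) (\ a -> p' a & euler-tabulated N 0 f (v a) & solves (euler (tabulated N f) (v a) :: ι (+ M) ::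
   evaluate (tabulated N f) (v a) :: []) (s0 -: (s1 -: 0:) *: s2) (s0 -: s1 *: s2))
   where
   evaluate-tabulated : ∀ N f t -> sum {N} (\ k -> t ^ # k * f (# k)) ≈ evaluate (tabulated N f) t
   evaluate-tabulated zero f t = refl
   evaluate-tabulated (suc N) f t = +-cong (*-identityˡ _) ((sum-cong-≋ {N} \ k -> *-assoc _ _ _) & sym (*-distribˡ-sum {N} t (\ k -> t ^ # k * f (suc (# k)))) & *-congˡ
    (evaluate-tabulated N (f ∘ suc) t))
   euler-tabulated : ∀ N j f t -> sum {N} (\ k -> t ^ # k * (ι (+ (j N.+ # k) O.- + M) * f (# k))) ≈ euler (tabulated N f) t - (ι (+ M) - ι (+ j)) * evaluate (tabulated N f) t
   euler-tabulated zero j f t = solves (ι (+ M) :: ι (+ j) :: []) 0: (0: -: (s0 -: s1) *: 0:)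
   euler-tabulated (suc N) j f t = +-cong (*-congˡ (*-congʳ (ι-cong (cong (\ z -> + z O.- + M) (N.+-identityʳ j)) & ι-+ (+ j) (O.- + M) & +-congˡ (ι-neg (+ M))))) ((sum-cong-≋ {N} \ k -> trans
    (*-assoc _ _ _) (*-congˡ (*-congˡ (*-congʳ (ι-cong (cong (\ z -> + z O.- + M) (N.+-suc j (# k)))))))) & sym (*-distribˡ-sum {N} t (\ k -> t ^ # k * (ι (+ (suc j N.+ # k) O.- + M) * f
    (suc (# k))))) & *-congˡ (euler-tabulated N (suc j) (f ∘ suc) t)) & solves (ι (+ M) :: ι (+ j) :: f 0 :: t :: evaluate (tabulated N (f ∘ suc)) t :: euler (tabulated N (f ∘ suc)) t :: []) (1:
    *: ((s1 -: s0) *: s2) +: s3 *: (s5 -: (s0 -: (1: +: s1)) *: s4)) (s3 *: (s4 +: s5) -: (s0 -: s1) *: (s2 +: s3 *: s4))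

 power-cancel : ∀ (a : Unit) k {x} -> val a ^ k * x ≈ 0# -> x ≈ 0#
 power-cancel a zero p = sym (*-identityˡ _) & p
 power-cancel a (suc k) {x} p = power-cancel a k (begin
  val a ^ k * x ≈⟨ *-identityˡ _ ⟨
  1# * (val a ^ k * x) ≈⟨ *-congʳ (trans (*-comm (val~1 a) (val a)) (val*val~1 a)) ⟨
  val~1 a * val a * (val a ^ k * x) ≈⟨ solves (val~1 a :: val a :: val a ^ k :: x :: []) (s0 *: s1 *: (s2 *: s3)) (s0 *: (s1 *: s2 *: s3)) ⟩
  val~1 a * (val a * val a ^ k * x) ≈⟨ trans (*-congˡ p) (zeroʳ _) ⟩
  0# ∎)

 Euler-vanish : ∀ {M F F'} -> Euler val M F F' -> (∀ a -> F a ≈ 0#) -> ∀ a -> F' a ≈ 0#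
 Euler-vanish {M} (eulerian cs p p') F≈0 a = power-cancel a M (p' a & +-cong (euler-null cs null (val a)) (-‿cong (*-congˡ (evaluate-null cs null (val a)) & zeroʳ _)) & +-identityˡ _ &
  -0#≈0#)
  where
  null : ∀ k -> coefficient cs k ≈ 0#
  null = coefficients-vanish cs \ a -> trans (sym (p a)) (*-congˡ (F≈0 a) & zeroʳ _)

 -- Taylor's theorem: functions F k with F k + 1 = (F k)′ vanish if they vanish at 0.
 Taylor-vanish : (F : ℕ -> Carrier -> Carrier) -> (∀ k -> Euler id 0 (F k) (\ t -> t * F (suc k) t)) -> (∀ k {s t} -> s ≈ t -> F k s ≈ F k t) -> (∀ k -> F k 0# ≈ 0#) -> ∀ k t -> F k t ≈ 0#
 Taylor-vanish F E F-cong F0 k t = value' k t & evaluate-null (cs k) (\ j -> null j k) t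
  where
  cs : ℕ -> List Carrier
  cs k = Euler.coefficients (E k)
  value' : ∀ k t -> F k t ≈ evaluate (cs k) t
  value' k t = sym (*-identityˡ _) & Euler.value (E k) t
  constant : ∀ cs -> evaluate cs 0# ≈ coefficient cs 0
  constant [] = refl
  constant (c :: cs) = +-congˡ (zeroˡ _) & +-identityʳ c
  null : ∀ j k -> coefficient (cs k) j ≈ 0#
  null zero k = sym (constant (cs k)) & sym (value' k 0#) & F0 k
  null (suc j) k = ι-regular (+ suc j) (\ ()) (*-comm _ _ & sym (coefficient-euler (cs k) (suc j)) & coefficients-unique (eulerl (cs k)) (0# :: cs (suc k)) (\ a -> evaluate-euler (cs k) (val
   a) & (solves (euler (cs k) (val a) :: evaluate (cs k) (val a) :: []) (s0) (s0 -: 0: *: s1) & sym (Euler.derivative (E k) (val a))) & *-identityˡ _ & *-congˡ (value' (suc k) (val a)) & sym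
   (+-identityˡ _)) (suc j) & null j (suc k))

module BigCell {c ℓ} {K : CommutativeRing c ℓ} (isℚ : IsℚAlgebra K) {n} (π : Representation n) where
 open RootSubgroups K π
 open RootConjugation K π
 open EulerDerivatives isℚ
 open TorusWeights isℚ π
 open LieSpan K π using (Lie; basis; _⊹_; _⊛_)
 open Points isℚ π using (Lie-elementary)
 open Matrices K using (ι; Invertible; invertible; mat; mat⁻¹; invˡ; invʳ)
 open S using (_≈_; _+_; _*_; -_; 0#; 1#; Carrier)

 data Polynomial : Set c where
  scalar : Carrier -> Polynomial
  entry : Fin n -> Fin n -> Polynomial
  _⊕_ : Polynomial -> Polynomial -> Polynomial
  _⊗_ : Polynomial -> Polynomial -> Polynomial

 embed : Poly n -> Polynomial
 embed (con k) = scalar (ι k)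
 embed (entry i j) = entry i j
 embed (p ⊕ q) = embed p ⊕ embed q
 embed (p ⊗ q) = embed p ⊗ embed q

 eval : M.Mat n -> Polynomial -> Carrier
 eval A (scalar r) = r
 eval A (entry i j) = A i j
 eval A (f ⊕ g) = eval A f + eval A g
 eval A (f ⊗ g) = eval A f * eval A g

 eval-embed : ∀ A p -> eval A (embed p) ≡ evalPoly K A p
 eval-embed A (con k) = rfl
 eval-embed A (entry i j) = rfl
 eval-embed A (p ⊕ q) = cong₂ _+_ (eval-embed A p) (eval-embed A q)
 eval-embed A (p ⊗ q) = cong₂ _*_ (eval-embed A p) (eval-embed A q)

 ∂ : M.Mat n -> M.Mat n -> Polynomial -> Carrier
 ∂ A V (scalar r) = 0#
 ∂ A V (entry i j) = V i j
 ∂ A V (f ⊕ g) = ∂ A V f + ∂ A V g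
 ∂ A V (f ⊗ g) = ∂ A V f * eval A g + eval A f * ∂ A V g

 eval-cong : ∀ {A B} -> A M.≈ B -> ∀ f -> eval A f ≈ eval B f
 eval-cong p (scalar r) = S.refl
 eval-cong p (entry i j) = p i j
 eval-cong p (f ⊕ g) = S.+-cong (eval-cong p f) (eval-cong p g)
 eval-cong p (f ⊗ g) = S.*-cong (eval-cong p f) (eval-cong p g)

 ∂-cong : ∀ {A B V W} -> A M.≈ B -> V M.≈ W -> ∀ f -> ∂ A V f ≈ ∂ B W f
 ∂-cong p q (scalar r) = S.refl
 ∂-cong p q (entry i j) = q i j
 ∂-cong p q (f ⊕ g) = S.+-cong (∂-cong p q f) (∂-cong p q g)
 ∂-cong p q (f ⊗ g) = S.+-cong (S.*-cong (∂-cong p q f) (eval-cong p g)) (S.*-cong (eval-cong p f) (∂-cong p q g))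

 ∂-linear : ∀ A r V W f -> ∂ A (r M.⊙ V M.+ W) f ≈ r * ∂ A V f + ∂ A W f
 ∂-linear A r V W (scalar s) = solves (r :: []) 0: (s0 *: 0: +: 0:)
 ∂-linear A r V W (entry i j) = S.refl
 ∂-linear A r V W (f ⊕ g) = S.+-cong (∂-linear A r V W f) (∂-linear A r V W g) S.& solves (r :: ∂ A V f :: ∂ A W f :: ∂ A V g :: ∂ A W g :: []) (s0 *: s1 +: s2 +: (s0 *: s3 +: s4)) (s0 *: (s1 +:
  s3) +: (s2 +: s4))
 ∂-linear A r V W (f ⊗ g) = S.+-cong (S.*-congʳ (∂-linear A r V W f)) (S.*-congˡ (∂-linear A r V W g)) S.& solves (r :: ∂ A V f :: ∂ A W f :: ∂ A V g :: ∂ A W g :: eval A f :: eval A g :: []) ((s0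
  *: s1 +: s2) *: s6 +: s5 *: (s0 *: s3 +: s4)) (s0 *: (s1 *: s6 +: s5 *: s3) +: (s2 *: s6 +: s5 *: s4))

 private
  combination : ∀ m -> (Fin m -> Polynomial) -> (Fin m -> Carrier) -> Polynomial
  combination zero f r = scalar 0#
  combination (suc m) f r = (f 0F ⊗ scalar (r 0F)) ⊕ combination m (f ∘ F.suc) (r ∘ F.suc)

  linear : M.Mat n -> Fin n -> Fin n -> Polynomial
  linear C i j = combination n (entry i) (\ k -> C k j)

  eval-combination : ∀ A m f r -> eval A (combination m f r) ≈ S.sum (\ k -> eval A (f k) * r k)
  eval-combination A zero f r = S.refl
  eval-combination A (suc m) f r = S.+-congˡ (eval-combination A m (f ∘ F.suc) (r ∘ F.suc))

  eval-linear : ∀ A C i j -> eval A (linear C i j) ≈ (A M.* C) i j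
  eval-linear A C i j = eval-combination A n (entry i) (\ k -> C k j)

 translate derive : M.Mat n -> Polynomial -> Polynomial
 translate C (scalar r) = scalar r
 translate C (entry i j) = linear C i j
 translate C (f ⊕ g) = translate C f ⊕ translate C g
 translate C (f ⊗ g) = translate C f ⊗ translate C g
 derive V (scalar r) = scalar 0#
 derive V (entry i j) = linear V i j
 derive V (f ⊕ g) = derive V f ⊕ derive V g
 derive V (f ⊗ g) = (derive V f ⊗ g) ⊕ (f ⊗ derive V g)

 eval-translate : ∀ A C f -> eval A (translate C f) ≈ eval (A M.* C) f
 eval-translate A C (scalar r) = S.refl
 eval-translate A C (entry i j) = eval-linear A C i j
 eval-translate A C (f ⊕ g) = S.+-cong (eval-translate A C f) (eval-translate A C g)
 eval-translate A C (f ⊗ g) = S.*-cong (eval-translate A C f) (eval-translate A C g)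

 eval-derive : ∀ A V f -> eval A (derive V f) ≈ ∂ A (A M.* V) f
 eval-derive A V (scalar r) = S.refl
 eval-derive A V (entry i j) = eval-linear A V i j
 eval-derive A V (f ⊕ g) = S.+-cong (eval-derive A V f) (eval-derive A V g)
 eval-derive A V (f ⊗ g) = S.+-cong (S.*-congʳ (eval-derive A V f)) (S.*-congˡ (eval-derive A V g))

 private
  degree : ℕ -> Polynomial -> ℕ
  degree d (scalar r) = 0
  degree d (entry i j) = d
  degree d (f ⊕ g) = degree d f N.+ degree d g
  degree d (f ⊗ g) = degree d f N.+ degree d g

  degree-0 : ∀ {d} f -> d ≡ 0 -> degree d f ≡ 0
  degree-0 (scalar r) p = rfl
  degree-0 (entry i j) p = p
  degree-0 (f ⊕ g) p = cong₂ N._+_ (degree-0 f p) (degree-0 g p)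
  degree-0 (f ⊗ g) p = cong₂ N._+_ (degree-0 f p) (degree-0 g p)

 sum-entry : ∀ {m} (w : Fin m -> M.Mat n) i j -> M.sum w i j ≈ S.sum (\ k -> w k i j)
 sum-entry {zero} w i j = S.refl
 sum-entry {suc m} w i j = S.+-congˡ (sum-entry (w ∘ F.suc) i j)

 series-entry : ∀ N D t i j -> series N D t i j ≈ S.sum {N} (\ k -> t S.^ # k * ι (D (# k) i j))
 series-entry N D t = sum-entry {N} (\ k -> (t S.^ # k) M.⊙ ιM (D (# k)))

 module _ {t} {T : Set t} {v : T -> Carrier} where
  Curve : ℕ -> (A A' : T -> M.Mat n) -> Set _
  Curve d A A' = ∀ i j -> Euler v d (\ a -> A a i j) (\ a -> A' a i j)

  curve-eval : ∀ {d A A'} -> Curve d A A' -> ∀ f -> Euler v (degree d f) (\ a -> eval (A a) f) (\ a -> ∂ (A a) (A' a) f)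
  curve-eval p (scalar r) = euler-const r
  curve-eval p (entry i j) = p i j
  curve-eval p (f ⊕ g) = Euler-+ (curve-eval p f) (curve-eval p g)
  curve-eval p (f ⊗ g) = Euler-* (curve-eval p f) (curve-eval p g)

  curve-*l : ∀ {d A A'} C -> Curve d A A' -> Curve (n N.* d) (\ a -> C M.* A a) (\ a -> C M.* A' a)
  curve-*l {A = A} {A'} C p i j = Euler-sum \ k -> Euler-cong (\ _ -> S.refl) (\ a -> S.+-congʳ (S.zeroˡ (A a k j)) S.& S.+-identityˡ _) (Euler-* (euler-const (C i k)) (p k j))

  curve-*r : ∀ {d A A'} C -> Curve d A A' -> Curve (n N.* d) (\ a -> A a M.* C) (\ a -> A' a M.* C)
  curve-*r {d} {A} {A'} C p i j = Euler-sum \ k -> J.subst (\ d -> Euler v d (\ a -> A a i k * C k j) (\ a -> A' a i k * C k j)) (N.+-identityʳ d) (Euler-cong (\ _ -> S.refl) (\ a -> S.+-congˡ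
   (S.zeroʳ (A a i k)) S.& S.+-identityʳ _) (Euler-* (p i k) (euler-const (C k j))))

  curve-x : ∀ γ -> Curve 0 (\ a -> x γ (v a)) (\ a -> v a M.⊙ (ιM (X γ) M.* x γ (v a)))
  curve-x γ i j = Euler-series 0 bound (\ k -> ι (divPow γ k i j)) (\ a -> S.*-identityˡ _ S.& series-entry bound (divPow γ) (v a) i j) (\ a -> S.*-identityˡ _ S.& M.sym (series-euler
   (X-divided γ) (v a)) i j S.& series-entry bound (\ k -> + k I.·ᴹ divPow γ k) (v a) i j S.& (S.sum-cong-≋ {bound} \ k -> S.*-congˡ (ι-* (+ # k) (divPow γ (# k) i j) S.& S.*-congʳ (ι-cong
   (J.sym (O.+-identityʳ (+ # k)))))))

 curve-h : ∀ γ -> Curve {v = val} (WeightGrading.offset (TorusProjections.grading isℚ π γ)) (Torus.h γ) (\ a -> ιM H[ γ ] M.* Torus.h γ a)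
 curve-h γ i j = Euler-series G.offset G.size (\ k -> ι (G.P k i j)) (\ a -> scaled-h a i j S.& series-entry G.size G.P (val a) i j) (\ a -> (M.solve (val a S.^ G.offset :: []) (ιM H[ γ ] :: h a
  :: []) (s0 :% (m0 :* m1)) (m0 :* (s0 :% m1)) i j S.& M.trans (M.congl (ιM H[ γ ]) (scaled-h a)) (M.sym (series-*l G.size G.P H[ γ ] (val a))) i j) S.& series-entry G.size (\ k -> H[ γ ] I.*
  G.P k) (val a) i j S.& (S.sum-cong-≋ {G.size} \ k -> S.*-congˡ (ι-cong (G.eigenl (# k) (F.toℕ<n k) i j) S.& ι-* (+ # k O.- + G.offset) (G.P (# k) i j))))
  where
  open Torus γ using (h)
  module G = WeightGrading (TorusProjections.grading isℚ π γ)
  scaled-h : ∀ a -> (val a S.^ G.offset) M.⊙ h a M.≈ series G.size G.P (val a)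
  scaled-h a = M.%-cong S.refl (TorusProjections.h-expansion isℚ π γ a) M.& M.solve (val a S.^ G.offset :: val~1 a S.^ G.offset :: []) (series G.size G.P (val a) :: []) (s0 :% s1 :% m0) ((s0 *:
   s1) :% m0) M.& M.%-cong (power-inverse a G.offset) M.refl M.& M.%-one _

 data Factor : Set where
  unipotent torus : Root -> Factor

 factor : Factor -> Unit -> M.Mat n
 factor (unipotent γ) u = x γ (val u)
 factor (torus γ) u = Torus.h γ u

 product : (φs : List Factor) -> Vec Unit (length φs) -> M.Mat n
 product [] [] = M.1#
 product (φ :: φs) (u :: us) = factor φ u M.* product φs us

 cellFactors : List Factor
 cellFactors = unipotent (-ᴿ qr) :: unipotent (-ᴿ pr) :: unipotent (-ᴿ ar) :: unipotent (-ᴿ br) :: torus ar :: torus br :: unipotent br :: unipotent ar :: unipotent pr :: unipotent qr :: []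

 cell : Vec Unit 10 -> M.Mat n
 cell = product cellFactors

 private
  E : Invertible n -> Set _
  E = Elementary K π

  ElementaryMatrix : M.Mat n -> Set _
  ElementaryMatrix A = Σ (Invertible n) \ h -> E h × mat h M.≈ A

  elementary-x : ∀ γ t -> ElementaryMatrix (x γ t)
  elementary-x γ t = invertible (x γ t) (x γ (- t)) (x-inverse γ (S.-‿inverseˡ t)) (x-inverse γ (S.-‿inverseʳ t)) , gen (γ , t , x≈rootElement γ t) , M.refl

  elementary-* : ∀ {A B} -> ElementaryMatrix A -> ElementaryMatrix B -> ElementaryMatrix (A M.* B)
  elementary-* (g , e , p) (h , f , q) = Group._∙_ (Matrices.GL K n) g h , mul e f , M.*-cong p q

  elementary-factor : ∀ φ u -> ElementaryMatrix (factor φ u)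
  elementary-factor (unipotent γ) u = elementary-x γ (val u)
  elementary-factor (torus γ) u = elementary-* (elementary-w u) (elementary-w (Torus.-1u γ))
   where
   elementary-w : ∀ u -> ElementaryMatrix (Torus.w γ u)
   elementary-w u = elementary-* (elementary-* (elementary-x γ (val u)) (elementary-x (-ᴿ γ) (- val~1 u))) (elementary-x γ (val u))

 elementary-product : ∀ φs us -> ElementaryMatrix (product φs us)
 elementary-product [] [] = Group.ε (Matrices.GL K n) , unit , M.refl
 elementary-product (φ :: φs) (u :: us) = elementary-* (elementary-factor φ u) (elementary-product φs us)

 module _ (f : Polynomial) where
  record Tangent (A B V : M.Mat n) : Set ℓ where
   constructor tangent
   field vanishes : ∂ (A M.* B) (A M.* (V M.* B)) f ≈ 0#

  record Vanishing (A : M.Mat n) (φs : List Factor) : Set (c ⊔ ℓ) where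
   constructor vanishing
   field at : ∀ us -> eval (A M.* product φs us) f ≈ 0#

  OnCell : Set _
  OnCell = ∀ us -> eval (cell us) f ≈ 0#

  private
   step : ∀ {A φ φs} -> Vanishing A (φ :: φs) -> ∀ u -> Vanishing (A M.* factor φ u) φs
   step {A} {φ} {φs} (vanishing p) u = vanishing \ us -> S.trans (eval-cong (M.*-assoc A (factor φ u) (product φs us)) f) (p (u :: us))

   tangent-linear : ∀ {A B V W} r -> Tangent A B V -> Tangent A B W -> Tangent A B (r M.⊙ V M.+ W)
   tangent-linear {A} {B} {V} {W} r (tangent p) (tangent q) = tangent (∂-cong M.refl (M.solve (r :: []) (A :: B :: V :: W :: []) (m0 :* ((s0 :% m2 :+ m3) :* m1)) (s0 :% (m0 :* (m2 :* m1)) :+ m0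
    :* (m3 :* m1))) f S.& ∂-linear (A M.* B) r (A M.* (V M.* B)) (A M.* (W M.* B)) f S.& S.+-cong (S.*-congˡ p S.& S.zeroʳ r) q S.& S.+-identityˡ _)

   tangent-cong : ∀ {A B V W} -> V M.≈ W -> Tangent A B V -> Tangent A B W
   tangent-cong {A} {B} {V} {W} p (tangent q) = tangent (∂-cong M.refl (M.congl A (M.congr B (M.sym p))) f S.& q)

   tangent-0 : ∀ {A B V} -> Tangent A B V -> Tangent A B M.0#
   tangent-0 {A} {B} {V} p = tangent-cong {A} {B} (M.solve [] (V :: []) ((-: 1:) :% m0 :+ m0) :0) (tangent-linear {A} {B} {V} {V} (- 1#) p p)

   tangent-scale : ∀ {A B V} r -> Tangent A B V -> Tangent A B (r M.⊙ V)
   tangent-scale {A} {B} {V} r p = tangent-cong {A} {B} (M.+-identityʳ (r M.⊙ V)) (tangent-linear {A} {B} {V} {M.0#} r p (tangent-0 {A} {B} {V} p))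

   right : ∀ {A m B V V'} -> Conj m V V' -> Tangent A (m M.* B) V' -> Tangent (A M.* m) B V
   right {A} {m} {B} {V} {V'} c (tangent p) = tangent (∂-cong (M.*-assoc A m B) (M.solve [] (A :: m :: B :: V :: []) ((m0 :* m1) :* (m3 :* m2)) (m0 :* ((m1 :* m3) :* m2)) M.& M.congl A (M.congr
    B c) M.& M.congl A (M.*-assoc V' m B)) f S.& p)

   left : ∀ {A m B V V'} -> Conj m V V' -> Tangent (A M.* m) B V -> Tangent A (m M.* B) V'
   left {A} {m} {B} {V} {V'} c (tangent p) = tangent (S.sym (∂-cong (M.*-assoc A m B) (M.solve [] (A :: m :: B :: V :: []) ((m0 :* m1) :* (m3 :* m2)) (m0 :* ((m1 :* m3) :* m2)) M.& M.congl A
    (M.congr B c) M.& M.congl A (M.*-assoc V' m B)) f) S.& p)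

   -- the tangent vector of the curve given by the parameter of the next factor
   moving : ∀ {A φ φs d m'} -> Curve {v = val} d (factor φ) m' -> Vanishing A (φ :: φs) -> ∀ u us -> ∂ (A M.* (factor φ u M.* product φs us)) (A M.* (m' u M.* product φs us)) f ≈ 0#
   moving {A} {φ} {φs} curve p u us = Euler-vanish (curve-eval (curve-*l A (curve-*r (product φs us) curve)) f) (\ u -> Vanishing.at p (u :: us)) u

   at-x : ∀ {A γ φs} -> Vanishing A (unipotent γ :: φs) -> ∀ u us -> Tangent A (x γ (val u) M.* product φs us) (ιM (X γ))
   at-x {A} {γ} {φs} p u us = tangent-cong {A} {B} (M.solve (val u :: val~1 u :: []) (ιM (X γ) :: []) (s1 :% s0 :% m0) ((s0 *: s1) :% m0) M.& M.%-cong (val*val~1 u) M.refl M.& M.%-one _)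
    (tangent-scale {A} {B} (val~1 u) (tangent (∂-cong M.refl (M.congl A (M.solve (val u :: []) (ιM (X γ) :: x γ (val u) :: product φs us :: []) ((s0 :% m0) :* (m1 :* m2)) ((s0 :% (m0 :* m1)) :*
    m2))) f S.& moving {A} {unipotent γ} {φs} (curve-x γ) p u us)))
    where
    B = x γ (val u) M.* product φs us

   at-h : ∀ {A γ φs} -> Vanishing A (torus γ :: φs) -> ∀ u us -> Tangent A (Torus.h γ u M.* product φs us) (ιM H[ γ ])
   at-h {A} {γ} {φs} p u us = tangent (∂-cong M.refl (M.congl A (M.sym (M.*-assoc (ιM H[ γ ]) (Torus.h γ u) (product φs us)))) f S.& moving {A} {torus γ} {φs} (curve-h γ) p u us)

   module _ {A B : M.Mat n} where
    right-fixed : ∀ β δ t -> δ ≢ -ᴿ β -> {False (any-root? \ ε -> β ⊞ δ ≟ ε)} -> Tangent A (x β t M.* B) (XR δ) -> Tangent (A M.* x β t) B (XR δ)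
    right-fixed β δ t q {r} = right {A} {x β t} {B} (conj-fixed q (no-sum β δ {r}) t)

    left-fixed : ∀ β δ t -> δ ≢ -ᴿ β -> {False (any-root? \ ε -> β ⊞ δ ≟ ε)} -> Tangent (A M.* x β t) B (XR δ) -> Tangent A (x β t M.* B) (XR δ)
    left-fixed β δ t q {r} = left {A} {x β t} {B} (conj-fixed q (no-sum β δ {r}) t)

    right-step : ∀ β {δ ε} t -> β ⊞ δ ≈ ε -> {False (any-root? \ ζ -> β ⊞ ε ≟ ζ)} -> Tangent A (x β t M.* B) (XR δ) -> Tangent A (x β t M.* B) (XR ε) -> Tangent (A M.* x β t) B (XR δ)
    right-step β {δ} {ε} t q {r} p p' = right {A} {x β t} {B} (conj-step q (no-sum β ε {r}) t) (tangent-cong {A} {x β t M.* B} (M.+-comm (_ M.⊙ XR ε) (XR δ)) (tangent-linear {A} {x β t M.*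
     B} (t * ι (N β δ ε)) p' p))

    left-step : ∀ β {δ ε} t -> β ⊞ δ ≈ ε -> {False (any-root? \ ζ -> β ⊞ ε ≟ ζ)} -> Tangent (A M.* x β t) B (XR δ) -> Tangent A (x β t M.* B) (XR ε) -> Tangent A (x β t M.* B) (XR δ)
    left-step β {δ} {ε} t q {r} p p' = tangent-cong {A} {x β t M.* B} (M.solve (t * ι (N β δ ε) :: []) (XR δ :: XR ε :: []) ((-: s0) :% m1 :+ (m0 :+ s0 :% m1)) (m0)) (tangent-linear {A} {x β t
     M.* B} (- (t * ι (N β δ ε))) p' (left {A} {x β t} {B} (conj-step q (no-sum β ε {r}) t) p))

    left-torus : ∀ γ δ u -> Tangent (A M.* Torus.h γ u) B (XR δ) -> Tangent A (Torus.h γ u M.* B) (XR δ)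
    left-torus γ δ u p = tangent-cong {A} {Torus.h γ u M.* B} (M.solve (s :: u ^ᶻ pairing γ δ :: []) (XR δ :: []) (s0 :% s1 :% m0) ((s0 *: s1) :% m0) M.& M.%-cong s-inverse M.refl M.& M.%-one
     _) (tangent-scale {A} {Torus.h γ u M.* B} s (left {A} {Torus.h γ u} {B} (torus-X γ δ u) p))
     where
     inverse : ∀ k -> ∃[ s ] s * (u ^ᶻ k) ≈ 1#
     inverse (+ k) = val~1 u S.^ k , S.trans (S.*-comm _ _) (power-inverse u k)
     inverse -[1+ k ] = val u S.^ suc k , power-inverse u (suc k)
     s = fst (inverse (pairing γ δ))
     s-inverse = snd (inverse (pairing γ δ))

  private
   H-span : ∀ δ -> ιM H[ δ ] M.≈ ι (corootCoeff δ 0F) M.⊙ ιM H[ ar ] M.+ ι (corootCoeff δ 1F) M.⊙ ιM H[ br ]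
   H-span δ = (ιM-cong {A = H[ δ ]} {corootCoeff δ 0F I.·ᴹ H[ ar ] I.+ corootCoeff δ 1F I.·ᴹ H[ br ]} \ i j -> ℤs.solves (corootCoeff δ 0F :: corootCoeff δ 1F :: H 0F i j :: H 1F i j :: []) (s0
    *: s2 +: (s1 *: s3 +: 0:)) (s0 *: (1: *: s2 +: (0: *: s3 +: 0:)) +: s1 *: (0: *: s2 +: (1: *: s3 +: 0:)))) M.& ιM-+ (corootCoeff δ 0F I.·ᴹ H[ ar ]) _ M.& M.+-cong (ιM-· (corootCoeff δ
    0F) H[ ar ]) (ιM-· (corootCoeff δ 1F) H[ br ])

  -- All tangent vectors are collected between the negative unipotent factors and the
  -- torus; the Lie algebra they span is invariant under conjugation.
  tangent-Lie : OnCell -> ∀ us {V} -> Lie V -> ∂ (cell us) (cell us M.* V) f ≈ 0#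
  tangent-Lie on-cell (s₁ :: s₂ :: s₃ :: s₄ :: u :: v :: t1 :: t2 :: t3 :: t4 :: []) {V} lie = S.sym (∂-cong assoc₄ (M.congl A4 conjugated M.& M.sym (M.*-assoc A4 B4 V) M.& M.congr V assoc₄) f) S.&
   Tangent.vanishes (spanned (fst (Lie-elementary (fst (snd elementary-B4)) lie)))
   where
   A1 = M.1# M.* x (-ᴿ qr) (val s₁)
   A2 = A1 M.* x (-ᴿ pr) (val s₂)
   A3 = A2 M.* x (-ᴿ ar) (val s₃)
   A4 = A3 M.* x (-ᴿ br) (val s₄)
   A5 = A4 M.* Torus.h ar u
   A6 = A5 M.* Torus.h br v
   A7 = A6 M.* x br (val t1)
   A8 = A7 M.* x ar (val t2)
   A9 = A8 M.* x pr (val t3)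
   φ4 = torus ar :: torus br :: unipotent br :: unipotent ar :: unipotent pr :: unipotent qr :: []
   us4 = u :: v :: t1 :: t2 :: t3 :: t4 :: []
   B4 = product φ4 us4
   v0 : Vanishing M.1# cellFactors
   v0 = vanishing \ us -> S.trans (eval-cong (M.*-identityˡ (cell us)) f) (on-cell us)
   v1 = step v0 s₁
   v₂ = step v1 s₂
   v3 = step v₂ s₃
   v4 = step v3 s₄
   v5 = step v4 u
   v6 = step v5 v
   v7 = step v6 t1
   v8 = step v7 t2
   v9 = step v8 t3

   q1 = right-fixed {M.1#} (-ᴿ qr) (-ᴿ qr) (val s₁) (\ ()) (at-x v0 s₁ (s₂ :: s₃ :: s₄ :: us4))
   q2 = right-fixed {A1} (-ᴿ pr) (-ᴿ qr) (val s₂) (\ ()) q1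
   p2 = right-fixed {A1} (-ᴿ pr) (-ᴿ pr) (val s₂) (\ ()) (at-x v1 s₂ (s₃ :: s₄ :: us4))
   q3 = right-fixed {A2} (-ᴿ ar) (-ᴿ qr) (val s₃) (\ ()) q2
   p3 = right-step {A2} (-ᴿ ar) { -ᴿ pr} { -ᴿ qr} (val s₃) ⟨ rfl , rfl ⟩ p2 q2
   a3 = right-fixed {A2} (-ᴿ ar) (-ᴿ ar) (val s₃) (\ ()) (at-x v₂ s₃ (s₄ :: us4))
   q4 = right-fixed {A3} (-ᴿ br) (-ᴿ qr) (val s₄) (\ ()) q3
   p4 = right-fixed {A3} (-ᴿ br) (-ᴿ pr) (val s₄) (\ ()) p3
   a4 = right-step {A3} (-ᴿ br) { -ᴿ ar} { -ᴿ pr} (val s₄) ⟨ rfl , rfl ⟩ a3 p3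
   b4 = right-fixed {A3} (-ᴿ br) (-ᴿ br) (val s₄) (\ ()) (at-x v3 s₄ us4)

   q8 = left-fixed {A8} pr qr (val t3) (\ ()) (at-x v9 t4 [])
   p₈ = at-x v8 t3 (t4 :: [])
   q7 = left-fixed {A7} ar qr (val t2) (\ ()) q8
   p₇ = left-step {A7} ar {pr} {qr} (val t2) ⟨ rfl , rfl ⟩ p₈ q7
   a7 = at-x v7 t2 (t3 :: t4 :: [])
   q6 = left-fixed {A6} br qr (val t1) (\ ()) q7
   p₆ = left-fixed {A6} br pr (val t1) (\ ()) p₇
   a6 = left-step {A6} br {ar} {pr} (val t1) ⟨ rfl , rfl ⟩ a7 p₆
   b6 = at-x v6 t1 (t2 :: t3 :: t4 :: [])

   through-torus : ∀ δ -> Tangent A6 (product (Data.List.Base.drop 2 φ4) (t1 :: t2 :: t3 :: t4 :: [])) (XR δ) -> Tangent A4 B4 (XR δ)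
   through-torus δ p = left-torus {A4} ar δ u (left-torus {A5} br δ v p)

   root-tangent : ∀ δ -> Tangent A4 B4 (XR δ)
   root-tangent (short pos pos) = through-torus pr p₆
   root-tangent (short pos neg) = through-torus ar a6
   root-tangent (short neg pos) = a4
   root-tangent (short neg neg) = p4
   root-tangent (long 0F pos) = through-torus qr q6
   root-tangent (long 0F neg) = q4
   root-tangent (long 1F pos) = through-torus br b6
   root-tangent (long 1F neg) = b4

   spanned : ∀ {V} -> Lie V -> Tangent A4 B4 V
   spanned (basis (root δ)) = root-tangent δ
   spanned (basis (cartan δ)) = tangent-cong {A4} {B4} (M.sym (H-span δ)) (tangent-linear {A4} {B4} {ιM H[ ar ]} {ι (corootCoeff δ 1F) M.⊙ ιM H[ br ]} (ι (corootCoeff δ 0F)) (at-h v4 u (v ::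
    t1 :: t2 :: t3 :: t4 :: [])) (tangent-scale {A4} {B4} {ιM H[ br ]} (ι (corootCoeff δ 1F)) (left {A4} {Torus.h ar u} (torus-H ar br u) (at-h v5 v (t1 :: t2 :: t3 :: t4 :: [])))))
   spanned (_⊹_ {V} {W} p q) = tangent-cong {A4} {B4} (M.+-congʳ (M.%-one V)) (tangent-linear {A4} {B4} {V} {W} 1# (spanned p) (spanned q))
   spanned (r ⊛ p) = tangent-scale {A4} {B4} r (spanned p)
   spanned (Lie.resp e p) = tangent-cong {A4} {B4} e (spanned p)

   elementary-B4 = elementary-product φ4 us4
   b = fst elementary-B4
   conjugated : (mat b M.* (V M.* mat⁻¹ b)) M.* B4 M.≈ B4 M.* V
   conjugated = M.congl (mat b M.* (V M.* mat⁻¹ b)) (M.sym (snd (snd elementary-B4))) M.& M.solve [] (mat b :: mat⁻¹ b :: V :: []) ((m0 :* (m2 :* m1)) :* m0) ((m0 :* m2) :* (m1 :* m0)) M.&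
    M.congl (mat b M.* V) (invˡ b) M.& M.*-identityʳ (mat b M.* V) M.& M.congr V (snd (snd elementary-B4))
   assoc₄ : A4 M.* B4 M.≈ cell (s₁ :: s₂ :: s₃ :: s₄ :: us4)
   assoc₄ = M.solve [] (x (-ᴿ qr) (val s₁) :: x (-ᴿ pr) (val s₂) :: x (-ᴿ ar) (val s₃) :: x (-ᴿ br) (val s₄) :: B4 :: []) ((:1 :* m0 :* m1 :* m2 :* m3) :* m4) (m0 :* (m1 :* (m2 :* (m3 :* m4))))

 OnCell-derive : ∀ f β -> OnCell f -> OnCell (derive (ιM (X β)) f)
 OnCell-derive f β p us = eval-derive (cell us) (ιM (X β)) f S.& tangent-Lie f p us (basis (root β))

 OnCell-translate : ∀ f β t -> OnCell f -> OnCell (translate (x β t) f)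
 OnCell-translate f β t p us = eval-translate ω (x β t) f S.& Taylor-vanish (\ k t -> eval (ω M.* x β t) (iterate k)) euler' (\ k q -> eval-cong (M.congl ω (x-cong β q)) (iterate k)) (\ k ->
  eval-cong (M.congl ω (x-0 β) M.& M.*-identityʳ ω) (iterate k) S.& on-cell k us) 0 t
  where
  ω = cell us
  V = ιM (X β)
  iterate : ℕ -> Polynomial
  iterate zero = f
  iterate (suc k) = derive V (iterate k)
  on-cell : ∀ k -> OnCell (iterate k)
  on-cell zero = p
  on-cell (suc k) = OnCell-derive (iterate k) β (on-cell k)
  euler' : ∀ k -> Euler id 0 (\ t -> eval (ω M.* x β t) (iterate k)) (\ t -> t * eval (ω M.* x β t) (derive V (iterate k)))
  euler' k = J.subst (\ d -> Euler id d F F') (degree-0 (iterate k) (N.*-zeroʳ n)) (Euler-cong (\ _ -> S.refl) derivative (curve-eval (curve-*l ω (curve-x β)) (iterate k)))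
   where
   F F' : Carrier -> Carrier
   F t = eval (ω M.* x β t) (iterate k)
   F' t = t * eval (ω M.* x β t) (derive V (iterate k))
   derivative : ∀ t -> ∂ (ω M.* x β t) (ω M.* (t M.⊙ (V M.* x β t))) (iterate k) ≈ F' t
   derivative t = ∂-cong M.refl (M.congl ω (M.%-cong S.refl (M.sym (SL2.x-X β t))) M.& M.solve (t :: []) (ω :: x β t :: V :: []) (m0 :* (s0 :% (m1 :* m2))) (s0 :% ((m0 :* m1) :* m2) :+ 0: :%
    m0)) (iterate k) S.& ∂-linear (ω M.* x β t) t ((ω M.* x β t) M.* V) (0# M.⊙ ω) (iterate k) S.& S.+-cong (S.*-congˡ (S.sym (eval-derive (ω M.* x β t) V (iterate k)))) (∂-0 (iterate k))
    S.& S.+-identityʳ _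
    where
    ∂-0 : ∀ g -> ∂ (ω M.* x β t) (0# M.⊙ ω) g ≈ 0#
    ∂-0 g = ∂-cong M.refl (M.solve [] (ω :: []) (0: :% m0) ((-: 1:) :% m0 :+ m0)) g S.& ∂-linear (ω M.* x β t) (- 1#) ω ω g S.& S.+-congʳ (S.-1*x≈-x _) S.& S.-‿inverseˡ _

 private
  OnCell-resp : ∀ f {C D} -> C M.≈ D -> OnCell (translate C f) -> OnCell (translate D f)
  OnCell-resp f {C} {D} p q us = eval-translate (cell us) D f S.& eval-cong (M.congl (cell us) (M.sym p)) f S.& S.sym (eval-translate (cell us) C f) S.& q us

  OnCell-* : ∀ f C D -> OnCell (translate C (translate D f)) -> OnCell (translate (C M.* D) f)
  OnCell-* f C D q us = eval-translate (cell us) (C M.* D) f S.& eval-cong (M.sym (M.*-assoc (cell us) C D)) f S.& S.sym (eval-translate (cell us M.* C) D f) S.& S.sym (eval-translate (cell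
   us) C (translate D f)) S.& q us

  Invariant : M.Mat n -> Set _
  Invariant C = ∀ f -> OnCell f -> OnCell (translate C f)

 translate-elementary : ∀ {h} -> E h -> Invariant (mat h) × Invariant (mat⁻¹ h)
 translate-elementary {h} (gen (γ , t , p)) = (\ f q -> OnCell-resp f (M.sym h≈) (OnCell-translate f γ t q)) , (\ f q -> OnCell-resp f {x γ (- t)} {mat⁻¹ h} (Group.⁻¹-cong (Matrices.GL K n)
  {fst (elementary-x γ t)} {h} (M.sym h≈)) (OnCell-translate f γ (- t) q))
  where
  h≈ : mat h M.≈ x γ t
  h≈ = p M.& M.sym (x≈rootElement γ t)
 translate-elementary unit = same , same
  where
  same : Invariant M.1#
  same f q us = eval-translate (cell us) M.1# f S.& eval-cong (M.*-identityʳ (cell us)) f S.& q us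
 translate-elementary (mul {g} {h} p q) = (\ f r -> OnCell-* f (mat g) (mat h) (fst (translate-elementary p) (translate (mat h) f) (fst (translate-elementary q) f r))) , (\ f r -> OnCell-*
  f (mat⁻¹ h) (mat⁻¹ g) (snd (translate-elementary q) (translate (mat⁻¹ g) f) (snd (translate-elementary p) f r)))
 translate-elementary (inv p) = let (a , b) = translate-elementary p in b , a
 translate-elementary (resp {g} {h} p q) = let (a , b) = translate-elementary q in
  (\ f r -> OnCell-resp f p (a f r)) , (\ f r -> OnCell-resp f {mat⁻¹ g} {mat⁻¹ h} (Group.⁻¹-cong (Matrices.GL K n) {g} {h} p) (b f r))

 density : ∀ p -> (∀ us -> evalPoly K (cell us) p ≈ 0#) -> ∀ h -> E h -> evalPoly K (mat h) p ≈ 0#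
 density p on-cell h e = S.reflexive (J.sym (eval-embed (mat h) p)) S.& eval-cong matrices f S.& S.sym (eval-translate ω C f) S.& fst (translate-elementary (mul (inv (fst (snd
  elementary-ω))) e)) f (\ us -> S.reflexive (eval-embed (cell us) p) S.& on-cell us) ones
  where
  f = embed p
  ones = Data.Vec.Base.replicate 10 1ᵘ
  ω = cell ones
  elementary-ω = elementary-product cellFactors ones
  g = fst elementary-ω
  C = mat⁻¹ g M.* mat h
  matrices : mat h M.≈ ω M.* C
  matrices = M.sym (M.congr C (M.sym (snd (snd elementary-ω))) M.& M.sym (M.*-assoc (mat g) (mat⁻¹ g) (mat h)) M.& M.congr (mat h) (invʳ g) M.& M.*-identityˡ (mat h))

-- Coordinates of the big cell

_·R_ : Sign -> Root -> Root
pos ·R γ = γ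
neg ·R γ = -ᴿ γ

signed-sum : ∀ σ {β δ γ} -> β ⊞ δ ≈ γ -> (σ ·R β) ⊞ (σ ·R δ) ≈ (σ ·R γ)
signed-sum pos p = p
signed-sum neg {β} {δ} {γ} p = toWitness {a? = all-roots? \ β -> all-roots? \ δ -> all-roots? \ γ -> (β ⊞ δ ≟ γ) →-dec ((-ᴿ β) ⊞ (-ᴿ δ) ≟ (-ᴿ γ))} tt β δ γ p

signed-no-source : ∀ σ β γ -> {False (any-root? \ δ -> β ⊞ δ ≟ γ)} -> {False (any-root? \ δ -> (-ᴿ β) ⊞ δ ≟ (-ᴿ γ))} -> ∀ δ -> ¬ ((σ ·R β) ⊞ δ ≈ (σ ·R γ))
signed-no-source pos β γ {f} = no-source β γ {f}
signed-no-source neg β γ {f} {g} = no-source (-ᴿ β) (-ᴿ γ) {g}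

signed-≢ : ∀ σ β γ -> {False (β ≟R γ)} -> {False ((-ᴿ β) ≟R (-ᴿ γ))} -> (σ ·R β) ≢ (σ ·R γ)
signed-≢ pos β γ {f} = toWitnessFalse f
signed-≢ neg β γ {f} {g} = toWitnessFalse g

module CellCoordinates {c ℓ} {K : CommutativeRing c ℓ} (isℚ : IsℚAlgebra K) {n} (π : Representation n) where
 open RootSubgroups K π
 open RootConjugation K π
 open TorusWeights isℚ π
 open LieSpan K π using (Lie; basis; _⊹_; _⊛_; conjugate; Lie-conjugate)
 open Coordinates isℚ π using (φ; κ)
 open Rows K isℚ π using (fixed-φ; step-φ; step-κ; φ-X; κ-X)
 open Trace K
 open BigCell isℚ π using (cell; cellFactors; elementary-product)
 open Matrices K using (ι; mat; mat⁻¹; invˡ; invʳ)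
 open S using (_≈_; _+_; _*_; -_; 0#; 1#; Carrier)

 lower : Sign -> (r1 r2 r3 r4 : Carrier) -> M.Mat n -> M.Mat n
 lower σ r1 r2 r3 r4 A = conjugate (σ ·R (-ᴿ qr)) r1 (conjugate (σ ·R (-ᴿ pr)) r2 (conjugate (σ ·R (-ᴿ ar)) r3 (conjugate (σ ·R (-ᴿ br)) r4 A)))

 module Column (σ : Sign) where
  φ' κ' : Root -> M.Mat n -> Carrier
  φ' γ A = ⟪ φ (σ ·R γ) , A ⟫
  κ' γ A = ⟪ κ (σ ·R γ) , A ⟫

  N' : Root -> Root -> Root -> Carrier
  N' β δ γ = ι (N (σ ·R β) (σ ·R δ) (σ ·R γ))

  fixed : ∀ β γ -> {False (any-root? \ δ -> β ⊞ δ ≟ γ)} -> {False (any-root? \ δ -> (-ᴿ β) ⊞ δ ≟ (-ᴿ γ))} -> {False (γ ≟R β)} -> {False ((-ᴿ γ) ≟R (-ᴿ β))} -> ∀ {A} -> Lie A -> ∀ t -> φ' γ (conjugate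
   (σ ·R β) t A) ≈ φ' γ A
  fixed β γ {f} {g} {f'} {g'} lie t = fixed-φ lie (signed-≢ σ γ β {f'} {g'}) (signed-no-source σ β γ {f} {g}) t

  step : ∀ β {δ} γ -> β ⊞ δ ≈ γ -> {False (any-root? \ ζ -> β ⊞ ζ ≟ δ)} -> {False (any-root? \ ζ -> (-ᴿ β) ⊞ ζ ≟ (-ᴿ δ))} -> {False (δ ≟R β)} -> {False ((-ᴿ δ) ≟R (-ᴿ β))} -> ∀ {A} -> Lie A -> ∀ t ->
   φ' γ (conjugate (σ ·R β) t A) ≈ φ' γ A + t * (N' β δ γ * φ' δ A)
  step β {δ} γ p {f} {g} {f'} {g'} lie t = step-φ lie (signed-sum σ p) (signed-≢ σ δ β {f'} {g'}) (signed-no-source σ β δ {f} {g}) t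

  module _ {A} (lie : Lie A) (r1 r2 r3 r4 : Carrier) where
   private
    A1 = conjugate (σ ·R (-ᴿ br)) r4 A
    l1 = Lie-conjugate (σ ·R (-ᴿ br)) r4 lie
    A2 = conjugate (σ ·R (-ᴿ ar)) r3 A1
    l2 = Lie-conjugate (σ ·R (-ᴿ ar)) r3 l1
    A3 = conjugate (σ ·R (-ᴿ pr)) r2 A2
    l3 = Lie-conjugate (σ ·R (-ᴿ pr)) r2 l2

    q2 : φ' qr A2 ≈ φ' qr A
    q2 = fixed (-ᴿ ar) qr l1 r3 S.& fixed (-ᴿ br) qr lie r4

    a1 : φ' ar A1 ≈ φ' ar A + r4 * (N' (-ᴿ br) pr ar * φ' pr A)
    a1 = step (-ᴿ br) ar ⟨ rfl , rfl ⟩ lie r4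

   q-coordinate : φ' qr (lower σ r1 r2 r3 r4 A) ≈ φ' qr A
   q-coordinate = fixed (-ᴿ qr) qr l3 r1 S.& fixed (-ᴿ pr) qr l2 r2 S.& q2

   p-coordinate : φ' pr (lower σ r1 r2 r3 r4 A) ≈ φ' pr A + r3 * (N' (-ᴿ ar) qr pr * φ' qr A)
   p-coordinate = fixed (-ᴿ qr) pr l3 r1 S.& fixed (-ᴿ pr) pr l2 r2 S.& (step (-ᴿ ar) pr ⟨ rfl , rfl ⟩ l1 r3) S.& S.+-cong (fixed (-ᴿ br) pr lie r4) (S.*-congˡ (S.*-congˡ (fixed (-ᴿ br) qr
    lie r4)))

   a-coordinate : φ' ar (lower σ r1 r2 r3 r4 A) ≈ φ' ar A + r4 * (N' (-ᴿ br) pr ar * φ' pr A) + r2 * (N' (-ᴿ pr) qr ar * φ' qr A)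
   a-coordinate = fixed (-ᴿ qr) ar l3 r1 S.& (step (-ᴿ pr) ar ⟨ rfl , rfl ⟩ l2 r2) S.& S.+-cong (fixed (-ᴿ ar) ar l1 r3 S.& a1) (S.*-congˡ (S.*-congˡ q2))

   cartan-coordinate : κ' ar A ≈ 0# -> φ' br A ≈ 0# -> φ' pr A ≈ 0# -> φ' ar A ≈ 0# -> κ' ar (lower σ r1 r2 r3 r4 A) ≈ - (r1 * φ' qr A)
   cartan-coordinate κ≈0 b≈0 p≈0 a≈0 = κ-step (-ᴿ qr) l3 r1 S.& S.+-cong (κ-step (-ᴿ pr) l2 r2 S.& S.+-cong (κ-step (-ᴿ ar) l1 r3 S.& S.+-cong (κ-step (-ᴿ br) lie r4 S.& S.+-cong κ≈0
    (times-zero (S.*-congˡ (coordinate br b≈0) S.& S.zeroʳ _)) S.& S.+-identityˡ 0#) (times-zero (S.*-congˡ (coordinate ar (a1 S.& S.+-cong a≈0 (times-zero (S.*-congˡ p≈0 S.& S.zeroʳ _)) S.&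
    S.+-identityˡ 0#)) S.& S.zeroʳ _)) S.& S.+-identityˡ 0#) (times-zero (S.*-congʳ (ι-cong (hval-p σ)) S.& S.zeroˡ _)) S.& S.+-identityˡ 0#) (S.*-congˡ (S.*-cong (ι-cong (hval-q σ) S.&
    S.-‿cong ι-1) (coordinate qr (fixed (-ᴿ pr) qr l2 r2 S.& q2)) S.& S.-1*x≈-x _)) S.& S.+-identityˡ _ S.& S.sym (S.-‿distribʳ-* _ _)
    where
    times-zero : ∀ {s t} -> t ≈ 0# -> s * t ≈ 0#
    times-zero p = S.*-congˡ p S.& S.zeroʳ _
    κ-step : ∀ β {B} -> Lie B -> ∀ t -> κ' ar (conjugate (σ ·R β) t B) ≈ κ' ar B + t * (ι (hval (σ ·R β) (σ ·R ar)) * ⟪ φ (-ᴿ (σ ·R β)) , B ⟫)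
    κ-step β lie t = step-κ lie (σ ·R β) (σ ·R ar) t
    coordinate : ∀ γ {B r} -> φ' γ B ≈ r -> ⟪ φ (-ᴿ (σ ·R (-ᴿ γ))) , B ⟫ ≈ r
    coordinate γ {B} p = S.reflexive (cong (\ δ -> ⟪ φ δ , B ⟫) (double σ γ)) S.& p
     where
     double : ∀ σ γ -> -ᴿ (σ ·R (-ᴿ γ)) ≡ σ ·R γ
     double pos γ = opposite-involutive γ
     double neg γ = cong -ᴿ_ (opposite-involutive γ)
    hval-p : ∀ σ -> hval (σ ·R (-ᴿ pr)) (σ ·R ar) ≡ + 0
    hval-p pos = hval≡ (-ᴿ pr) ar
    hval-p neg = hval≡ pr (-ᴿ ar)
    hval-q : ∀ σ -> hval (σ ·R (-ᴿ qr)) (σ ·R ar) ≡ -[1+ 0 ]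
    hval-q pos = hval≡ (-ᴿ qr) ar
    hval-q neg = hval≡ qr (-ᴿ ar)

 record Conjugation (g A B : M.Mat n) : Set ℓ where
  constructor conjugation
  field conj : Conj g A B
 open Conjugation public

 infixr 5 _∘c_
 _∘c_ : ∀ {h g A B C} -> Conjugation h B C -> Conjugation g A B -> Conjugation (h M.* g) A C
 _∘c_ {h} {g} (conjugation q) (conjugation p) = conjugation (conj-∘ {h} {g} q p)

 _+c_ : ∀ {g A B A' B'} -> Conjugation g A B -> Conjugation g A' B' -> Conjugation g (A M.+ A') (B M.+ B')
 _+c_ {g} {A} {B} {A'} {B'} (conjugation p) (conjugation q) = conjugation (conj-+ {g} {A} {B} {A'} {B'} p q)

 _%c_ : ∀ r {g A B} -> Conjugation g A B -> Conjugation g (r M.⊙ A) (r M.⊙ B)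
 _%c_ r {g} {A} {B} (conjugation p) = conjugation (conj-% r {g} {A} {B} p)

 respc : ∀ {g A A' B B'} -> A M.≈ A' -> B M.≈ B' -> Conjugation g A B -> Conjugation g A' B'
 respc {g} {A} {A'} {B} {B'} p q (conjugation r) = conjugation (conj-resp {g} {A} {A'} {B} {B'} p q r)

 by-inverse : ∀ {m m~} -> m~ M.* m M.≈ M.1# -> ∀ A -> Conjugation m A (m M.* (A M.* m~))
 by-inverse {m} {m~} p A = conjugation (M.sym (M.solve [] (m :: m~ :: A :: []) ((m0 :* (m2 :* m1)) :* m0) ((m0 :* m2) :* (m1 :* m0)) M.& M.congl (m M.* A) p M.& M.*-identityʳ (m M.* A)))

 by-x : ∀ β t A -> Conjugation (x β t) A (conjugate β t A)
 by-x β t = by-inverse (x-inverse β (S.-‿inverseˡ t))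

 from-x : ∀ β t A -> Conjugation (x β t) (conjugate β (- t) A) A
 from-x β t A = conjugation (M.congl (x β t) (M.congl (x β (- t)) (M.congl A (x-cong β (S.-‿involutive t)))) M.& M.sym (M.*-assoc (x β t) (x β (- t)) (A M.* x β t)) M.& M.congr (A M.* x β t)
  (x-inverse β (S.-‿inverseʳ t)) M.& M.*-identityˡ (A M.* x β t))

 fixedc : ∀ β δ {t} -> {False (δ ≟R (-ᴿ β))} -> {False (any-root? \ ε -> β ⊞ δ ≟ ε)} -> Conjugation (x β t) (XR δ) (XR δ)
 fixedc β δ {t} {f} {g} = conjugation (conj-fixed (toWitnessFalse f) (no-sum β δ {g}) t)

 stepc : ∀ β {δ} ε {t} -> β ⊞ δ ≈ ε -> {False (any-root? \ ζ -> β ⊞ ε ≟ ζ)} -> Conjugation (x β t) (XR δ) (XR δ M.+ (t * ι (N β δ ε)) M.⊙ XR ε)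
 stepc β ε {t} p {f} = conjugation (conj-step p (no-sum β ε {f}) t)

 torusc : ∀ γ δ {u} -> Conjugation (Torus.h γ u) (XR δ) ((u ^ᶻ pairing γ δ) M.⊙ XR δ)
 torusc γ δ {u} = conjugation (torus-X γ δ u)

 private
  inverses : ∀ us -> Σ (M.Mat n) \ C~ -> C~ M.* cell us M.≈ M.1# × cell us M.* C~ M.≈ M.1#
  inverses us = let (h , _ , p) = elementary-product cellFactors us in
   mat⁻¹ h , M.trans (M.congl (mat⁻¹ h) (M.sym p)) (invˡ h) , M.trans (M.congr (mat⁻¹ h) (M.sym p)) (invʳ h)

 module Cell (us : Vec Unit 10) where
  cell~ : M.Mat n
  cell~ = fst (inverses us)

  private
   module P = PolynomialSyntax {n}
   module Eval = PolynomialEvaluation K (cell us)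

   det-cell : Determinant.det K (cell us) ≈ 1#
   det-cell = let (h , e , p) = elementary-product cellFactors us in
    S.trans (Determinant.det-cong K (M.sym p)) (Points.det-elementary isℚ π e)

   inverse-cell : Eval.evalM P.inverseᴾ M.≈ cell~
   inverse-cell = Eval.eval-inverse cell~ (fst (snd (inverses us))) det-cell

  eval-Ad : ∀ (A : I.Mat n) {B} -> Conjugation (cell us) (ιM A) B -> Eval.evalM (entry P.⊡ (P.conM A P.⊡ P.inverseᴾ)) M.≈ B
  eval-Ad A {B} (conjugation p) = Eval.eval-⊡ entry (P.conM A P.⊡ P.inverseᴾ) M.& M.congl (cell us) (Eval.eval-⊡ (P.conM A) P.inverseᴾ M.& M.congl (ιM A) inverse-cell) M.& M.sym (M.*-assoc
   (cell us) (ιM A) cell~) M.& M.congr cell~ p M.& M.*-assoc B (cell us) cell~ M.& M.congl B (snd (snd (inverses us))) M.& M.*-identityʳ B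

  eval-Ad~ : ∀ (A : I.Mat n) {B} -> Conjugation (cell us) B (ιM A) -> Eval.evalM (P.inverseᴾ P.⊡ (P.conM A P.⊡ entry)) M.≈ B
  eval-Ad~ A {B} (conjugation p) = Eval.eval-⊡ P.inverseᴾ (P.conM A P.⊡ entry) M.& M.*-cong inverse-cell (Eval.eval-⊡ (P.conM A) entry M.& M.sym p) M.& M.sym (M.*-assoc cell~ (cell us) B)
   M.& M.congr B (fst (snd (inverses us))) M.& M.*-identityˡ B

 -- The torus part of the conjugates of the vectors X q and X p, for both signs
 columnᵖ columnᵍ : Sign -> Unit -> Unit -> Carrier -> M.Mat n
 columnᵍ σ u v r = (val u * val u) M.⊙ XR (σ ·R qr)
 columnᵖ σ u v r = val v M.⊙ XR (σ ·R pr) M.+ (val u * val u * (r * ι (N (σ ·R ar) (σ ·R pr) (σ ·R qr)))) M.⊙ XR (σ ·R qr)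

 module _ (s₁ s₂ s₃ s₄ u v t1 t2 t3 t4 : Unit) where
  private
   us : Vec Unit 10
   us = s₁ :: s₂ :: s₃ :: s₄ :: u :: v :: t1 :: t2 :: t3 :: t4 :: []

   unit-% : ∀ (u : Unit) {k} {A : M.Mat n} -> (val~1 u * (val u * k)) M.⊙ A M.≈ k M.⊙ A
   unit-% u {k} {A} = M.%-cong (solves (val u :: val~1 u :: k :: []) (s1 *: (s0 *: s2)) (s0 *: s1 *: s2) S.& S.*-congʳ (val*val~1 u) S.& S.*-identityˡ k) M.refl

   lowering : ∀ A -> Conjugation (x (-ᴿ qr) (val s₁) M.* (x (-ᴿ pr) (val s₂) M.* (x (-ᴿ ar) (val s₃) M.* x (-ᴿ br) (val s₄)))) A (lower pos (val s₁) (val s₂) (val s₃) (val s₄) A)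
   lowering A = by-x _ _ _ ∘c by-x _ _ _ ∘c by-x _ _ _ ∘c by-x _ _ A

   raising : ∀ A -> Conjugation (x br (val t1) M.* (x ar (val t2) M.* (x pr (val t3) M.* x qr (val t4)))) (lower neg (- val t4) (- val t3) (- val t2) (- val t1) A) A
   raising A = from-x _ _ A ∘c from-x _ _ _ ∘c from-x _ _ _ ∘c from-x _ _ _

   assemble : ∀ {A B C D} -> Conjugation (x (-ᴿ qr) (val s₁) M.* (x (-ᴿ pr) (val s₂) M.* (x (-ᴿ ar) (val s₃) M.* x (-ᴿ br) (val s₄)))) C D -> Conjugation (Torus.h ar u M.* Torus.h br v) B C ->
    Conjugation (x br (val t1) M.* (x ar (val t2) M.* (x pr (val t3) M.* x qr (val t4)))) A B -> Conjugation (cell us) A D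
   assemble {A} {B} {C} {D} p q r = conjugation (M.congr A same M.& conj (p ∘c q ∘c r) M.& M.congl D (M.sym same))
    where
    m₁ = x (-ᴿ qr) (val s₁)
    same : cell us M.≈ (x (-ᴿ qr) (val s₁) M.* (x (-ᴿ pr) (val s₂) M.* (x (-ᴿ ar) (val s₃) M.* x (-ᴿ br) (val s₄)))) M.* ((Torus.h ar u M.* Torus.h br v) M.* (x br (val t1) M.* (x ar (val
     t2) M.* (x pr (val t3) M.* x qr (val t4)))))
    same = M.solve [] (x (-ᴿ qr) (val s₁) :: x (-ᴿ pr) (val s₂) :: x (-ᴿ ar) (val s₃) :: x (-ᴿ br) (val s₄) :: Torus.h ar u :: Torus.h br v :: x br (val t1) :: x ar (val t2) :: x pr (val t3) :: x qr
     (val t4) :: []) (m0 :* (m1 :* (m2 :* (m3 :* (m4 :* (m5 :* (m6 :* (m7 :* (m8 :* (m9 :* :1)))))))))) ((m0 :* (m1 :* (m2 :* m3))) :* ((m4 :* m5) :* (m6 :* (m7 :* (m8 :* m9)))))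

  Ad-q : Conjugation (cell us) (XR qr) (lower pos (val s₁) (val s₂) (val s₃) (val s₄) (columnᵍ pos u v (val t2)))
  Ad-q = assemble (lowering _) (respc M.refl (M.solve (val u :: []) (XR qr :: []) (1: :% (s0 *: (s0 *: 1:)) :% m0) ((s0 *: s0) :% m0)) ((1# %c torusc ar qr {u}) ∘c torusc br qr {v})) (fixedc
   br qr ∘c fixedc ar qr ∘c fixedc pr qr ∘c fixedc qr qr)

  Ad-p : Conjugation (cell us) (XR pr) (lower pos (val s₁) (val s₂) (val s₃) (val s₄) (columnᵖ pos u v (val t2)))
  Ad-p = assemble (lowering _) (respc M.refl (M.solve (val u :: val v :: r :: []) (XR pr :: XR qr :: []) ((s1 *: 1:) :% 1: :% m0 :+ s2 :% 1: :% (s0 *: (s0 *: 1:)) :% m1) (s1 :% m0 :+ (s0 *: s0 *: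
   s2) :% m1)) ((((val v * 1#) %c torusc ar pr {u}) +c (r %c (1# %c torusc ar qr {u}))) ∘c (torusc br pr {v} +c (r %c torusc br qr {v})))) ((fixedc br pr +c (r %c fixedc br qr)) ∘c stepc ar
   qr ⟨ rfl , rfl ⟩ ∘c fixedc pr pr ∘c fixedc qr pr)
   where
   r = val t2 * ι (N ar pr qr)

  Ad~-q : Conjugation (cell us) (lower neg (- val t4) (- val t3) (- val t2) (- val t1) (columnᵍ neg u v (- val s₃))) (XR (-ᴿ qr))
  Ad~-q = assemble (fixedc (-ᴿ qr) (-ᴿ qr) ∘c fixedc (-ᴿ pr) (-ᴿ qr) ∘c fixedc (-ᴿ ar) (-ᴿ qr) ∘c fixedc (-ᴿ br) (-ᴿ qr)) (respc M.refl torus-part (((val u * val u) %c (1# %c torusc ar (-ᴿ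
   qr) {u})) ∘c ((val u * val u) %c torusc br (-ᴿ qr) {v}))) (raising _)
   where
   torus-part : (val u * val u) M.⊙ (1# M.⊙ ((val~1 u * (val~1 u * 1#)) M.⊙ XR (-ᴿ qr))) M.≈ XR (-ᴿ qr)
   torus-part = M.solve (val u :: val~1 u :: []) (XR (-ᴿ qr) :: []) ((s0 *: s0) :% 1: :% (s1 *: (s1 *: 1:)) :% m0) ((s1 *: (s0 *: (s1 *: (s0 *: 1:)))) :% m0) M.& unit-% u M.& unit-% u M.&
    M.%-one _

  Ad~-p : Conjugation (cell us) (lower neg (- val t4) (- val t3) (- val t2) (- val t1) (columnᵖ neg u v (- val s₃))) (XR (-ᴿ pr))
  Ad~-p = assemble (fixedc (-ᴿ qr) (-ᴿ pr) ∘c fixedc (-ᴿ pr) (-ᴿ pr) ∘c respc M.refl (M.solve (val s₃ :: ν :: []) (XR (-ᴿ pr) :: XR (-ᴿ qr) :: []) (m0 :+ (s0 *: s1) :% m1 :+ ((-: s0) *: s1) :%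
   m1) (m0)) (stepc (-ᴿ ar) (-ᴿ qr) ⟨ rfl , rfl ⟩ +c (r %c fixedc (-ᴿ ar) (-ᴿ qr))) ∘c (fixedc (-ᴿ br) (-ᴿ pr) +c (r %c fixedc (-ᴿ br) (-ᴿ qr)))) (respc M.refl (M.+-cong torus-p torus-q)
   (((val v %c ((val~1 v * 1#) %c torusc ar (-ᴿ pr) {u})) +c ((val u * val u * r) %c (1# %c torusc ar (-ᴿ qr) {u}))) ∘c ((val v %c torusc br (-ᴿ pr) {v}) +c ((val u * val u * r) %c torusc br
   (-ᴿ qr) {v})))) (raising _)
   where
   ν = ι (N (-ᴿ ar) (-ᴿ pr) (-ᴿ qr))
   r = - val s₃ * ν
   torus-p : val v M.⊙ ((val~1 v * 1#) M.⊙ (1# M.⊙ XR (-ᴿ pr))) M.≈ XR (-ᴿ pr)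
   torus-p = M.solve (val v :: val~1 v :: []) (XR (-ᴿ pr) :: []) (s0 :% (s1 *: 1:) :% 1: :% m0) ((s1 *: (s0 *: 1:)) :% m0) M.& unit-% v M.& M.%-one _
   torus-q : (val u * val u * r) M.⊙ (1# M.⊙ ((val~1 u * (val~1 u * 1#)) M.⊙ XR (-ᴿ qr))) M.≈ r M.⊙ XR (-ᴿ qr)
   torus-q = M.solve (val u :: val~1 u :: r :: []) (XR (-ᴿ qr) :: []) ((s0 *: s0 *: s2) :% 1: :% (s1 *: (s1 *: 1:)) :% m0) ((s1 *: (s0 *: (s1 *: (s0 *: s2)))) :% m0) M.& unit-% u M.& unit-% u

module CoordinatePolynomials {c ℓ} {K : CommutativeRing c ℓ} (isℚ : IsℚAlgebra K) {n} (π : Representation n) where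
 open RootSubgroups K π
 open RootConjugation K π
 open LieSpan K π using (Lie; basis; _⊹_; _⊛_)
 open Coordinates isℚ π using (φ; κ)
 open Rows K isℚ π using (φ-X; κ-X)
 open Trace K
 open BigCell isℚ π using (cell)
 open CellCoordinates isℚ π
 open Primitivity π using (N-unit)
 open PolynomialSyntax {n}
 open Matrices K using (ι)
 open S using (_≈_; _+_; _*_; -_; 0#; 1#; Carrier)

 rowRoot : Fin 3 -> Root
 rowRoot 0F = qr
 rowRoot 1F = pr
 rowRoot 2F = ar

 columnRoot : Fin 2 -> Root
 columnRoot 0F = qr
 columnRoot 1F = pr

 -- g ↦ g A g⁻¹ and g ↦ g⁻¹ A g
 Adᴾ : Sign -> I.Mat n -> PolyMatrix
 Adᴾ pos A = entry ⊡ (conM A ⊡ inverseᴾ)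
 Adᴾ neg A = inverseᴾ ⊡ (conM A ⊡ entry)

 θ : Sign -> Fin 3 -> Fin 2 -> Poly n
 θ σ i j = ⟪ φ (σ ·R rowRoot i) , Adᴾ σ (X (σ ·R columnRoot j)) ⟫ᴾ

 θc : Sign -> Poly n
 θc σ = ⟪ κ (σ ·R ar) , Adᴾ σ (X (σ ·R qr)) ⟫ᴾ

 private
  at : Fin 10 -> Vec Unit 10 -> Unit
  at i us = lookup us i

 χq χp : Vec Unit 10 -> Carrier
 χq us = val (at 4F us) * val (at 4F us)
 χp us = val (at 5F us)

 -- the parameters of the unipotent factors applied last, for g and for g⁻¹
 parameter : Sign -> Fin 4 -> Vec Unit 10 -> Carrier
 parameter pos 0F us = val (at 0F us)
 parameter pos 1F us = val (at 1F us)
 parameter pos 2F us = val (at 2F us)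
 parameter pos 3F us = val (at 3F us)
 parameter neg 0F us = - val (at 9F us)
 parameter neg 1F us = - val (at 8F us)
 parameter neg 2F us = - val (at 7F us)
 parameter neg 3F us = - val (at 6F us)

 private
  first-parameter : Sign -> Vec Unit 10 -> Carrier
  first-parameter pos us = val (at 7F us)
  first-parameter neg us = - val (at 2F us)

 -- the coordinate of X q in the column of p
 mixed : Sign -> Vec Unit 10 -> Carrier
 mixed σ us = χq us * (first-parameter σ us * ι (N (σ ·R ar) (σ ·R pr) (σ ·R qr)))

 private
  column : Sign -> Fin 2 -> Vec Unit 10 -> M.Mat n
  column σ 0F us = columnᵍ σ (at 4F us) (at 5F us) (first-parameter σ us)
  column σ 1F us = columnᵖ σ (at 4F us) (at 5F us) (first-parameter σ us)

  Lie-column : ∀ σ j us -> Lie (column σ j us)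
  Lie-column σ 0F us = (χq us) ⊛ basis (root (σ ·R qr))
  Lie-column σ 1F us = ((χp us) ⊛ basis (root (σ ·R pr))) ⊹ ((mixed σ us) ⊛ basis (root (σ ·R qr)))

  lowered : Sign -> Fin 2 -> Vec Unit 10 -> M.Mat n
  lowered σ j us = lower σ (parameter σ 0F us) (parameter σ 1F us) (parameter σ 2F us) (parameter σ 3F us) (column σ j us)

  Ad-cell : ∀ σ j us -> PolynomialEvaluation.evalM K (cell us) (Adᴾ σ (X (σ ·R columnRoot j))) M.≈ lowered σ j us
  Ad-cell pos 0F us@(s₁ :: s₂ :: s₃ :: s₄ :: u :: v :: t1 :: t2 :: t3 :: t4 :: []) = Cell.eval-Ad us (X qr) (Ad-q s₁ s₂ s₃ s₄ u v t1 t2 t3 t4)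
  Ad-cell pos 1F us@(s₁ :: s₂ :: s₃ :: s₄ :: u :: v :: t1 :: t2 :: t3 :: t4 :: []) = Cell.eval-Ad us (X pr) (Ad-p s₁ s₂ s₃ s₄ u v t1 t2 t3 t4)
  Ad-cell neg 0F us@(s₁ :: s₂ :: s₃ :: s₄ :: u :: v :: t1 :: t2 :: t3 :: t4 :: []) = Cell.eval-Ad~ us (X (-ᴿ qr)) (Ad~-q s₁ s₂ s₃ s₄ u v t1 t2 t3 t4)
  Ad-cell neg 1F us@(s₁ :: s₂ :: s₃ :: s₄ :: u :: v :: t1 :: t2 :: t3 :: t4 :: []) = Cell.eval-Ad~ us (X (-ᴿ pr)) (Ad~-p s₁ s₂ s₃ s₄ u v t1 t2 t3 t4)

  on-same : ∀ γ r -> ⟪ φ γ , r M.⊙ XR γ ⟫ ≈ r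
  on-same γ r = ⟪⟫-% (φ γ) r (XR γ) S.& S.*-congˡ (φ-X γ γ S.& ι-cong (indicator-self γ) S.& ι-1) S.& S.*-identityʳ r

  on-other : ∀ γ δ r -> γ ≢ δ -> ⟪ φ γ , r M.⊙ XR δ ⟫ ≈ 0#
  on-other γ δ r p = ⟪⟫-% (φ γ) r (XR δ) S.& S.*-congˡ (φ-X γ δ S.& ι-cong (indicator-≢ p)) S.& S.zeroʳ r

  on-sum : ∀ (Λ : I.Mat n) (A B : M.Mat n) {r s t} -> ⟪ Λ , A ⟫ ≈ r -> ⟪ Λ , B ⟫ ≈ s -> r + s ≈ t -> ⟪ Λ , A M.+ B ⟫ ≈ t
  on-sum Λ A B p q e = ⟪⟫-+ Λ A B S.& S.+-cong p q S.& e

 module _ (σ : Sign) (us : Vec Unit 10) where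
  open Column σ
  private
   e : Poly n -> Carrier
   e = evalPoly K (cell us)
   r1 = parameter σ 0F us
   r2 = parameter σ 1F us
   r3 = parameter σ 2F us
   r4 = parameter σ 3F us

   θ-value : ∀ i j -> e (θ σ i j) ≈ φ' (rowRoot i) (lowered σ j us)
   θ-value i j = PolynomialEvaluation.eval-⟪⟫ K (cell us) (φ (σ ·R rowRoot i)) (Adᴾ σ (X (σ ·R columnRoot j))) S.& ⟪⟫-cong (φ (σ ·R rowRoot i)) (Ad-cell σ j us)

   q-q : φ' qr (column σ 0F us) ≈ χq us
   q-q = on-same (σ ·R qr) (χq us)
   p-q : φ' pr (column σ 0F us) ≈ 0#
   p-q = on-other (σ ·R pr) (σ ·R qr) (χq us) (signed-≢ σ pr qr)
   a-q : φ' ar (column σ 0F us) ≈ 0#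
   a-q = on-other (σ ·R ar) (σ ·R qr) (χq us) (signed-≢ σ ar qr)
   b-q : φ' br (column σ 0F us) ≈ 0#
   b-q = on-other (σ ·R br) (σ ·R qr) (χq us) (signed-≢ σ br qr)
   p1 q1 : M.Mat n
   p1 = χp us M.⊙ XR (σ ·R pr)
   q1 = mixed σ us M.⊙ XR (σ ·R qr)
   q-p : φ' qr (column σ 1F us) ≈ mixed σ us
   q-p = on-sum (φ (σ ·R qr)) p1 q1 (on-other (σ ·R qr) (σ ·R pr) (χp us) (signed-≢ σ qr pr)) (on-same (σ ·R qr) (mixed σ us)) (S.+-identityˡ _)
   p-p : φ' pr (column σ 1F us) ≈ χp us
   p-p = on-sum (φ (σ ·R pr)) p1 q1 (on-same (σ ·R pr) (χp us)) (on-other (σ ·R pr) (σ ·R qr) (mixed σ us) (signed-≢ σ pr qr)) (S.+-identityʳ _)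
   a-p : φ' ar (column σ 1F us) ≈ 0#
   a-p = on-sum (φ (σ ·R ar)) p1 q1 (on-other (σ ·R ar) (σ ·R pr) (χp us) (signed-≢ σ ar pr)) (on-other (σ ·R ar) (σ ·R qr) (mixed σ us) (signed-≢ σ ar qr)) (S.+-identityʳ _)

  θ-q-q : e (θ σ 0F 0F) ≈ χq us
  θ-q-q = θ-value 0F 0F S.& q-coordinate (Lie-column σ 0F us) r1 r2 r3 r4 S.& q-q

  θ-p-q : e (θ σ 1F 0F) ≈ r3 * (N' (-ᴿ ar) qr pr * χq us)
  θ-p-q = θ-value 1F 0F S.& p-coordinate (Lie-column σ 0F us) r1 r2 r3 r4 S.& S.+-cong p-q (S.*-congˡ (S.*-congˡ q-q)) S.& S.+-identityˡ _

  θ-a-q : e (θ σ 2F 0F) ≈ r2 * (N' (-ᴿ pr) qr ar * χq us)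
  θ-a-q = θ-value 2F 0F S.& a-coordinate (Lie-column σ 0F us) r1 r2 r3 r4 S.& S.+-cong (S.+-cong a-q (S.*-congˡ (S.*-congˡ p-q))) (S.*-congˡ (S.*-congˡ q-q)) S.& solves (r4 :: N' (-ᴿ br) pr
   ar :: r2 * (N' (-ᴿ pr) qr ar * χq us) :: []) (0: +: s0 *: (s1 *: 0:) +: s2) (s2)

  θ-cartan : e (θc σ) ≈ - (r1 * χq us)
  θ-cartan = PolynomialEvaluation.eval-⟪⟫ K (cell us) (κ (σ ·R ar)) (Adᴾ σ (X (σ ·R qr))) S.& ⟪⟫-cong (κ (σ ·R ar)) (Ad-cell σ 0F us) S.& cartan-coordinate (Lie-column σ 0F us) r1 r2 r3 r4
   (⟪⟫-% (κ (σ ·R ar)) (χq us) (XR (σ ·R qr)) S.& S.*-congˡ (κ-X (σ ·R ar) (σ ·R qr)) S.& S.zeroʳ _) b-q p-q a-q S.& S.-‿cong (S.*-congˡ q-q)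

  θ-q-p : e (θ σ 0F 1F) ≈ mixed σ us
  θ-q-p = θ-value 0F 1F S.& q-coordinate (Lie-column σ 1F us) r1 r2 r3 r4 S.& q-p

  θ-p-p : e (θ σ 1F 1F) ≈ χp us + r3 * (N' (-ᴿ ar) qr pr * mixed σ us)
  θ-p-p = θ-value 1F 1F S.& p-coordinate (Lie-column σ 1F us) r1 r2 r3 r4 S.& S.+-cong p-p (S.*-congˡ (S.*-congˡ q-p))

  θ-a-p : e (θ σ 2F 1F) ≈ r4 * (N' (-ᴿ br) pr ar * χp us) + r2 * (N' (-ᴿ pr) qr ar * mixed σ us)
  θ-a-p = θ-value 2F 1F S.& a-coordinate (Lie-column σ 1F us) r1 r2 r3 r4 S.& S.+-cong (S.+-cong a-p (S.*-congˡ (S.*-congˡ p-p)) S.& S.+-identityˡ _) (S.*-congˡ (S.*-congˡ q-p))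

-- Two points with the same coordinates θ, normalized such that the denominator of the
-- cell is 1, agree at every polynomial which on the cell is a polynomial in the θ
-- and the inverse of the denominator.
module Localization {c ℓ} {K : CommutativeRing c ℓ} (isℚ : IsℚAlgebra K) {n} (π : Representation n)
 {c' ℓ′} {R : CommutativeRing c' ℓ′} (g g' : Matrices.Matrix R n) where
 open CoordinatePolynomials isℚ π
 open RootSubgroups K π
 open BigCell isℚ π using (cell; factor)
 open CellCoordinates isℚ π using (module Column)
 open Primitivity π using (N-unit)
 open PolynomialSyntax {n}
 open Matrices K using (ι)
 open S using (_≈_; _+_; _*_; -_; 0#; 1#; Carrier)
 private
  module RR = CommutativeRing R
  P = Vec Unit 10

 Agrees : Poly n -> Set ℓ′
 Agrees p = evalPoly R g p RR.≈ evalPoly R g' p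

 record Agreement : Set ℓ′ where
  field
   θ-agrees : ∀ σ i j -> Agrees (θ σ i j)
   θc-agrees : ∀ σ -> Agrees (θc σ)

 denominator : Poly n
 denominator = θ pos 0F 0F ⊗ ((θ pos 0F 0F ⊗ θ pos 1F 1F) ⊕ negᴾ (θ pos 1F 0F ⊗ θ pos 0F 1F))

 module _ (agreement : Agreement) where
  open Agreement agreement

  private
   e : P -> Poly n -> Carrier
   e us = evalPoly K (cell us)
   e-neg : ∀ us p -> e us (negᴾ p) ≈ - e us p
   e-neg us = PolynomialEvaluation.eval-neg K (cell us)

   agrees-neg : ∀ p -> Agrees p -> Agrees (negᴾ p)
   agrees-neg p a = RR.*-congˡ a

   agrees-denominator : Agrees denominator
   agrees-denominator = RR.*-cong (θ-agrees pos 0F 0F) (RR.+-cong (RR.*-cong (θ-agrees pos 0F 0F) (θ-agrees pos 1F 1F)) (agrees-neg (θ pos 1F 0F ⊗ θ pos 0F 1F) (RR.*-cong (θ-agrees pos 1F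
    0F) (θ-agrees pos 0F 1F))))

   D : P -> Carrier
   D us = e us denominator

   powᴾ : ℕ -> Poly n
   powᴾ zero = con (+ 1)
   powᴾ (suc k) = denominator ⊗ powᴾ k

   e-pow : ∀ us k -> e us (powᴾ k) ≈ D us S.^ k
   e-pow us zero = ι-1
   e-pow us (suc k) = S.*-congˡ (e-pow us k)

   agrees-pow : ∀ k -> Agrees (powᴾ k)
   agrees-pow zero = RR.refl
   agrees-pow (suc k) = RR.*-cong agrees-denominator (agrees-pow k)

  record Local (F : P -> Carrier) : Set (c ⊔ ℓ ⊔ ℓ′) where
   constructor local
   field
    exponent : ℕ
    poly : Poly n
    on-cell : ∀ us -> D us S.^ exponent * F us ≈ e us poly
    agrees : Agrees poly

  Local-cong : ∀ {F G} -> (∀ us -> F us ≈ G us) -> Local F -> Local G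
  Local-cong p (local N f q a) = local N f (\ us -> S.*-congˡ (S.sym (p us)) S.& q us) a

  Local-θ : ∀ p -> Agrees p -> Local (\ us -> e us p)
  Local-θ p a = local 0 p (\ us -> S.*-identityˡ _) a

  Local-ι : ∀ k -> Local (\ _ -> ι k)
  Local-ι k = Local-θ (con k) RR.refl

  Local-+ : ∀ {F G} -> Local F -> Local G -> Local (\ us -> F us + G us)
  Local-+ {F} {G} (local N f p a) (local M h q b) = local (N N.+ M) ((powᴾ M ⊗ f) ⊕ (powᴾ N ⊗ h)) (\ us -> S.*-congʳ (S.^-homo-* (D us) N M) S.& solves (D us S.^ N :: D us S.^ M :: F us :: G us
   :: []) (s0 *: s1 *: (s2 +: s3)) (s1 *: (s0 *: s2) +: s0 *: (s1 *: s3)) S.& S.+-cong (S.*-cong (S.sym (e-pow us M)) (p us)) (S.*-cong (S.sym (e-pow us N)) (q us))) (RR.+-cong (RR.*-cong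
   (agrees-pow M) a) (RR.*-cong (agrees-pow N) b))

  Local-* : ∀ {F G} -> Local F -> Local G -> Local (\ us -> F us * G us)
  Local-* {F} {G} (local N f p a) (local M h q b) = local (N N.+ M) (f ⊗ h) (\ us -> S.*-congʳ (S.^-homo-* (D us) N M) S.& solves (D us S.^ N :: D us S.^ M :: F us :: G us :: []) (s0 *: s1 *: (s2
   *: s3)) ((s0 *: s2) *: (s1 *: s3)) S.& S.*-cong (p us) (q us)) (RR.*-cong a b)

  Local-0 : Local (\ _ -> 0#)
  Local-0 = Local-ι (+ 0)

  Local-1 : Local (\ _ -> 1#)
  Local-1 = Local-cong (\ _ -> ι-1) (Local-ι (+ 1))

  Local-neg : ∀ {F} -> Local F -> Local (\ us -> - F us)
  Local-neg {F} l = Local-cong (\ us -> S.*-congʳ (S.-‿cong ι-1) S.& S.-1*x≈-x (F us)) (Local-* (Local-ι -[1+ 0 ]) l)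

  Local-^ : ∀ {F} k -> Local F -> Local (\ us -> F us S.^ k)
  Local-^ zero l = Local-1
  Local-^ (suc k) l = Local-* l (Local-^ k l)

  Local-sum : ∀ {m} {F : Fin m -> P -> Carrier} -> (∀ k -> Local (F k)) -> Local (\ us -> S.sum (\ k -> F k us))
  Local-sum {zero} l = Local-0
  Local-sum {suc m} l = Local-+ (l 0F) (Local-sum (l ∘ F.suc))

  private
   divide : ∀ {G} (F U V : P -> Carrier) -> (∀ us -> G us ≈ F us * U us) -> (∀ us -> U us * V us ≈ 1#) -> Local G -> Local V -> Local F
   divide F U V p q l v = Local-cong (\ us -> S.*-congʳ (p us) S.& S.*-assoc (F us) (U us) (V us) S.& S.*-congˡ (q us) S.& S.*-identityʳ (F us)) (Local-* l v)

   u v : P -> Unit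
   u us = lookup us 4F
   v us = lookup us 5F

   minor : Fin 3 -> Sign -> Poly n
   minor i σ = (θ σ 0F 0F ⊗ θ σ i 1F) ⊕ negᴾ (θ σ i 0F ⊗ θ σ 0F 1F)

   minor-value : ∀ i σ us {r s t w} -> e us (θ σ 0F 0F) ≈ r -> e us (θ σ i 1F) ≈ s -> e us (θ σ i 0F) ≈ t -> e us (θ σ 0F 1F) ≈ w -> e us (minor i σ) ≈ r * s + - (t * w)
   minor-value i σ us p q r s = S.+-cong (S.*-cong p q) (e-neg us (θ σ i 0F ⊗ θ σ 0F 1F) S.& S.-‿cong (S.*-cong r s))

   minor-p : ∀ us -> e us (minor 1F pos) ≈ χq us * χp us
   minor-p us = minor-value 1F pos us (θ-q-q pos us) (θ-p-p pos us) (θ-p-q pos us) (θ-q-p pos us) S.& solves (χq us :: χp us :: parameter pos 2F us :: Column.N' pos (-ᴿ ar) qr pr :: mixed pos us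
    :: []) (s0 *: (s1 +: s2 *: (s3 *: s4)) +: (-: (s2 *: (s3 *: s0) *: s4))) (s0 *: s1)

   minor-a : ∀ σ us -> e us (minor 2F σ) ≈ parameter σ 3F us * (Column.N' σ (-ᴿ br) pr ar * (χq us * χp us))
   minor-a σ us = minor-value 2F σ us (θ-q-q σ us) (θ-a-p σ us) (θ-a-q σ us) (θ-q-p σ us) S.& solves (χq us :: χp us :: parameter σ 3F us :: Column.N' σ (-ᴿ br) pr ar :: parameter σ 1F us ::
    Column.N' σ (-ᴿ pr) qr ar :: mixed σ us :: []) (s0 *: (s2 *: (s3 *: s1) +: s4 *: (s5 *: s6)) +: (-: (s4 *: (s5 *: s0) *: s6))) (s2 *: (s3 *: (s0 *: s1)))

   agrees-minor : ∀ i σ -> Agrees (minor i σ)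
   agrees-minor i σ = RR.+-cong (RR.*-cong (θ-agrees σ 0F 0F) (θ-agrees σ i 1F)) (agrees-neg (θ σ i 0F ⊗ θ σ 0F 1F) (RR.*-cong (θ-agrees σ i 0F) (θ-agrees σ 0F 1F)))

  denominator-cell : ∀ us -> D us ≈ χq us * (χq us * χp us)
  denominator-cell us = S.*-cong (θ-q-q pos us) (minor-p us)

  Local-χq : Local χq
  Local-χq = Local-cong (θ-q-q pos) (Local-θ (θ pos 0F 0F) (θ-agrees pos 0F 0F))

  private
   χq~1 : P -> Carrier
   χq~1 us = val~1 (u us) * val~1 (u us)

   Local-χqχp : Local (\ us -> χq us * χp us)
   Local-χqχp = Local-cong minor-p (Local-θ (minor 1F pos) (agrees-minor 1F pos))

   one-left : ∀ {s t r} -> s ≈ 1# -> t ≈ 1# -> s * t * r ≈ r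
   one-left p q = S.*-congʳ (S.*-cong p q S.& S.*-identityˡ 1#) S.& S.*-identityˡ _

   uu≈1 : ∀ us -> χq us * χq~1 us ≈ 1#
   uu≈1 us = solves (val (u us) :: val~1 (u us) :: []) (s0 *: s0 *: (s1 *: s1)) (s0 *: s1 *: (s0 *: s1) *: 1:) S.& one-left (val*val~1 (u us)) (val*val~1 (u us))

   Local-D~1 : Local (\ us -> χq~1 us * χq~1 us * val~1 (v us))
   Local-D~1 = local 1 (con (+ 1)) (\ us -> S.*-congʳ (S.*-identityʳ _ S.& denominator-cell us) S.& solves (χq us :: χq~1 us :: val (v us) :: val~1 (v us) :: []) (s0 *: (s0 *: s2) *: (s1 *: s1 *:
    s3)) ((s0 *: s1) *: (s0 *: s1) *: (s2 *: s3)) S.& one-left (uu≈1 us) (uu≈1 us) S.& val*val~1 (v us) S.& S.sym ι-1) RR.refl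

  Local-χq~1 : Local (\ us -> val~1 (lookup us 4F) * val~1 (lookup us 4F))
  Local-χq~1 = Local-cong (\ us -> solves (χq us :: χq~1 us :: val (v us) :: val~1 (v us) :: []) (s1 *: s1 *: s3 *: (s0 *: s2)) ((s0 *: s1) *: (s2 *: s3) *: s1) S.& one-left (uu≈1 us) (val*val~1
   (v us))) (Local-* Local-D~1 Local-χqχp)

  Local-χp : Local χp
  Local-χp = divide χp χq χq~1 (\ us -> S.*-comm (χq us) (χp us)) uu≈1 Local-χqχp Local-χq~1

  Local-χp~1 : Local (\ us -> val~1 (lookup us 5F))
  Local-χp~1 = Local-cong (\ us -> solves (χq us :: χq~1 us :: val~1 (v us) :: []) (s1 *: s1 *: s2 *: (s0 *: s0)) ((s0 *: s1) *: (s0 *: s1) *: s2) S.& one-left (uu≈1 us) (uu≈1 us)) (Local-*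
   Local-D~1 (Local-* Local-χq Local-χq))

  private
   N2≈1 : ∀ σ β δ γ -> β ⊞ δ ≈ γ -> {True (chainLength β δ N.≟ 0)} -> {True (chainLength (-ᴿ β) (-ᴿ δ) N.≟ 0)} -> Column.N' σ β δ γ * Column.N' σ β δ γ ≈ 1#
   N2≈1 pos β δ γ p {f} = S.sym (ι-* (N β δ γ) (N β δ γ)) S.& ι-cong (N-unit p (toWitness f)) S.& ι-1
   N2≈1 neg β δ γ p {f} {g} = S.sym (ι-* (N (-ᴿ β) (-ᴿ δ) (-ᴿ γ)) (N (-ᴿ β) (-ᴿ δ) (-ᴿ γ))) S.& ι-cong (N-unit {(-ᴿ β)} {(-ᴿ δ)} {(-ᴿ γ)} (signed-sum neg p) (toWitness g)) S.& ι-1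

   Local-N : ∀ σ β δ γ -> Local (\ _ -> Column.N' σ β δ γ)
   Local-N σ β δ γ = Local-ι (N (σ ·R β) (σ ·R δ) (σ ·R γ))

   by-units : ∀ {ν} -> ν * ν ≈ 1# -> ∀ us -> ν * χq us * (ν * χq~1 us) ≈ 1#
   by-units {ν} p us = solves (ν :: χq us :: χq~1 us :: []) (s0 *: s1 *: (s0 *: s2)) (s0 *: s0 *: (s1 *: s2) *: 1:) S.& one-left p (uu≈1 us)

  Local-parameter : ∀ σ i -> Local (parameter σ i)
  Local-parameter σ 0F = divide (parameter σ 0F) χq χq~1 (\ us -> S.refl) uu≈1 (Local-cong {G = \ us -> parameter σ 0F us * χq us} (\ us -> S.-‿cong (θ-cartan σ us) S.& S.-‿involutive
   (parameter σ 0F us * χq us)) (Local-neg (Local-θ (θc σ) (θc-agrees σ)))) Local-χq~1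
  Local-parameter σ 1F = divide (parameter σ 1F) (\ us -> Column.N' σ (-ᴿ pr) qr ar * χq us) (\ us -> Column.N' σ (-ᴿ pr) qr ar * χq~1 us) (θ-a-q σ) (by-units (N2≈1 σ (-ᴿ pr) qr ar ⟨ rfl , rfl
   ⟩)) (Local-θ (θ σ 2F 0F) (θ-agrees σ 2F 0F)) (Local-* (Local-N σ (-ᴿ pr) qr ar) Local-χq~1)
  Local-parameter σ 2F = divide (parameter σ 2F) (\ us -> Column.N' σ (-ᴿ ar) qr pr * χq us) (\ us -> Column.N' σ (-ᴿ ar) qr pr * χq~1 us) (θ-p-q σ) (by-units (N2≈1 σ (-ᴿ ar) qr pr ⟨ rfl , rfl
   ⟩)) (Local-θ (θ σ 1F 0F) (θ-agrees σ 1F 0F)) (Local-* (Local-N σ (-ᴿ ar) qr pr) Local-χq~1)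
  Local-parameter σ 3F = divide (parameter σ 3F) (\ us -> Column.N' σ (-ᴿ br) pr ar * (χq us * χp us)) (\ us -> Column.N' σ (-ᴿ br) pr ar * (χq~1 us * val~1 (v us))) (minor-a σ)
   (\ us -> let ν = Column.N' σ (-ᴿ br) pr ar in S.trans (solves (ν :: χq us :: χq~1 us :: val (v us) :: val~1 (v us) :: [])
   (s0 *: (s1 *: s3) *: (s0 *: (s2 *: s4))) ((s0 *: s1 *: (s0 *: s2)) *: (s3 *: s4) *: 1:))
   (one-left (by-units (N2≈1 σ (-ᴿ br) pr ar ⟨ rfl , rfl ⟩) us) (val*val~1 (v us))))
   (Local-θ (minor 2F σ) (agrees-minor 2F σ)) (Local-* (Local-N σ (-ᴿ br) pr ar) (Local-* Local-χq~1 Local-χp~1))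

  LocalM : (P -> M.Mat n) -> Set _
  LocalM A = ∀ i j -> Local (\ us -> A us i j)

  LocalM-cong : ∀ {A B} -> (∀ us -> A us M.≈ B us) -> LocalM A -> LocalM B
  LocalM-cong p l i j = Local-cong (\ us -> p us i j) (l i j)

  LocalM-* : ∀ {A B} -> LocalM A -> LocalM B -> LocalM (\ us -> A us M.* B us)
  LocalM-* l m i j = Local-sum \ k -> Local-* (l i k) (m k j)

  LocalM-x : ∀ γ {F} -> Local F -> LocalM (\ us -> x γ (F us))
  LocalM-x γ {F} l i j = Local-cong (\ us -> S.sym (x≈rootElement γ (F us) i j)) (Local-sum {bound} \ k -> Local-* (Local-^ (# k) l) (Local-ι (divPow γ (# k) i j)))

  LocalM-w : ∀ γ (w : P -> Unit) -> Local (\ us -> val (w us)) -> Local (\ us -> val~1 (w us)) -> LocalM (\ us -> Torus.w γ (w us))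
  LocalM-w γ w l m = LocalM-* (LocalM-* (LocalM-x γ l) (LocalM-x (-ᴿ γ) (Local-neg m))) (LocalM-x γ l)

  agreement-at : (∀ p q -> (∀ us -> e us p ≈ e us q) -> evalPoly R g p RR.≈ evalPoly R g q) -> (∀ p q -> (∀ us -> e us p ≈ e us q) -> evalPoly R g' p RR.≈ evalPoly R g' q) -> evalPoly R g
   denominator RR.≈ RR.1# -> ∀ p {F} -> Local F -> (∀ us -> e us p ≈ F us) -> Agrees p
  agreement-at transfer transfer' normalized p {F} (local N f q a) eq = RR.trans (RR.sym (one-power g normalized)) (RR.trans (transfer (powᴾ N ⊗ p) f same) (RR.trans a (RR.trans (RR.sym
   (transfer' (powᴾ N ⊗ p) f same)) (one-power g' (RR.trans (RR.sym agrees-denominator) normalized)))))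
   where
   same : ∀ us -> e us (powᴾ N ⊗ p) ≈ e us f
   same us = S.*-cong (e-pow us N) (eq us) S.& q us
   one-power : ∀ A -> evalPoly R A denominator RR.≈ RR.1# -> evalPoly R A (powᴾ N ⊗ p) RR.≈ evalPoly R A p
   one-power A r = RR.trans (RR.*-congʳ (power N)) (RR.*-identityˡ _)
    where
    power : ∀ k -> evalPoly R A (powᴾ k) RR.≈ RR.1#
    power zero = IntegerScalars.ι-1 R
    power (suc k) = RR.trans (RR.*-cong r (power k)) (RR.*-identityˡ _)

module Parity {c ℓ} {K : CommutativeRing c ℓ} (isℚ : IsℚAlgebra K) {n} (π : Representation n) where
 open RootSubgroups K π
 open TorusWeights isℚ π
 open Points isℚ π using (conjugate-x)
 open WeightGrading (TorusProjections.grading isℚ π ar)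
 open IsℚAlgebra isℚ using (ι-regular)
 open Torus ar using (h)
 open Matrices K using (ι)
 open S using (_≈_; _+_; _*_; -_; 0#; 1#; Carrier)

 projection : ℕ -> M.Mat n
 projection d = ιM (P d)

 private
  S : Carrier -> M.Mat n
  S = series size P

  total' : M.sum {n} {size} (\ d -> projection (# d)) M.≈ M.1#
  total' = M.sym (ιM-sum {m = size} (P ∘ #)) M.& ιM-cong {A = I.sum {n} {size} (P ∘ #)} {I.1#} total M.& ιM-1

  orthogonal : ∀ {d e} -> d N.< size -> e N.< size -> d ≢ e -> projection d M.* projection e M.≈ M.0#
  orthogonal {d} {e} d< e< d≢e = M.sym (ιM-* (P d) (P e)) M.& ιM-cong {A = P d I.* P e} {I.0#} (I.congl (P d) (I.sym (I.*-identityˡ (P e))) I.& (eigen-zero {I.1#} {+ 0} (I.solve [] (H[ ar ]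
   :: []) (m0 :* :1) (:1 :* m0 :+ 0: :% :1)) d< e< \ p -> d≢e (O.+-injective (p ⟫ O.+-identityʳ (+ e))))) M.& ιM-0

  S-projection : ∀ s (d : Fin size) -> S s M.* projection (# d) M.≈ (s S.^ # d) M.⊙ projection (# d)
  S-projection s d = M.*-distribʳ-sum {n} {size} (projection (# d)) (\ e -> (s S.^ # e) M.⊙ projection (# e)) M.& M.sum-cong-≋ {n} {size} term M.& M.sym (M.*-distribʳ-sum {n} {size} ((s
   S.^ # d) M.⊙ projection (# d)) (\ e -> projection (# e))) M.& M.congr ((s S.^ # d) M.⊙ projection (# d)) total' M.& M.*-identityˡ _
   where
   term : ∀ e -> ((s S.^ # e) M.⊙ projection (# e)) M.* projection (# d) M.≈ projection (# e) M.* ((s S.^ # d) M.⊙ projection (# d))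
   term e with # e N.≟ # d
   ... | yes q = M.congr (projection (# d)) (M.%-cong (S.reflexive (cong (s S.^_) q)) M.refl) M.& M.solve (s S.^ # d :: []) (projection (# e) :: projection (# d) :: []) ((s0 :% m0) :*
    m1) (m0 :* (s0 :% m1))
   ... | no ¬q = M.solve (s S.^ # e :: []) (projection (# e) :: projection (# d) :: []) ((s0 :% m0) :* m1) (s0 :% (m0 :* m1)) M.& M.%-cong S.refl zero-product M.& M.solve (s S.^ # e :: s
    S.^ # d :: []) [] (s0 :% :0) (s1 :% :0) M.& M.%-cong S.refl (M.sym zero-product) M.& M.solve (s S.^ # d :: []) (projection (# e) :: projection (# d) :: []) (s0 :% (m0 :* m1)) (m0 :*
    (s0 :% m1))
    where
    zero-product = orthogonal (F.toℕ<n e) (F.toℕ<n d) ¬q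

  projection-S : ∀ s (d : Fin size) -> projection (# d) M.* S s M.≈ (s S.^ # d) M.⊙ projection (# d)
  projection-S s d = M.*-distribˡ-sum {n} {size} (projection (# d)) (\ e -> (s S.^ # e) M.⊙ projection (# e)) M.& M.sum-cong-≋ {n} {size} term M.& M.sym (M.*-distribˡ-sum {n} {size} ((s
   S.^ # d) M.⊙ projection (# d)) (\ e -> projection (# e))) M.& M.congl ((s S.^ # d) M.⊙ projection (# d)) total' M.& M.*-identityʳ _
   where
   term : ∀ e -> projection (# d) M.* ((s S.^ # e) M.⊙ projection (# e)) M.≈ ((s S.^ # d) M.⊙ projection (# d)) M.* projection (# e)
   term e with # e N.≟ # d
   ... | yes q = M.congl (projection (# d)) (M.%-cong {y = projection (# e)} (S.reflexive (cong (s S.^_) q)) M.refl) M.& M.solve (s S.^ # d :: []) (projection (# d) :: projection (#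
    e) :: []) (m0 :* (s0 :% m1)) ((s0 :% m0) :* m1)
   ... | no ¬q = M.solve (s S.^ # e :: []) (projection (# d) :: projection (# e) :: []) (m0 :* (s0 :% m1)) (s0 :% (m0 :* m1)) M.& M.%-cong S.refl zero-product M.& M.solve (s S.^ # e :: s
    S.^ # d :: []) [] (s0 :% :0) (s1 :% :0) M.& M.%-cong S.refl (M.sym zero-product) M.& M.solve (s S.^ # d :: []) (projection (# d) :: projection (# e) :: []) (s0 :% (m0 :* m1)) ((s0 :%
    m0) :* m1)
    where
    zero-product = orthogonal (F.toℕ<n d) (F.toℕ<n e) (¬q ∘ J.sym)

 h-series : ∀ u -> h u M.≈ (val~1 u S.^ offset) M.⊙ S (val u)
 h-series = TorusProjections.h-expansion isℚ π ar

 -- The conjugates of Y under the torus, Y decomposed by the weights of both sides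
 conjugate-torus : ∀ {u h~ Y} -> h u M.* h~ M.≈ M.1# -> h u M.* (Y M.* h~) M.≈ M.sum {n} {size} \ d -> M.sum {n} {size} \ e -> (val u S.^ # d * val~1 u S.^ # e) M.⊙ (projection (# d) M.*
  (Y M.* projection (# e)))
 conjugate-torus {u} {h~} {Y} inverse = begin
  h u M.* (Y M.* h~)
  ≈⟨ M.trans (M.*-cong (M.sym (M.*-identityʳ (h u))) (M.congl Y (M.sym (M.*-identityˡ h~))))
  (M.trans (M.*-cong (M.congl (h u) (M.sym total')) (M.congl Y (M.congr h~ (M.sym total'))))
  (M.solve [] (h u :: Σp :: Y :: h~ :: []) ((m0 :* m1) :* (m2 :* (m1 :* m3))) ((m0 :* m1) :* (m2 :* (m1 :* m3))))) ⟩
  (h u M.* Σp) M.* (Y M.* (Σp M.* h~))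
  ≈⟨ M.*-cong (M.trans (M.*-distribˡ-sum {n} {size} (h u) (\ d -> p d)) (M.sum-cong-≋ {n} {size} left-eigen))
  (M.congl Y (M.trans (M.*-distribʳ-sum {n} {size} h~ (\ e -> p e)) (M.sum-cong-≋ {n} {size} right-eigen))) ⟩
  M.sum {n} {size} (\ d -> k d M.⊙ p d) M.* (Y M.* M.sum {n} {size} (\ e -> k~ e M.⊙ p e))
  ≈⟨ M.trans (M.congl (M.sum {n} {size} (\ d -> k d M.⊙ p d)) (M.*-distribˡ-sum {n} {size} Y (\ e -> k~ e M.⊙ p e)))
  (M.trans (M.*-distribʳ-sum {n} {size} (M.sum {n} {size} (\ e -> Y M.* (k~ e M.⊙ p e))) (\ d -> k d M.⊙ p d))
  (M.sum-cong-≋ {n} {size} \ d -> M.trans (M.*-distribˡ-sum {n} {size} (k d M.⊙ p d) (\ e -> Y M.* (k~ e M.⊙ p e))) (M.sum-cong-≋ {n} {size} (term d)))) ⟩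
  M.sum {n} {size} (\ d -> M.sum {n} {size} \ e -> (val u S.^ # d * val~1 u S.^ # e) M.⊙ (p d M.* (Y M.* p e))) ∎
  where
  open Reasoning (M.setoid {n})
  Σp = M.sum {n} {size} (\ d -> projection (# d))
  p : Fin size -> M.Mat n
  p d = projection (# d)
  k k~ : Fin size -> Carrier
  k d = val~1 u S.^ offset * val u S.^ # d
  k~ d = val u S.^ offset * val~1 u S.^ # d
  left-eigen : ∀ d -> h u M.* p d M.≈ k d M.⊙ p d
  left-eigen d = M.congr (p d) (h-series u) M.& M.solve (val~1 u S.^ offset :: []) (S (val u) :: p d :: []) ((s0 :% m0) :* m1) (s0 :% (m0 :* m1)) M.& M.%-cong S.refl (S-projection (val u) d)
   M.& M.solve (val~1 u S.^ offset :: val u S.^ # d :: []) (p d :: []) (s0 :% s1 :% m0) ((s0 *: s1) :% m0)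
  eigen : ∀ d -> p d M.* h u M.≈ k d M.⊙ p d
  eigen d = M.congl (p d) (h-series u) M.& M.solve (val~1 u S.^ offset :: []) (S (val u) :: p d :: []) (m1 :* (s0 :% m0)) (s0 :% (m1 :* m0)) M.& M.%-cong S.refl (projection-S (val u) d) M.&
   M.solve (val~1 u S.^ offset :: val u S.^ # d :: []) (p d :: []) (s0 :% s1 :% m0) ((s0 *: s1) :% m0)
  k~k : ∀ d -> k~ d * k d ≈ 1#
  k~k d = solves (val u S.^ offset :: val~1 u S.^ offset :: val u S.^ # d :: val~1 u S.^ # d :: []) (s0 *: s3 *: (s1 *: s2)) (s0 *: s1 *: (s2 *: s3)) S.& S.*-cong (power-inverse u offset)
   (power-inverse u (# d)) S.& S.*-identityˡ 1#
  right-eigen : ∀ d -> p d M.* h~ M.≈ k~ d M.⊙ p d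
  right-eigen d = (M.sym (M.%-one _) M.& M.%-cong (S.sym (k~k d)) M.refl) M.& M.solve (k~ d :: k d :: []) (p d :: h~ :: []) ((s0 *: s1) :% (m0 :* m1)) (s0 :% ((s1 :% m0) :* m1)) M.& M.%-cong
   S.refl (M.congr h~ (M.sym (eigen d)) M.& M.*-assoc (p d) (h u) h~ M.& M.congl (p d) inverse M.& M.*-identityʳ (p d))
  term : ∀ d e -> (k d M.⊙ p d) M.* (Y M.* (k~ e M.⊙ p e)) M.≈ (val u S.^ # d * val~1 u S.^ # e) M.⊙ (p d M.* (Y M.* p e))
  term d e = M.solve (val u S.^ offset :: val~1 u S.^ offset :: val u S.^ # d :: val~1 u S.^ # e :: []) (p d :: Y :: p e :: []) (((s1 *: s2) :% m0) :* (m1 :* ((s0 *: s3) :% m2))) ((s0 *: s1 *: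
   (s2 *: s3)) :% (m0 :* (m1 :* m2))) M.& M.%-cong (S.*-congʳ (power-inverse u offset) S.& S.*-identityˡ _) M.refl

 same : ℕ -> ℕ -> Bool
 same zero zero = true
 same zero (suc zero) = false
 same zero (suc (suc e)) = same zero e
 same (suc d) (suc e) = same d e
 same (suc zero) zero = false
 same (suc (suc d)) zero = same d zero

 sign-power : ∀ d e -> same d e ≡ false -> (- 1#) S.^ d ≈ - ((- 1#) S.^ e)
 sign-power zero (suc zero) p = solves [] 1: (-: ((-: 1:) *: 1:))
 sign-power zero (suc (suc e)) p = sign-power zero e p S.& S.-‿cong (solves ((- 1#) S.^ e :: []) (s0) ((-: 1:) *: ((-: 1:) *: s0)))
 sign-power (suc zero) zero p = solves [] ((-: 1:) *: 1:) (-: 1:)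
 sign-power (suc (suc d)) zero p = solves ((- 1#) S.^ d :: []) ((-: 1:) *: ((-: 1:) *: s0)) (s0) S.& sign-power d zero p
 sign-power (suc d) (suc e) p = S.*-congˡ (sign-power d e p) S.& S.sym (S.-‿distribʳ-* _ _)

 private
  sign-square : ∀ d -> (- 1#) S.^ d * (- 1#) S.^ d ≈ 1#
  sign-square zero = S.*-identityˡ 1#
  sign-square (suc d) = solves ((- 1#) S.^ d :: []) ((-: 1:) *: s0 *: ((-: 1:) *: s0)) (s0 *: s0) S.& sign-square d

 -- acts by (-1)^d on the d-th weight space of H[ a ]
 parity : M.Mat n
 parity = S (- 1#)

 parity-x : ∀ γ t -> parity M.* x γ t M.≈ x γ t M.* parity
 parity-x γ t = conjugate-x γ {parity} {1#} (commutes (fst (even γ)) (snd (even γ)) M.& M.sym (M.%-one _)) t M.& M.congr parity (x-cong γ (S.*-identityˡ t))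
  where
  even : ∀ γ -> Σ (Fin 3) \ l -> pairing ar γ ≡ + 2 O.- + (# l N.+ # l)
  even (short pos pos) = 1F , rfl
  even (short pos neg) = 0F , rfl
  even (short neg pos) = 2F , rfl
  even (short neg neg) = 1F , rfl
  even (long 0F pos) = 0F , rfl
  even (long 0F neg) = 2F , rfl
  even (long 1F pos) = 2F , rfl
  even (long 1F neg) = 0F , rfl
  commutes : ∀ (l : Fin 3) -> pairing ar γ ≡ + 2 O.- + (# l N.+ # l) -> parity M.* ιM (X γ) M.≈ ιM (X γ) M.* parity
  commutes l p = M.sym (M.%-one _) M.& M.%-cong (S.sym (even-sign (# l))) M.refl M.& weight-shift ar {X γ} {hval ar γ} {# l N.+ # l} {2} (bracket-cartan ar γ) (hval≡ ar γ ⟫ p) (- 1#)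
   M.& M.%-cong (even-sign 1) M.refl M.& M.%-one _
   where
   even-sign : ∀ l -> (- 1#) S.^ (l N.+ l) ≈ 1#
   even-sign l = S.^-homo-* (- 1#) l l S.& sign-square l

 odd-part-vanishes : ∀ {Y} -> parity M.* Y M.≈ Y M.* parity -> ∀ (d e : Fin size) -> same (# d) (# e) ≡ false -> projection (# d) M.* (Y M.* projection (# e)) M.≈ M.0#
 odd-part-vanishes {Y} comm d e odd i j = ι-regular (+ 2) (\ ()) (solves (z :: []) (s0 *: (1: +: (1: +: 0:))) (s0 +: s0) S.& S.+-congˡ z≈-z S.& S.-‿inverseʳ z)
  where
  Z = projection (# d) M.* (Y M.* projection (# e))
  z = Z i j
  ε = (- 1#) S.^ # d
  ε′ = (- 1#) S.^ # e
  both : ε M.⊙ Z M.≈ ε′ M.⊙ Z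
  both = M.solve (ε :: []) (projection (# d) :: Y :: projection (# e) :: []) (s0 :% (m0 :* (m1 :* m2))) ((s0 :% m0) :* m1 :* m2) M.& M.congr (projection (# e)) (M.congr Y (M.sym
   (projection-S (- 1#) d))) M.& M.solve [] (projection (# d) :: parity :: Y :: projection (# e) :: []) (m0 :* m1 :* m2 :* m3) (m0 :* (m1 :* m2) :* m3) M.& M.congr (projection (# e))
   (M.congl (projection (# d)) comm) M.& M.solve [] (projection (# d) :: parity :: Y :: projection (# e) :: []) (m0 :* (m2 :* m1) :* m3) (m0 :* (m2 :* (m1 :* m3))) M.& M.congl (projection
   (# d)) (M.congl Y (S-projection (- 1#) e)) M.& M.solve (ε′ :: []) (projection (# d) :: Y :: projection (# e) :: []) (m0 :* (m1 :* (s0 :% m2))) (s0 :% (m0 :* (m1 :* m2)))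
  z≈-z : z ≈ - z
  z≈-z = S.sym (S.*-identityˡ z) S.& S.*-congʳ (S.sym (sign-square (# d))) S.& S.*-assoc ε ε z S.& S.*-congˡ (both i j) S.& S.*-congʳ (sign-power (# d) (# e) odd) S.& solves (ε′ :: z ::
   []) ((-: s0) *: (s0 *: s1)) (-: (s0 *: s0 *: s1)) S.& S.-‿cong (S.*-congʳ (sign-square (# e)) S.& S.*-identityˡ z)

 module _ (adjoint : IsAdjoint π) where
  private
   module B = WeightGrading (TorusProjections.grading isℚ π br)

   projections-commute : ∀ {H} (G : WeightGrading H) {Z} -> H I.* Z I.≈ Z I.* H -> ∀ (e : Fin (WeightGrading.size G)) -> WeightGrading.P G (# e) I.* Z I.≈ Z I.* WeightGrading.P G (# e)
   projections-commute {H} G {Z} p e = (I.solve [] (G.P (# e) :: Z :: []) (m0 :* m1) ((m0 :* m1) :* :1) I.& I.congl (G.P (# e) I.* Z) (I.sym G.total)) I.& I.*-distribˡ-sum {n} {G.size}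
    (G.P (# e) I.* Z) (G.P ∘ #) I.& I.sum-cong-≋ {n} {G.size} term I.& I.sym (I.*-distribʳ-sum {n} {G.size} (Z I.* G.P (# e)) (G.P ∘ #)) I.& I.congr (Z I.* G.P (# e)) G.total I.&
    I.*-identityˡ (Z I.* G.P (# e))
    where
    module G = WeightGrading G
    p' : H I.* Z I.≈ Z I.* H I.+ + 0 I.·ᴹ Z
    p' = p I.& I.solve [] (Z :: H :: []) (m0 :* m1) (m0 :* m1 :+ 0: :% m0)
    term : ∀ f -> (G.P (# e) I.* Z) I.* G.P (# f) I.≈ G.P (# f) I.* (Z I.* G.P (# e))
    term f with # e N.≟ # f
    ... | yes q = I.*-assoc (G.P (# e)) Z (G.P (# f)) I.& I.reflexive (cong₂ (\ d d' -> G.P d I.* (Z I.* G.P d')) q (J.sym q))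
    ... | no ¬q = I.*-assoc (G.P (# e)) Z (G.P (# f)) I.& G.eigen-zero {Z} {+ 0} p' (F.toℕ<n e) (F.toℕ<n f) (\ r -> ¬q (O.+-injective (r ⟫ O.+-identityʳ _))) I.& I.sym (G.eigen-zero {Z}
     {+ 0} p' (F.toℕ<n f) (F.toℕ<n e) (\ r -> ¬q (J.sym (O.+-injective (r ⟫ O.+-identityʳ _)))))

   even-roots : ∀ {μ} -> Generated W.group IsRoot μ -> ∃[ k ] fst μ O.- snd μ ≡ k O.+ k
   even-roots (gen (γ , p , q)) = let (k , r) = on-root γ in k , J.trans (J.sym (cong₂ O._-_ p q)) r
    where
    on-root : ∀ γ -> ∃[ k ] fst (coords γ) O.- snd (coords γ) ≡ k O.+ k
    on-root (short pos pos) = + 0 , rfl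
    on-root (short pos neg) = + 1 , rfl
    on-root (short neg pos) = -[1+ 0 ] , rfl
    on-root (short neg neg) = + 0 , rfl
    on-root (long 0F pos) = + 1 , rfl
    on-root (long 0F neg) = -[1+ 0 ] , rfl
    on-root (long 1F pos) = -[1+ 0 ] , rfl
    on-root (long 1F neg) = + 1 , rfl
   even-roots unit = + 0 , rfl
   even-roots (mul {μ1 , μ2} {ν1 , ν2} p q) = let (k , r) = even-roots p ; (l , s) = even-roots q in k O.+ l ,
    J.trans (ℤs.solves (μ1 :: μ2 :: ν1 :: ν2 :: []) (s0 +: s2 -: (s1 +: s3)) (s0 -: s1 +: (s2 -: s3)))
    (J.trans (cong₂ O._+_ r s) (ℤs.solves (k :: l :: []) (s0 +: s0 +: (s1 +: s1)) (s0 +: s1 +: (s0 +: s1))))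
   even-roots (inv {μ1 , μ2} p) = let (k , r) = even-roots p in O.- k ,
    J.trans (ℤs.solves (μ1 :: μ2 :: []) (-: s0 -: -: s1) (-: (s0 -: s1))) (J.trans (cong O.-_ r) (ℤs.solves (k :: []) (-: (s0 +: s0)) (-: s0 +: -: s0)))
   even-roots (resp (p , q) r) = let (k , s) = even-roots r in k , J.trans (J.sym (cong₂ O._-_ p q)) s

   same-sound : ∀ d e k -> + d O.- + e ≡ k O.+ k -> same d e ≡ true
   same-sound zero zero k p = rfl
   same-sound zero (suc zero) k p = contradiction p (odd k)
    where
    odd : ∀ k -> -[1+ 0 ] ≢ k O.+ k
    odd -[1+ k ] ()
    odd (+ k) ()
   same-sound zero (suc (suc e)) k p = same-sound zero e (k O.+ + 1) (ℤs.solves (+ e :: []) (0: -: s0) (0: -: (1: +: (1: +: s0)) +: (1: +: 1:)) ⟫ cong (O._+ + 2) p ⟫ ℤs.solves (k :: []) (s0 +: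
    s0 +: (1: +: 1:)) (s0 +: 1: +: (s0 +: 1:)))
   same-sound (suc zero) zero k p = contradiction p (odd k)
    where
    odd : ∀ k -> + 1 ≢ k O.+ k
    odd (+ zero) ()
    odd (+ suc k) q = contradiction (O.+-injective q ⟫ cong suc (N.+-suc k k)) \ ()
   same-sound (suc (suc d)) zero k p = same-sound d zero (k O.- + 1) (ℤs.solves (+ d :: []) (s0 -: 0:) ((1: +: (1: +: s0)) -: 0: -: (1: +: 1:)) ⟫ cong (O._- + 2) p ⟫ ℤs.solves (k :: []) (s0 +:
    s0 -: (1: +: 1:)) (s0 -: 1: +: (s0 -: 1:)))
   same-sound (suc d) (suc e) k p = same-sound d e k (ℤs.solves (+ d :: + e :: []) (s0 -: s1) ((1: +: s0) -: (1: +: s1)) ⟫ p)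

  odd-projection-vanishes : ∀ (d : Fin size) -> same (# d) offset ≡ false -> P (# d) I.≈ I.0#
  odd-projection-vanishes d odd = (I.sym (I.*-identityʳ (P (# d))) I.& I.congl (P (# d)) (I.sym B.total)) I.& I.*-distribˡ-sum {n} {B.size} (P (# d)) (B.P ∘ #) I.& (I.sum-zero {n}
   {B.size} \ e i j -> vanish e i j)
   where
   vanish : ∀ (e : Fin B.size) i j -> (P (# d) I.* B.P (# e)) i j ≡ + 0
   vanish e i j with (P (# d) I.* B.P (# e)) i j O.≟ + 0
   ... | yes p = p
   ... | no ¬p = contradiction (J.sym odd ⟫ same-sound (# d) offset (fst root-lattice) (ℤs.solves (m :: l :: []) (s0) (s0 +: s1 -: s1) ⟫ snd root-lattice)) \ ()
    where
    m l : ℤ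
    m = + # d O.- + offset
    l = + # e O.- + B.offset
    Q : I.Mat n
    Q = P (# d) I.* B.P (# e)
    HaQ : H[ ar ] I.* Q I.≈ m I.·ᴹ Q
    HaQ = I.sym (I.*-assoc H[ ar ] (P (# d)) (B.P (# e))) I.& I.congr (B.P (# e)) (eigenl (# d) (F.toℕ<n d)) I.& I.solve (m :: []) (P (# d) :: B.P (# e) :: []) ((s0 :% m0) :* m1)
     (s0 :% (m0 :* m1))
    HbQ : H[ br ] I.* Q I.≈ l I.·ᴹ Q
    HbQ = I.sym (I.*-assoc H[ br ] (P (# d)) (B.P (# e))) I.& I.congr (B.P (# e)) (I.sym (projections-commute (TorusProjections.grading isℚ π ar) {H[ br ]} (cartan-commute ar br) d))
     I.& I.*-assoc (P (# d)) H[ br ] (B.P (# e)) I.& I.congl (P (# d)) (B.eigenl (# e) (F.toℕ<n e)) I.& I.solve (l :: []) (P (# d) :: B.P (# e) :: []) (m0 :* (s0 :% m1)) (s0 :% (m0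
     :* m1))
    weight : IsWeight π (m O.+ l , l)
    weight = (\ k -> Q k j) , (\ z -> ¬p (z i)) , \ { 0F k -> J.trans ((ℤT.sumZ-cong \ k' -> cong (O._* Q k' j) (J.sym (H0 k k'))) ⟫ HaQ k j) (cong (O._* Q k j) (ℤs.solves (m :: l :: []) (s0) ((s0
     +: s1) *: 1: +: s1 *: (-: 1:)))) ; 1F k -> J.trans ((ℤT.sumZ-cong \ k' -> cong (O._* Q k' j) (J.sym (H1 k k'))) ⟫ HbQ k j) (cong (O._* Q k j) (ℤs.solves (m :: l :: []) (s1) ((s0 +: s1) *:
     0: +: s1 *: 1:))) }
     where
     H0 : ∀ k k' -> H[ ar ] k k' ≡ H 0F k k'
     H0 k k' = ℤs.solves (H 0F k k' :: H 1F k k' :: []) (1: *: s0 +: (0: *: s1 +: 0:)) (s0)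
     H1 : ∀ k k' -> H[ br ] k k' ≡ H 1F k k'
     H1 k k' = ℤs.solves (H 0F k k' :: H 1F k k' :: []) (0: *: s0 +: (1: *: s1 +: 0:)) (s1)
    root-lattice : ∃[ k ] m O.+ l O.- l ≡ k O.+ k
    root-lattice = even-roots (Function.Bundles.Equivalence.to (adjoint (m O.+ l , l)) (gen weight))

module Comparison {c ℓ} {K : CommutativeRing c ℓ} (isℚ : IsℚAlgebra K) {n} (π : Representation n)
 {c' ℓ′} {R : CommutativeRing c' ℓ′} {g g' : Matrices.Invertible R n}
 (point : Points.Point isℚ π R g) (point' : Points.Point isℚ π R g')
 (agreement : Localization.Agreement isℚ π {R = R} (Matrices.mat g) (Matrices.mat g'))
 (normalized : CommutativeRing._≈_ R (evalPoly R (Matrices.mat g) (Localization.denominator isℚ π {R = R} (Matrices.mat g) (Matrices.mat g'))) (CommutativeRing.1# R)) where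
 open RootSubgroups K π
 open BigCell isℚ π using (cell; density; sum-entry; series-entry)
 open CellCoordinates isℚ π
 open CoordinatePolynomials isℚ π using (parameter; Adᴾ)
 open Localization isℚ π {R = R} (Matrices.mat g) (Matrices.mat g')
 open Parity isℚ π
 open Matrices K using (ι)
 open S using (_≈_; _+_; _*_; -_; 0#; 1#; Carrier)
 private
  module RR = CommutativeRing R
  module MR = Matrices R
  module P = PolynomialSyntax {n}
  module G = WeightGrading (TorusProjections.grading isℚ π ar)
  Par = Vec Unit 10

  transfer : ∀ {f} -> Points.Point isℚ π R f -> ∀ p q -> (∀ us -> evalPoly K (cell us) p ≈ evalPoly K (cell us) q) -> evalPoly R (MR.mat f) p RR.≈ evalPoly R (MR.mat f) q
  transfer {f} pt p q eq = Points.AtPoint.transfer isℚ π {R = R} {f} pt p q \ h e -> S.x∙y⁻¹≈ε⇒x≈y _ _ (S.+-congˡ (S.sym (PolynomialEvaluation.eval-neg K (Matrices.mat h) q)) S.& density (p ⊕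
   P.negᴾ q) (\ us -> S.+-cong (eq us) (PolynomialEvaluation.eval-neg K (cell us) q) S.& S.-‿inverseʳ _) h e)

 agree : ∀ p {F} -> Local agreement F -> (∀ us -> evalPoly K (cell us) p ≈ F us) -> Agrees p
 agree p = agreement-at agreement (transfer {g} point) (transfer {g'} point') normalized p

 private
  L : (Par -> Carrier) -> Set _
  L = Local agreement
  LM : (Par -> M.Mat n) -> Set _
  LM = LocalM agreement

  u v : Par -> Unit
  u us = lookup us 4F
  v us = lookup us 5F

  value : Fin 10 -> Par -> Carrier
  value i us = val (lookup us i)

  positive : ∀ {i} j -> (∀ us -> parameter neg j us ≡ - value i us) -> L (value i)
  positive j p = Local-cong agreement (\ us -> S.-‿cong (S.reflexive (p us)) S.& S.-‿involutive _) (Local-neg agreement (Local-parameter agreement neg j))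

  t1 = positive {6F} 3F (\ _ -> rfl)
  t2 = positive {7F} 2F (\ _ -> rfl)
  t3 = positive {8F} 1F (\ _ -> rfl)
  t4 = positive {9F} 0F (\ _ -> rfl)
  s₁ = Local-parameter agreement pos 0F
  s₂ = Local-parameter agreement pos 1F
  s₃ = Local-parameter agreement pos 2F
  s₄ = Local-parameter agreement pos 3F

  Local-even : ∀ d e -> same d e ≡ true -> L (\ us -> val (u us) S.^ d * val~1 (u us) S.^ e)
  Local-even zero zero p = Local-cong agreement (\ _ -> S.sym (S.*-identityˡ 1#)) (Local-1 agreement)
  Local-even zero (suc (suc e)) p = Local-cong agreement (\ us -> solves (val~1 (u us) :: val~1 (u us) S.^ e :: []) (s0 *: s0 *: (1: *: s1)) (1: *: (s0 *: (s0 *: s1)))) (Local-* agreement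
   (Local-χq~1 agreement) (Local-even zero e p))
  Local-even (suc d) (suc e) p = Local-cong agreement (\ us -> S.sym (S.*-identityˡ _) S.& S.*-congʳ (S.sym (val*val~1 (u us))) S.& solves (val (u us) :: val~1 (u us) :: val (u us) S.^ d ::
   val~1 (u us) S.^ e :: []) (s0 *: s1 *: (s2 *: s3)) (s0 *: s2 *: (s1 *: s3))) (Local-even d e p)
  Local-even (suc (suc d)) zero p = Local-cong agreement (\ us -> solves (val (u us) :: val (u us) S.^ d :: []) (s0 *: s0 *: (s1 *: 1:)) (s0 *: (s0 *: s1) *: 1:)) (Local-* agreement (Local-χq
   agreement) (Local-even d zero p))

  Local-weight : ∀ d e {F} -> L F -> (same d e ≡ false -> ∀ us -> F us ≈ 0#) -> L (\ us -> (val (u us) S.^ d * val~1 (u us) S.^ e) * F us)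
  Local-weight d e {F} l vanish = by-parity (same d e) rfl
   where
   by-parity : ∀ b -> same d e ≡ b -> L (\ us -> (val (u us) S.^ d * val~1 (u us) S.^ e) * F us)
   by-parity true eq = Local-* agreement (Local-even d e eq) l
   by-parity false eq = Local-cong agreement (\ us -> S.sym (S.*-congˡ (vanish eq us) S.& S.zeroʳ _)) (Local-0 agreement)

  LM-ι : ∀ (A : I.Mat n) -> LM (\ _ -> ιM A)
  LM-ι A i j = Local-ι agreement (A i j)

  infixr 5 _⊗ᴸ_
  _⊗ᴸ_ : ∀ {A B} -> LM A -> LM B -> LM (\ us -> A us M.* B us)
  _⊗ᴸ_ = LocalM-* agreement

  Lx : ∀ γ {F} -> L F -> LM (\ us -> x γ (F us))
  Lx = LocalM-x agreement

  torus-b : LM (\ us -> Torus.h br (v us))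
  torus-b = LocalM-w agreement br v (Local-χp agreement) (Local-χp~1 agreement) ⊗ᴸ LocalM-w agreement br (\ _ -> Torus.-1u br) (Local-neg agreement (Local-1 agreement)) (Local-neg agreement
   (Local-1 agreement))

 module _ (adjoint : IsAdjoint π) where
  private
   torus-a : LM (\ us -> Torus.h ar (u us))
   torus-a i j = Local-cong agreement (\ us -> S.sym (h-series (u us) i j S.& S.*-congˡ (series-entry G.size G.P (val (u us)) i j) S.& S.*-distribˡ-sum {G.size} (val~1 (u us) S.^ G.offset) (\
    d -> val (u us) S.^ # d * ι (G.P (# d) i j)) S.& (S.sum-cong-≋ {G.size} \ d -> S.trans (S.sym (S.*-assoc _ _ _)) (S.*-congʳ (S.*-comm _ _))))) (Local-sum agreement {G.size} \ d ->
    Local-weight (# d) G.offset (Local-ι agreement (G.P (# d) i j)) \ odd us -> ι-cong (odd-projection-vanishes adjoint d odd i j))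

  points-equal : ∀ i j -> MR.mat g i j RR.≈ MR.mat g' i j
  points-equal i j = agree (entry i j) (LocalM-cong agreement same-product (Lx (-ᴿ qr) s₁ ⊗ᴸ Lx (-ᴿ pr) s₂ ⊗ᴸ Lx (-ᴿ ar) s₃ ⊗ᴸ Lx (-ᴿ br) s₄ ⊗ᴸ torus-a ⊗ᴸ torus-b ⊗ᴸ Lx br t1 ⊗ᴸ Lx ar t2 ⊗ᴸ
   Lx pr t3 ⊗ᴸ Lx qr t4) i j) \ _ -> S.refl
   where
   same-product : ∀ us -> _ M.≈ cell us
   same-product (_ :: _ :: _ :: _ :: _ :: _ :: t1 :: t2 :: t3 :: t4 :: []) = congruent (congruent (congruent (congruent (congruent (congruent (congruent (congruent (congruent (M.sym (M.*-identityʳ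
    _))))))))))
    where
    congruent : ∀ {m A B} -> A M.≈ B -> m M.* A M.≈ m M.* B
    congruent {m} p = M.congl m p

 private
  record Commutes (A : M.Mat n) : Set ℓ where
   constructor commutes
   field commute : parity M.* A M.≈ A M.* parity
  open Commutes

  commutes-* : ∀ {A B} -> Commutes A -> Commutes B -> Commutes (A M.* B)
  commutes-* {A} {B} (commutes p) (commutes q) = commutes (M.sym (M.*-assoc parity A B) M.& M.congr B p M.& M.*-assoc A parity B M.& M.congl A q M.& M.sym (M.*-assoc A B parity))

  Cx : ∀ γ t -> Commutes (x γ t)
  Cx γ t = commutes (parity-x γ t)

  -u_ : Unit -> Unit
  -u unit a b p = unit (- a) (- b) (solves (a :: b :: []) ((-: s0) *: (-: s1)) (s0 *: s1) S.& p)

  h~ : Root -> Unit -> M.Mat n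
  h~ γ a = Torus.w γ (-u Torus.-1u γ) M.* Torus.w γ (-u a)

  nested-inverse : ∀ {A B C D : M.Mat n} -> B M.* C M.≈ M.1# -> A M.* D M.≈ M.1# -> (A M.* B) M.* (C M.* D) M.≈ M.1#
  nested-inverse {A} {B} {C} {D} p q = M.solve [] (A :: B :: C :: D :: []) ((m0 :* m1) :* (m2 :* m3)) (m0 :* (m1 :* m2) :* m3) M.& M.congr D (M.congl A p M.& M.*-identityʳ A) M.& q

  h-inverse : ∀ γ a -> Torus.h γ a M.* h~ γ a M.≈ M.1#
  h-inverse γ a = nested-inverse {Torus.w γ a} {Torus.w γ (Torus.-1u γ)} (Torus.w-inverse γ (Torus.-1u γ) (-u Torus.-1u γ) (S.-‿inverseʳ _) (S.-‿inverseʳ _)) (Torus.w-inverse γ a (-u a)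
   (S.-‿inverseʳ _) (S.-‿inverseʳ _))

  inverse-h : ∀ γ a -> h~ γ a M.* Torus.h γ a M.≈ M.1#
  inverse-h γ a = nested-inverse {Torus.w γ (-u Torus.-1u γ)} {Torus.w γ (-u a)} (Torus.w-inverse γ (-u a) a (S.-‿inverseˡ _) (S.-‿inverseˡ _)) (Torus.w-inverse γ (-u Torus.-1u γ) (Torus.-1u
   γ) (S.-‿inverseˡ _) (S.-‿inverseˡ _))

  Cw : ∀ γ a -> Commutes (Torus.w γ a)
  Cw γ a = commutes-* (commutes-* (Cx γ (val a)) (Cx (-ᴿ γ) (- val~1 a))) (Cx γ (val a))

  _by_ : M.Mat n -> M.Mat n × M.Mat n -> M.Mat n
  A by (m , m~) = m M.* (A M.* m~)

  xx : Root -> Carrier -> M.Mat n × M.Mat n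
  xx γ t = x γ t , x γ (- t)

  Lby-x : ∀ γ {F A} -> L F -> LM A -> LM (\ us -> A us by xx γ (F us))
  Lby-x γ l m = Lx γ l ⊗ᴸ (m ⊗ᴸ Lx γ (Local-neg agreement l))

  C-by : ∀ {A m m~} -> Commutes m -> Commutes m~ -> Commutes A -> Commutes (A by (m , m~))
  C-by p q r = commutes-* p (commutes-* r q)

  -- the conjugate of A by the factors of the cell following the torus of a
  inner : I.Mat n -> Par -> M.Mat n
  inner A us = ((((ιM A by xx qr (value 9F us)) by xx pr (value 8F us)) by xx ar (value 7F us)) by xx br (value 6F us)) by (Torus.h br (v us) , h~ br (v us))

  inner-local : ∀ A -> LM (inner A)
  inner-local A = torus-b ⊗ᴸ (Lby-x br t1 (Lby-x ar t2 (Lby-x pr t3 (Lby-x qr t4 (LM-ι A)))) ⊗ᴸ LocalM-w agreement br (\ _ -> -u Torus.-1u br) (Local-neg agreement (Local-neg agreement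
   (Local-1 agreement))) (Local-neg agreement (Local-neg agreement (Local-1 agreement))) ⊗ᴸ LocalM-w agreement br (\ us -> -u v us) (Local-neg agreement (Local-χp agreement)) (Local-neg
   agreement (Local-χp~1 agreement)))

  inner-commutes : ∀ A -> Commutes (ιM A) -> ∀ us -> Commutes (inner A us)
  inner-commutes A p us = C-by (commutes-* (Cw br (v us)) (Cw br (Torus.-1u br))) (commutes-* (Cw br (-u Torus.-1u br)) (Cw br (-u v us))) (by-x' br (by-x' ar (by-x' pr (by-x' qr p))))
   where
   by-x' : ∀ γ {t B} -> Commutes B -> Commutes (B by xx γ t)
   by-x' γ {t} = C-by (Cx γ t) (Cx γ (- t))

  torus-local : ∀ A -> Commutes (ιM A) -> LM (\ us -> inner A us by (Torus.h ar (u us) , h~ ar (u us)))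
  torus-local A p i j = Local-cong agreement (\ us -> S.sym (conjugate-torus {u us} {h~ ar (u us)} {inner A us} (h-inverse ar (u us)) i j S.& sum-entry {G.size} (\ d -> M.sum {n} {G.size}
   (term us d)) i j S.& (S.sum-cong-≋ {G.size} \ d -> sum-entry {G.size} (term us d) i j))) (Local-sum agreement {G.size} \ d -> Local-sum agreement {G.size} \ e -> Local-weight (# d) (# e)
   ((LM-ι (G.P (# d)) ⊗ᴸ (inner-local A ⊗ᴸ LM-ι (G.P (# e)))) i j) \ odd us -> odd-part-vanishes {inner A us} (commute (inner-commutes A p us)) d e odd i j)
   where
   term : Par -> Fin G.size -> Fin G.size -> M.Mat n
   term us d e = (val (u us) S.^ # d * val~1 (u us) S.^ # e) M.⊙ (projection (# d) M.* (inner A us M.* projection (# e)))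

  outer : I.Mat n -> Par -> M.Mat n
  outer A us = ((((inner A us by (Torus.h ar (u us) , h~ ar (u us))) by xx (-ᴿ br) (value 3F us)) by xx (-ᴿ ar) (value 2F us)) by xx (-ᴿ pr) (value 1F us)) by xx (-ᴿ qr) (value 0F us)

  outer-conjugation : ∀ A us -> Conjugation (cell us) (ιM A) (outer A us)
  outer-conjugation A (s₁ :: s₂ :: s₃ :: s₄ :: u :: v :: t1 :: t2 :: t3 :: t4 :: []) = by-x (-ᴿ qr) (val s₁) _ ∘c by-x (-ᴿ pr) (val s₂) _ ∘c by-x (-ᴿ ar) (val s₃) _ ∘c by-x (-ᴿ br) (val s₄) _ ∘c
   by-inverse (inverse-h ar u) _ ∘c by-inverse (inverse-h br v) _ ∘c by-x br (val t1) _ ∘c by-x ar (val t2) _ ∘c by-x pr (val t3) _ ∘c by-x qr (val t4) _ ∘c conjugation (M.*-identityˡ (ιM A)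
   M.& M.sym (M.*-identityʳ (ιM A)))

 conjugates-agree : ∀ γ k i j -> Agrees (Adᴾ pos (RootSubgroups.x ℤ-ring π γ k) i j)
 conjugates-agree γ k i j = agree (Adᴾ pos A i j) (Lby-x (-ᴿ qr) s₁ (Lby-x (-ᴿ pr) s₂ (Lby-x (-ᴿ ar) s₃ (Lby-x (-ᴿ br) s₄ (torus-local A A-commutes)))) i j) \ us -> Cell.eval-Ad us A
  (outer-conjugation A us) i j
  where
  A = RootSubgroups.x ℤ-ring π γ k
  A-commutes : Commutes (ιM A)
  A-commutes = commutes (M.congl parity (IntegerPoints.x-ι K π γ k) M.& parity-x γ (ι k) M.& M.congr parity (M.sym (IntegerPoints.x-ι K π γ k)))

-- The centralizer of five root elements

module Centralizers {c ℓ} {K : CommutativeRing c ℓ} (isℚ : IsℚAlgebra K) {n} (π : Representation n) {c' ℓ′} (R : CommutativeRing c' ℓ′) where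
 open RootSubgroups R π
 open RootConjugation R π
 open Coordinates isℚ π using (φ; κ)
 open Rows R isℚ π using (φ-X; κ-X; step-κ)
 open Conjugates R isℚ π
 open LieSpan R π using (basis)
 open Trace R
 open CoordinatePolynomials isℚ π using (θ; θc; Adᴾ; rowRoot; columnRoot)
 open Points isℚ π using (Point; module AtPoint)
 open Matrices R using (ι; Invertible; mat; mat⁻¹; invˡ; invʳ)
 open S using (_≈_; _+_; _*_; -_; 0#; 1#; Carrier)
 private
  module P = PolynomialSyntax {n}

 Special : Root -> Set
 Special β = β ≡ qr ⊎ β ≡ br ⊎ β ≡ (-ᴿ br) ⊎ β ≡ ar ⊎ β ≡ pr

 record Central (g : Invertible n) : Set (c ⊔ ℓ ⊔ c' ⊔ ℓ′) where
  field
   point : Point R g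
   commutes : ∀ {β} -> Special β -> mat g M.* x β 1# M.≈ x β 1# M.* mat g

 Ad-value : ∀ {g} -> Point R g -> ∀ (A : I.Mat n) i j -> evalPoly R (mat g) (Adᴾ pos A i j) ≈ (mat g M.* (ιM A M.* mat⁻¹ g)) i j
 Ad-value {g} pt A = E.eval-⊡ entry (P.conM A P.⊡ P.inverseᴾ) M.& M.congl (mat g) (E.eval-⊡ (P.conM A) P.inverseᴾ M.& M.congl (ιM A) (AtPoint.inverse-value {R = R} {g} pt))
  where module E = PolynomialEvaluation R (mat g)

 Ad~-value : ∀ {g} -> Point R g -> ∀ (A : I.Mat n) i j -> evalPoly R (mat g) (Adᴾ neg A i j) ≈ (mat⁻¹ g M.* (ιM A M.* mat g)) i j
 Ad~-value {g} pt A = E.eval-⊡ P.inverseᴾ (P.conM A P.⊡ entry) M.& M.*-cong (AtPoint.inverse-value {R = R} {g} pt) (E.eval-⊡ (P.conM A) entry)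
  where module E = PolynomialEvaluation R (mat g)

 expected : Fin 3 -> Fin 2 -> Carrier
 expected 0F 0F = 1#
 expected 1F 1F = 1#
 expected _ _ = 0#

 module _ {g} (central : Central g) where
  open Central central
  private
   module E = PolynomialEvaluation R (mat g)

   cz : Centralizing (mat g) (mat⁻¹ g)
   cz = record { inverseʳ = invʳ g ; inverseˡ = invˡ g ; lieLike = \ δ -> fst (AtPoint.lieLike-point {R = R} {g} point δ) ; commutes = commutes }

   cz~ : Centralizing (mat⁻¹ g) (mat g)
   cz~ = record { inverseʳ = invˡ g ; inverseˡ = invʳ g ; lieLike = \ δ -> snd (AtPoint.lieLike-point {R = R} {g} point δ)
    ; commutes = \ {β} s -> inverse-commutes (commutes s) }
    where
    inverse-commutes : ∀ {A} -> mat g M.* A M.≈ A M.* mat g -> mat⁻¹ g M.* A M.≈ A M.* mat⁻¹ g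
    inverse-commutes {A} p = M.congl (mat⁻¹ g) (M.sym (M.*-identityʳ A) M.& M.congl A (M.sym (invʳ g))) M.& M.solve [] (mat g :: mat⁻¹ g :: A :: []) (m1 :* (m2 :* (m0 :* m1))) (m1 :* (m2 :* m0)
     :* m1) M.& M.congr (mat⁻¹ g) (M.congl (mat⁻¹ g) (M.sym p)) M.& M.solve [] (mat g :: mat⁻¹ g :: A :: []) (m1 :* (m0 :* m2) :* m1) ((m1 :* m0) :* (m2 :* m1)) M.& M.congr (A M.* mat⁻¹ g)
     (invˡ g) M.& M.*-identityˡ (A M.* mat⁻¹ g)

   module V = Equations.WithUnitScalar cz {Equations.scalar cz~} (scalars-inverse cz cz~)
   module V~ = Equations.WithUnitScalar cz~ {Equations.scalar cz} (scalars-inverse cz~ cz)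

   at+ : ∀ Λ δ {r} -> ⟪ Λ , mat g M.* (XR δ M.* mat⁻¹ g) ⟫ ≈ r -> evalPoly R (mat g) P.⟪ Λ , Adᴾ pos (X δ) ⟫ᴾ ≈ r
   at+ Λ δ p = E.eval-⟪⟫ Λ (Adᴾ pos (X δ)) S.& ⟪⟫-cong Λ (Ad-value {g} point (X δ)) S.& p

   at~ : ∀ Λ δ {r} -> ⟪ Λ , mat⁻¹ g M.* (XR δ M.* mat g) ⟫ ≈ r -> evalPoly R (mat g) P.⟪ Λ , Adᴾ neg (X δ) ⟫ᴾ ≈ r
   at~ Λ δ p = E.eval-⟪⟫ Λ (Adᴾ neg (X δ)) S.& ⟪⟫-cong Λ (Ad~-value {g} point (X δ)) S.& p

  θ-central : ∀ σ i j -> evalPoly R (mat g) (θ σ i j) ≈ expected i j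
  θ-central pos 0F 0F = at+ (φ qr) qr V.v-q-q
  θ-central pos 1F 0F = at+ (φ pr) qr V.v-p-q
  θ-central pos 2F 0F = at+ (φ ar) qr V.v-a-q
  θ-central pos 0F 1F = at+ (φ qr) pr V.v-q-p
  θ-central pos 1F 1F = at+ (φ pr) pr V.v-p-p
  θ-central pos 2F 1F = at+ (φ ar) pr V.v-a-p
  θ-central neg 0F 0F = at~ (φ (-ᴿ qr)) (-ᴿ qr) V~.v-q~-q~
  θ-central neg 1F 0F = at~ (φ (-ᴿ pr)) (-ᴿ qr) V~.v-p~-q~
  θ-central neg 2F 0F = at~ (φ (-ᴿ ar)) (-ᴿ qr) V~.v-a~-q~
  θ-central neg 0F 1F = at~ (φ (-ᴿ qr)) (-ᴿ pr) V~.v-q~-p~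
  θ-central neg 1F 1F = at~ (φ (-ᴿ pr)) (-ᴿ pr) V~.v-p~-p~
  θ-central neg 2F 1F = at~ (φ (-ᴿ ar)) (-ᴿ pr) V~.v-a~-p~

  θc-central : evalPoly R (mat g) (θc pos) ≈ 0#
  θc-central = at+ (κ ar) qr V.w-a-q

  coordinate : Carrier
  coordinate = evalPoly R (mat g) (θc neg)

  normalized-at : ∀ {A} -> evalPoly R (mat g) (Localization.denominator isℚ π {R = R} (mat g) A) ≈ 1#
  normalized-at = S.*-cong (θ-central pos 0F 0F) (S.+-cong (S.*-cong (θ-central pos 0F 0F) (θ-central pos 1F 1F)) (E.eval-neg (θ pos 1F 0F ⊗ θ pos 0F 1F) S.& S.-‿cong (S.*-cong (θ-central
   pos 1F 0F) (θ-central pos 0F 1F)))) S.& solves [] (1: *: (1: *: 1: +: (-: (0: *: 0:)))) 1: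

 coordinate-x : ∀ {g} (central : Central g) {t} -> mat g M.≈ x qr t -> coordinate central ≈ t
 coordinate-x {g} central {t} p = E.eval-⟪⟫ (κ (-ᴿ ar)) (Adᴾ neg (X (-ᴿ qr))) S.& ⟪⟫-cong (κ (-ᴿ ar)) (Ad~-value {g} (Central.point central) (X (-ᴿ qr)) M.& M.*-cong inverse (M.congl (XR (-ᴿ
  qr)) (p M.& x-cong qr (S.sym (S.-‿involutive t))))) S.& step-κ (basis (root (-ᴿ qr))) qr (-ᴿ ar) (- t) S.& S.+-cong (κ-X (-ᴿ ar) (-ᴿ qr)) (S.*-congˡ (S.*-cong (ι-cong (hval≡ qr (-ᴿ ar))
  S.& S.-‿cong ι-1) (φ-X (-ᴿ qr) (-ᴿ qr) S.& ι-cong (indicator-self (-ᴿ qr)) S.& ι-1))) S.& solves (t :: []) (0: +: (-: s0) *: ((-: 1:) *: 1:)) (s0)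
  where
  module E = PolynomialEvaluation R (mat g)
  inverse : mat⁻¹ g M.≈ x qr (- t)
  inverse = Group.⁻¹-cong (Matrices.GL R n) {g} {Matrices.invertible (x qr t) (x qr (- t)) (x-inverse qr (S.-‿inverseˡ t)) (x-inverse qr (S.-‿inverseʳ t))} p

 module _ {g g'} (central : Central g) (central' : Central g') (same-coordinate : coordinate central ≈ coordinate central') where
  private
   agreement : Localization.Agreement isℚ π {R = R} (mat g) (mat g')
   agreement = record
    { θ-agrees = \ σ i j -> S.trans (θ-central central σ i j) (S.sym (θ-central central' σ i j))
    ; θc-agrees = \ { pos -> S.trans (θc-central central) (S.sym (θc-central central')) ; neg -> same-coordinate } }
   module C = Comparison isℚ π {R = R} {g} {g'} (Central.point central) (Central.point central') agreement (normalized-at central {mat g'})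

  central-equal : IsAdjoint π -> mat g M.≈ mat g'
  central-equal = C.points-equal

  central-conjugates-equal : ∀ γ k -> mat g M.* (x γ (ι k) M.* mat⁻¹ g) M.≈ mat g' M.* (x γ (ι k) M.* mat⁻¹ g')
  central-conjugates-equal γ k = side g (Central.point central) M.& C.conjugates-agree γ k M.& M.sym (side g' (Central.point central'))
   where
   A = RootSubgroups.x ℤ-ring π γ k
   side : ∀ g -> Point R g -> ∀ i j -> (mat g M.* (x γ (ι k) M.* mat⁻¹ g)) i j ≈ evalPoly R (mat g) (Adᴾ pos A i j)
   side g pt = M.congl (mat g) (M.congr (mat⁻¹ g) (M.sym (IntegerPoints.x-ι R π γ k))) M.& M.sym (Ad-value {g} pt A)

-- Commutator formulas

module Commutators {c ℓ} (R : CommutativeRing c ℓ) {n} (π : Representation n) where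
 open RootSubgroups R π
 open RootConjugation R π using (XR)
 open DoubleStrings π
 open Primitivity π using (N-unit)
 open IntegerPoints R π using (x-ι)
 open Matrices R using (ι)
 open S using (_≈_; _+_; _*_; -_; 0#; 1#; Carrier)
 private
  module Z = RootSubgroups ℤ-ring π
  module ZC = RootConjugation ℤ-ring π
  module ZC2 = RootConjugation2 ℤ-ring π

  ιM-ℤ : ∀ (A : I.Mat n) -> Z.ιM A I.≈ A
  ιM-ℤ A i j = ι-ℤ (A i j)

  commutes-with-series : ∀ {C} N D -> (∀ k -> ιM (D k) M.* C M.≈ C M.* ιM (D k)) -> ∀ t -> series N D t M.* C M.≈ C M.* series N D t
  commutes-with-series {C} N D p t = M.*-distribʳ-sum {n} {N} C (\ k -> (t S.^ # k) M.⊙ ιM (D (# k))) M.& (M.sum-cong-≋ {n} {N} \ k -> M.trans (M.solve (t S.^ # k :: []) (ιM (D (# k)) ::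
   C :: []) ((s0 :% m0) :* m1) (s0 :% (m0 :* m1))) (M.%-cong S.refl (p (# k)) M.& M.solve (t S.^ # k :: []) (ιM (D (# k)) :: C :: []) (s0 :% (m1 :* m0)) (m1 :* (s0 :% m0)))) M.& M.sym
   (M.*-distribˡ-sum {n} {N} C (\ k -> (t S.^ # k) M.⊙ ιM (D (# k))))

 x-commute : ∀ {β δ} -> X β I.* X δ I.≈ X δ I.* X β -> ∀ s t -> x β s M.* x δ t M.≈ x δ t M.* x β s
 x-commute {β} {δ} p s t = commutes-with-series bound (divPow β) (\ k -> M.sym (commutes-with-series bound (divPow δ) (\ l -> terms l k) t)) s
  where
  terms : ∀ l k -> ιM (divPow δ l) M.* ιM (divPow β k) M.≈ ιM (divPow β k) M.* ιM (divPow δ l)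
  terms l k = M.sym (ιM-* (divPow δ l) (divPow β k)) M.& ιM-cong {A = divPow δ l I.* divPow β k} {divPow β k I.* divPow δ l} (DividedPowers.D-central (X-divided δ) {divPow β k} (I.sym
   (DividedPowers.D-central (X-divided β) {X δ} p k)) l) M.& ιM-* (divPow β k) (divPow δ l)

 module _ {β δ : Root} (k : ℤ) where
  private
   C = Z.x β k
   C≈ : ιM C M.≈ x β (ι k)
   C≈ = x-ι β k

   multiple : Root -> ℤ -> I.Mat n
   multiple γ c = c I.·ᴹ X γ
   D : Root -> ℤ -> ℕ -> I.Mat n
   D γ c k = (c O.^ k) I.·ᴹ divPow γ k
   divided : ∀ γ c -> DividedPowers (multiple γ c) (D γ c) bound
   divided γ c = D-scale c (X-divided γ)

   commute-multiples : ∀ {γ} c {Y : I.Mat n} -> X γ I.* Y I.≈ Y I.* X γ -> Y I.* multiple γ c I.≈ multiple γ c I.* Y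
   commute-multiples {γ} c {Y} p = I.solve (c :: []) (X γ :: Y :: []) (m1 :* (s0 :% m0)) (s0 :% (m1 :* m0)) I.& I.%-cong {r = c} rfl (I.sym p) I.& I.solve (c :: []) (X γ :: Y :: []) (s0 :% (m0 :*
    m1)) ((s0 :% m0) :* m1)

   transport : ∀ {Y E N} -> DividedPowers Y E N -> C I.* X δ I.≈ Y I.* C -> ∀ t -> x β (ι k) M.* x δ t M.≈ series N E t M.* x β (ι k)
   transport {Y} {E} {N} dq p t = M.congr (x δ t) (M.sym C≈) M.& M.congl (ιM C) (M.sym (series-bound {D = divPow δ} (DividedPowers.vanish (X-divided δ)) (\ k q -> DividedPowers.vanish
    (X-divided δ) k (N.≤-trans (N.m≤n+m bound N) q)))) M.& series-conjugate (N N.+ bound) {divPow δ} {E} {C} (D-conjugate (X-divided δ) dq p) t M.& M.*-cong (series-bound {D = E}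
    (DividedPowers.vanish dq) (\ k q -> DividedPowers.vanish dq k (N.≤-trans (N.m≤m+n N bound) q))) C≈

  conjugate-single-step : ∀ {ε} -> β ⊞ δ ≈ ε -> (∀ ζ -> ¬ (β ⊞ ε ≈ ζ)) -> X ε I.* X δ I.≈ X δ I.* X ε -> ∀ t -> x β (ι k) M.* x δ t M.≈ (x δ t M.* x ε (ι (k O.* N β δ ε) * t)) M.* x β (ι k)
  conjugate-single-step {ε} p q comm t = transport (convolution-power (X-divided δ) (divided ε e) (commute-multiples {ε} e comm)) (I.congl C (I.sym (ιM-ℤ (X δ))) I.& ZC.conj-step p q k I.&
   I.congr C (I.+-cong (ιM-ℤ (X δ)) (I.%-cong (cong (k O.*_) (ι-ℤ (N β δ ε))) (ιM-ℤ (X ε))))) t M.& M.congr (x β (ι k)) (series-convolution {D = divPow δ} {D ε e} (DividedPowers.vanish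
   (X-divided δ)) (DividedPowers.vanish (divided ε e)) t M.& M.congl (x δ t) (series-scale bound (divPow ε) e t))
   where e = k O.* N β δ ε

  conjugate-double-step : ∀ {ε ζ} (p : β ⊞ δ ≈ ε) (q : β ⊞ ε ≈ ζ) -> X ε I.* X δ I.≈ X δ I.* X ε -> X ζ I.* X δ I.≈ X δ I.* X ζ -> X ζ I.* X ε I.≈ X ε I.* X ζ -> ∀ t -> x β (ι k) M.* x δ t M.≈
   ((x δ t M.* x ε (ι (k O.* N β δ ε) * t)) M.* x ζ (ι (k O.* k O.* halfN p q) * t)) M.* x β (ι k)
  conjugate-double-step {ε} {ζ} p q c1 c2 c3 t = transport (convolution-power first-two (divided ζ f) (commute-multiples {ζ} f both)) (I.congl C (I.sym (ιM-ℤ (X δ))) I.& ZC2.conj-two-steps p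
   q k I.& I.congr C (I.+-cong (I.+-cong (ιM-ℤ (X δ)) (I.%-cong (cong (k O.*_) (ι-ℤ (N β δ ε))) (ιM-ℤ (X ε)))) (I.%-cong (cong (k O.* k O.*_) (ι-ℤ (halfN p q))) (ιM-ℤ (X ζ))))) t M.& M.congr
   (x β (ι k)) (series-convolution {D = I.convolution (divPow δ) (D ε e)} {D ζ f} (DividedPowers.vanish first-two) (DividedPowers.vanish (divided ζ f)) t M.& M.*-cong (series-convolution {D
   = divPow δ} {D ε e} (DividedPowers.vanish (X-divided δ)) (DividedPowers.vanish (divided ε e)) t M.& M.congl (x δ t) (series-scale bound (divPow ε) e t)) (series-scale bound (divPow ζ) f
   t))
   where
   e = k O.* N β δ ε
   f = k O.* k O.* halfN p q
   first-two = convolution-power (X-divided δ) (divided ε e) (commute-multiples {ε} e c1)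
   both : X ζ I.* (X δ I.+ multiple ε e) I.≈ (X δ I.+ multiple ε e) I.* X ζ
   both = I.distribˡ (X ζ) (X δ) (multiple ε e) I.& I.+-cong c2 (I.solve (e :: []) (X ζ :: X ε :: []) (m0 :* (s0 :% m1)) (s0 :% (m0 :* m1)) I.& I.%-cong {r = e} rfl c3 I.& I.solve (e :: []) (X ζ
    :: X ε :: []) (s0 :% (m1 :* m0)) ((s0 :% m1) :* m0)) I.& I.sym (I.distribʳ (X ζ) (X δ) (multiple ε e))

 -- the reflection in γ maps x γ t to x -γ (-t)
 reflect : ∀ γ t -> Torus.w γ 1ᵘ M.* x γ t M.≈ x (-ᴿ γ) (- t) M.* Torus.w γ 1ᵘ
 reflect γ t = M.congr (x γ t) (M.sym w≈) M.& series-conjugate bound {divPow γ} {\ k -> (-[1+ 0 ] O.^ k) I.·ᴹ divPow (-ᴿ γ) k} {w} (D-conjugate (X-divided γ) (D-scale -[1+ 0 ] (X-divided (-ᴿ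
  γ))) reflected) t M.& M.*-cong (series-scale bound (divPow (-ᴿ γ)) -[1+ 0 ] t M.& x-cong (-ᴿ γ) (S.*-congʳ (S.-‿cong ι-1) S.& S.-1*x≈-x t)) w≈
  where
  w = Z.Torus.w γ Z.1ᵘ
  w≈ : ιM w M.≈ Torus.w γ 1ᵘ
  w≈ = ιM-* (Z.x γ (+ 1) I.* Z.x (-ᴿ γ) -[1+ 0 ]) (Z.x γ (+ 1)) M.& M.*-cong (ιM-* (Z.x γ (+ 1)) (Z.x (-ᴿ γ) -[1+ 0 ]) M.& M.*-cong (x-ι γ (+ 1) M.& x-cong γ ι-1) (x-ι (-ᴿ γ) -[1+ 0 ] M.&
   x-cong (-ᴿ γ) (S.-‿cong ι-1))) (x-ι γ (+ 1) M.& x-cong γ ι-1)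
  reflected : w I.* X γ I.≈ (-[1+ 0 ] I.·ᴹ X (-ᴿ γ)) I.* w
  reflected = I.congl w (I.sym (ιM-ℤ (X γ))) I.& Z.Torus.w-X γ Z.1ᵘ I.& (I.congr w \ i j -> J.trans (cong (\ z -> O.- (+ 1 O.* z)) (ιM-ℤ (X (-ᴿ γ)) i j)) (ℤs.solves (X (-ᴿ γ) i j :: []) (-: (1:
   *: s0)) ((-: 1:) *: s0)))

 -- Two Jacobi identities: the products of structure constants along a string
 string-product : ∀ {β δ ε} -> β ⊞ δ ≈ ε -> (-ᴿ β) ⊞ ε ≈ δ -> X (-ᴿ β) I.* X δ I.≈ X δ I.* X (-ᴿ β) -> ¬ (X δ I.≈ I.0#) -> N β δ ε O.* N (-ᴿ β) ε δ ≡ O.- hval β δ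
 string-product {β} {δ} {ε} p q comm X≉0 = coefficient (N β δ ε O.* N (-ᴿ β) ε δ) (O.- hval β δ) (I.solve (N β δ ε :: N (-ᴿ β) ε δ :: []) (X δ :: X ε :: X (-ᴿ β) :: []) ((s0 *: s1) :% m0) (s0 :%
  (m1 :* m2 :+ s1 :% m0) :- s0 :% (m1 :* m2)) I.& I.+-congʳ (I.%-cong {r = N β δ ε} rfl (I.sym (bracket-sum q))) I.& I.solve (N β δ ε :: []) (X δ :: X β :: X ε :: X (-ᴿ β) :: []) (s0 :% (m3 :*
  m2) :- s0 :% (m2 :* m3)) (m3 :* (m0 :* m1 :+ s0 :% m2) :- (m0 :* m1 :+ s0 :% m2) :* m3 :- (m3 :* m0 :* m1 :- m0 :* m1 :* m3)) I.& I.+-cong (I.+-cong (I.congl (X (-ᴿ β)) (I.sym (bracket-sum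
  p))) (I.-‿cong (I.congr (X (-ᴿ β)) (I.sym (bracket-sum p))))) (I.-‿cong (I.+-congʳ (I.congr (X β) comm))) I.& I.solve [] (X δ :: X β :: X (-ᴿ β) :: []) (m2 :* (m1 :* m0) :- m1 :* m0 :* m2 :-
  (m0 :* m2 :* m1 :- m0 :* m1 :* m2)) ((m2 :* m1) :* m0 :- m1 :* (m0 :* m2) :- m0 :* (m2 :* m1) :+ m0 :* (m1 :* m2)) I.& I.+-congʳ (I.+-congʳ (I.+-congˡ {x = X (-ᴿ β) I.* X β I.* X δ}
  (I.-‿cong (I.congl (X β) (I.sym comm))))) I.& (I.solve [] (X δ :: X β :: X (-ᴿ β) :: []) ((m2 :* m1) :* m0 :- m1 :* (m2 :* m0) :- m0 :* (m2 :* m1) :+ m0 :* (m1 :* m2)) ((m2 :* m1) :* m0 :-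
  (m1 :* m2) :* m0 :- m0 :* (m2 :* m1) :+ m0 :* (m1 :* m2)) I.& I.+-cong (I.+-congʳ (I.+-congˡ {x = X (-ᴿ β) I.* X β I.* X δ} (I.-‿cong (I.congr (X δ) (bracket-opposite β))))) (I.congl (X δ)
  (bracket-opposite β))) I.& I.solve [] (X δ :: X β :: X (-ᴿ β) :: H[ β ] :: []) ((m2 :* m1) :* m0 :- (m2 :* m1 :+ m3) :* m0 :- m0 :* (m2 :* m1) :+ m0 :* (m2 :* m1 :+ m3)) (m0 :* m3 :- m3 :* m0)
  I.& I.+-congˡ {x = X δ I.* H[ β ]} (I.-‿cong (bracket-cartan β δ)) I.& I.solve (hval β δ :: []) (X δ :: H[ β ] :: []) (m0 :* m1 :- (m0 :* m1 :+ s0 :% m0)) ((-: s0) :% m0))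
  where
  coefficient : ∀ c d -> c I.·ᴹ X δ I.≈ d I.·ᴹ X δ -> c ≡ d
  coefficient c d eq with c O.≟ d
  ... | yes r = r
  ... | no ¬r = contradiction (\ i j -> zero-entry (X δ i j) (eq i j)) X≉0
   where
   zero-entry : ∀ z -> c O.* z ≡ d O.* z -> z ≡ + 0
   zero-entry z e with O.i*j≡0⇒i≡0∨j≡0 (c O.- d) {z} (O.*-distribʳ-+ z c (O.- d) ⟫ cong₂ O._+_ e (J.sym (O.neg-distribˡ-* d z)) ⟫ O.+-inverseʳ (d O.* z))
   ... | inl p = contradiction (O.i-j≡0⇒i≡j c d p) ¬r
   ... | inr q = q

-- Diophantine sets

module DiophantineSets {c ℓ} (Γ : Group c ℓ) where
 open Group Γ
 open import Algebra.Properties.Group Γ using (x∙y⁻¹≈ε⇒x≈y; x≈y⇒x∙y⁻¹≈ε) public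

 rename : ∀ {m k} -> (Fin m -> Fin k) -> Word Γ m -> Word Γ k
 rename f (const g) = const g
 rename f (var i) = var (f i)
 rename f (v · w) = rename f v · rename f w
 rename f (w ′) = rename f w ′

 eval-rename : ∀ {m k} (f : Fin m -> Fin k) {ρ σ} -> (∀ i -> ρ (f i) ≡ σ i) -> ∀ w -> evalWord Γ ρ (rename f w) ≡ evalWord Γ σ w
 eval-rename f p (const g) = rfl
 eval-rename f p (var i) = p i
 eval-rename f p (v · w) = cong₂ _∙_ (eval-rename f p v) (eval-rename f p w)
 eval-rename f p (w ′) = cong _⁻¹ (eval-rename f p w)

 Solves : ∀ {m} -> (Fin m -> Carrier) -> List (Word Γ m) -> Set _
 Solves ρ = All (\ w -> evalWord Γ ρ w ≈ ε)

 private
  solves-rename : ∀ {m k} (f : Fin m -> Fin k) {ρ σ} -> (∀ i -> ρ (f i) ≡ σ i) -> ∀ {ws} -> (Solves ρ (map (rename f) ws) -> Solves σ ws) × (Solves σ ws -> Solves ρ (map (rename f) ws))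
  solves-rename f p {[]} = (\ _ -> []) , (\ _ -> [])
  solves-rename f p {w :: ws} = (\ { (q :: qs) -> trans (reflexive (J.sym (eval-rename f p w))) q :: fst (solves-rename f p) qs })
   , (\ { (q :: qs) -> trans (reflexive (eval-rename f p w)) q :: snd (solves-rename f p) qs })

  solves-++ : ∀ {m} {ρ : Fin m -> Carrier} {vs ws} -> Solves ρ vs -> Solves ρ ws -> Solves ρ (vs ++ ws)
  solves-++ [] qs = qs
  solves-++ (p :: ps) qs = p :: solves-++ ps qs

  split-++ : ∀ {m} {ρ : Fin m -> Carrier} vs {ws} -> Solves ρ (vs ++ ws) -> Solves ρ vs × Solves ρ ws
  split-++ [] qs = [] , qs
  split-++ (v :: vs) (p :: ps) = let (a , b) = split-++ vs ps in p :: a , b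

 triple : Carrier -> Carrier -> Carrier -> Fin 3 -> Carrier
 triple z x y 0F = z
 triple z x y 1F = x
 triple z x y 2F = y

 projection : ∀ {p q} {P : Carrier -> Set p} {Q : Carrier -> Set q} -> Diophantine Γ P -> Diophantine Γ Q -> (es : List (Word Γ 3)) -> Diophantine Γ (\ z -> ∃[ x ] ∃[ y ] P x × Q y × Solves (triple
  z x y) es)
 projection {P = P} {Q} (m , ws , P⇔) (k , vs , Q⇔) es = 2 N.+ (m N.+ k) , map (rename f) ws ++ (map (rename g) vs ++ map (rename e) es) ,
  \ z -> Function.Bundles.mk⇔
  (\ (x , y , Px , Qy , s) -> let (a , p) = Function.Bundles.Equivalence.to (P⇔ x) Px ; (b , q) = Function.Bundles.Equivalence.to (Q⇔ y) Qy in
  env x y a b , solves-++ (snd (solves-rename f (at-f z x y a b)) p) (solves-++ (snd (solves-rename g (at-g z x y a b)) q) (snd (solves-rename e (at-e z x y a b)) s)))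
  (\ (Y , s) -> let (s₁ , s') = split-++ (map (rename f) ws) s ; (s₂ , s₃) = split-++ (map (rename g) vs) s' in
  Y 0F , Y 1F , Function.Bundles.Equivalence.from (P⇔ (Y 0F)) ((\ i -> Y (F.suc (F.suc (i ↑ˡ k)))) , fst (solves-rename f (\ { F.zero -> rfl ; (F.suc i) -> rfl })) s₁)
  , Function.Bundles.Equivalence.from (Q⇔ (Y 1F)) ((\ j -> Y (F.suc (F.suc (m ↑ʳ j)))) , fst (solves-rename g (\ { F.zero -> rfl ; (F.suc i) -> rfl })) s₂)
  , fst (solves-rename e (\ { 0F -> rfl ; 1F -> rfl ; 2F -> rfl })) s₃)
  where
  f : Fin (suc m) -> Fin (3 N.+ (m N.+ k))
  f F.zero = 1F
  f (F.suc i) = F.suc (F.suc (F.suc (i ↑ˡ k)))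
  g : Fin (suc k) -> Fin (3 N.+ (m N.+ k))
  g F.zero = 2F
  g (F.suc j) = F.suc (F.suc (F.suc (m ↑ʳ j)))
  e : Fin 3 -> Fin (3 N.+ (m N.+ k))
  e 0F = 0F
  e 1F = 1F
  e 2F = 2F
  env : Carrier -> Carrier -> (Fin m -> Carrier) -> (Fin k -> Carrier) -> Fin (2 N.+ (m N.+ k)) -> Carrier
  env x y a b F.zero = x
  env x y a b (F.suc F.zero) = y
  env x y a b (F.suc (F.suc i)) = Data.Sum.Base.[ a , b ]′ (splitAt m i)
  module _ (z x y : Carrier) (a : Fin m -> Carrier) (b : Fin k -> Carrier) where
   at-f : ∀ i -> (z Data.Vec.Functional.∷ env x y a b) (f i) ≡ (x Data.Vec.Functional.∷ a) i
   at-f F.zero = rfl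
   at-f (F.suc i) = cong Data.Sum.Base.[ a , b ]′ (F.splitAt-↑ˡ m i k)
   at-g : ∀ i -> (z Data.Vec.Functional.∷ env x y a b) (g i) ≡ (y Data.Vec.Functional.∷ b) i
   at-g F.zero = rfl
   at-g (F.suc i) = cong Data.Sum.Base.[ a , b ]′ (F.splitAt-↑ʳ m k i)
   at-e : ∀ i -> (z Data.Vec.Functional.∷ env x y a b) (e i) ≡ triple z x y i
   at-e 0F = rfl
   at-e 1F = rfl
   at-e 2F = rfl

 transport : ∀ {p q} {P : Carrier -> Set p} {Q : Carrier -> Set q} -> (∀ x -> P x -> Q x) -> (∀ x -> Q x -> P x) -> Diophantine Γ P -> Diophantine Γ Q
 transport to from (m , ws , P⇔) = m , ws , \ x -> Function.Bundles.mk⇔ (\ q -> Function.Bundles.Equivalence.to (P⇔ x) (from x q)) (\ s -> to x (Function.Bundles.Equivalence.from (P⇔ x) s))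

 image : ∀ {p q} {P : Carrier -> Set p} {Q : Carrier -> Set q} -> Diophantine Γ P -> Diophantine Γ Q -> (w : Word Γ 3) -> Diophantine Γ (\ z -> ∃[ x ] ∃[ y ] P x × Q y × z ≈ evalWord Γ (triple z x
  y) w)
 image P Q w = transport (\ z -> \ { (x , y , p , q , e :: []) -> x , y , p , q , x∙y⁻¹≈ε⇒x≈y _ _ e })
  (\ z -> \ (x , y , p , q , e) -> x , y , p , q , x≈y⇒x∙y⁻¹≈ε e :: []) (projection P Q ((var 0F · (w ′)) :: []))

 intersection : ∀ {p q} {P : Carrier -> Set p} {Q : Carrier -> Set q} -> (∀ {x y} -> x ≈ y -> P x -> P y) -> (∀ {x y} -> x ≈ y -> Q x -> Q y) -> Diophantine Γ P -> Diophantine Γ Q -> Diophantine Γ (\ z ->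
  P z × Q z)
 intersection P-resp Q-resp P Q = transport (\ z -> \ { (x , y , p , q , e :: e' :: []) -> P-resp (sym (x∙y⁻¹≈ε⇒x≈y _ _ e)) p , Q-resp (sym (x∙y⁻¹≈ε⇒x≈y _ _ e')) q })
  (\ z -> \ (p , q) -> z , z , p , q , inverseʳ z :: inverseʳ z :: []) (projection P Q ((var 0F · (var 1F ′)) :: (var 0F · (var 2F ′)) :: []))

ℚ-isℚ : IsℚAlgebra ℚ-ring
ℚ-isℚ = record { ι-inverse = \ k -> inverse _ (positive k) ; nontrivial = \ () }
 where
 open Matrices ℚ-ring using (ι)
 positive : ∀ k -> Q.0ℚ Q.< ι (+ suc k)
 positive zero = toWitness {a? = Q.0ℚ Q.<? ι (+ 1)} tt
 positive (suc k) = Q.+-mono-< {Q.0ℚ} {Q.1ℚ} {Q.0ℚ} {ι (+ suc k)} (toWitness {a? = Q.0ℚ Q.<? Q.1ℚ} tt) (positive k)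
 inverse : ∀ q -> Q.0ℚ Q.< q -> ∃[ u ] q Q.* u ≡ Q.1ℚ
 inverse q p = Q.1/_ q {{q≢0}} , Q.*-inverseʳ q {{q≢0}}
  where
  q≢0 : Q.NonZero q
  q≢0 = Q.>-nonZero p

module RootSubgroupsDiophantine {c ℓ p} {R : CommutativeRing c ℓ} {n} {π : Representation n} (G : LargeSubgroup R π p) where
 open RootSubgroups R π
 open RootConjugation R π
 open Coordinates ℚ-isℚ π using (φ; κ)
 open Rows R ℚ-isℚ π using (φ-X; κ-X; step-κ)
 open Trace R
 open LieSpan R π using (Lie; basis; conjugate; Lie-conjugate)
 open Primitivity π using (N-unit; X≉0)
 open DoubleStrings π
 open Commutators R π
 open Centralizers ℚ-isℚ π R
 open Matrices R using (ι; Invertible; invertible; mat; mat⁻¹; invˡ; invʳ)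
 open S using (_≈_; _+_; _*_; -_; 0#; 1#; Carrier)
 private
  module G = LargeSubgroup G
  Γ = G.group
  module Γ = Group Γ
 open DiophantineSets Γ

 invertible-x : Root -> Carrier -> Invertible n
 invertible-x γ t = invertible (x γ t) (x γ (- t)) (x-inverse γ (S.-‿inverseˡ t)) (x-inverse γ (S.-‿inverseʳ t))

 element : Root -> Carrier -> Γ.Carrier
 element γ t = invertible-x γ t , G.Elementary⊆ (gen (γ , t , x≈rootElement γ t))

 ⟦_⟧ : Γ.Carrier -> M.Mat n
 ⟦ g ⟧ = mat (fst g)

 X⟨_⟩ : Root -> Γ.Carrier -> Set _
 X⟨ γ ⟩ g = ∃[ t ] ⟦ g ⟧ M.≈ x γ t

 private
  -x : ∀ {g γ t} -> ⟦ g ⟧ M.≈ x γ t -> mat⁻¹ (fst g) M.≈ x γ (- t)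
  -x {g} {γ} {t} q = Group.⁻¹-cong (Matrices.GL R n) {fst g} {invertible-x γ t} q

  merge : ∀ γ s t {A} -> (x γ s M.* (x γ t M.* A)) M.≈ x γ (s + t) M.* A
  merge γ s t {A} = M.sym (M.*-assoc (x γ s) (x γ t) A) M.& M.congr A (M.sym (x-+ γ s t))

  ι-sign : ∀ {u} -> u O.* u ≡ + 1 -> ∀ t -> ι u * (ι u * t) ≈ t
  ι-sign {u} p t = S.sym (S.*-assoc _ _ _) S.& S.*-congʳ (S.sym (ι-* u u) S.& ι-cong p S.& ι-1) S.& S.*-identityˡ t

  X-commute : ∀ β δ -> {False (δ ≟R (-ᴿ β))} -> {False (any-root? \ ε -> β ⊞ δ ≟ ε)} -> X β I.* X δ I.≈ X δ I.* X β
  X-commute β δ {f} {g} = bracket-zero (toWitnessFalse f) (no-sum β δ {g})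

 Centralizes : Γ.Carrier -> Set _
 Centralizes g = ∀ β -> Special β -> ⟦ g ⟧ M.* x β 1# M.≈ x β 1# M.* ⟦ g ⟧

 private
  central : ∀ g -> Centralizes g -> Central (fst g)
  central g c = record { point = G.⊆Chevalley (snd g) ; commutes = \ {β} -> c β }

  centralizes-x : ∀ {g t} -> ⟦ g ⟧ M.≈ x qr t -> Centralizes g
  centralizes-x {g} {t} p β s = M.congr (x β 1#) p M.& x-commute (commute-X s) t 1# M.& M.congl (x β 1#) (M.sym p)
   where
   commute-X : ∀ {β} -> Special β -> X qr I.* X β I.≈ X β I.* X qr
   commute-X (inl rfl) = X-commute qr qr
   commute-X (inr (inl rfl)) = X-commute qr br
   commute-X (inr (inr (inl rfl))) = X-commute qr (-ᴿ br)
   commute-X (inr (inr (inr (inl rfl)))) = X-commute qr ar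
   commute-X (inr (inr (inr (inr rfl)))) = X-commute qr pr

  central-x : ∀ t -> Central (fst (element qr t))
  central-x t = central (element qr t) (centralizes-x {element qr t} M.refl)

  same-coordinate : ∀ g (c : Centralizes g) -> coordinate (central g c) ≈ coordinate (central-x (coordinate (central g c)))
  same-coordinate g c = S.sym (coordinate-x (central-x (coordinate (central g c))) M.refl)

 centralizer-Diophantine : Diophantine Γ Centralizes
 centralizer-Diophantine = 0 , word qr :: word br :: word (-ᴿ br) :: word ar :: word pr :: [] , \ g -> Function.Bundles.mk⇔
  (\ c -> (\ ()) , to g qr (c _ (inl rfl)) :: to g br (c _ (inr (inl rfl))) :: to g (-ᴿ br) (c _ (inr (inr (inl rfl))))
  :: to g ar (c _ (inr (inr (inr (inl rfl))))) :: to g pr (c _ (inr (inr (inr (inr rfl))))) :: [])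
  (\ { (_ , e1 :: e2 :: e3 :: e4 :: e5 :: []) -> \ β -> \
  { (inl rfl) -> from g qr e1 ; (inr (inl rfl)) -> from g br e2 ; (inr (inr (inl rfl))) -> from g (-ᴿ br) e3
  ; (inr (inr (inr (inl rfl)))) -> from g ar e4 ; (inr (inr (inr (inr rfl)))) -> from g pr e5 } })
  where
  word : Root -> Word Γ 1
  word β = (var 0F · const (element β 1#)) · ((const (element β 1#) · var 0F) ′)
  to : ∀ g β -> g Γ.∙ element β 1# Γ.≈ element β 1# Γ.∙ g -> (g Γ.∙ element β 1#) Γ.∙ (element β 1# Γ.∙ g) Γ.⁻¹ Γ.≈ Γ.ε
  to g β = x≈y⇒x∙y⁻¹≈ε {g Γ.∙ element β 1#} {element β 1# Γ.∙ g}
  from : ∀ g β -> (g Γ.∙ element β 1#) Γ.∙ (element β 1# Γ.∙ g) Γ.⁻¹ Γ.≈ Γ.ε -> g Γ.∙ element β 1# Γ.≈ element β 1# Γ.∙ g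
  from g β = x∙y⁻¹≈ε⇒x≈y (g Γ.∙ element β 1#) (element β 1# Γ.∙ g)

 by-conjugation : ∀ {γ δ} (w : Γ.Carrier) (f f⁻ : Carrier -> Carrier) -> (∀ t -> ⟦ w ⟧ M.* x γ t M.≈ x δ (f t) M.* ⟦ w ⟧) -> (∀ t -> f (f⁻ t) ≈ t) -> Diophantine Γ X⟨ γ ⟩ -> Diophantine Γ X⟨ δ ⟩
 by-conjugation {γ} {δ} w f f⁻ conj inverse D = transport (\ z -> \ (y , _ , (t , p) , _ , e) -> f t , M.trans e (conjugated {y} p)) (\ z -> \ (t , p) -> element γ (f⁻ t) , element γ (f⁻ t) ,
  (f⁻ t , M.refl) , (f⁻ t , M.refl) , M.trans p (x-cong δ (S.sym (inverse t)) M.& M.sym (conjugated {element γ (f⁻ t)} M.refl))) (image D D ((const w · var 1F) · (const w ′)))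
  where
  conjugated : ∀ {y t} -> ⟦ y ⟧ M.≈ x γ t -> (⟦ w ⟧ M.* ⟦ y ⟧) M.* mat⁻¹ (fst w) M.≈ x δ (f t)
  conjugated {y} {t} p = M.congr (mat⁻¹ (fst w)) (M.congl (⟦ w ⟧) p M.& conj t) M.& M.*-assoc (x δ (f t)) ⟦ w ⟧ (mat⁻¹ (fst w)) M.& M.congl (x δ (f t)) (invʳ (fst w)) M.& M.*-identityʳ
   (x δ (f t))

 by-reflection : ∀ γ -> Diophantine Γ X⟨ γ ⟩ -> Diophantine Γ X⟨ -ᴿ γ ⟩
 by-reflection γ = by-conjugation ((element γ 1# Γ.∙ element (-ᴿ γ) (- 1#)) Γ.∙ element γ 1#) (\ t -> - t) (\ t -> - t) (reflect γ) S.-‿involutive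

 commutator : ∀ {β δ ε ζ} (p : β ⊞ δ ≈ ε) (q : β ⊞ ε ≈ ζ) -> X ε I.* X δ I.≈ X δ I.* X ε -> X ζ I.* X δ I.≈ X δ I.* X ζ -> X ζ I.* X ε I.≈ X ε I.* X ζ -> ∀ k s -> ((x δ s M.* x β (ι k)) M.* x δ
  (- s)) M.* x β (- ι k) M.≈ x ε (ι (k O.* N β δ ε) * - s) M.* x ζ (ι (k O.* k O.* halfN p q) * - s)
 commutator {β} {δ} {ε} {ζ} p q c1 c2 c3 k s = M.solve [] (x δ s :: x β (ι k) :: x δ (- s) :: x β (- ι k) :: []) (m0 :* m1 :* m2 :* m3) (m0 :* ((m1 :* m2) :* m3)) M.& M.congl (x δ s) (M.congr (x
  β (- ι k)) (conjugate-double-step k p q c1 c2 c3 (- s))) M.& M.solve [] (x δ s :: x δ (- s) :: e :: f :: x β (ι k) :: x β (- ι k) :: []) (m0 :* (((m1 :* m2 :* m3) :* m4) :* m5)) ((m0 :* m1) :*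
  (m2 :* m3) :* (m4 :* m5)) M.& M.*-cong (M.congr (e M.* f) (x-inverse δ (S.-‿inverseʳ s))) (x-inverse β (S.-‿inverseʳ (ι k))) M.& M.solve [] (e :: f :: []) (:1 :* (m0 :* m1) :* :1) (m0 :* m1)
  where
  e = x ε (ι (k O.* N β δ ε) * - s)
  f = x ζ (ι (k O.* k O.* halfN p q) * - s)

 private
  -a+q≈p : (-ᴿ ar) ⊞ qr ≈ pr
  -a+q≈p = ⟨ rfl , rfl ⟩
  -a+p≈b : (-ᴿ ar) ⊞ pr ≈ br
  -a+p≈b = ⟨ rfl , rfl ⟩
  a+b≈p : ar ⊞ br ≈ pr
  a+b≈p = ⟨ rfl , rfl ⟩
  a+p≈q : ar ⊞ pr ≈ qr
  a+p≈q = ⟨ rfl , rfl ⟩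

  N1 N2 N3 N4 H1 H2 : ℤ
  N1 = N (-ᴿ ar) qr pr
  N2 = N ar pr qr
  N3 = N ar br pr
  N4 = N (-ᴿ ar) pr br
  H1 = halfN -a+q≈p -a+p≈b
  H2 = halfN a+b≈p a+p≈q

  halve : ∀ {i j} -> + 2 O.* i ≡ + 2 O.* j -> i ≡ j
  halve = O.*-cancelˡ-≡ (+ 2) _ _

  N1N2 : N1 O.* N2 ≡ + 2
  N1N2 = string-product -a+q≈p a+p≈q (X-commute ar qr) (X≉0 qr) ⟫ cong O.-_ (hval≡ (-ᴿ ar) qr)
  N3N4 : N3 O.* N4 ≡ + 2
  N3N4 = string-product a+b≈p -a+p≈b (X-commute (-ᴿ ar) br) (X≉0 br) ⟫ cong O.-_ (hval≡ ar br)
  double : ∀ z -> + 2 O.* z ≡ z O.+ z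
  double z = ℤs.solves (z :: []) ((1: +: 1:) *: s0) (s0 +: s0)
  2H₁ : + 2 O.* H1 ≡ N1 O.* N4
  2H₁ = double H1 ⟫ J.sym (halfN-double -a+q≈p -a+p≈b)
  2H₂ : + 2 O.* H2 ≡ N3 O.* N2
  2H₂ = double H2 ⟫ J.sym (halfN-double a+b≈p a+p≈q)
  N3H1 : N3 O.* H1 ≡ N1
  N3H1 = halve (ℤs.solves (N3 :: H1 :: []) ((1: +: 1:) *: (s0 *: s1)) (s0 *: ((1: +: 1:) *: s1)) ⟫ cong (N3 O.*_) 2H₁ ⟫ ℤs.solves (N3 :: N1 :: N4 :: []) (s0 *: (s1 *: s2)) (s0 *: s2 *: s1) ⟫ cong
   (O._* N1) N3N4)
  H1H2 : H1 O.* H2 ≡ + 1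
  H1H2 = halve (halve (ℤs.solves (H1 :: H2 :: []) ((1: +: 1:) *: ((1: +: 1:) *: (s0 *: s1))) ((1: +: 1:) *: s0 *: ((1: +: 1:) *: s1)) ⟫ cong₂ O._*_ 2H₁ 2H₂ ⟫ ℤs.solves (N1 :: N2 :: N3 :: N4 :: [])
   (s0 *: s3 *: (s2 *: s1)) (s0 *: s1 *: (s2 *: s3)) ⟫ cong₂ O._*_ N1N2 N3N4))
  H12 : H1 O.* H1 ≡ + 1
  H12 = halfN-unit -a+q≈p -a+p≈b rfl

  weyl : Γ.Carrier
  weyl = element ar (ι (+ 1)) Γ.∙ element (-ᴿ ar) (ι -[1+ 0 ])

  -- x_a(1) x_{-a}(-1) maps x q t to x b (± t): the components in x p and x q cancel
  -- by the Jacobi identities.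
  weyl-q : ∀ t -> ⟦ weyl ⟧ M.* x qr t M.≈ x br (ι H1 * t) M.* ⟦ weyl ⟧
  weyl-q t = begin
   (A M.* B) M.* x qr t
   ≈⟨ M.trans (M.*-assoc A B (x qr t)) (M.congl A (conjugate-double-step -[1+ 0 ] -a+q≈p -a+p≈b (X-commute pr qr) (X-commute br qr) (X-commute br pr) t)) ⟩
   A M.* (((x qr t M.* P) M.* F) M.* B)
   ≈⟨ M.trans (M.solve [] (A :: x qr t :: P :: F :: B :: []) (m0 :* (((m1 :* m2) :* m3) :* m4)) ((m0 :* m1) :* (m2 :* (m3 :* m4))))
   (M.congr (P M.* (F M.* B)) (x-commute (X-commute ar qr) (ι (+ 1)) t)) ⟩
   (x qr t M.* A) M.* (P M.* (F M.* B))
   ≈⟨ M.trans (M.solve [] (A :: x qr t :: P :: F :: B :: []) ((m1 :* m0) :* (m2 :* (m3 :* m4))) (m1 :* ((m0 :* m2) :* (m3 :* m4))))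
   (M.congl (x qr t) (M.congr (F M.* B) (conjugate-single-step (+ 1) a+p≈q (no-sum ar qr) (X-commute qr pr) e))) ⟩
   x qr t M.* (((P M.* Q1) M.* A) M.* (F M.* B))
   ≈⟨ M.trans (M.solve [] (A :: x qr t :: P :: Q1 :: F :: B :: []) (m1 :* (((m2 :* m3) :* m0) :* (m4 :* m5))) (m1 :* (m2 :* (m3 :* ((m0 :* m4) :* m5)))))
   (M.congl (x qr t) (M.congl P (M.congl Q1 (M.congr B (conjugate-double-step (+ 1) a+b≈p a+p≈q (X-commute pr br) (X-commute qr br) (X-commute qr pr) f))))) ⟩
   x qr t M.* (P M.* (Q1 M.* ((((F M.* P2) M.* Q2) M.* A) M.* B)))
   ≈⟨ M.solve [] (A :: x qr t :: P :: Q1 :: F :: P2 :: Q2 :: B :: []) (m1 :* (m2 :* (m3 :* ((((m4 :* m5) :* m6) :* m0) :* m7)))) ((m1 :* (m2 :* (m3 :* (m4 :* (m5 :* m6))))) :* (m0 :* m7)) ⟩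
   (x qr t M.* (P M.* (Q1 M.* (F M.* (P2 M.* Q2))))) M.* (A M.* B)
   ≈⟨ M.congr (A M.* B) collect ⟩
   x br (ι H1 * t) M.* (A M.* B) ∎
   where
   open Reasoning (M.setoid {n})
   e = ι (-[1+ 0 ] O.* N1) * t
   f = ι (-[1+ 0 ] O.* -[1+ 0 ] O.* H1) * t
   A = x ar (ι (+ 1))
   B = x (-ᴿ ar) (ι -[1+ 0 ])
   P = x pr e
   F = x br f
   Q1 = x qr (ι (+ 1 O.* N2) * e)
   P2 = x pr (ι (+ 1 O.* N3) * f)
   Q2 = x qr (ι (+ 1 O.* + 1 O.* H2) * f)
   n1 = ι N1
   n2 = ι N2
   n₃ = ι N3
   h1 = ι H1
   h2 = ι H2
   minus : ∀ z -> ι (-[1+ 0 ] O.* z) ≈ - ι z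
   minus z = ι-cong (O.-1*i≡-i z) S.& ι-neg z
   f≈ : f ≈ h1 * t
   f≈ = S.*-congʳ (ι-cong (O.*-identityˡ H1))
   p≈0 : e + ι (+ 1 O.* N3) * f ≈ 0#
   p≈0 = S.+-cong (S.*-congʳ (minus N1 S.& S.-‿cong (ι-cong (J.sym N3H1) S.& ι-* N3 H1))) (S.*-cong (ι-cong (O.*-identityˡ N3)) f≈) S.& solves (n₃ :: h1 :: t :: []) ((-: (s0 *: s1)) *: s2 +: s0
    *: (s1 *: s2)) 0:
   q≈0 : t + (ι (+ 1 O.* N2) * e + ι (+ 1 O.* + 1 O.* H2) * f) ≈ 0#
   q≈0 = S.+-congˡ (S.+-cong (S.*-cong (ι-cong (O.*-identityˡ N2)) (S.*-congʳ (minus N1))) (S.*-cong (ι-cong (O.*-identityˡ H2)) f≈)) S.& solves (t :: n1 :: n2 :: h1 :: h2 :: []) (s0 +: (s2 *: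
    ((-: s1) *: s0) +: s4 *: (s3 *: s0))) (s0 *: (1: -: s1 *: s2 +: s3 *: s4)) S.& S.*-congˡ (S.+-cong (S.+-congˡ (S.-‿cong (S.sym (ι-* N1 N2) S.& ι-cong N1N2))) (S.sym (ι-* H1 H2) S.&
    ι-cong H1H2)) S.& solves (t :: []) (s0 *: (1: -: (1: +: (1: +: 0:)) +: (1: +: 0:))) 0:
   swap : ∀ {C D E : M.Mat n} -> C M.* D M.≈ D M.* C -> C M.* (D M.* E) M.≈ D M.* (C M.* E)
   swap {C} {D} {E} p = M.sym (M.*-assoc C D E) M.& M.congr E p M.& M.*-assoc D C E
   collect : x qr t M.* (P M.* (Q1 M.* (F M.* (P2 M.* Q2)))) M.≈ x br (ι H1 * t)
   collect = M.congl (x qr t) (M.congl P (swap {Q1} {F} (x-commute (X-commute qr br) _ f) M.& M.congl F (swap {Q1} {P2} (x-commute (X-commute qr pr) _ _) M.& M.congl P2 (M.sym (x-+ qr _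
    _))))) M.& M.congl (x qr t) (swap {P} {F} (x-commute (X-commute pr br) e f) M.& M.congl F (merge pr e _ M.& M.congr (x qr _) (x-cong pr p≈0 M.& x-0 pr) M.& M.*-identityˡ (x qr _))) M.&
    swap {x qr t} {F} (x-commute (X-commute qr br) t f) M.& M.congl F (M.sym (x-+ qr t _) M.& x-cong qr q≈0 M.& x-0 qr) M.& M.*-identityʳ F M.& x-cong br f≈

 q⇒b : Diophantine Γ X⟨ qr ⟩ -> Diophantine Γ X⟨ br ⟩
 q⇒b = by-conjugation weyl (ι H1 *_) (ι H1 *_) weyl-q (ι-sign {H1} H12)

 b⇒q : Diophantine Γ X⟨ br ⟩ -> Diophantine Γ X⟨ qr ⟩
 b⇒q = by-conjugation (weyl Γ.⁻¹) (ι H1 *_) (ι H1 *_) (\ t -> let w~ = mat⁻¹ (fst weyl) ; s = ι H1 * t in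
  M.trans (M.congl w~ (M.trans (x-cong br (S.sym (ι-sign {H1} H12 t))) (M.trans (M.sym (M.*-identityʳ _)) (M.congl (x br (ι H1 * s)) (M.sym (invʳ (fst weyl)))))))
  (M.trans (M.solve [] (w~ :: x br (ι H1 * s) :: ⟦ weyl ⟧ :: []) (m0 :* (m1 :* (m2 :* m0))) (m0 :* (m1 :* m2) :* m0))
  (M.trans (M.congr w~ (M.congl w~ (M.sym (weyl-q s))))
  (M.trans (M.solve [] (w~ :: x qr s :: ⟦ weyl ⟧ :: []) (m0 :* (m2 :* m1) :* m0) ((m0 :* m2) :* (m1 :* m0)))
  (M.trans (M.congr (x qr s M.* w~) (invˡ (fst weyl))) (M.*-identityˡ (x qr s M.* w~)))))))
  (ι-sign {H1} H12)

 adjoint-q : IsAdjoint π -> Diophantine Γ X⟨ qr ⟩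
 adjoint-q adjoint = transport (\ g c -> _ , central-equal (central g c) (central-x _) (same-coordinate g c) adjoint) (\ g (t , p) -> centralizes-x {g} p) centralizer-Diophantine

 private
  c+ c~ : Γ.Carrier
  c+ = element (-ᴿ ar) (ι (+ 1))
  c~ = element (-ᴿ ar) (ι -[1+ 0 ])

  commutator-value : ∀ g (c : Centralizes g) k -> ((⟦ g ⟧ M.* x (-ᴿ ar) (ι k)) M.* mat⁻¹ (fst g)) M.* x (-ᴿ ar) (- ι k) M.≈ x pr (ι (k O.* N1) * - coordinate (central g c)) M.* x br (ι (k
   O.* k O.* H1) * - coordinate (central g c))
  commutator-value g c k = M.congr (x (-ᴿ ar) (- ι k)) (M.*-assoc ⟦ g ⟧ (x (-ᴿ ar) (ι k)) (mat⁻¹ (fst g)) M.& central-conjugates-equal (central g c) (central-x t) (same-coordinate g c) (-ᴿ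
   ar) k M.& M.sym (M.*-assoc (x qr t) (x (-ᴿ ar) (ι k)) (x qr (- t)))) M.& commutator -a+q≈p -a+p≈b (X-commute pr qr) (X-commute br qr) (X-commute br pr) k t
   where t = coordinate (central g c)

  twice : ∀ g (c : Centralizes g) -> ((((⟦ g ⟧ M.* x (-ᴿ ar) (ι (+ 1))) M.* mat⁻¹ (fst g)) M.* x (-ᴿ ar) (- ι (+ 1))) M.* (((⟦ g ⟧ M.* x (-ᴿ ar) (ι -[1+ 0 ])) M.* mat⁻¹ (fst g)) M.* x (-ᴿ
   ar) (- ι -[1+ 0 ]))) M.≈ x br (- ((1# + 1#) * (ι H1 * coordinate (central g c))))
  twice g c = M.*-cong (commutator-value g c (+ 1)) (commutator-value g c -[1+ 0 ]) M.& M.solve [] (P1 :: B1 :: P2 :: B2 :: []) ((m0 :* m1) :* (m2 :* m3)) (m0 :* (m1 :* m2) :* m3) M.& M.congr B2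
   (M.congl P1 (x-commute (X-commute br pr) _ _)) M.& M.solve [] (P1 :: B1 :: P2 :: B2 :: []) (m0 :* (m2 :* m1) :* m3) ((m0 :* m2) :* (m1 :* m3)) M.& M.*-cong (x-inverse pr (S.+-cong (S.*-congʳ
   (ι-cong (O.*-identityˡ N1))) (S.*-congʳ (ι-cong (O.-1*i≡-i N1) S.& ι-neg N1)) S.& solves (ι N1 :: t :: []) (s0 *: -: s1 +: (-: s0) *: -: s1) 0:)) (M.sym (x-+ br _ _)) M.& M.*-identityˡ (x
   br (b1 + b2)) M.& x-cong br (S.+-cong (S.*-congʳ (ι-cong (O.*-identityˡ H1))) (S.*-congʳ (ι-cong (O.*-identityˡ H1))) S.& solves (ι H1 :: t :: []) (s0 *: -: s1 +: s0 *: -: s1) (-: ((1: +: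
   1:) *: (s0 *: s1))))
   where
   t = coordinate (central g c)
   b1 = ι (+ 1 O.* + 1 O.* H1) * - t
   b2 = ι (-[1+ 0 ] O.* -[1+ 0 ] O.* H1) * - t
   P1 = x pr (ι (+ 1 O.* N1) * - t)
   P2 = x pr (ι (-[1+ 0 ] O.* N1) * - t)
   B1 = x br b1
   B2 = x br b2

 half-b : TwoInvertible R -> Diophantine Γ X⟨ br ⟩
 half-b (u , 2u≈1) = transport (\ z -> \ (g , _ , c , _ , e) -> _ , M.trans e (twice g c))
  (\ z -> \ (s , p) -> let g = element qr (- (u * (ι H1 * s))) ; c = centralizes-x {g} M.refl in g , g , c , c
  , M.trans p (M.trans (x-cong br (S.sym (value s (S.trans (coordinate-x (central g c) M.refl) S.refl)))) (M.sym (twice g c))))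
  (image centralizer-Diophantine centralizer-Diophantine (word c+ · word c~))
  where
  word : Γ.Carrier -> Word Γ 3
  word c = ((var 1F · const c) · (var 1F ′)) · (const c ′)
  value : ∀ s {t} -> t ≈ - (u * (ι H1 * s)) -> - ((1# + 1#) * (ι H1 * t)) ≈ s
  value s p = S.-‿cong (S.*-congˡ (S.*-congˡ p)) S.& solves (u :: ι H1 :: s :: []) (-: ((1: +: 1:) *: (s1 *: -: (s0 *: (s1 *: s2))))) ((1: +: 1:) *: s0 *: (s1 *: (s1 *: s2))) S.& S.*-cong 2u≈1
   (ι-sign {H1} H12 s) S.& S.*-identityˡ s

 -- The short root s ⋅ p is half the sum of q and of s ⋅ b, and X (s p) is cut out from
 -- X (s p) X q and X (s p) X (s b), which consist of commutators up to a factor.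
 module ShortRoot (β α δ : Root) (p1 : α ⊞ δ ≈ β) (p2 : α ⊞ β ≈ qr) (m₁ : (-ᴿ α) ⊞ qr ≈ β) (m₂ : (-ᴿ α) ⊞ β ≈ δ)
  (βδ : X β I.* X δ I.≈ X δ I.* X β) (qδ : X qr I.* X δ I.≈ X δ I.* X qr) (qβ : X qr I.* X β I.≈ X β I.* X qr)
  (chain : chainLength α δ ≡ 0) (chain~ : chainLength (-ᴿ α) qr ≡ 0)
  (α-q : pairing qr α ≡ + 1) (α-β : pairing β α ≡ + 0) (δ≢q : (-ᴿ δ) ≢ (-ᴿ qr)) where

  private
   Independent : ∀ r s r' s' -> x β r M.* x qr s M.≈ x β r' M.* x δ s' -> s ≈ 0#
   Independent r s r' s' p = S.sym left S.& ⟪⟫-cong (κ α) same S.& right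
    where
    B = XR (-ᴿ qr)
    lie : Lie B
    lie = basis (root (-ᴿ qr))
    conjugates : ∀ ε ζ r s -> conjugate ε r (conjugate ζ s B) M.* (x ε r M.* x ζ s) M.≈ (x ε r M.* x ζ s) M.* B
    conjugates ε ζ r s = M.solve [] (x ε r :: x ζ s :: x ε (- r) :: x ζ (- s) :: B :: []) ((m0 :* (m1 :* (m4 :* m3) :* m2)) :* (m0 :* m1)) ((m0 :* m1 :* m4) :* (m3 :* (m2 :* m0) :* m1)) M.&
     M.congl (x ε r M.* x ζ s M.* B) (M.congr (x ζ s) (M.congl (x ζ (- s)) (x-inverse ε (S.-‿inverseˡ r)) M.& M.*-identityʳ (x ζ (- s))) M.& x-inverse ζ (S.-‿inverseˡ s)) M.& M.*-identityʳ
     (x ε r M.* x ζ s M.* B)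
    h = x β r M.* x qr s
    h~ = x qr (- s) M.* x β (- r)
    hh~ : h M.* h~ M.≈ M.1#
    hh~ = M.solve [] (x β r :: x qr s :: x qr (- s) :: x β (- r) :: []) ((m0 :* m1) :* (m2 :* m3)) (m0 :* (m1 :* m2) :* m3) M.& M.congr (x β (- r)) (M.congl (x β r) (x-inverse qr (S.-‿inverseʳ
     s)) M.& M.*-identityʳ (x β r)) M.& x-inverse β (S.-‿inverseʳ r)
    Y1 = conjugate β r (conjugate qr s B)
    Y2 = conjugate β r' (conjugate δ s' B)
    same : Y1 M.≈ Y2
    same = M.sym (M.*-identityʳ Y1) M.& M.congl Y1 (M.sym hh~) M.& M.sym (M.*-assoc Y1 h h~) M.& M.congr h~ (conjugates β qr r s M.& M.congr B p M.& M.sym (conjugates β δ r' s') M.& M.congl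
     Y2 (M.sym p)) M.& M.*-assoc Y2 h h~ M.& M.congl Y2 hh~ M.& M.*-identityʳ Y2
    β-step : ∀ t {A} -> Lie A -> ⟪ κ α , conjugate β t A ⟫ ≈ ⟪ κ α , A ⟫
    β-step t {A} l = step-κ l β α t S.& S.+-congˡ (S.*-congˡ (S.*-congʳ (ι-cong (hval≡ β α ⟫ α-β)) S.& S.zeroˡ _) S.& S.zeroʳ t) S.& S.+-identityʳ _
    left : ⟪ κ α , Y1 ⟫ ≈ s
    left = β-step r (Lie-conjugate qr s lie) S.& step-κ lie qr α s S.& S.+-cong (κ-X α (-ᴿ qr)) (S.*-congˡ (S.*-cong (ι-cong (hval≡ qr α ⟫ α-q) S.& ι-1) (φ-X (-ᴿ qr) (-ᴿ qr) S.& ι-cong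
     (indicator-self (-ᴿ qr)) S.& ι-1))) S.& solves (s :: []) (0: +: s0 *: (1: *: 1:)) (s0)
    right : ⟪ κ α , Y2 ⟫ ≈ 0#
    right = β-step r' (Lie-conjugate δ s' lie) S.& step-κ lie δ α s' S.& S.+-cong (κ-X α (-ᴿ qr)) (S.*-congˡ (S.*-congˡ (φ-X (-ᴿ δ) (-ᴿ qr) S.& ι-cong (indicator-≢ δ≢q)))) S.& solves (s' :: ι
     (hval δ α) :: []) (0: +: s0 *: (s1 *: 0:)) 0:

   -- commutators of X μ with x ν 1, times X ξ
   word : Root -> Word Γ 3
   word ν = (((var 1F · const (element ν (ι (+ 1)))) · (var 1F ′)) · (const (element ν (ι (+ 1))) ′)) · var 2F

   Products : Root -> Γ.Carrier -> Set _
   Products ξ z = ∃[ r ] ∃[ s ] ⟦ z ⟧ M.≈ x β r M.* x ξ s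

   products : ∀ {μ ν ξ} (p : ν ⊞ μ ≈ β) (q : ν ⊞ β ≈ ξ) -> X β I.* X μ I.≈ X μ I.* X β -> X ξ I.* X μ I.≈ X μ I.* X ξ -> X ξ I.* X β I.≈ X β I.* X ξ -> N ν μ β O.* N ν μ β ≡ + 1 -> Diophantine Γ
    X⟨ μ ⟩ -> Diophantine Γ X⟨ ξ ⟩ -> Diophantine Γ (Products ξ)
   products {μ} {ν} {ξ} p q c1 c2 c3 unitary Dμ Dξ = transport (\ z -> \ (y , y' , (s , e) , (t , e') , f) -> _ , _ , M.trans f (value {y} {y'} e e')) (\ z -> \ (r , s , e) -> element μ (- (ν1 *
    r)) , element ξ (- d r + s) , (_ , M.refl) , (_ , M.refl) , M.trans e (M.*-cong (x-cong β (S.sym (r-value r))) (x-cong ξ (S.sym (s-value r s))) M.& M.sym (value {element μ (- (ν1 * r))}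
    {element ξ (- d r + s)} M.refl M.refl))) (image Dμ Dξ (word ν))
    where
    ν1 = ι (+ 1 O.* N ν μ β)
    d : Carrier -> Carrier
    d r = ι (+ 1 O.* + 1 O.* halfN p q) * - - (ν1 * r)
    r-value : ∀ r -> ν1 * - - (ν1 * r) ≈ r
    r-value r = S.*-congˡ (S.-‿involutive _) S.& ι-sign {+ 1 O.* N ν μ β} (cong₂ O._*_ (O.*-identityˡ (N ν μ β)) (O.*-identityˡ (N ν μ β)) ⟫ unitary) r
    s-value : ∀ r s -> d r + (- d r + s) ≈ s
    s-value r s = solves (d r :: s :: []) (s0 +: (-: s0 +: s1)) (s1)
    value : ∀ {y y' s t} -> ⟦ y ⟧ M.≈ x μ s -> ⟦ y' ⟧ M.≈ x ξ t -> (((⟦ y ⟧ M.* x ν (ι (+ 1))) M.* mat⁻¹ (fst y)) M.* x ν (- ι (+ 1))) M.* ⟦ y' ⟧ M.≈ x β (ν1 * - s) M.* x ξ (ι (+ 1 O.* + 1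
     O.* halfN p q) * - s + t)
    value {y} {y'} {s} {t} e e' = M.*-cong (M.congr (x ν (- ι (+ 1))) (M.*-cong (M.congr (x ν (ι (+ 1))) e) (-x {y} e)) M.& commutator p q c1 c2 c3 (+ 1) s) e' M.& M.*-assoc (x β (ν1 * - s))
     (x ξ _) (x ξ t) M.& M.congl (x β (ν1 * - s)) (M.sym (x-+ ξ _ t))

   Products-resp : ∀ ξ {g h} -> g Γ.≈ h -> Products ξ g -> Products ξ h
   Products-resp ξ p (r , s , e) = r , s , M.trans (M.sym p) e

  short-root : Diophantine Γ X⟨ qr ⟩ -> Diophantine Γ X⟨ δ ⟩ -> Diophantine Γ X⟨ β ⟩
  short-root Dq Dδ = transport
   (\ z -> \ ((r , s , e) , (r' , s' , e')) -> r , M.trans e (M.trans (M.congl (x β r) (M.trans (x-cong qr (Independent r s r' s' (M.trans (M.sym e) e'))) (x-0 qr))) (M.*-identityʳ (x β r))))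
   (\ z -> \ (r , e) -> (r , 0# , with-zero qr e) , (r , 0# , with-zero δ e))
   (intersection (\ {g} {h} -> Products-resp qr {g} {h}) (\ {g} {h} -> Products-resp δ {g} {h})
   (products p1 p2 βδ qδ qβ (N-unit p1 chain) Dδ Dq) (products m₁ m₂ (I.sym qβ) (I.sym qδ) (I.sym βδ) (N-unit m₁ chain~) Dq Dδ))
   where
   with-zero : ∀ ξ {A r} -> A M.≈ x β r -> A M.≈ x β r M.* x ξ 0#
   with-zero ξ {r = r} e = M.trans e (M.sym (M.*-identityʳ (x β r)) M.& M.congl (x β r) (M.sym (x-0 ξ)))

 all-roots : Diophantine Γ X⟨ qr ⟩ -> Diophantine Γ X⟨ br ⟩ -> ∀ γ -> Diophantine Γ X⟨ γ ⟩
 all-roots Dq Db = \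
  { (long 0F pos) -> Dq ; (long 0F neg) -> by-reflection qr Dq ; (long 1F pos) -> Db ; (long 1F neg) -> Db~
  ; (short pos pos) -> Dp ; (short neg neg) -> by-reflection pr Dp ; (short pos neg) -> Da ; (short neg pos) -> by-reflection ar Da }
  where
  Db~ = by-reflection br Db
  Dp = ShortRoot.short-root pr ar br ⟨ rfl , rfl ⟩ ⟨ rfl , rfl ⟩ ⟨ rfl , rfl ⟩ ⟨ rfl , rfl ⟩ (X-commute pr br) (X-commute qr br) (X-commute qr pr) rfl rfl rfl rfl (\ ()) Dq Db
  Da = ShortRoot.short-root ar pr (-ᴿ br) ⟨ rfl , rfl ⟩ ⟨ rfl , rfl ⟩ ⟨ rfl , rfl ⟩ ⟨ rfl , rfl ⟩ (X-commute ar (-ᴿ br)) (X-commute qr (-ᴿ br)) (X-commute qr ar) rfl rfl rfl rfl (\ ()) Dq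
   Db~

 root-subgroups : IsAdjoint π ⊎ TwoInvertible R -> ∀ γ -> Diophantine Γ (RootSubgroup G γ)
 root-subgroups either γ = transport (\ g (t , p) -> t , M.trans p (x≈rootElement γ t)) (\ g (t , p) -> t , M.trans p (M.sym (x≈rootElement γ t))) (subgroup either)
  where
  subgroup : IsAdjoint π ⊎ TwoInvertible R -> Diophantine Γ X⟨ γ ⟩
  subgroup (inl adjoint) = let Dq = adjoint-q adjoint in all-roots Dq (q⇒b Dq) γ
  subgroup (inr half) = let Db = half-b half in all-roots (b⇒q Db) Db γ

proposition4 : ∀ {c ℓ p : Level} (R : CommutativeRing c ℓ) (n : ℕ) (π : Representation n) -> IsAdjoint π ⊎ TwoInvertible R -> (G : LargeSubgroup R π p) (γ : Root) -> Diophantine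
 (LargeSubgroup.group G) (RootSubgroup G γ)
proposition4 R n π either G γ = RootSubgroupsDiophantine.root-subgroups G either γ
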